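{- For each fixed $\delta\in(0,1)$ there is a fully polynomial randomized approximation scheme (FPRAS) for \#BIS restricted to the class of $\lfloor \delta n\rfloor$-regular bipartite graphs on $2n$ vertices. That is, there is a randomized algorithm which, given $n$, a $\lfloor\delta n\rfloor$-regular bipartite graph $G$ on $2n$ vertices, and $\varepsilon>0$, outputs with probability at least $3/4$ a relative $\varepsilon$-approximation of the number $i(G)$ of independent sets of $G$, in time polynomial in $n$ and $1/\varepsilon$ (the polynomial may depend on $\delta$).
   Context: $i(G)$ denotes the number of independent sets (including the empty set) of a graph $G$. \#BIS is the problem of computing $i(G)$ for a bipartite graph $G$. A relative $\varepsilon$-approximation of a real number $x$ is a real number $y$ with $e^{ -\varepsilon}\le x/y\le e^{\varepsilon}$. -}

module Defs where

open import Data.Bool.Base using (Bool; true; false; if_then_else_)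
import Data.Bool.Properties as Bool
open import Data.Fin.Base using (Fin; fromℕ<; remQuot)
open import Data.Fin.Properties using (all?)
open import Data.Fin.Subset using (Subset; _∈_; ∣_∣)
open import Data.Fin.Subset.Properties using (_∈?_)
import Data.Integer.Base as ℤ
open import Data.List.Base using (List; []; _∷_; _++_; map; foldr; filter; filterᵇ; length; head; drop)
open import Data.Maybe.Base using (just; nothing)
open import Data.Nat.Base as ℕ using (ℕ; zero; suc)
import Data.Nat.Properties as ℕ
open import Data.Product.Base using (∃-syntax; Σ-syntax; _×_; _,_)
open import Data.Rational.Base as ℚ using (ℚ; 0ℚ; 1ℚ; Positive; NonZero; _÷_; 1/_; ↥_; ↧ₙ_)
open import Data.Rational.Properties using (pos⇒nonZero)
open import Data.Vec.Base as Vec using (Vec; []; _∷_; tabulate)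
open import Relation.Binary.PropositionalEquality using (_≡_; _≢_)
open import Relation.Nullary using (Dec; yes; no)
open import Relation.Nullary.Decidable using (_→-dec_)

fromℕ : ℕ → ℚ
fromℕ n = ℤ.+ n ℚ./ 1

record ℝ : Set where
  field
    seq    : ℕ → ℚ
    cauchy : ∀ η → Positive η →
             ∃[ N ] (∀ k l → N ℕ.≤ k → N ℕ.≤ l → ℚ.∣ seq k ℚ.- seq l ∣ ℚ.≤ η)

open ℝ public

-- Comparison of a rational with the limit of a convergent sequence.

infix 4 _≤lim_ _lim≤_ _<lim_ _lim<_

_≤lim_ : ℚ → (ℕ → ℚ) → Set
a ≤lim s = ∀ η → Positive η → ∃[ N ] (∀ k → N ℕ.≤ k → a ℚ.≤ s k ℚ.+ η)

_lim≤_ : (ℕ → ℚ) → ℚ → Set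
s lim≤ b = ∀ η → Positive η → ∃[ N ] (∀ k → N ℕ.≤ k → s k ℚ.≤ b ℚ.+ η)

_<lim_ : ℚ → (ℕ → ℚ) → Set
a <lim s = ∃[ q ] (a ℚ.< q × q ≤lim s)

_lim<_ : (ℕ → ℚ) → ℚ → Set
s lim< b = ∃[ q ] (s lim≤ q × q ℚ.< b)

-- d = ⌊ δ n ⌋, as a relation: the floor of a real is not a computable function.
IsFloor : ℝ → ℕ → ℕ → Set
IsFloor δ n d = fromℕ d ≤lim nδ × nδ lim< fromℕ (suc d)
  where
  nδ : ℕ → ℚ
  nδ k = fromℕ n ℚ.* seq δ k

expTerm : ℚ → ℕ → ℚ
expTerm q zero    = 1ℚ
expTerm q (suc k) = expTerm q k ℚ.* q ℚ.* (ℤ.+ 1 ℚ./ suc k)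

-- The partial sums of Σ qᵏ / k!, whose limit is e^q.
exp : ℚ → ℕ → ℚ
exp q zero    = 0ℚ
exp q (suc k) = exp q k ℚ.+ expTerm q k

-- y is a relative ε-approximation of x: e^(-ε) ≤ x/y ≤ e^ε.
RelApprox : ℚ → ℚ → ℚ → Set
RelApprox ε x y =
  Σ[ y≢0 ∈ NonZero y ]
    let x/y = (x ÷ y) {{y≢0}} in
    x/y ≤lim exp ε  ×  exp (ℚ.- ε) lim≤ x/y

record Graph (m : ℕ) : Set where
  field
    adj    : Fin m → Fin m → Bool
    sym    : ∀ u v → adj u v ≡ adj v u
    irrefl : ∀ v → adj v v ≡ false

open Graph public

degree : ∀ {m} → Graph m → Fin m → ℕ
degree G v = ∣ tabulate (adj G v) ∣

Regular : ∀ {m} → ℕ → Graph m → Set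
Regular d G = ∀ v → degree G v ≡ d

Bipartite : ∀ {m} → Graph m → Set
Bipartite {m} G =
  Σ[ side ∈ (Fin m → Bool) ] (∀ u v → adj G u v ≡ true → side u ≢ side v)

Independent : ∀ {m} → Graph m → Subset m → Set
Independent G S = ∀ u → ∀ v → u ∈ S → v ∈ S → adj G u v ≡ false

independent? : ∀ {m} (G : Graph m) (S : Subset m) → Dec (Independent G S)
independent? G S =
  all? λ u → all? λ v → (u ∈? S) →-dec ((v ∈? S) →-dec (adj G u v Bool.≟ false))

bitVectors : ∀ m → List (Vec Bool m)
bitVectors zero    = [] ∷ []
bitVectors (suc m) =
  map (true ∷_) (bitVectors m) ++ map (false ∷_) (bitVectors m)

i[_] : ∀ {m} → Graph m → ℕ
i[_] {m} G = length (filter (independent? G) (bitVectors m))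

-- The model is the random access machine with unit-cost addition and
-- (truncated) subtraction, but no multiplication, extended by fair coin tosses.
-- Without multiplication, t steps lengthen the numbers by at most O(t) bits,
-- so polynomial time here is polynomial time on Turing machines.

data Instr : Set where
  const : (i c : ℕ)   → Instr
  add   : (i j k : ℕ) → Instr
  sub   : (i j k : ℕ) → Instr
  load  : (i j : ℕ)   → Instr
  store : (i j : ℕ)   → Instr
  jz    : (i l : ℕ)   → Instr
  coin  : (i : ℕ)     → Instr

Program : Set
Program = List Instr

Memory : Set
Memory = ℕ → ℕ

record Config : Set where
  constructor ⟨_,_⟩
  field
    pc  : ℕ
    mem : Memory

open Config public

_[_↦_] : Memory → ℕ → ℕ → Memory
(r [ i ↦ x ]) j = if i ℕ.≡ᵇ j then x else r j

toBit : Bool → ℕ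
toBit b = if b then 1 else 0

exec : Instr → Bool → Config → Config
exec (const i c) _ ⟨ p , r ⟩ = ⟨ suc p , r [ i ↦ c ] ⟩
exec (add i j k) _ ⟨ p , r ⟩ = ⟨ suc p , r [ i ↦ r j ℕ.+ r k ] ⟩
exec (sub i j k) _ ⟨ p , r ⟩ = ⟨ suc p , r [ i ↦ r j ℕ.∸ r k ] ⟩
exec (load i j)  _ ⟨ p , r ⟩ = ⟨ suc p , r [ i ↦ r (r j) ] ⟩
exec (store i j) _ ⟨ p , r ⟩ = ⟨ suc p , r [ r i ↦ r j ] ⟩
exec (jz i l)    _ ⟨ p , r ⟩ = ⟨ (if r i ℕ.≡ᵇ 0 then l else suc p) , r ⟩
exec (coin i)    b ⟨ p , r ⟩ = ⟨ suc p , r [ i ↦ toBit b ] ⟩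

-- The machine stops when the program counter leaves the program.
Halted : Program → Config → Set
Halted P c = length P ℕ.≤ pc c

step : Program → Config → Bool → Config
step P c b with head (drop (pc c) P)
... | just ins = exec ins b c
... | nothing  = c

-- Run for t steps. Every step is offered a fresh random bit, which only coin
-- looks at.
run : Program → ∀ {t} → Config → Vec Bool t → Config
run P c []       = c
run P c (b ∷ bs) = run P (step P c b) bs

-- Under the uniform distribution on Vec Bool t, the event E has probability at
-- least 3/4. E need not be decidable, so it is bounded below by a decidable event.
Pr[_]≥¾ : ∀ {t} → (Vec Bool t → Set) → Set
Pr[_]≥¾ {t} E =
  Σ[ f ∈ (Vec Bool t → Bool) ]
    (∀ bs → f bs ≡ true → E bs) ×
    3 ℕ.* 2 ℕ.^ t ℕ.≤ 4 ℕ.* length (filterᵇ f (bitVectors t))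

-- Registers 0, 1, 2 hold n and the numerator and denominator of ε; the adjacency
-- matrix follows row by row, and all other registers are 0. The bipartition is
-- not part of the input.
inputMemory : ∀ n → Graph (2 ℕ.* n) → ℚ → Memory
inputMemory n G ε 0 = n
inputMemory n G ε 1 = ℤ.∣ ↥ ε ∣
inputMemory n G ε 2 = ↧ₙ ε
inputMemory n G ε (suc (suc (suc k))) with k ℕ.<? (2 ℕ.* n) ℕ.* (2 ℕ.* n)
... | yes k< = let (u , v) = remQuot (2 ℕ.* n) (fromℕ< k<) in toBit (adj G u v)
... | no  _  = 0

input : ∀ n → Graph (2 ℕ.* n) → ℚ → Config
input n G ε = ⟨ 0 , inputMemory n G ε ⟩

-- The output is the rational r[0] / (1 + r[1]).
output : Config → ℚ
output c = ℤ.+ mem c 0 ℚ./ suc (mem c 1)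

-- Polynomials in one and two variables, lowest coefficient first.

eval : List ℚ → ℚ → ℚ
eval p x = foldr (λ c acc → c ℚ.+ x ℚ.* acc) 0ℚ p

eval₂ : List (List ℚ) → ℚ → ℚ → ℚ
eval₂ p x y = eval (map (λ q → eval q y) p) x

HasFPRAS : (∀ n → Graph (2 ℕ.* n) → Set) → Set
HasFPRAS 𝒢 =
  Σ[ P ∈ Program ] Σ[ p ∈ List (List ℚ) ]
    ∀ n (G : Graph (2 ℕ.* n)) → 𝒢 n G →
    ∀ ε → .{{ε>0 : Positive ε}} →
    Σ[ t ∈ ℕ ]
      fromℕ t ℚ.≤ eval₂ p (fromℕ n) ((1/ ε) {{pos⇒nonZero ε}}) ×
      (∀ (bs : Vec Bool t) → Halted P (run P (input n G ε) bs)) ×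
      Pr[ (λ (bs : Vec Bool t) →
             RelApprox ε (fromℕ i[ G ]) (output (run P (input n G ε) bs))) ]≥¾

DenseRegularBipartite : ℝ → ∀ n → Graph (2 ℕ.* n) → Set
DenseRegularBipartite δ n G =
  Bipartite G × ∃[ d ] (IsFloor δ n d × Regular d G)

{-# OPTIONS --safe #-}
-- Let G be a d-regular bipartite graph on 2n vertices with n ≤ K d. An independent set is
-- coded by a path of choices. Vertices with at least τ ≈ n / 6 K undecided neighbours are
-- decided first; choosing one removes more than τ vertices, so this happens O(K) times and
-- the table B (b + 1) = B b + B (b ∸ τ) bounds the number of paths by 2 ^ n times a
-- polynomial. In the remaining graph on a set U all degrees are below τ, whereas regularity
-- forces d (|U| ∸ n) edges; hence a greedy matching has at least 3 (|U| ∸ n) edges, and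
-- relaxing independence to these edges leaves at most
-- 3 ^ p * 2 ^ (|U| ∸ 2 p) ≤ 2 ^ n candidates. So the independent sets correspond to exactly
-- i(G) of the numbers r < 2 ^ N, where 2 ^ N ≤ 2 ^ n * poly(n), and i(G) ≥ 2 ^ n because one
-- side of the bipartition has n vertices. Sampling r uniformly therefore succeeds with
-- probability at least 1 / poly(n), and Chebyshev's inequality turns polynomially many
-- samples into a relative approximation.
module Submission where

open import Data.Bool.Base using (Bool; true; false; if_then_else_; T; _∧_; _∨_; not)
open import Data.Empty using (⊥-elim)
open import Data.Fin.Base using (Fin; zero; suc; toℕ; fromℕ<; combine; remQuot)
import Data.Bool.Properties as Bool
import Data.Fin.Properties as Fin
open import Data.Fin.Subset using () renaming (∣_∣ to ∣_∣ˢ)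
open import Data.Integer.Base as ℤ using (ℤ)
import Data.Integer.Properties as ℤ
open import Data.List.Base using (List; []; _∷_; _++_; length; head; drop; map; filter; filterᵇ)
import Data.List.Properties as List
open import Data.Maybe.Base using (Maybe; just; nothing)
open import Data.Nat.Base
open import Data.Nat.Properties
open import Data.Nat.Tactic.RingSolver using (solve-∀)
open import Data.Product.Base using (Σ-syntax; ∃-syntax; _×_; _,_; proj₁; proj₂)
open import Data.Rational.Base as ℚ using (ℚ; 0ℚ; 1ℚ)
import Data.Rational.Properties as ℚ
import Data.Rational.Solver as ℚ-Solver
open import Data.Rational.Unnormalised.Base as ℚᵘ using (mkℚᵘ; *≡*)
import Data.Rational.Unnormalised.Properties as ℚᵘ
open import Data.Sum.Base using (_⊎_; inj₁; inj₂)
open import Data.Unit.Base using (⊤; tt)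
open import Data.Vec.Base using (Vec; []; _∷_; lookup; tabulate)
import Data.Vec.Properties as Vec
open import Relation.Binary.PropositionalEquality
open import Relation.Nullary using (Dec; yes; no)
open import Defs renaming (sym to adj-sym; irrefl to adj-irrefl)

-- Runs of the machine

-- Because the number of accepted `r` is exactly `i(G)`, slack in the coding costs only acceptance
-- probability: codes beyond the last one keep a positive remainder and are rejected. Hence the
-- counting lemmas hold for every range at least as long as the table entry or weight, and crude
-- bounds on paths and candidates suffice. The program depends on δ only through a positive rational
-- below it, which gives n ≤ (d + 1) (K + 1). This is a bound by a multiple of d only once d ≥ 1, so
-- the finitely many smaller n are answered from decision trees. The machine cannot multiply and has
-- no structured memory. The sampler therefore appears twice: as a function on 0/1-valued functions,
-- whose acceptance count is analysed, and as a command of a compiled loop language, which simulates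
-- it. Memory is not cleared between trials, so the trials are not literally independent; what the
-- variance needs is that the acceptance count is the same from every admissible state. All coins
-- are tossed before the sampling, which confines randomness to a single loop.

T-∧₁ : ∀ a {b} → T (a ∧ b) → T a
T-∧₁ true _ = tt

T-∧₂ : ∀ a {b} → T (a ∧ b) → T b
T-∧₂ true t = t

≡ᵇ-refl : ∀ n → (n ≡ᵇ n) ≡ true
≡ᵇ-refl zero = refl
≡ᵇ-refl (suc n) = ≡ᵇ-refl n

≢⇒≡ᵇ : ∀ {m n} → m ≢ n → (m ≡ᵇ n) ≡ false
≢⇒≡ᵇ {m} {n} m≢n with m ≡ᵇ n in eq
... | false = refl
... | true = ⊥-elim (m≢n (≡ᵇ⇒≡ m n (subst T (sym eq) tt)))

upd-same : ∀ (r : Memory) i x → (r [ i ↦ x ]) i ≡ x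
upd-same r i x rewrite ≡ᵇ-refl i = refl

upd-other : ∀ (r : Memory) {i j} x → i ≢ j → (r [ i ↦ x ]) j ≡ r j
upd-other r x i≢j rewrite ≢⇒≡ᵇ i≢j = refl

-- A function and not a `with`, so that a projection of a branching state can be pushed into both
-- branches by `ifz-map`.
ifz : ∀ {a} {A : Set a} → ℕ → A → A → A
ifz zero    x y = x
ifz (suc _) x y = y

-- Shared by the semantics of `for` and by the functional sampler, so that `loop-sim` can relate the
-- two round by round.
loopFrom : ∀ {a} {A : Set a} → ℕ → ℕ → (ℕ → A → A) → A → A
loopFrom v zero    f s = s
loopFrom v (suc k) f s = loopFrom (suc v) k f (f v s)

takeᵛ : ∀ {A : Set} s {t} → Vec A (s + t) → Vec A s
takeᵛ zero    bs       = []
takeᵛ (suc s) (b ∷ bs) = b ∷ takeᵛ s bs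

dropᵛ : ∀ {A : Set} s {t} → Vec A (s + t) → Vec A t
dropᵛ zero    bs       = bs
dropᵛ (suc s) (_ ∷ bs) = dropᵛ s bs

-- The end is the same for all bits offered, so this describes stretches of a run in which no coin
-- influences the result.
record Reach (P : Program) (c : Config) (t : ℕ) (c′ : Config) : Set where
  constructor reach
  field runs : (bs : Vec Bool t) → run P c bs ≡ c′

open Reach public

cast-time : ∀ {P c c′ s t} → s ≡ t → Reach P c s c′ → Reach P c t c′
cast-time refl r = r

cast-end : ∀ {P c p p′ m t} → p ≡ p′ → Reach P c t ⟨ p , m ⟩ → Reach P c t ⟨ p′ , m ⟩
cast-end refl r = r

run-split : ∀ P s {t} c (bs : Vec Bool (s + t)) →
            run P c bs ≡ run P (run P c (takeᵛ s bs)) (dropᵛ s bs)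
run-split P zero    c bs       = refl
run-split P (suc s) c (b ∷ bs) = run-split P s (step P c b) bs

run-drop : ∀ {P c c′} s {t} → Reach P c s c′ → (bs : Vec Bool (s + t)) →
           run P c bs ≡ run P c′ (dropᵛ s bs)
run-drop {P} {c} s r bs =
  trans (run-split P s c bs) (cong (λ d → run P d (dropᵛ s bs)) (runs r (takeᵛ s bs)))

reach-trans : ∀ {P c c′ c″ s t} → Reach P c s c′ → Reach P c′ t c″ → Reach P c (s + t) c″
reach-trans {s = s} r r′ = reach λ bs → trans (run-drop s r bs) (runs r′ (dropᵛ s bs))

fetch : Program → ℕ → Maybe Instr
fetch P p = head (drop p P)

step-fetch : ∀ P c b {ins} → fetch P (pc c) ≡ just ins → step P c b ≡ exec ins b c
step-fetch P c b eq with head (drop (pc c) P)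
step-fetch P c b refl | just ins = refl

step-halted : ∀ P c b → fetch P (pc c) ≡ nothing → step P c b ≡ c
step-halted P c b eq with head (drop (pc c) P)
step-halted P c b refl | nothing = refl

fetch-beyond : ∀ P p → length P ≤ p → fetch P p ≡ nothing
fetch-beyond []      zero    _         = refl
fetch-beyond []      (suc p) _         = refl
fetch-beyond (_ ∷ P) (suc p) (s≤s P≤p) = fetch-beyond P p P≤p

run-halted : ∀ P c {t} (bs : Vec Bool t) → Halted P c → run P c bs ≡ c
run-halted P c []       h = refl
run-halted P c (b ∷ bs) h rewrite step-halted P c b (fetch-beyond P (pc c) h) = run-halted P c bs h

-- Located by fetches rather than by a decomposition of the program, so a fragment can be verified
-- without knowing what surrounds it.
CodeAt : Program → ℕ → List Instr → Set
CodeAt P b []       = ⊤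
CodeAt P b (i ∷ is) = fetch P b ≡ just i × CodeAt P (suc b) is

codeAt-++ : ∀ {P} b xs {ys} → CodeAt P b (xs ++ ys) → CodeAt P b xs × CodeAt P (length xs + b) ys
codeAt-++ b []       h       = tt , h
codeAt-++ {P} b (x ∷ xs) {ys} (f , h) with codeAt-++ (suc b) xs h
... | l , r = (f , l) , subst (λ p → CodeAt P p ys) (+-suc (length xs) b) r

fetch-++ : ∀ pre {is} k → fetch (pre ++ is) (k + length pre) ≡ fetch is k
fetch-++ []        {is} k rewrite +-identityʳ k = refl
fetch-++ (_ ∷ pre) k rewrite +-suc k (length pre) = fetch-++ pre k

codeAt-self : ∀ P → CodeAt P 0 P
codeAt-self P = go [] P
  where
  go : ∀ pre is → CodeAt (pre ++ is) (length pre) is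
  go pre []       = tt
  go pre (i ∷ is) = fetch-++ pre 0 ,
    subst₂ (λ Q p → CodeAt Q p is) (List.++-assoc pre (i ∷ []) is)
      (trans (List.length-++ pre) (+-comm (length pre) 1)) (go (pre ++ i ∷ []) is)

-- The program counter and the bit are dummies: the memory left by a straight instruction depends on
-- neither.
eff : Instr → Memory → Memory
eff ins r = mem (exec ins false ⟨ 0 , r ⟩)

straight : Instr → Bool
straight (jz _ _) = false
straight (coin _) = false
straight _        = true

execs : List Instr → Memory → Memory
execs []       r = r
execs (i ∷ is) r = execs is (eff i r)

all-straight : List Instr → Bool
all-straight []       = true
all-straight (i ∷ is) = straight i ∧ all-straight is

exec-straight : ∀ ins b p r → T (straight ins) → exec ins b ⟨ p , r ⟩ ≡ ⟨ suc p , eff ins r ⟩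
exec-straight (const _ _) b p r _ = refl
exec-straight (add _ _ _) b p r _ = refl
exec-straight (sub _ _ _) b p r _ = refl
exec-straight (load _ _)  b p r _ = refl
exec-straight (store _ _) b p r _ = refl

reach-straight : ∀ {P} b is r → T (all-straight is) → CodeAt P b is →
                 Reach P ⟨ b , r ⟩ (length is) ⟨ length is + b , execs is r ⟩
reach-straight b []       r t h = reach λ { [] → refl }
reach-straight {P} b (i ∷ is) r t (f , h) = reach go
  where
  go : ∀ bs → run P ⟨ b , r ⟩ bs ≡ ⟨ suc (length is) + b , execs (i ∷ is) r ⟩
  go (c ∷ bs)
    rewrite step-fetch P ⟨ b , r ⟩ c f | exec-straight i c b r (T-∧₁ (straight i) t) | sym (+-suc (length is) b)
    = runs (reach-straight (suc b) is (eff i r) (T-∧₂ (straight i) t) h) bs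

reach-jz : ∀ {P} b i l r → fetch P b ≡ just (jz i l) →
           Reach P ⟨ b , r ⟩ 1 ⟨ ifz (r i) l (suc b) , r ⟩
reach-jz {P} b i l r f = reach go
  where
  go : ∀ bs → run P ⟨ b , r ⟩ bs ≡ ⟨ ifz (r i) l (suc b) , r ⟩
  go (c ∷ []) rewrite step-fetch P ⟨ b , r ⟩ c f with r i
  ... | zero  = refl
  ... | suc _ = refl

reach-jump : ∀ {P} b i l r → fetch P b ≡ just (jz i l) → r i ≡ 0 → Reach P ⟨ b , r ⟩ 1 ⟨ l , r ⟩
reach-jump b i l r f z = cast-end (cong (λ x → ifz x l (suc b)) z) (reach-jz b i l r f)

reach-fall : ∀ {P} b i l r {x} → fetch P b ≡ just (jz i l) → r i ≡ suc x → Reach P ⟨ b , r ⟩ 1 ⟨ suc b , r ⟩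
reach-fall b i l r f z = cast-end (cong (λ x → ifz x l (suc b)) z) (reach-jz b i l r f)

-- Loops of the shape  L : jz i E ; body ; jz 3 L,  register 3 being 0.
reach-while : ∀ {P} L i body E → T (all-straight body) →
  CodeAt P L (jz i E ∷ body ++ jz 3 L ∷ []) →
  (I : ℕ → Memory → Set) →
  (∀ r → I 0 r → r i ≡ 0) →
  (∀ k r → I (suc k) r → (∃[ x ] r i ≡ suc x) × execs body r 3 ≡ 0 × I k (execs body r)) →
  ∀ k r → I k r →
  ∃[ r′ ] Reach P ⟨ L , r ⟩ (k * (2 + length body) + 1) ⟨ E , r′ ⟩ × I 0 r′
reach-while L i body E st (f , h) I done next zero r inv =
  r , reach-jump L i E r f (done r inv) , inv
reach-while L i body E st (f , h) I done next (suc k) r inv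
  with next k r inv | codeAt-++ (suc L) body h
... | (x , nz) , z3 , inv′ | hb , (fj , _)
  with reach-while L i body E st (f , h) I done next k (execs body r) inv′
... | r′ , rest , fin =
  r′ ,
  cast-time (eq (length body) (k * (2 + length body)))
    (reach-trans (reach-fall L i E r f nz)
      (reach-trans (reach-straight (suc L) body r st hb)
        (reach-trans (reach-jump (length body + suc L) 3 L (execs body r) fj z3) rest))) ,
  fin
  where
  eq : ∀ b c → 1 + (b + (1 + (c + 1))) ≡ 2 + b + c + 1
  eq = solve-∀

-- A language of loops bounded by parameters, and its compilation

infixr 5 _⨾_

data Cmd : Set where
  skip    : Cmd
  _⨾_     : (c d : Cmd) → Cmd
  set     : (x k : ℕ) → Cmd
  par     : (x p : ℕ) → Cmd
  add sub : (x y z : ℕ) → Cmd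
  get     : (x a y : ℕ) → Cmd
  put     : (a y x : ℕ) → Cmd
  ifzero  : (x : ℕ) (c d : Cmd) → Cmd
  for     : (x p : ℕ) (c : Cmd) → Cmd

record St : Set where
  constructor st
  field
    vars : ℕ → ℕ
    arrs : ℕ → ℕ → ℕ

open St public

_[_⇐_] : (ℕ → ℕ → ℕ) → ℕ → (ℕ → ℕ) → ℕ → ℕ → ℕ
(A [ a ⇐ f ]) b = if a ≡ᵇ b then f else A b

_⟪_≔_⟫ : St → ℕ → ℕ → St
σ ⟪ x ≔ k ⟫ = st (vars σ [ x ↦ k ]) (arrs σ)

-- The parameters ρ cannot be assigned to; they bound the loops.
⟦_⟧ : Cmd → (ℕ → ℕ) → St → St
⟦ skip ⟧         ρ σ = σ
⟦ c ⨾ d ⟧        ρ σ = ⟦ d ⟧ ρ (⟦ c ⟧ ρ σ)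
⟦ set x k ⟧      ρ σ = σ ⟪ x ≔ k ⟫
⟦ par x p ⟧      ρ σ = σ ⟪ x ≔ ρ p ⟫
⟦ add x y z ⟧    ρ σ = σ ⟪ x ≔ vars σ y + vars σ z ⟫
⟦ sub x y z ⟧    ρ σ = σ ⟪ x ≔ vars σ y ∸ vars σ z ⟫
⟦ get x a y ⟧    ρ σ = σ ⟪ x ≔ arrs σ a (vars σ y) ⟫
⟦ put a y x ⟧    ρ σ = st (vars σ) (arrs σ [ a ⇐ arrs σ a [ vars σ y ↦ vars σ x ] ])
⟦ ifzero x c d ⟧ ρ σ = ifz (vars σ x) (⟦ c ⟧ ρ σ) (⟦ d ⟧ ρ σ)
⟦ for x p c ⟧    ρ σ = loopFrom 0 (ρ p) (λ v τ → ⟦ c ⟧ ρ (τ ⟪ x ≔ v ⟫)) σ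

-- A bound that depends on the parameters and not on the state; `ifzero` pays for both branches. The
-- 5 is the overhead of a round: exit test (two instructions), loading the variable, increment, jump
-- back.
cost : Cmd → (ℕ → ℕ) → ℕ
cost skip           ρ = 0
cost (c ⨾ d)        ρ = cost c ρ + cost d ρ
cost (set _ _)      ρ = 1
cost (par _ _)      ρ = 1
cost (add _ _ _)    ρ = 1
cost (sub _ _ _)    ρ = 1
cost (get _ _ _)    ρ = 5
cost (put _ _ _)    ρ = 5
cost (ifzero _ c d) ρ = 2 + (cost c ρ + cost d ρ)
cost (for _ p c)    ρ = ρ p * (cost c ρ + 5) + 3

-- Registers: 3 holds 0, 4 holds 1, 5–7 are scratch, 8+a holds the base address
-- of array a, 16+e counts the loop of nesting depth e, 24+p holds the parameter
-- p and 32+x the variable x. The arrays are interleaved above the address W.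

reg-base reg-count reg-par reg-var : ℕ → ℕ
reg-base a  = 8 + a
reg-count e = 16 + e
reg-par p   = 24 + p
reg-var x   = 32 + x

-- Spelled with additions so that it is literally what the doublings in `address` compute; 8 is the
-- number of interleaved arrays.
octuple : ℕ → ℕ
octuple y = ((y + y) + (y + y)) + ((y + y) + (y + y))

cell : ℕ → ℕ → ℕ → ℕ
cell W a i = octuple i + (a + W)

address : (a y : ℕ) → List Instr
address a y = add 5 (reg-var y) (reg-var y) ∷ add 5 5 5 ∷ add 5 5 5 ∷ add 5 5 (reg-base a) ∷ []

size : Cmd → ℕ
size skip           = 0
size (c ⨾ d)        = size c + size d
size (set _ _)      = 1
size (par _ _)      = 1
size (add _ _ _)    = 1
size (sub _ _ _)    = 1
size (get _ _ _)    = 5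
size (put _ _ _)    = 5
size (ifzero _ c d) = suc (size d + suc (size c))
size (for _ _ c)    = 4 + (size c + 2)

code : (depth base : ℕ) → Cmd → List Instr
code e b skip           = []
code e b (c ⨾ d)        = code e b c ++ code e (size c + b) d
code e b (set x k)      = const (reg-var x) k ∷ []
code e b (par x p)      = add (reg-var x) (reg-par p) 3 ∷ []
code e b (add x y z)    = add (reg-var x) (reg-var y) (reg-var z) ∷ []
code e b (sub x y z)    = sub (reg-var x) (reg-var y) (reg-var z) ∷ []
code e b (get x a y)    = address a y ++ load (reg-var x) 5 ∷ []
code e b (put a y x)    = address a y ++ store 5 (reg-var x) ∷ []
code e b (ifzero x c d) =
  let d-end = size d + suc b in
  jz (reg-var x) (suc d-end) ∷ code e (suc b) d ++ jz 3 (size c + suc d-end) ∷ code e (suc d-end) c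
code e b (for x p c)    =
  let c-end = size c + (4 + b) in
  const (reg-count e) 0 ∷
  sub 5 (reg-par p) (reg-count e) ∷ jz 5 (2 + c-end) ∷ add (reg-var x) (reg-count e) 3 ∷
  code (suc e) (4 + b) c ++ add (reg-count e) (reg-count e) 4 ∷ jz 3 (suc b) ∷ []

length-code : ∀ e b c → length (code e b c) ≡ size c
length-code e b skip           = refl
length-code e b (c ⨾ d)        = trans (List.length-++ (code e b c))
  (cong₂ _+_ (length-code e b c) (length-code e (size c + b) d))
length-code e b (set _ _)      = refl
length-code e b (par _ _)      = refl
length-code e b (add _ _ _)    = refl
length-code e b (sub _ _ _)    = refl
length-code e b (get _ _ _)    = refl
length-code e b (put _ _ _)    = refl
length-code e b (ifzero x c d) = cong suc (trans (List.length-++ (code e (suc b) d))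
  (cong₂ _+_ (length-code e (suc b) d) (cong suc (length-code e _ c))))
length-code e b (for x p c)    = cong (4 +_) (trans (List.length-++ (code (suc e) (4 + b) c))
  (cong (_+ 2) (length-code (suc e) (4 + b) c)))

-- The register layout has room for 32 variables and for 8 arrays, parameters and nested loops.
-- Being Boolean, the condition evaluates to `tt` for a concrete command.
wf : ℕ → Cmd → Bool
wf e skip           = true
wf e (c ⨾ d)        = wf e c ∧ wf e d
wf e (set x k)      = x <ᵇ 32
wf e (par x p)      = (x <ᵇ 32) ∧ (p <ᵇ 8)
wf e (add x y z)    = (x <ᵇ 32) ∧ ((y <ᵇ 32) ∧ (z <ᵇ 32))
wf e (sub x y z)    = (x <ᵇ 32) ∧ ((y <ᵇ 32) ∧ (z <ᵇ 32))
wf e (get x a y)    = (x <ᵇ 32) ∧ ((a <ᵇ 8) ∧ (y <ᵇ 32))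
wf e (put a y x)    = (x <ᵇ 32) ∧ ((a <ᵇ 8) ∧ (y <ᵇ 32))
wf e (ifzero x c d) = (x <ᵇ 32) ∧ (wf e c ∧ wf e d)
wf e (for x p c)    = (e <ᵇ 8) ∧ ((x <ᵇ 32) ∧ ((p <ᵇ 8) ∧ wf (suc e) c))

record Rep (W : ℕ) (ρ : ℕ → ℕ) (m : Memory) (σ : St) : Set where
  field
    rep-zero : m 3 ≡ 0
    rep-one  : m 4 ≡ 1
    rep-base : ∀ a → a < 8 → m (reg-base a) ≡ a + W
    rep-par  : ∀ p → p < 8 → m (reg-par p) ≡ ρ p
    rep-var  : ∀ x → x < 32 → m (reg-var x) ≡ vars σ x
    rep-arr  : ∀ a → a < 8 → ∀ i → m (cell W a i) ≡ arrs σ a i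

open Rep public

octuple-* : ∀ y → octuple y ≡ y * 8
octuple-* = unfolded
  where
  unfolded : ∀ y → ((y + y) + (y + y)) + ((y + y) + (y + y)) ≡ y * 8
  unfolded = solve-∀

block-injective : ∀ i j {a b} → a < 8 → b < 8 → i * 8 + a ≡ j * 8 + b → i ≡ j × a ≡ b
block-injective zero    zero    a<8 b<8 eq = refl , eq
block-injective zero    (suc j) {b = b} a<8 b<8 refl = ⊥-elim (m+n≮m 8 (j * 8 + b) a<8)
block-injective (suc i) zero    {a = a} a<8 b<8 refl = ⊥-elim (m+n≮m 8 (i * 8 + a) b<8)
block-injective (suc i) (suc j) a<8 b<8 eq with block-injective i j a<8 b<8 (+-cancelˡ-≡ 8 _ _ eq)
... | i≡j , a≡b = cong suc i≡j , a≡b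

cell-injective : ∀ W {a b} i j → a < 8 → b < 8 → cell W a i ≡ cell W b j → i ≡ j × a ≡ b
cell-injective W {a} {b} i j a<8 b<8 eq = block-injective i j a<8 b<8
  (+-cancelʳ-≡ W _ _ (trans (sym (shape i a)) (trans eq (shape j b))))
  where
  shape : ∀ i a → cell W a i ≡ i * 8 + a + W
  shape i a = trans (cong (_+ (a + W)) (octuple-* i)) (sym (+-assoc (i * 8) a W))

cell-≥ : ∀ W a i → W ≤ cell W a i
cell-≥ W a i = ≤-trans (m≤n+m W a) (m≤n+m (a + W) (octuple i))

record Scratch (k : ℕ) : Set where
  field
    s-zero : k ≢ 3
    s-one  : k ≢ 4
    s-base : ∀ a → a < 8 → k ≢ reg-base a
    s-par  : ∀ p → p < 8 → k ≢ reg-par p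
    s-var  : k < 32

module _ {W : ℕ} (W≥64 : 64 ≤ W) {ρ : ℕ → ℕ} where

  reg-≢-cell : ∀ {k} a i → k < 64 → k ≢ cell W a i
  reg-≢-cell a i k<64 refl = <-irrefl refl (<-≤-trans k<64 (≤-trans W≥64 (cell-≥ W a i)))

  rep-scratch : ∀ {m σ k} x → Scratch k → Rep W ρ m σ → Rep W ρ (m [ k ↦ x ]) σ
  rep-scratch {m} {k = k} x s r = record
    { rep-zero = trans (upd-other m x s-zero) (rep-zero r)
    ; rep-one  = trans (upd-other m x s-one) (rep-one r)
    ; rep-base = λ a a<8 → trans (upd-other m x (s-base a a<8)) (rep-base r a a<8)
    ; rep-par  = λ p p<8 → trans (upd-other m x (s-par p p<8)) (rep-par r p p<8)
    ; rep-var  = λ y y<32 → trans (upd-other m x (<⇒≢ (<-≤-trans s-var (m≤m+n 32 y)))) (rep-var r y y<32)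
    ; rep-arr  = λ a a<8 i → trans (upd-other m x (reg-≢-cell a i (<-≤-trans s-var (m≤m+n 32 32)))) (rep-arr r a a<8 i)
    }
    where open Scratch s

  rep-assign : ∀ {m σ x v w} → x < 32 → v ≡ w → Rep W ρ m σ → Rep W ρ (m [ reg-var x ↦ v ]) (σ ⟪ x ≔ w ⟫)
  rep-assign {m} {σ} {x} {v} x<32 refl r = record
    { rep-zero = rep-zero r
    ; rep-one  = rep-one r
    ; rep-base = λ a a<8 → trans (upd-other m v (≢-sym (<⇒≢ (<-≤-trans (+-monoʳ-< 8 a<8) (m≤m+n 16 (16 + x)))))) (rep-base r a a<8)
    ; rep-par  = λ p p<8 → trans (upd-other m v (≢-sym (<⇒≢ (<-≤-trans (+-monoʳ-< 24 p<8) (m≤m+n 32 x))))) (rep-par r p p<8)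
    ; rep-var  = var
    ; rep-arr  = λ a a<8 i → trans (upd-other m v (reg-≢-cell a i (+-monoʳ-< 32 x<32))) (rep-arr r a a<8 i)
    }
    where
    var : ∀ y → y < 32 → (m [ reg-var x ↦ v ]) (reg-var y) ≡ (vars σ [ x ↦ v ]) y
    var y y<32 with x ≡ᵇ y
    ... | true  = refl
    ... | false = rep-var r y y<32

  rep-put : ∀ {m σ a i v w} → a < 8 → v ≡ w → Rep W ρ m σ →
            Rep W ρ (m [ cell W a i ↦ v ]) (st (vars σ) (arrs σ [ a ⇐ arrs σ a [ i ↦ w ] ]))
  rep-put {m} {σ} {a} {i} {v} a<8 refl r = record
    { rep-zero = trans (upd-other m v (≢-sym (reg-≢-cell a i (m≤m+n 4 60)))) (rep-zero r)
    ; rep-one  = trans (upd-other m v (≢-sym (reg-≢-cell a i (m≤m+n 5 59)))) (rep-one r)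
    ; rep-base = λ b b<8 → trans (upd-other m v (≢-sym (reg-≢-cell a i (<-≤-trans (+-monoʳ-< 8 b<8) (m≤m+n 16 48))))) (rep-base r b b<8)
    ; rep-par  = λ p p<8 → trans (upd-other m v (≢-sym (reg-≢-cell a i (<-≤-trans (+-monoʳ-< 24 p<8) (m≤m+n 32 32))))) (rep-par r p p<8)
    ; rep-var  = λ y y<32 → trans (upd-other m v (≢-sym (reg-≢-cell a i (+-monoʳ-< 32 y<32)))) (rep-var r y y<32)
    ; rep-arr  = arr
    }
    where
    arr : ∀ b → b < 8 → ∀ j → (m [ cell W a i ↦ v ]) (cell W b j) ≡ (arrs σ [ a ⇐ arrs σ a [ i ↦ v ] ]) b j
    arr b b<8 j with a ≟ b
    arr b b<8 j | no a≢b rewrite ≢⇒≡ᵇ a≢b =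
      trans (upd-other m v (λ eq → a≢b (proj₂ (cell-injective W i j a<8 b<8 eq)))) (rep-arr r b b<8 j)
    arr b b<8 j | yes refl rewrite ≡ᵇ-refl a with i ≟ j
    ... | yes refl rewrite ≡ᵇ-refl i = upd-same m (cell W a i) v
    ... | no i≢j rewrite ≢⇒≡ᵇ i≢j =
      trans (upd-other m v (λ eq → i≢j (proj₁ (cell-injective W i j a<8 b<8 eq)))) (rep-arr r b b<8 j)

scratch-5 : Scratch 5
scratch-5 = record
  { s-zero = λ () ; s-one = λ () ; s-base = λ _ _ () ; s-par = λ _ _ () ; s-var = m≤m+n 6 26 }

scratch-count : ∀ {e} → e < 8 → Scratch (reg-count e)
scratch-count {e} e<8 = record
  { s-zero = λ () ; s-one = λ ()
  ; s-base = λ a a<8 → ≢-sym (<⇒≢ (<-≤-trans (+-monoʳ-< 8 a<8) (m≤m+n 16 e)))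
  ; s-par  = λ p _ → <⇒≢ (<-≤-trans (+-monoʳ-< 16 e<8) (m≤m+n 24 p))
  ; s-var  = <-≤-trans (+-monoʳ-< 16 e<8) (m≤m+n 24 8) }

-- The exact time depends on the branches taken, so it is existential with a bound. `keeps` protects
-- the counters of the enclosing loops, which are not part of the represented state.
record Compiled (P : Program) (W : ℕ) (ρ : ℕ → ℕ) (e b : ℕ) (m : Memory) (b′ bound : ℕ) (τ : St) : Set where
  field
    time   : ℕ
    end    : Memory
    within : time ≤ bound
    steps  : Reach P ⟨ b , m ⟩ time ⟨ b′ , end ⟩
    rep    : Rep W ρ end τ
    keeps  : ∀ f → f < e → end (reg-count f) ≡ m (reg-count f)

count≢ : ∀ {e f} → f < e → reg-count e ≢ reg-count f
count≢ f<e eq = <⇒≢ f<e (sym (+-cancelˡ-≡ 16 _ _ eq))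

count<24 : ∀ {f} → f < 8 → reg-count f < 24
count<24 = +-monoʳ-< 16

module _ {P : Program} {W : ℕ} (W≥64 : 64 ≤ W) {ρ : ℕ → ℕ} where

  open Compiled

  infixr 5 _then_
  _then_ : ∀ {e b m b₁ t₁ σ₁ b₂ t₂ σ₂} (C : Compiled P W ρ e b m b₁ t₁ σ₁) →
           Compiled P W ρ e b₁ (end C) b₂ t₂ σ₂ → Compiled P W ρ e b m b₂ (t₁ + t₂) σ₂
  C then D = record
    { time = time C + time D ; end = end D ; within = +-mono-≤ (within C) (within D)
    ; steps = reach-trans (steps C) (steps D) ; rep = rep D
    ; keeps = λ f f<e → trans (keeps D f f<e) (keeps C f f<e) }

  relax : ∀ {e b m b₁ b₂ t₁ t₂ σ} → b₁ ≡ b₂ → t₁ ≤ t₂ →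
          Compiled P W ρ e b m b₁ t₁ σ → Compiled P W ρ e b m b₂ t₂ σ
  relax refl t≤ C = record
    { time = time C ; end = end C ; within = ≤-trans (within C) t≤
    ; steps = steps C ; rep = rep C ; keeps = keeps C }

  straight-line : ∀ {e b m τ} is → T (all-straight is) → CodeAt P b is → Rep W ρ (execs is m) τ →
    (∀ f → f < e → execs is m (reg-count f) ≡ m (reg-count f)) →
    Compiled P W ρ e b m (length is + b) (length is) τ
  straight-line {b = b} {m} is t h r k = record
    { time = length is ; end = execs is m ; within = ≤-refl
    ; steps = reach-straight b is m t h ; rep = r ; keeps = k }

  jump : ∀ {e b m σ} i l → fetch P b ≡ just (jz i l) → m i ≡ 0 → Rep W ρ m σ → Compiled P W ρ e b m l 1 σ
  jump {b = b} {m} i l f z r = record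
    { time = 1 ; end = m ; within = ≤-refl ; steps = reach-jump b i l m f z ; rep = r ; keeps = λ _ _ → refl }

  fall : ∀ {e b m σ x} i l → fetch P b ≡ just (jz i l) → m i ≡ suc x → Rep W ρ m σ → Compiled P W ρ e b m (suc b) 1 σ
  fall {b = b} {m} i l f z r = record
    { time = 1 ; end = m ; within = ≤-refl ; steps = reach-fall b i l m f z ; rep = r ; keeps = λ _ _ → refl }

  address-rep : ∀ {m σ} a y → Rep W ρ m σ → Rep W ρ (execs (address a y) m) σ
  address-rep a y r = scratch (scratch (scratch (scratch r)))
    where
    scratch : ∀ {m σ x} → Rep W ρ m σ → Rep W ρ (m [ 5 ↦ x ]) σ
    scratch {x = x} = rep-scratch W≥64 x scratch-5

  address-value : ∀ {m σ a y} → a < 8 → y < 32 → Rep W ρ m σ →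
                  execs (address a y) m 5 ≡ cell W a (vars σ y)
  address-value {m} {σ} {a} {y} a<8 y<32 r =
    cong₂ (λ u w → octuple u + w) (rep-var r y y<32) (rep-base r a a<8)

  var-keeps : ∀ {e x} (m : Memory) v → e ≤ 8 → ∀ f → f < e → (m [ reg-var x ↦ v ]) (reg-count f) ≡ m (reg-count f)
  var-keeps {e} {x} m v e≤8 f f<e =
    upd-other m v (≢-sym (<⇒≢ (<-≤-trans (count<24 (<-≤-trans f<e e≤8)) (m≤m+n 24 (8 + x)))))

  assign : ∀ {e b m σ ins} x v {w} → e ≤ 8 → x < 32 → T (straight ins) → eff ins m ≡ m [ reg-var x ↦ v ] → v ≡ w →
           CodeAt P b (ins ∷ []) → Rep W ρ m σ → Compiled P W ρ e b m (suc b) 1 (σ ⟪ x ≔ w ⟫)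
  assign {m = m} {σ} {ins} x v {w} e≤8 x<32 t eq v≡w h r = straight-line (ins ∷ []) (pair t)
    h (subst (λ m′ → Rep W ρ m′ (σ ⟪ x ≔ w ⟫)) (sym eq) (rep-assign W≥64 x<32 v≡w r))
    (λ f f<e → trans (cong (λ m′ → m′ (reg-count f)) eq) (var-keeps m v e≤8 f f<e))
    where
    pair : ∀ {a} → T a → T (a ∧ true)
    pair {true} _ = tt

  -- Induction on the command, with an inner induction on the remaining rounds for `for`. The body
  -- of a loop is compiled one level deeper, so its `keeps` covers the counter of the loop itself.
  correct : ∀ c e b {m σ} → e ≤ 8 → T (wf e c) → CodeAt P b (code e b c) → Rep W ρ m σ →
            Compiled P W ρ e b m (size c + b) (cost c ρ) (⟦ c ⟧ ρ σ)
  correct skip e b {m} e≤8 w h r = record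
    { time = 0 ; end = m ; within = z≤n ; steps = reach (λ { [] → refl }) ; rep = r ; keeps = λ _ _ → refl }
  correct (c ⨾ d) e b e≤8 w h r with codeAt-++ b (code e b c) h
  ... | hc , hd = relax (trans (sym (+-assoc (size d) (size c) b)) (cong (_+ b) (+-comm (size d) (size c)))) ≤-refl (C then D)
    where
    C = correct c e b e≤8 (T-∧₁ (wf e c) w) hc r
    D = correct d e (size c + b) e≤8 (T-∧₂ (wf e c) w)
          (subst (λ l → CodeAt P (l + b) (code e (size c + b) d)) (length-code e b c) hd) (rep C)
  correct (set x k) e b e≤8 w h r = assign x k e≤8 (<ᵇ⇒< x 32 w) tt refl refl h r
  correct (par x p) e b e≤8 w h r = assign x _ e≤8 (<ᵇ⇒< x 32 (T-∧₁ (x <ᵇ 32) w)) tt refl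
    (trans (cong₂ _+_ (rep-par r p (<ᵇ⇒< p 8 (T-∧₂ (x <ᵇ 32) w))) (rep-zero r)) (+-identityʳ (ρ p))) h r
  correct (add x y z) e b e≤8 w h r = assign x _ e≤8 (<ᵇ⇒< x 32 (T-∧₁ (x <ᵇ 32) w)) tt refl
    (cong₂ _+_ (rep-var r y (<ᵇ⇒< y 32 (T-∧₁ (y <ᵇ 32) (T-∧₂ (x <ᵇ 32) w))))
               (rep-var r z (<ᵇ⇒< z 32 (T-∧₂ (y <ᵇ 32) (T-∧₂ (x <ᵇ 32) w))))) h r
  correct (sub x y z) e b e≤8 w h r = assign x _ e≤8 (<ᵇ⇒< x 32 (T-∧₁ (x <ᵇ 32) w)) tt refl
    (cong₂ _∸_ (rep-var r y (<ᵇ⇒< y 32 (T-∧₁ (y <ᵇ 32) (T-∧₂ (x <ᵇ 32) w))))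
               (rep-var r z (<ᵇ⇒< z 32 (T-∧₂ (y <ᵇ 32) (T-∧₂ (x <ᵇ 32) w))))) h r
  correct (get x a y) e b {m} {σ} e≤8 w (h₁ , h₂ , h₃ , h₄ , h₅) r = C then D
    where
    x<32 = <ᵇ⇒< x 32 (T-∧₁ (x <ᵇ 32) w)
    a<8 = <ᵇ⇒< a 8 (T-∧₁ (a <ᵇ 8) (T-∧₂ (x <ᵇ 32) w))
    y<32 = <ᵇ⇒< y 32 (T-∧₂ (a <ᵇ 8) (T-∧₂ (x <ᵇ 32) w))
    C : Compiled P W ρ e b m (4 + b) 4 σ
    C = straight-line (address a y) tt (h₁ , h₂ , h₃ , h₄ , tt) (address-rep a y r) (λ _ _ → refl)
    D : Compiled P W ρ e (4 + b) (end C) (5 + b) 1 (⟦ get x a y ⟧ ρ σ)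
    D = assign x _ e≤8 x<32 tt refl
      (trans (cong (end C) (address-value a<8 y<32 r)) (rep-arr (rep C) a a<8 (vars σ y))) h₅ (rep C)
  correct (put a y x) e b {m} {σ} e≤8 w (h₁ , h₂ , h₃ , h₄ , h₅) r = C then D
    where
    x<32 = <ᵇ⇒< x 32 (T-∧₁ (x <ᵇ 32) w)
    a<8 = <ᵇ⇒< a 8 (T-∧₁ (a <ᵇ 8) (T-∧₂ (x <ᵇ 32) w))
    y<32 = <ᵇ⇒< y 32 (T-∧₂ (a <ᵇ 8) (T-∧₂ (x <ᵇ 32) w))
    C : Compiled P W ρ e b m (4 + b) 4 σ
    C = straight-line (address a y) tt (h₁ , h₂ , h₃ , h₄ , tt) (address-rep a y r) (λ _ _ → refl)
    addr = address-value a<8 y<32 r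
    D : Compiled P W ρ e (4 + b) (end C) (5 + b) 1 (⟦ put a y x ⟧ ρ σ)
    D = straight-line (store 5 (reg-var x) ∷ []) tt h₅
      (subst (λ k → Rep W ρ (end C [ k ↦ m (reg-var x) ]) (⟦ put a y x ⟧ ρ σ)) (sym addr)
        (rep-put W≥64 {i = vars σ y} a<8 (rep-var r x x<32) (rep C)))
      (λ f f<e → trans (cong (λ k → (end C [ k ↦ m (reg-var x) ]) (reg-count f)) addr)
        (upd-other (end C) _ (≢-sym (reg-≢-cell W≥64 {ρ} a (vars σ y)
          (<-≤-trans (count<24 (<-≤-trans f<e e≤8)) (m≤m+n 24 40))))))
  correct (ifzero x c d) e b {m} {σ} e≤8 w (f , h) r
    with codeAt-++ (suc b) (code e (suc b) d) h
  ... | hd , (fj , hc) = branch (vars σ x) refl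
    where
    x<32 = <ᵇ⇒< x 32 (T-∧₁ (x <ᵇ 32) w)
    wc = T-∧₁ (wf e c) (T-∧₂ (x <ᵇ 32) w)
    wd = T-∧₂ (wf e c) (T-∧₂ (x <ᵇ 32) w)
    d-end = size d + suc b
    len : length (code e (suc b) d) + suc b ≡ d-end
    len = cong (_+ suc b) (length-code e (suc b) d)
    last : size c + suc d-end ≡ size (ifzero x c d) + b
    last = eq (size c) (size d) b
      where
      eq : ∀ c d b → c + suc (d + suc b) ≡ suc (d + suc c) + b
      eq = solve-∀
    branch : ∀ k → vars σ x ≡ k →
      Compiled P W ρ e b m (size (ifzero x c d) + b) (cost (ifzero x c d) ρ) (ifz k (⟦ c ⟧ ρ σ) (⟦ d ⟧ ρ σ))
    branch zero eq = relax last (s≤s (≤-trans (m≤m+n (cost c ρ) (cost d ρ)) (n≤1+n _)))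
      (jump (reg-var x) (suc d-end) f (trans (rep-var r x x<32) eq) r then
       correct c e (suc d-end) e≤8 wc (subst (λ l → CodeAt P (suc l) (code e (suc d-end) c)) len hc) r)
    branch (suc k) eq = relax last (s≤s (≤-trans (≤-reflexive (+-comm (cost d ρ) 1)) (s≤s (m≤n+m (cost d ρ) (cost c ρ)))))
      (fall (reg-var x) (suc d-end) f (trans (rep-var r x x<32) eq) r then D then
       jump 3 (size c + suc d-end) (subst (λ l → fetch P l ≡ just (jz 3 (size c + suc d-end))) len fj) (rep-zero (rep D)) (rep D))
      where
      D = correct d e (suc b) e≤8 wd hd r
  correct (for x p c) e b {m} {σ} e≤8 w (f₀ , f₁ , f₂ , f₃ , h) r
    with codeAt-++ (4 + b) (code (suc e) (4 + b) c) h
  ... | hc , (f₄ , f₅ , _) = relax last (≤-reflexive (loop-cost (ρ p * (cost c ρ + 5)))) (C then iterate (ρ p) 0 refl (upd-same m (reg-count e) 0) (rep C))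
    where
    loop-cost : ∀ k → 1 + (k + 2) ≡ k + 3
    loop-cost = solve-∀
    body : ℕ → St → St
    body v τ = ⟦ c ⟧ ρ (τ ⟪ x ≔ v ⟫)
    e<8 = <ᵇ⇒< e 8 (T-∧₁ (e <ᵇ 8) w)
    x<32 = <ᵇ⇒< x 32 (T-∧₁ (x <ᵇ 32) (T-∧₂ (e <ᵇ 8) w))
    p<8 = <ᵇ⇒< p 8 (T-∧₁ (p <ᵇ 8) (T-∧₂ (x <ᵇ 32) (T-∧₂ (e <ᵇ 8) w)))
    wc = T-∧₂ (p <ᵇ 8) (T-∧₂ (x <ᵇ 32) (T-∧₂ (e <ᵇ 8) w))
    c-end = size c + (4 + b)
    len : length (code (suc e) (4 + b) c) + (4 + b) ≡ c-end
    len = cong (_+ (4 + b)) (length-code (suc e) (4 + b) c)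
    last : 2 + c-end ≡ size (for x p c) + b
    last = eq (size c) b
      where
      eq : ∀ c b → 2 + (c + (4 + b)) ≡ 4 + (c + 2) + b
      eq = solve-∀
    C : Compiled P W ρ e b m (suc b) 1 σ
    C = straight-line (const (reg-count e) 0 ∷ []) tt (f₀ , tt) (rep-scratch W≥64 0 (scratch-count e<8) r)
          (λ g g<e → upd-other m 0 (count≢ g<e))
    -- Here v rounds are done and k remain. The exit test subtracts the counter from the parameter,
    -- so it sees k.
    iterate : ∀ k v {m σ} → v + k ≡ ρ p → m (reg-count e) ≡ v → Rep W ρ m σ →
              Compiled P W ρ e (suc b) m (2 + c-end) (k * (cost c ρ + 5) + 2) (loopFrom v k body σ)
    iterate k v {m} {σ} v+k≡ mv r = go k v+k≡
      where
      remaining : m (reg-par p) ∸ m (reg-count e) ≡ ρ p ∸ v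
      remaining = cong₂ _∸_ (rep-par r p p<8) mv
      S : Compiled P W ρ e (suc b) m (2 + b) 1 σ
      S = straight-line (sub 5 (reg-par p) (reg-count e) ∷ []) tt (f₁ , tt) (rep-scratch W≥64 _ scratch-5 r) (λ _ _ → refl)
      go : ∀ k → v + k ≡ ρ p →
           Compiled P W ρ e (suc b) m (2 + c-end) (k * (cost c ρ + 5) + 2) (loopFrom v k body σ)
      go zero eq = S then jump 5 (2 + c-end) f₂
        (trans remaining (trans (cong (_∸ v) (trans (sym eq) (+-identityʳ v))) (n∸n≡0 v))) (rep S)
      go (suc k) eq = relax refl (≤-reflexive (arith (cost c ρ) (k * (cost c ρ + 5))))
          (S then
           fall 5 (2 + c-end) f₂
             (trans remaining (trans (cong (_∸ v) (sym eq)) (m+n∸m≡n v (suc k)))) (rep S) then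
           A then lower B then I then
           jump 3 (suc b) (subst (λ l → fetch P (suc l) ≡ just (jz 3 (suc b))) len f₅) (rep-zero (rep I)) (rep I) then
           iterate k (suc v) (trans (sym (+-suc v k)) eq) (trans (upd-same (end B) (reg-count e) _) count) (rep I))
        where
        arith : ∀ c r → 1 + (1 + (1 + (c + (1 + (1 + (r + 2)))))) ≡ c + 5 + r + 2
        arith = solve-∀
        A : Compiled P W ρ e (3 + b) (end S) (4 + b) 1 (σ ⟪ x ≔ v ⟫)
        A = assign x _ e≤8 x<32 tt refl (trans (cong₂ _+_ mv (rep-zero (rep S))) (+-identityʳ v)) (f₃ , tt) (rep S)
        B = correct c (suc e) (4 + b) e<8 wc hc (rep A)
        lower : ∀ {m b b′ t τ} → Compiled P W ρ (suc e) b m b′ t τ → Compiled P W ρ e b m b′ t τ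
        lower C = record
          { time = time C ; end = end C ; within = within C ; steps = steps C ; rep = rep C
          ; keeps = λ g g<e → keeps C g (m<n⇒m<1+n g<e) }
        I : Compiled P W ρ e c-end (end B) (suc c-end) 1 (body v σ)
        I = straight-line (add (reg-count e) (reg-count e) 4 ∷ []) tt
              (subst (λ l → fetch P l ≡ just (add (reg-count e) (reg-count e) 4)) len f₄ , tt)
              (rep-scratch W≥64 _ (scratch-count e<8) (rep B)) (λ g g<e → upd-other (end B) _ (count≢ g<e))
        before : end A (reg-count e) ≡ v
        before = trans (var-keeps (end S) _ e<8 e ≤-refl) mv
        count : end B (reg-count e) + end B 4 ≡ suc v
        count = trans (cong₂ _+_ (trans (keeps B e ≤-refl) before) (rep-one (rep B))) (+-comm v 1)

-- Independent sets agreeing with a partial choice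

sumTo : ℕ → (ℕ → ℕ) → ℕ
sumTo zero    f = 0
sumTo (suc k) f = sumTo k f + f k

-- Unlike `sumTo`, this peels off the front factor, following the structure of the vectors whose
-- entries are multiplied in `agree`.
prodTo : ℕ → (ℕ → ℕ) → ℕ
prodTo zero    f = 1
prodTo (suc k) f = f 0 * prodTo k (λ x → f (suc x))

sumᵇ : ∀ k → (Vec Bool k → ℕ) → ℕ
sumᵇ zero    f = f []
sumᵇ (suc k) f = sumᵇ k (λ w → f (true ∷ w)) + sumᵇ k (λ w → f (false ∷ w))

sum-cong : ∀ m {f g : ℕ → ℕ} → (∀ x → x < m → f x ≡ g x) → sumTo m f ≡ sumTo m g
sum-cong zero    h = refl
sum-cong (suc m) h = cong₂ _+_ (sum-cong m λ x x<m → h x (m<n⇒m<1+n x<m)) (h m ≤-refl)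

sum-mono : ∀ m {f g : ℕ → ℕ} → (∀ x → x < m → f x ≤ g x) → sumTo m f ≤ sumTo m g
sum-mono zero    h = z≤n
sum-mono (suc m) h = +-mono-≤ (sum-mono m λ x x<m → h x (m<n⇒m<1+n x<m)) (h m ≤-refl)

sum-zero : ∀ m {f : ℕ → ℕ} → (∀ x → x < m → f x ≡ 0) → sumTo m f ≡ 0
sum-zero zero    h = refl
sum-zero (suc m) h = cong₂ _+_ (sum-zero m λ x x<m → h x (m<n⇒m<1+n x<m)) (h m ≤-refl)

sum-const : ∀ m k → sumTo m (λ _ → k) ≡ m * k
sum-const zero    k = refl
sum-const (suc m) k = trans (cong (_+ k) (sum-const m k)) (+-comm (m * k) k)

interchange : ∀ a b c d → a + b + (c + d) ≡ a + c + (b + d)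
interchange = solve-∀

sum-+ : ∀ m (f g : ℕ → ℕ) → sumTo m (λ x → f x + g x) ≡ sumTo m f + sumTo m g
sum-+ zero    f g = refl
sum-+ (suc m) f g = trans (cong (_+ (f m + g m)) (sum-+ m f g)) (interchange (sumTo m f) (sumTo m g) (f m) (g m))

term≤sum : ∀ m (f : ℕ → ℕ) x → x < m → f x ≤ sumTo m f
term≤sum (suc m) f x x<1+m with m<1+n⇒m<n∨m≡n x<1+m
... | inj₁ x<m = ≤-trans (term≤sum m f x x<m) (m≤m+n _ _)
... | inj₂ refl = m≤n+m (f x) (sumTo x f)

sum-upd : ∀ m (U g : ℕ → ℕ) x → x < m →
          sumTo m (λ y → U y * g y) ≡ sumTo m (λ y → (U [ x ↦ 0 ]) y * g y) + U x * g x
sum-upd (suc m) U g x x<1+m with x ≟ m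
... | yes refl = begin
    sumTo x (λ y → U y * g y) + U x * g x
      ≡⟨ cong (_+ U x * g x) (sum-cong x λ y y<x → cong (_* g y) (sym (upd-other U 0 (≢-sym (<⇒≢ y<x))))) ⟩
    sumTo x (λ y → (U [ x ↦ 0 ]) y * g y) + U x * g x
      ≡⟨ cong (λ k → k + U x * g x) (sym (+-identityʳ _)) ⟩
    sumTo x (λ y → (U [ x ↦ 0 ]) y * g y) + 0 + U x * g x
      ≡⟨ cong (λ k → sumTo x (λ y → (U [ x ↦ 0 ]) y * g y) + k * g x + U x * g x) (sym (upd-same U x 0)) ⟩
    sumTo x (λ y → (U [ x ↦ 0 ]) y * g y) + (U [ x ↦ 0 ]) x * g x + U x * g x ∎
  where open ≡-Reasoning
... | no x≢m with m<1+n⇒m<n∨m≡n x<1+m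
... | inj₂ x≡m = ⊥-elim (x≢m x≡m)
... | inj₁ x<m = trans (cong₂ _+_ (sum-upd m U g x x<m) (cong (_* g m) (sym (upd-other U 0 x≢m))))
      (swap (sumTo m (λ y → (U [ x ↦ 0 ]) y * g y)) (U x * g x) ((U [ x ↦ 0 ]) m * g m))
  where
  swap : ∀ a b c → a + b + c ≡ a + c + b
  swap = solve-∀

prod-cong : ∀ k {f g : ℕ → ℕ} → (∀ x → x < k → f x ≡ g x) → prodTo k f ≡ prodTo k g
prod-cong zero    h = refl
prod-cong (suc k) h = cong₂ _*_ (h 0 z<s) (prod-cong k λ x x<k → h (suc x) (s≤s x<k))

prod-one : ∀ k {f : ℕ → ℕ} → (∀ x → x < k → f x ≡ 1) → prodTo k f ≡ 1
prod-one zero    h = refl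
prod-one (suc k) h = cong₂ _*_ (h 0 z<s) (prod-one k λ x x<k → h (suc x) (s≤s x<k))

prod-zero : ∀ k (f : ℕ → ℕ) x → x < k → f x ≡ 0 → prodTo k f ≡ 0
prod-zero (suc k) f zero    _         eq = cong (_* prodTo k (λ x → f (suc x))) eq
prod-zero (suc k) f (suc x) (s≤s x<k) eq =
  trans (cong (f 0 *_) (prod-zero k (λ x → f (suc x)) x x<k eq)) (*-zeroʳ (f 0))

prod-split : ∀ k {f g h : ℕ → ℕ} x → x < k → f x ≡ g x + h x →
             (∀ y → x ≢ y → f y ≡ g y) → (∀ y → x ≢ y → f y ≡ h y) →
             prodTo k f ≡ prodTo k g + prodTo k h
prod-split (suc k) {f} {g} {h} zero _ eq fg fh = begin
  f 0 * F ≡⟨ cong (_* F) eq ⟩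
  (g 0 + h 0) * F ≡⟨ *-distribʳ-+ F (g 0) (h 0) ⟩
  g 0 * F + h 0 * F ≡⟨ cong₂ (λ a b → g 0 * a + h 0 * b) (prod-cong k λ y _ → fg (suc y) λ ()) (prod-cong k λ y _ → fh (suc y) λ ()) ⟩
  g 0 * prodTo k (λ y → g (suc y)) + h 0 * prodTo k (λ y → h (suc y)) ∎
  where
  open ≡-Reasoning
  F = prodTo k (λ y → f (suc y))
prod-split (suc k) {f} {g} {h} (suc x) (s≤s x<k) eq fg fh = begin
  f 0 * prodTo k (λ y → f (suc y))
    ≡⟨ cong (f 0 *_) (prod-split k x x<k eq (λ y n → fg (suc y) λ { refl → n refl }) (λ y n → fh (suc y) λ { refl → n refl })) ⟩
  f 0 * (G + H) ≡⟨ *-distribˡ-+ (f 0) G H ⟩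
  f 0 * G + f 0 * H ≡⟨ cong₂ (λ a b → a * G + b * H) (fg 0 λ ()) (fh 0 λ ()) ⟩
  g 0 * G + h 0 * H ∎
  where
  open ≡-Reasoning
  G = prodTo k (λ y → g (suc y))
  H = prodTo k (λ y → h (suc y))

sumᵇ-cong : ∀ k {f g : Vec Bool k → ℕ} → (∀ w → f w ≡ g w) → sumᵇ k f ≡ sumᵇ k g
sumᵇ-cong zero    h = h []
sumᵇ-cong (suc k) h = cong₂ _+_ (sumᵇ-cong k λ w → h (true ∷ w)) (sumᵇ-cong k λ w → h (false ∷ w))

sumᵇ-mono : ∀ k {f g : Vec Bool k → ℕ} → (∀ w → f w ≤ g w) → sumᵇ k f ≤ sumᵇ k g
sumᵇ-mono zero    h = h []
sumᵇ-mono (suc k) h = +-mono-≤ (sumᵇ-mono k λ w → h (true ∷ w)) (sumᵇ-mono k λ w → h (false ∷ w))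

sumᵇ-+ : ∀ k (f g : Vec Bool k → ℕ) → sumᵇ k (λ w → f w + g w) ≡ sumᵇ k f + sumᵇ k g
sumᵇ-+ zero    f g = refl
sumᵇ-+ (suc k) f g = trans (cong₂ _+_ (sumᵇ-+ k (λ w → f (true ∷ w)) (λ w → g (true ∷ w)))
    (sumᵇ-+ k (λ w → f (false ∷ w)) (λ w → g (false ∷ w))))
  (interchange (sumᵇ k (λ w → f (true ∷ w))) (sumᵇ k (λ w → g (true ∷ w))) _ _)

sumᵇ-* : ∀ k a (f : Vec Bool k → ℕ) → sumᵇ k (λ w → a * f w) ≡ a * sumᵇ k f
sumᵇ-* zero    a f = refl
sumᵇ-* (suc k) a f = trans (cong₂ _+_ (sumᵇ-* k a _) (sumᵇ-* k a _)) (sym (*-distribˡ-+ a _ _))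

sumᵇ-const : ∀ k a → sumᵇ k (λ _ → a) ≡ 2 ^ k * a
sumᵇ-const zero    a = sym (*-identityˡ a)
sumᵇ-const (suc k) a = trans (cong₂ _+_ (sumᵇ-const k a) (sumᵇ-const k a)) (double (2 ^ k) a)
  where
  double : ∀ p a → p * a + p * a ≡ 2 * p * a
  double = solve-∀

at : ∀ {m} → Vec Bool m → ℕ → ℕ
at []      x       = 0
at (b ∷ J) zero    = toBit b
at (b ∷ J) (suc x) = at J x

at-bit : ∀ {m} (J : Vec Bool m) x → at J x ≡ 0 ⊎ at J x ≡ 1
at-bit []          x       = inj₁ refl
at-bit (true ∷ J)  zero    = inj₂ refl
at-bit (false ∷ J) zero    = inj₁ refl
at-bit (b ∷ J)     (suc x) = at-bit J x

same : ℕ → ℕ → ℕ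
same j i = toBit (j ≡ᵇ i)

Bits : (ℕ → ℕ) → Set
Bits U = ∀ x → U x ≤ 1

bits-upd : ∀ {U} x {k} → k ≤ 1 → Bits U → Bits (U [ x ↦ k ])
bits-upd x k≤1 h y with x ≡ᵇ y
... | true  = k≤1
... | false = h y

-- The product is a Kronecker delta that singles out the vector spelling out I. As I is a function,
-- g comes with a version g′ on functions, which may look only at the first m values.
pick-bits : ∀ m (I : ℕ → ℕ) → Bits I → (g : Vec Bool m → ℕ) (g′ : (ℕ → ℕ) → ℕ) →
  (∀ J → g J ≡ g′ (at J)) → (∀ {K L} → (∀ x → x < m → K x ≡ L x) → g′ K ≡ g′ L) →
  sumᵇ m (λ J → prodTo m (λ x → same (at J x) (I x)) * g J) ≡ g′ I
pick-bits zero    I bits g g′ gg′ c = trans (+-identityʳ (g [])) (trans (gg′ []) (c λ _ ()))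
pick-bits (suc m) I bits g g′ gg′ c with I 0 in eq | bits 0
... | 0 | _ = cong₂ _+_ (trans (sumᵇ-const m 0) (*-zeroʳ (2 ^ m)))
    (trans (sumᵇ-cong m λ J → cong (_* g (false ∷ J)) (*-identityˡ (prodTo m (λ x → same (at J x) (I (suc x))))))
      (trans (pick-bits m (λ x → I (suc x)) (λ x → bits (suc x)) (λ J → g (false ∷ J)) (λ K → g′ (cons 0 K))
          (λ J → trans (gg′ (false ∷ J)) (c λ { zero _ → refl ; (suc x) _ → refl }))
          (λ h → c λ { zero _ → refl ; (suc x) (s≤s x<m) → h x x<m }))
        (c λ { zero _ → sym eq ; (suc x) _ → refl })))
  where
  cons : ℕ → (ℕ → ℕ) → ℕ → ℕ
  cons k K zero    = k
  cons k K (suc x) = K x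
... | 1 | _ = trans (cong₂ _+_
    (trans (sumᵇ-cong m λ J → cong (_* g (true ∷ J)) (*-identityˡ (prodTo m (λ x → same (at J x) (I (suc x))))))
      (trans (pick-bits m (λ x → I (suc x)) (λ x → bits (suc x)) (λ J → g (true ∷ J)) (λ K → g′ (cons 1 K))
          (λ J → trans (gg′ (true ∷ J)) (c λ { zero _ → refl ; (suc x) _ → refl }))
          (λ h → c λ { zero _ → refl ; (suc x) (s≤s x<m) → h x x<m }))
        (c λ { zero _ → sym eq ; (suc x) _ → refl })))
    (trans (sumᵇ-const m 0) (*-zeroʳ (2 ^ m)))) (+-identityʳ _)
  where
  cons : ℕ → (ℕ → ℕ) → ℕ → ℕ
  cons k K zero    = k
  cons k K (suc x) = K x
... | suc (suc _) | s≤s ()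

-- Sets of vertices are 0/1-valued functions on {0, …, m-1}; A is an adjacency matrix.
degree-in : ℕ → (ℕ → ℕ → ℕ) → (ℕ → ℕ) → ℕ → ℕ
degree-in m A U x = sumTo m λ y → U y * A x y

edges-in : ℕ → (ℕ → ℕ → ℕ) → (ℕ → ℕ) → ℕ
edges-in m A U = sumTo m λ x → U x * degree-in m A U x

agreeAt : ℕ → ℕ → ℕ → ℕ
agreeAt u j i = ifz u (same j i) 1

agree : ∀ {m} → (ℕ → ℕ) → (ℕ → ℕ) → Vec Bool m → ℕ
agree {m} U I J = prodTo m λ x → agreeAt (U x) (at J x) (I x)

-- By truncation, `1 ∸ edges-in` is the indicator of independence: it is 1 exactly when no edge is
-- spanned.
isets : ℕ → (ℕ → ℕ → ℕ) → ℕ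
isets m A = sumᵇ m λ J → 1 ∸ edges-in m A (at J)

-- The number of independent sets that agree with I outside U.
completions : ℕ → (ℕ → ℕ → ℕ) → (ℕ → ℕ) → (ℕ → ℕ) → ℕ
completions m A U I = sumᵇ m λ J → agree U I J * (1 ∸ edges-in m A (at J))

edges-cong : ∀ m {A B : ℕ → ℕ → ℕ} {U V : ℕ → ℕ} → (∀ x y → x < m → y < m → A x y ≡ B x y) →
             (∀ x → x < m → U x ≡ V x) → edges-in m A U ≡ edges-in m B V
edges-cong m hA hU = sum-cong m λ x x<m → cong₂ _*_ (hU x x<m)
  (sum-cong m λ y y<m → cong₂ _*_ (hU y y<m) (hA x y x<m y<m))

isets-cong : ∀ m {A B : ℕ → ℕ → ℕ} → (∀ x y → x < m → y < m → A x y ≡ B x y) → isets m A ≡ isets m B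
isets-cong m hA = sumᵇ-cong m λ J → cong (1 ∸_) (edges-cong m {U = at J} {V = at J} hA λ _ _ → refl)

record IsGraph (m : ℕ) (A : ℕ → ℕ → ℕ) : Set where
  field
    bit       : ∀ x y → x < m → y < m → A x y ≤ 1
    symmetric : ∀ x y → x < m → y < m → A x y ≡ A y x
    loopless  : ∀ x → x < m → A x x ≡ 0

module Completions {m : ℕ} {A : ℕ → ℕ → ℕ} (gr : IsGraph m A) where

  open IsGraph gr public

  deg = degree-in m A
  edges = edges-in m A
  count = completions m A

  count-cong : ∀ {U V I K} → (∀ x → x < m → U x ≡ V x) → (∀ x → x < m → I x ≡ K x) → count U I ≡ count V K
  count-cong hU hI = sumᵇ-cong m λ J → cong (_* (1 ∸ edges (at J)))
    (prod-cong m λ x x<m → cong₂ (λ u i → agreeAt u (at J x) i) (hU x x<m) (hI x x<m))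

  -- The factor of `agree` at x is 1 as long as x is undecided; it splits into the indicators of the
  -- two values of J at x, while all other factors are untouched.
  count-decide : ∀ U I x → x < m → U x ≡ 1 →
    count U I ≡ count (U [ x ↦ 0 ]) (I [ x ↦ 0 ]) + count (U [ x ↦ 0 ]) (I [ x ↦ 1 ])
  count-decide U I x x<m Ux = trans (sumᵇ-cong m λ J → trans
      (cong (_* (1 ∸ edges (at J))) (prod-split m x x<m (at-x J) (λ y → other J y 0) (λ y → other J y 1)))
      (*-distribʳ-+ (1 ∸ edges (at J)) (agree (U [ x ↦ 0 ]) (I [ x ↦ 0 ]) J) (agree (U [ x ↦ 0 ]) (I [ x ↦ 1 ]) J)))
    (sumᵇ-+ m _ _)
    where
    at-x : ∀ (J : Vec Bool m) → agreeAt (U x) (at J x) (I x) ≡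
           agreeAt ((U [ x ↦ 0 ]) x) (at J x) ((I [ x ↦ 0 ]) x) + agreeAt ((U [ x ↦ 0 ]) x) (at J x) ((I [ x ↦ 1 ]) x)
    at-x J rewrite ≡ᵇ-refl x | Ux with at-bit J x
    ... | inj₁ eq rewrite eq = refl
    ... | inj₂ eq rewrite eq = refl
    other : ∀ (J : Vec Bool m) y k → x ≢ y → agreeAt (U y) (at J y) (I y) ≡ agreeAt ((U [ x ↦ 0 ]) y) (at J y) ((I [ x ↦ k ]) y)
    other J y k x≢y rewrite ≢⇒≡ᵇ x≢y = refl

  -- Every J either disagrees at v or u, which kills a factor of `agree`, or contains both ends of
  -- an edge, which kills the indicator of independence.
  count-conflict : ∀ U I v u → v < m → u < m → v ≢ u → U v ≡ 0 → I v ≡ 1 → A v u ≡ 1 →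
    count (U [ u ↦ 0 ]) (I [ u ↦ 1 ]) ≡ 0
  count-conflict U I v u v<m u<m v≢u Uv Iv Avu =
    trans (sumᵇ-cong m zero-term) (trans (sumᵇ-const m 0) (*-zeroʳ (2 ^ m)))
    where
    agreement : Vec Bool m → ℕ → ℕ
    agreement J x = agreeAt ((U [ u ↦ 0 ]) x) (at J x) ((I [ u ↦ 1 ]) x)
    zero-term : ∀ J → agree (U [ u ↦ 0 ]) (I [ u ↦ 1 ]) J * (1 ∸ edges (at J)) ≡ 0
    zero-term J with at-bit J v | at-bit J u
    ... | inj₁ Jv | _ = cong (_* (1 ∸ edges (at J))) (prod-zero m (agreement J) v v<m eq)
      where
      eq : agreement J v ≡ 0
      eq rewrite ≢⇒≡ᵇ (≢-sym v≢u) | Uv | Iv | Jv = refl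
    ... | inj₂ _ | inj₁ Ju = cong (_* (1 ∸ edges (at J))) (prod-zero m (agreement J) u u<m eq)
      where
      eq : agreement J u ≡ 0
      eq rewrite ≡ᵇ-refl u | Ju = refl
    ... | inj₂ Jv | inj₂ Ju = trans (cong (agree (U [ u ↦ 0 ]) (I [ u ↦ 1 ]) J *_) (m≤n⇒m∸n≡0 edge))
        (*-zeroʳ (agree (U [ u ↦ 0 ]) (I [ u ↦ 1 ]) J))
      where
      edge : 1 ≤ edges (at J)
      edge = ≤-trans (≤-reflexive (sym (cong₂ _*_ Jv (cong₂ _*_ Ju Avu))))
        (≤-trans (*-monoʳ-≤ (at J v) (term≤sum m (λ y → at J y * A v y) u u<m))
          (term≤sum m (λ x → at J x * deg (at J) x) v v<m))

  count-kill : ∀ U I v u → v < m → u < m → U v ≡ 0 → I v ≡ 1 → U u ≡ 1 → A v u ≡ 1 →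
    count U I ≡ count (U [ u ↦ 0 ]) (I [ u ↦ 0 ])
  count-kill U I v u v<m u<m Uv Iv Uu Avu = trans (count-decide U I u u<m Uu)
    (trans (cong (count (U [ u ↦ 0 ]) (I [ u ↦ 0 ]) +_)
      (count-conflict U I v u v<m u<m (λ { refl → 0≢1+n (trans (sym Uv) Uu) }) Uv Iv Avu)) (+-identityʳ _))

  count-done : ∀ U I → (∀ x → x < m → U x ≡ 0) → Bits I → count U I ≡ 1 ∸ edges I
  count-done U I U≡0 bits = trans
    (sumᵇ-cong m λ J → cong (_* (1 ∸ edges (at J))) (prod-cong m λ x x<m → cong (λ u → agreeAt u (at J x) (I x)) (U≡0 x x<m)))
    (pick-bits m I bits (λ J → 1 ∸ edges (at J)) (λ K → 1 ∸ edges K) (λ _ → refl)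
      λ h → cong (1 ∸_) (edges-cong m (λ _ _ _ _ → refl) h))

  count-all : ∀ U I → (∀ x → x < m → U x ≡ 1) → count U I ≡ isets m A
  count-all U I U≡1 = sumᵇ-cong m λ J → trans (cong (_* (1 ∸ edges (at J)))
    (prod-one m λ x x<m → cong (λ u → agreeAt u (at J x) (I x)) (U≡1 x x<m))) (*-identityˡ _)

  degree-remove : ∀ U x a → x < m → U x ≡ 1 → deg U a ≡ deg (U [ x ↦ 0 ]) a + A a x
  degree-remove U x a x<m Ux = trans (sum-upd m U (A a) x x<m)
    (cong (deg (U [ x ↦ 0 ]) a +_) (trans (cong (_* A a x) Ux) (*-identityˡ _)))

  -- `edges-in` counts ordered pairs, so each edge at x disappears twice: from the row of x and from
  -- the row of its neighbour.
  edges-remove : ∀ U x → x < m → U x ≡ 1 → edges U ≡ edges (U [ x ↦ 0 ]) + 2 * deg U x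
  edges-remove U x x<m Ux = begin
    edges U ≡⟨ sum-upd m U (deg U) x x<m ⟩
    sumTo m (λ a → V a * deg U a) + U x * deg U x
      ≡⟨ cong₂ _+_ (sum-cong m λ a _ → trans (cong (V a *_) (degree-remove U x a x<m Ux)) (*-distribˡ-+ (V a) (deg V a) (A a x)))
                   (trans (cong (_* deg U x) Ux) (*-identityˡ (deg U x))) ⟩
    sumTo m (λ a → V a * deg V a + V a * A a x) + deg U x
      ≡⟨ cong (_+ deg U x) (sum-+ m (λ a → V a * deg V a) (λ a → V a * A a x)) ⟩
    edges V + sumTo m (λ a → V a * A a x) + deg U x
      ≡⟨ cong (λ k → edges V + k + deg U x) (sum-cong m λ a a<m → cong (V a *_) (symmetric a x a<m x<m)) ⟩
    edges V + deg V x + deg U x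
      ≡⟨ cong (λ k → edges V + k + deg U x) (sym (trans (degree-remove U x x x<m Ux)
           (trans (cong (deg V x +_) (loopless x x<m)) (+-identityʳ (deg V x))))) ⟩
    edges V + deg U x + deg U x ≡⟨ arith (edges V) (deg U x) ⟩
    edges V + 2 * deg U x ∎
    where
    open ≡-Reasoning
    V = U [ x ↦ 0 ]
    arith : ∀ a b → a + b + b ≡ a + 2 * b
    arith = solve-∀

  size-remove : ∀ U x → x < m → U x ≡ 1 → sumTo m U ≡ suc (sumTo m (U [ x ↦ 0 ]))
  size-remove U x x<m Ux = begin
    sumTo m U ≡⟨ sum-cong m (λ y _ → sym (*-identityʳ (U y))) ⟩
    sumTo m (λ y → U y * 1) ≡⟨ sum-upd m U (λ _ → 1) x x<m ⟩
    sumTo m (λ y → (U [ x ↦ 0 ]) y * 1) + U x * 1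
      ≡⟨ cong₂ _+_ (sum-cong m λ y _ → *-identityʳ ((U [ x ↦ 0 ]) y)) (cong (_* 1) Ux) ⟩
    sumTo m (U [ x ↦ 0 ]) + 1 ≡⟨ +-comm _ 1 ⟩
    suc (sumTo m (U [ x ↦ 0 ])) ∎
    where open ≡-Reasoning

-- The sampler

sum-split : ∀ w k (F : ℕ → ℕ) → sumTo (w + k) F ≡ sumTo w F + sumTo k (λ r → F (w + r))
sum-split w zero    F rewrite +-identityʳ w = sym (+-identityʳ _)
sum-split w (suc k) F rewrite +-suc w k =
  trans (cong (_+ F (w + k)) (sum-split w k F)) (+-assoc (sumTo w F) _ _)

ifz-zero : ∀ {a} {A : Set a} {k} {x y : A} → k ≡ 0 → ifz k x y ≡ x
ifz-zero refl = refl

ifz-suc : ∀ {a} {A : Set a} {k} {x y : A} → 0 < k → ifz k x y ≡ y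
ifz-suc (s≤s _) = refl

loop-inv : ∀ {a} {S : Set a} (R : ℕ → S → Set) m {f : ℕ → S → S} →
           (∀ v s → v < m → R v s → R (suc v) (f v s)) → ∀ s → R 0 s → R m (loopFrom 0 m f s)
loop-inv {S = S} R m {f} next s r = go m 0 (+-identityʳ m) s r
  where
  go : ∀ k v → k + v ≡ m → ∀ s → R v s → R m (loopFrom v k f s)
  go zero    v refl s r = r
  go (suc k) v eq   s r = go k (suc v) (trans (+-suc k v) eq) (f v s)
    (next v s (subst (suc v ≤_) eq (s≤s (m≤n+m v k))) r)

bit-cases : ∀ {k} → k ≤ 1 → k ≡ 0 ⊎ k ≡ 1
bit-cases z≤n       = inj₁ refl
bit-cases (s≤s z≤n) = inj₂ refl

-- The machine cannot multiply; for bits, addition and truncated subtraction form the product.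
both : ∀ {u a} → u ≤ 1 → a ≤ 1 → u + a ∸ 1 ≡ u * a
both z≤n       z≤n       = refl
both z≤n       (s≤s z≤n) = refl
both (s≤s z≤n) z≤n       = refl
both (s≤s z≤n) (s≤s z≤n) = refl

both-suc : ∀ {u a k} → u ≤ 1 → a ≤ 1 → u + a ∸ 1 ≡ suc k → u ≡ 1 × a ≡ 1
both-suc z≤n       z≤n       ()
both-suc z≤n       (s≤s z≤n) ()
both-suc (s≤s z≤n) z≤n       ()
both-suc (s≤s z≤n) (s≤s z≤n) _ = refl , refl

-- `budget` bounds the number of vertices still alive and is the index into the table B; `rest` is
-- the part of the random number not yet used up by choices.
record Walk : Set where
  constructor walk
  field
    alive chosen : ℕ → ℕ
    budget rest  : ℕ

module Sampler (m τ : ℕ) (A : ℕ → ℕ → ℕ) (B : ℕ → ℕ) where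

  hit : (ℕ → ℕ) → ℕ → ℕ → ℕ
  hit U v y = U y + A v y ∸ 1

  hits : (ℕ → ℕ) → ℕ → ℕ
  hits U v = sumTo m (hit U v)

  killStep : ℕ → ℕ → (ℕ → ℕ) × (ℕ → ℕ) → (ℕ → ℕ) × (ℕ → ℕ)
  killStep v y (U , I) = ifz (hit U v y) (U , I) (U [ y ↦ 0 ] , I [ y ↦ 0 ])

  kill : ℕ → (ℕ → ℕ) → (ℕ → ℕ) → (ℕ → ℕ) × (ℕ → ℕ)
  kill v U I = loopFrom 0 m (killStep v) (U , I)

  -- The number r is read as a path in the recursion of B: values below B (b ∸ 1) leave v out; the
  -- others, shifted down, choose v. Choosing removes at least τ neighbours as well, so the budget
  -- may fall by τ more.
  heavy : ℕ → Walk → Walk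
  heavy v (walk U I b r) =
    ifz (B (b ∸ 1) ∸ r)
      (let (U′ , I′) = kill v (U [ v ↦ 0 ]) (I [ v ↦ 1 ]) in walk U′ I′ (b ∸ 1 ∸ τ) (r ∸ B (b ∸ 1)))
      (walk (U [ v ↦ 0 ]) (I [ v ↦ 0 ]) (b ∸ 1) r)

  branch : ℕ → Walk → Walk
  branch v s@(walk U I b r) = ifz (U v) s (ifz (τ ∸ hits U v) (heavy v s) s)

  -- 0 stands for no neighbour and `suc y` for the neighbour y; the last one found wins.
  mate : ℕ → (ℕ → ℕ) → ℕ
  mate v U = loopFrom 0 m (λ y s → ifz (hit U v y) s (suc y)) 0

  partner : ℕ → (ℕ → ℕ) → ℕ
  partner v U = mate v (U [ v ↦ 0 ])

  -- What the greedy matching leaves of U after visiting the vertices below v. A visited vertex goes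
  -- in any case, together with its partner if it has one.
  unmatched : (ℕ → ℕ) → ℕ → ℕ → ℕ
  unmatchedStep : ℕ → (ℕ → ℕ) → ℕ → ℕ
  unmatchedStep v U = ifz (U v) U (ifz (partner v U) (U [ v ↦ 0 ]) ((U [ v ↦ 0 ]) [ partner v U ∸ 1 ↦ 0 ]))
  unmatched U zero    = U
  unmatched U (suc v) = unmatchedStep v (unmatched U v)

  -- 0: not a head, 1: free vertex, 2+u: head of the matching edge to u.
  kind : ℕ → (ℕ → ℕ) → ℕ
  kind v U = ifz (U v) 0 (suc (partner v U))

  -- A free vertex multiplies the number of candidates by 2, a matching edge only by 3, since its
  -- two ends are not both chosen.
  weight : (ℕ → ℕ) → ℕ → ℕ
  weight U zero    = 1
  weight U (suc v) =
    let w = weight U v ; V = unmatched U v in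
    ifz (V v) w (ifz (partner v V) (w + w) (w + w + w))

  -- For a matching edge the digits 0, 1, 2 mean neither end, v, and the partner. Too large an r is
  -- not clamped: the excess stays in the remainder.
  digit : ℕ → ℕ → ℕ → (ℕ → ℕ) × ℕ → (ℕ → ℕ) × ℕ
  digit v t w (I , r) =
    ifz t (I , r)
      (ifz (t ∸ 1)
        (ifz (w ∸ r) (I [ v ↦ 1 ] , r ∸ w) (I [ v ↦ 0 ] , r))
        (ifz (w ∸ r)
          (ifz (w ∸ (r ∸ w))
            ((I [ v ↦ 0 ]) [ t ∸ 1 ∸ 1 ↦ 1 ] , r ∸ w ∸ w)
            ((I [ v ↦ 1 ]) [ t ∸ 1 ∸ 1 ↦ 0 ] , r ∸ w))
          ((I [ v ↦ 0 ]) [ t ∸ 1 ∸ 1 ↦ 0 ] , r)))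

  decodeAt : (ℕ → ℕ) → ℕ → (ℕ → ℕ) × ℕ → (ℕ → ℕ) × ℕ
  decodeAt U v = digit v (kind v (unmatched U v)) (weight U v)

  decode : (ℕ → ℕ) → (ℕ → ℕ) × ℕ → (ℕ → ℕ) × ℕ
  decode U = loopFrom 0 m λ k → decodeAt U (m ∸ 1 ∸ k)

  defect : (ℕ → ℕ) × ℕ → ℕ
  defect (I , r) = loopFrom 0 m (λ v e → ifz (I v) e (e + hits I v)) r

  finish : Walk → (ℕ → ℕ) × ℕ
  finish (walk U I b r) = decode U (I , r)

  accept : Walk → ℕ
  accept s = 1 ∸ defect (finish s)

  module Correct {d : ℕ} (gr : IsGraph m A) (regular : ∀ x → x < m → sumTo m (A x) ≡ d) where

    open Completions gr

    hits≡deg : ∀ {U} v → v < m → Bits U → hits U v ≡ deg U v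
    hits≡deg v v<m bits = sum-cong m λ y y<m → both (bits y) (bit v y v<m y<m)

    deg≤d : ∀ {U} x → x < m → Bits U → deg U x ≤ d
    deg≤d {U} x x<m bits = subst (deg U x ≤_) (regular x x<m)
      (sum-mono m λ y _ → ≤-trans (*-monoˡ-≤ (A x y) (bits y)) (≤-reflexive (*-identityˡ (A x y))))

    deg-mono : ∀ {U V} x → (∀ y → U y ≤ V y) → deg U x ≤ deg V x
    deg-mono x U≤V = sum-mono m λ y _ → *-monoˡ-≤ (A x y) (U≤V y)

    upd-≤ : ∀ (U : ℕ → ℕ) x y → (U [ x ↦ 0 ]) y ≤ U y
    upd-≤ U x y with x ≡ᵇ y
    ... | true  = z≤n
    ... | false = ≤-refl

    defect≡ : ∀ I r → Bits I → defect (I , r) ≡ r + edges I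
    defect≡ I r bits = loop-inv (λ v e → e ≡ r + sumTo v (λ x → I x * deg I x)) m next r (sym (+-identityʳ r))
      where
      next : ∀ v e → v < m → e ≡ r + sumTo v (λ x → I x * deg I x) →
             ifz (I v) e (e + hits I v) ≡ r + (sumTo v (λ x → I x * deg I x) + I v * deg I v)
      next v e v<m refl with I v | bits v
      ... | 0 | _ = cong (r +_) (sym (+-identityʳ _))
      ... | 1 | _ = trans (+-assoc r _ _) (cong (λ k → r + (sumTo v (λ x → I x * deg I x) + k))
                      (trans (hits≡deg v v<m bits) (sym (*-identityˡ (deg I v)))))
      ... | suc (suc _) | s≤s ()

    record MateSpec (v : ℕ) (U : ℕ → ℕ) (t : ℕ) : Set where
      field
        none : t ≡ 0 → deg U v ≡ 0
        some : ∀ u → t ≡ suc u → u < m × U u ≡ 1 × A v u ≡ 1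

    mate-spec : ∀ v U → v < m → Bits U → MateSpec v U (mate v U)
    mate-spec v U v<m bits = record { none = proj₁ inv ; some = proj₂ inv }
      where
      R : ℕ → ℕ → Set
      R k t = (t ≡ 0 → sumTo k (λ y → U y * A v y) ≡ 0) × (∀ u → t ≡ suc u → u < m × U u ≡ 1 × A v u ≡ 1)
      next : ∀ k t → k < m → R k t → R (suc k) (ifz (hit U v k) t (suc k))
      next k t k<m (z , s) with hit U v k in eq
      ... | zero = (λ t≡0 → cong₂ _+_ (z t≡0) (trans (sym (both (bits k) (bit v k v<m k<m))) eq)) , s
      ... | suc _ = (λ ()) , λ { u refl → k<m , both-suc (bits k) (bit v k v<m k<m) eq }
      inv : R m (mate v U)
      inv = loop-inv R m next 0 ((λ _ → refl) , λ _ ())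

    module Matching (U : ℕ → ℕ) (bits : Bits U) (light : ∀ x → x < m → U x ≡ 1 → deg U x < τ) where

      Us = unmatched U
      ws = weight U

      Us-≤ : ∀ v y → Us (suc v) y ≤ Us v y
      Us-≤ v y with Us v v
      ... | zero  = ≤-refl
      ... | suc _ with partner v (Us v)
      ... | zero  = upd-≤ (Us v) v y
      ... | suc u = ≤-trans (upd-≤ (Us v [ v ↦ 0 ]) u y) (upd-≤ (Us v) v y)

      Us-≤U : ∀ v y → Us v y ≤ U y
      Us-≤U zero    y = ≤-refl
      Us-≤U (suc v) y = ≤-trans (Us-≤ v y) (Us-≤U v y)

      Us-bits : ∀ v → Bits (Us v)
      Us-bits v y = ≤-trans (Us-≤U v y) (bits y)

      Us-dead : ∀ v → Us (suc v) v ≡ 0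
      Us-dead v with Us v v in eq
      ... | zero  = eq
      ... | suc _ with partner v (Us v)
      ... | zero  = upd-same (Us v) v 0
      ... | suc u = n≤0⇒n≡0 (≤-trans (upd-≤ (Us v [ v ↦ 0 ]) u v) (≤-reflexive (upd-same (Us v) v 0)))

      Us-gone : ∀ v y → y < v → Us v y ≡ 0
      Us-gone (suc v) y y<1+v with m<1+n⇒m<n∨m≡n y<1+v
      ... | inj₁ y<v  = n≤0⇒n≡0 (≤-trans (Us-≤ v y) (≤-reflexive (Us-gone v y y<v)))
      ... | inj₂ refl = Us-dead v

      partner-spec : ∀ v → v < m → MateSpec v (Us v [ v ↦ 0 ]) (partner v (Us v))
      partner-spec v v<m = mate-spec v _ v<m (bits-upd v z≤n (Us-bits v))

      partner≢ : ∀ (V : ℕ → ℕ) v {u} → (V [ v ↦ 0 ]) u ≡ 1 → v ≢ u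
      partner≢ V v eq refl = 0≢1+n (trans (sym (upd-same V v 0)) eq)

      partner-alive : ∀ (V : ℕ → ℕ) v {u} → (V [ v ↦ 0 ]) u ≡ 1 → V u ≡ 1
      partner-alive V v eq = trans (sym (upd-other V 0 (partner≢ V v eq))) eq

      -- In `bounded` only pairs pay for lost edges: a free vertex has no neighbour left when it is
      -- removed, and the two ends of a pair have degree below τ, so the pair destroys at most 2 τ
      -- edges, that is 4 τ ordered pairs.
      record Weighed (V : ℕ → ℕ) (w : ℕ) : Set where
        field
          pairs frees : ℕ
          product     : w ≡ 3 ^ pairs * 2 ^ frees
          balance     : sumTo m V + (2 * pairs + frees) ≡ sumTo m U
          bounded     : edges U ≤ edges V + 4 * (pairs * τ)

      open Weighed

      weighed : ∀ v → v ≤ m → Weighed (Us v) (ws v)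
      weighed zero    _   = record
        { pairs = 0 ; frees = 0 ; product = refl ; balance = +-identityʳ _ ; bounded = ≤-reflexive (sym (+-identityʳ _)) }
      weighed (suc v) v<m with weighed v (<⇒≤ v<m)
      ... | W with Us v v in eq | Us-bits v v
      ... | suc (suc _) | s≤s ()
      ... | zero  | _ = record { pairs = pairs W ; frees = frees W ; product = product W ; balance = balance W ; bounded = bounded W }
      ... | suc zero | _ with partner v (Us v) | partner-spec v v<m
      ... | zero | sp = record
        { pairs = pairs W ; frees = suc (frees W)
        ; product = trans (cong₂ _+_ (product W) (product W)) (double (3 ^ pairs W) (2 ^ frees W))
        ; balance = trans (cong (sumTo m (Us v [ v ↦ 0 ]) +_) (+-suc (2 * pairs W) (frees W)))
            (trans (+-suc _ _) (trans (cong (_+ (2 * pairs W + frees W)) (sym (size-remove (Us v) v v<m eq))) (balance W)))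
        ; bounded = ≤-trans (bounded W) (≤-reflexive (cong (_+ 4 * (pairs W * τ))
            (trans (edges-remove (Us v) v v<m eq)
              (trans (cong (λ k → edges (Us v [ v ↦ 0 ]) + 2 * k)
                (trans (degree-remove (Us v) v v v<m eq) (cong₂ _+_ (MateSpec.none sp refl) (loopless v v<m)))) (+-identityʳ _))))) }
        where
        double : ∀ a b → a * b + a * b ≡ a * (2 * b)
        double = solve-∀
      ... | suc u | sp = record
        { pairs = suc (pairs W) ; frees = frees W
        ; product = trans (cong (λ w → w + w + w) (product W)) (triple (3 ^ pairs W) (2 ^ frees W))
        ; balance = trans (shift (sumTo m V₂) (pairs W) (frees W))
            (trans (cong (λ k → suc k + (2 * pairs W + frees W)) (sym (size-remove V₁ u u<m Vu)))
              (trans (cong (_+ (2 * pairs W + frees W)) (sym (size-remove (Us v) v v<m eq))) (balance W)))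
        ; bounded = begin
            edges U ≤⟨ bounded W ⟩
            edges (Us v) + 4 * (pairs W * τ) ≡⟨ cong (_+ 4 * (pairs W * τ)) (edges-remove (Us v) v v<m eq) ⟩
            edges V₁ + 2 * deg (Us v) v + 4 * (pairs W * τ)
              ≡⟨ cong (λ k → k + 2 * deg (Us v) v + 4 * (pairs W * τ)) (edges-remove V₁ u u<m Vu) ⟩
            edges V₂ + 2 * deg V₁ u + 2 * deg (Us v) v + 4 * (pairs W * τ)
              ≤⟨ +-monoˡ-≤ _ (+-mono-≤ (+-monoʳ-≤ (edges V₂) (*-monoʳ-≤ 2 (low u u<m Uu V₁≤U)))
                   (*-monoʳ-≤ 2 (low v v<m Uv (Us-≤U v)))) ⟩
            edges V₂ + 2 * τ + 2 * τ + 4 * (pairs W * τ) ≡⟨ collect (edges V₂) τ (pairs W) ⟩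
            edges V₂ + 4 * (suc (pairs W) * τ) ∎ }
        where
        open ≤-Reasoning
        V₁ = Us v [ v ↦ 0 ]
        V₂ = V₁ [ u ↦ 0 ]
        u<m = proj₁ (MateSpec.some sp u refl)
        Vu = proj₁ (proj₂ (MateSpec.some sp u refl))
        V₁≤U : ∀ y → V₁ y ≤ U y
        V₁≤U y = ≤-trans (upd-≤ (Us v) v y) (Us-≤U v y)
        Uv : U v ≡ 1
        Uv = ≤-antisym (bits v) (subst (_≤ U v) eq (Us-≤U v v))
        Uu : U u ≡ 1
        Uu = ≤-antisym (bits u) (subst (_≤ U u) Vu (V₁≤U u))
        low : ∀ {V} x → x < m → U x ≡ 1 → (∀ y → V y ≤ U y) → deg V x ≤ τ
        low x x<m Ux V≤U = ≤-trans (deg-mono x V≤U) (<⇒≤ (light x x<m Ux))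
        triple : ∀ a b → a * b + a * b + a * b ≡ 3 * a * b
        triple = solve-∀
        shift : ∀ s p f → s + (2 * suc p + f) ≡ suc (suc s) + (2 * p + f)
        shift = solve-∀
        collect : ∀ e t p → e + 2 * t + 2 * t + 4 * (p * t) ≡ e + 4 * (suc p * t)
        collect = solve-∀

      decodeDown : ℕ → (ℕ → ℕ) × ℕ → (ℕ → ℕ) × ℕ
      decodeDown zero    s = s
      decodeDown (suc v) s = decodeDown v (decodeAt U v s)

      decode≡ : ∀ s → decode U s ≡ decodeDown m s
      decode≡ s = go m 0 refl s
        where
        go : ∀ j k → k + j ≡ m → ∀ s → loopFrom k j (λ k → decodeAt U (m ∸ 1 ∸ k)) s ≡ decodeDown j s
        go zero    k eq s = refl
        go (suc j) k eq s = trans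
          (cong (λ x → loopFrom (suc k) j (λ k → decodeAt U (m ∸ 1 ∸ k)) (decodeAt U x s)) idx)
          (go j (suc k) (trans (sym (+-suc k j)) eq) (decodeAt U j s))
          where
          idx : m ∸ 1 ∸ k ≡ j
          idx = trans (cong (λ m → m ∸ 1 ∸ k) (trans (sym eq) (+-suc k j))) (m+n∸m≡n k j)

      -- The vertices that the matching removed while visiting those below v. Decoding runs
      -- downwards, so at stage v these are the ones whose values the remaining digits determine.
      decided : ℕ → ℕ → ℕ
      decided v x = U x ∸ Us v x

      tail : ℕ → (ℕ → ℕ) → ℕ → ℕ
      tail v I r = 1 ∸ defect (decodeDown v (I , r))

      -- The accepted r are exactly the mixed-radix codes, with place values ws, of the completions.
      decode-count : ∀ v → v ≤ m → ∀ I → Bits I → ∀ X → ws v ≤ X → sumTo X (tail v I) ≡ count (decided v) I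
      -- Without digits left, only remainder 0 can be accepted; this is what makes any surplus of X
      -- harmless.
      decode-count zero _ I bI (suc X) (s≤s _) = begin
        sumTo (suc X) (tail 0 I) ≡⟨ sum-split 1 X (tail 0 I) ⟩
        tail 0 I 0 + sumTo X (λ r → tail 0 I (suc r))
          ≡⟨ cong₂ _+_ (cong (1 ∸_) (defect≡ I 0 bI))
               (sum-zero X λ r _ → m≤n⇒m∸n≡0 (subst (1 ≤_) (sym (defect≡ I (suc r) bI)) (s≤s z≤n))) ⟩
        1 ∸ edges I + 0 ≡⟨ +-identityʳ _ ⟩
        1 ∸ edges I ≡⟨ sym (count-done (decided 0) I (λ x _ → n∸n≡0 (U x)) bI) ⟩
        count (decided 0) I ∎
        where open ≡-Reasoning
      decode-count (suc v) v<m I bI X w≤X with Us v v in eq | Us-bits v v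
      ... | suc (suc _) | s≤s ()
      ... | zero | _ = decode-count v (<⇒≤ v<m) I bI X w≤X
      ... | suc zero | _ with partner v (Us v) | partner-spec v v<m
      ... | zero | sp with m≤n⇒∃[o]m+o≡n w≤X
      ... | k , refl = begin
        sumTo (w + w + k) F ≡⟨ trans (cong (λ x → sumTo x F) (+-assoc w w k)) (sum-split w (w + k) F) ⟩
        sumTo w F + sumTo (w + k) (λ r → F (w + r))
          ≡⟨ cong₂ _+_ (sum-cong w λ r r<w → cong (λ s → 1 ∸ defect (decodeDown v s)) (ifz-suc (m<n⇒0<n∸m r<w)))
               (sum-cong (w + k) λ r _ → cong (λ s → 1 ∸ defect (decodeDown v s)) (trans (ifz-zero (m≤n⇒m∸n≡0 (m≤m+n w r)))
                  (cong (I [ v ↦ 1 ] ,_) (m+n∸m≡n w r)))) ⟩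
        sumTo w (tail v (I [ v ↦ 0 ])) + sumTo (w + k) (tail v (I [ v ↦ 1 ]))
          ≡⟨ cong₂ _+_ (decode-count v (<⇒≤ v<m) _ (bits-upd v z≤n bI) w ≤-refl)
               (decode-count v (<⇒≤ v<m) _ (bits-upd v ≤-refl bI) (w + k) (m≤m+n w k)) ⟩
        count (decided v) (I [ v ↦ 0 ]) + count (decided v) (I [ v ↦ 1 ])
          ≡⟨ sym (cong₂ _+_ (count-cong D₁ λ _ _ → refl) (count-cong D₁ λ _ _ → refl)) ⟩
        count (D [ v ↦ 0 ]) (I [ v ↦ 0 ]) + count (D [ v ↦ 0 ]) (I [ v ↦ 1 ])
          ≡⟨ sym (count-decide D I v v<m Dv) ⟩
        count D I ∎
        where
        open ≡-Reasoning
        w = ws v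
        D : ℕ → ℕ
        D x = U x ∸ (Us v [ v ↦ 0 ]) x
        Uv : U v ≡ 1
        Uv = ≤-antisym (bits v) (subst (_≤ U v) eq (Us-≤U v v))
        Dv : D v ≡ 1
        Dv = cong₂ _∸_ Uv (upd-same (Us v) v 0)
        D₁ : ∀ x → x < m → (D [ v ↦ 0 ]) x ≡ decided v x
        D₁ x _ with v ≟ x
        ... | yes refl = trans (upd-same D v 0) (sym (cong₂ _∸_ Uv eq))
        ... | no v≢x = trans (upd-other D 0 v≢x) (cong (U x ∸_) (upd-other (Us v) 0 v≢x))
        F : ℕ → ℕ
        F r = 1 ∸ defect (decodeDown v (ifz (w ∸ r) (I [ v ↦ 1 ] , r ∸ w) (I [ v ↦ 0 ] , r)))
      decode-count (suc v) v<m I bI X w≤X | suc zero | _ | suc u | sp with m≤n⇒∃[o]m+o≡n w≤X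
      ... | k , refl = begin
        sumTo (w + w + w + k) F
          ≡⟨ trans (cong (λ x → sumTo x F) (assoc w k)) (trans (sum-split w (w + (w + k)) F) (cong (sumTo w F +_) (sum-split w (w + k) (λ r → F (w + r))))) ⟩
        sumTo w F + (sumTo w (λ r → F (w + r)) + sumTo (w + k) (λ r → F (w + (w + r))))
          ≡⟨ cong₂ _+_ (sum-cong w λ r r<w → via (ifz-suc (m<n⇒0<n∸m r<w)))
               (cong₂ _+_ (sum-cong w λ r r<w → via (second r r<w)) (sum-cong (w + k) λ r _ → via (third r))) ⟩
        sumTo w (tail v (I₀ [ u ↦ 0 ])) + (sumTo w (tail v (I₁ [ u ↦ 0 ])) + sumTo (w + k) (tail v (I₀ [ u ↦ 1 ])))
          ≡⟨ cong₂ _+_ (decode-count v v≤m _ (bits-upd u z≤n bI₀) w ≤-refl)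
               (cong₂ _+_ (decode-count v v≤m _ (bits-upd u z≤n bI₁) w ≤-refl)
                 (decode-count v v≤m _ (bits-upd u ≤-refl bI₀) (w + k) (m≤m+n w k))) ⟩
        count (decided v) (I₀ [ u ↦ 0 ]) + (count (decided v) (I₁ [ u ↦ 0 ]) + count (decided v) (I₀ [ u ↦ 1 ]))
          ≡⟨ sym (cong₂ _+_ (count-cong D₂ λ _ _ → refl) (cong₂ _+_ (count-cong D₂ λ _ _ → refl) (count-cong D₂ λ _ _ → refl))) ⟩
        count E (I₀ [ u ↦ 0 ]) + (count E (I₁ [ u ↦ 0 ]) + count E (I₀ [ u ↦ 1 ]))
          ≡⟨ rotate (count E (I₀ [ u ↦ 0 ])) (count E (I₁ [ u ↦ 0 ])) (count E (I₀ [ u ↦ 1 ])) ⟩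
        count E (I₀ [ u ↦ 0 ]) + count E (I₀ [ u ↦ 1 ]) + count E (I₁ [ u ↦ 0 ])
          -- With v left out both values of u occur, with v chosen u must be left out: three counts,
          -- one per digit value.
          ≡⟨ sym (cong₂ _+_ (count-decide (D [ v ↦ 0 ]) I₀ u u<m D₁u)
               (count-kill (D [ v ↦ 0 ]) I₁ v u v<m u<m (upd-same D v 0) (upd-same I v 1) D₁u Avu)) ⟩
        count (D [ v ↦ 0 ]) I₀ + count (D [ v ↦ 0 ]) I₁ ≡⟨ sym (count-decide D I v v<m Dv) ⟩
        count D I ∎
        where
        open ≡-Reasoning
        w = ws v
        v≤m = <⇒≤ v<m
        I₀ = I [ v ↦ 0 ]
        I₁ = I [ v ↦ 1 ]
        bI₀ = bits-upd v z≤n bI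
        bI₁ = bits-upd v ≤-refl bI
        V₁ = Us v [ v ↦ 0 ]
        u<m = proj₁ (MateSpec.some sp u refl)
        Vu = proj₁ (proj₂ (MateSpec.some sp u refl))
        Avu = proj₂ (proj₂ (MateSpec.some sp u refl))
        v≢u = partner≢ (Us v) v Vu
        D : ℕ → ℕ
        D x = U x ∸ (V₁ [ u ↦ 0 ]) x
        E = (D [ v ↦ 0 ]) [ u ↦ 0 ]
        Uv : U v ≡ 1
        Uv = ≤-antisym (bits v) (subst (_≤ U v) eq (Us-≤U v v))
        Usu : Us v u ≡ 1
        Usu = partner-alive (Us v) v Vu
        Uu : U u ≡ 1
        Uu = ≤-antisym (bits u) (subst (_≤ U u) Usu (Us-≤U v u))
        Dv : D v ≡ 1
        Dv = cong₂ _∸_ Uv (trans (upd-other V₁ 0 (≢-sym v≢u)) (upd-same (Us v) v 0))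
        D₁u : (D [ v ↦ 0 ]) u ≡ 1
        D₁u = trans (upd-other D 0 v≢u) (cong₂ _∸_ Uu (upd-same V₁ u 0))
        D₂ : ∀ x → x < m → E x ≡ decided v x
        D₂ x _ with u ≟ x
        ... | yes refl = trans (upd-same (D [ v ↦ 0 ]) u 0) (sym (cong₂ _∸_ Uu Usu))
        ... | no u≢x with v ≟ x
        ... | yes refl = trans (upd-other (D [ v ↦ 0 ]) 0 u≢x) (trans (upd-same D v 0) (sym (cong₂ _∸_ Uv eq)))
        ... | no v≢x = trans (upd-other (D [ v ↦ 0 ]) 0 u≢x) (trans (upd-other D 0 v≢x)
              (cong (U x ∸_) (trans (upd-other V₁ 0 u≢x) (upd-other (Us v) 0 v≢x))))
        assoc : ∀ w k → w + w + w + k ≡ w + (w + (w + k))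
        assoc = solve-∀
        rotate : ∀ a b c → a + (b + c) ≡ a + c + b
        rotate = solve-∀
        s₀ s₁ s₂ : ℕ → (ℕ → ℕ) × ℕ
        s₀ r = I₀ [ u ↦ 0 ] , r
        s₁ r = I₁ [ u ↦ 0 ] , r
        s₂ r = I₀ [ u ↦ 1 ] , r
        D? : ℕ → (ℕ → ℕ) × ℕ
        D? r = ifz (w ∸ r) (ifz (w ∸ (r ∸ w)) (s₂ (r ∸ w ∸ w)) (s₁ (r ∸ w))) (s₀ r)
        F : ℕ → ℕ
        F r = 1 ∸ defect (decodeDown v (D? r))
        via : ∀ {s t} → s ≡ t → 1 ∸ defect (decodeDown v s) ≡ 1 ∸ defect (decodeDown v t)
        via = cong (λ s → 1 ∸ defect (decodeDown v s))
        second : ∀ r → r < w → D? (w + r) ≡ s₁ r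
        second r r<w = trans (ifz-zero (m≤n⇒m∸n≡0 (m≤m+n w r))) (trans
          (cong (λ k → ifz (w ∸ k) (s₂ (k ∸ w)) (s₁ k)) (m+n∸m≡n w r)) (ifz-suc (m<n⇒0<n∸m r<w)))
        third : ∀ r → D? (w + (w + r)) ≡ s₂ r
        third r = trans (ifz-zero (m≤n⇒m∸n≡0 (m≤m+n w (w + r)))) (trans
          (cong (λ k → ifz (w ∸ k) (s₂ (k ∸ w)) (s₁ k)) (m+n∸m≡n w (w + r)))
          (trans (ifz-zero (m≤n⇒m∸n≡0 (m≤m+n w r))) (cong s₂ (m+n∸m≡n w r))))

      finish-count : ∀ I → Bits I → ∀ X → ws m ≤ X → ∀ b → sumTo X (λ r → accept (walk U I b r)) ≡ count U I
      finish-count I bI X w≤X b = trans (sum-cong X λ r _ → cong (λ s → 1 ∸ defect s) (decode≡ (I , r)))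
        (trans (decode-count m ≤-refl I bI X w≤X)
          (count-cong (λ x x<m → cong (U x ∸_) (Us-gone m x x<m)) λ _ _ → refl))

-- Bounding the candidates and counting the accepted codes

-- Let s be the excess of 2 p + f over n. The hypothesis says d s ≤ 2 p τ, and 6 τ ≤ d turns this
-- into p ≥ 3 s. Three pairs have 27 ≤ 2 ^ 5 candidates instead of 2 ^ 6, so every three pairs save
-- one bit, enough to pay for the excess. This is the origin of the 6.
relaxations-bound : ∀ {n d τ} p f → 1 ≤ d → 6 * τ ≤ d →
  d * (2 * n) + 2 * (d * (2 * p + f)) ≤ 4 * (p * τ) + 2 * (d * (2 * n)) → 3 ^ p * 2 ^ f ≤ 2 ^ n
relaxations-bound {n} {d} {τ} p f 1≤d τ≤d energy with ≤-total (2 * p + f) n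
... | inj₁ small = begin
  3 ^ p * 2 ^ f ≤⟨ *-monoˡ-≤ (2 ^ f) (^-monoˡ-≤ p (n≤1+n 3)) ⟩
  (2 ^ 2) ^ p * 2 ^ f ≡⟨ cong (_* 2 ^ f) (^-*-assoc 2 2 p) ⟩
  2 ^ (2 * p) * 2 ^ f ≡⟨ sym (^-distribˡ-+-* 2 (2 * p) f) ⟩
  2 ^ (2 * p + f) ≤⟨ ^-monoʳ-≤ 2 small ⟩
  2 ^ n ∎
  where open ≤-Reasoning
... | inj₂ large with m≤n⇒∃[o]m+o≡n large
... | s , excess with m≤n⇒∃[o]m+o≡n 3s≤p
  where
  3s≤p : 3 * s ≤ p
  3s≤p = *-cancelˡ-≤ (2 * d) {{m*n≢0 2 d {{_}} {{>-nonZero 1≤d}}}} (begin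
    2 * d * (3 * s) ≡⟨ e₁ d s ⟩
    3 * (2 * (d * s)) ≤⟨ *-monoʳ-≤ 3 (+-cancelˡ-≤ (2 * (d * (2 * n))) _ _ (begin
      2 * (d * (2 * n)) + 2 * (d * s) ≡⟨ e₂ d n s ⟩
      d * (2 * n) + 2 * (d * (n + s)) ≡⟨ cong (λ a → d * (2 * n) + 2 * (d * a)) excess ⟩
      d * (2 * n) + 2 * (d * (2 * p + f)) ≤⟨ energy ⟩
      4 * (p * τ) + 2 * (d * (2 * n)) ≡⟨ +-comm (4 * (p * τ)) _ ⟩
      2 * (d * (2 * n)) + 4 * (p * τ) ∎)) ⟩
    3 * (4 * (p * τ)) ≡⟨ e₃ p τ ⟩
    2 * (6 * τ) * p ≤⟨ *-monoˡ-≤ p (*-monoʳ-≤ 2 τ≤d) ⟩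
    2 * d * p ∎)
    where
    open ≤-Reasoning
    e₁ : ∀ d s → 2 * d * (3 * s) ≡ 3 * (2 * (d * s))
    e₁ = solve-∀
    e₂ : ∀ d n s → 2 * (d * (2 * n)) + 2 * (d * s) ≡ d * (2 * n) + 2 * (d * (n + s))
    e₂ = solve-∀
    e₃ : ∀ p t → 3 * (4 * (p * t)) ≡ 2 * (6 * t) * p
    e₃ = solve-∀
... | q , refl = begin
  3 ^ (3 * s + q) * 2 ^ f ≡⟨ cong (_* 2 ^ f) (trans (^-distribˡ-+-* 3 (3 * s) q) (cong (_* 3 ^ q) (sym (^-*-assoc 3 3 s)))) ⟩
  (3 ^ 3) ^ s * 3 ^ q * 2 ^ f
    ≤⟨ *-monoˡ-≤ (2 ^ f) (*-mono-≤ (^-monoˡ-≤ s (m≤m+n 27 5)) (^-monoˡ-≤ q (n≤1+n 3))) ⟩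
  (2 ^ 5) ^ s * (2 ^ 2) ^ q * 2 ^ f ≡⟨ cong (_* 2 ^ f) (cong₂ _*_ (^-*-assoc 2 5 s) (^-*-assoc 2 2 q)) ⟩
  2 ^ (5 * s) * 2 ^ (2 * q) * 2 ^ f ≡⟨ cong (_* 2 ^ f) (sym (^-distribˡ-+-* 2 (5 * s) (2 * q))) ⟩
  2 ^ (5 * s + 2 * q) * 2 ^ f ≡⟨ sym (^-distribˡ-+-* 2 (5 * s + 2 * q) f) ⟩
  2 ^ (5 * s + 2 * q + f) ≡⟨ cong (2 ^_) (sym (+-cancelˡ-≡ s n _ (trans (+-comm s n) (trans excess (e s q f))))) ⟩
  2 ^ n ∎
  where
  open ≤-Reasoning
  e : ∀ s q f → 2 * (3 * s + q) + f ≡ s + (5 * s + 2 * q + f)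
  e = solve-∀

module Acceptance (m τ : ℕ) (A : ℕ → ℕ → ℕ) (B : ℕ → ℕ) {n d : ℕ}
    (gr : IsGraph m A) (m≡ : m ≡ 2 * n) (regular : ∀ x → x < m → sumTo m (A x) ≡ d)
    (1≤d : 1 ≤ d) (τ≤d : 6 * τ ≤ d) (B-least : ∀ b → b ≤ m → 2 ^ n ≤ B b)
    (B-suc : ∀ b → b < m → B (suc b) ≡ B b + B (b ∸ τ)) where

  open Sampler m τ A B
  open Correct gr regular
  open Completions gr

  -- As m = 2 n and `edges` counts ordered pairs, this is d (|U| - n) ≤ e(U) without subtraction. It
  -- is an equality for the set of all vertices, and removing a vertex lowers the left side by d and
  -- the right side by at most d.
  Energy : (ℕ → ℕ) → Set
  Energy U = d * m + 2 * (d * sumTo m U) ≤ edges U + 2 * (d * m)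

  energy-remove : ∀ U x → x < m → U x ≡ 1 → Bits U → Energy U → Energy (U [ x ↦ 0 ])
  energy-remove U x x<m Ux bits e = +-cancelʳ-≤ (2 * d) _ _ (begin
    d * m + 2 * (d * s) + 2 * d ≡⟨ e₁ d m s ⟩
    d * m + 2 * (d * suc s) ≡⟨ cong (λ k → d * m + 2 * (d * k)) (sym (size-remove U x x<m Ux)) ⟩
    d * m + 2 * (d * sumTo m U) ≤⟨ e ⟩
    edges U + 2 * (d * m) ≡⟨ cong (_+ 2 * (d * m)) (edges-remove U x x<m Ux) ⟩
    edges V + 2 * deg U x + 2 * (d * m) ≤⟨ +-monoˡ-≤ _ (+-monoʳ-≤ (edges V) (*-monoʳ-≤ 2 (deg≤d x x<m bits))) ⟩
    edges V + 2 * d + 2 * (d * m) ≡⟨ e₂ (edges V) d (d * m) ⟩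
    edges V + 2 * (d * m) + 2 * d ∎)
    where
    open ≤-Reasoning
    V = U [ x ↦ 0 ]
    s = sumTo m V
    e₁ : ∀ d m s → d * m + 2 * (d * s) + 2 * d ≡ d * m + 2 * (d * suc s)
    e₁ = solve-∀
    e₂ : ∀ a d k → a + 2 * d + 2 * k ≡ a + 2 * k + 2 * d
    e₂ = solve-∀

  energy-full : ∀ U → (∀ x → x < m → U x ≡ 1) → Energy U
  energy-full U U≡1 = ≤-reflexive (begin
    d * m + 2 * (d * sumTo m U) ≡⟨ cong (λ k → d * m + 2 * (d * k)) size≡ ⟩
    d * m + 2 * (d * m) ≡⟨ cong (_+ 2 * (d * m)) (sym edges≡) ⟩
    edges U + 2 * (d * m) ∎)
    where
    open ≡-Reasoning
    size≡ : sumTo m U ≡ m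
    size≡ = trans (sum-cong m U≡1) (trans (sum-const m 1) (*-identityʳ m))
    edges≡ : edges U ≡ d * m
    edges≡ = trans (sum-cong m λ x x<m → trans (cong₂ _*_ (U≡1 x x<m)
        (trans (sum-cong m λ y y<m → trans (cong (_* A x y) (U≡1 y y<m)) (*-identityˡ _)) (regular x x<m))) (*-identityˡ d))
      (trans (sum-const m d) (*-comm m d))

  -- After the last vertex nothing is left of U, so |U| = 2 p + f and all edges have been charged to
  -- the p pairs.
  weight-bound : ∀ U (bits : Bits U) → (∀ x → x < m → U x ≡ 1 → deg U x < τ) → Energy U → weight U m ≤ 2 ^ n
  weight-bound U bits light energy = subst (_≤ 2 ^ n) (sym product) (relaxations-bound {n} pairs frees 1≤d τ≤d (begin
    d * (2 * n) + 2 * (d * (2 * pairs + frees))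
      ≡⟨ cong₂ (λ a b → d * a + 2 * (d * b)) (sym m≡) (trans (cong (_+ (2 * pairs + frees)) (sym empty)) balance) ⟩
    d * m + 2 * (d * sumTo m U) ≤⟨ energy ⟩
    edges U + 2 * (d * m) ≤⟨ +-monoˡ-≤ (2 * (d * m)) bounded ⟩
    edges (Us m) + 4 * (pairs * τ) + 2 * (d * m)
      ≡⟨ cong₂ (λ a b → a + 4 * (pairs * τ) + 2 * (d * b)) (sum-zero m λ x x<m → cong (_* deg (Us m) x) (Us-gone m x x<m)) m≡ ⟩
    4 * (pairs * τ) + 2 * (d * (2 * n)) ∎))
    where
    open Matching U bits light
    open Weighed (weighed m ≤-refl)
    open ≤-Reasoning
    empty : sumTo m (Us m) ≡ 0
    empty = sum-zero m (Us-gone m)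

  -- `light` concerns the vertices already visited: a degree below τ stays so, because vertices are
  -- only removed later.
  record Live (v : ℕ) (U I : ℕ → ℕ) (b : ℕ) : Set where
    field
      bitsU  : Bits U
      bitsI  : Bits I
      room   : sumTo m U ≤ b
      b≤m    : b ≤ m
      light  : ∀ x → x < v → U x ≡ 1 → deg U x < τ
      energy : Energy U

  -- `rest` says that cells not yet visited are intact, so hits in the shrinking set V are hits in
  -- the original U, and `lost` can count the removed vertices by the latter.
  record Killed (v : ℕ) (U I : ℕ → ℕ) (y : ℕ) (V K : ℕ → ℕ) : Set where
    field
      bitsV  : Bits V
      bitsK  : Bits K
      out    : V v ≡ 0
      in′    : K v ≡ 1
      V≤U    : ∀ z → V z ≤ U z
      energy : Energy V
      stable : count V K ≡ count U I
      lost   : sumTo m V + sumTo y (hit U v) ≤ sumTo m U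
      rest   : ∀ z → y ≤ z → V z ≡ U z

  kill-spec : ∀ v U I → v < m → Bits U → Bits I → U v ≡ 0 → I v ≡ 1 → Energy U →
              Killed v U I m (proj₁ (kill v U I)) (proj₂ (kill v U I))
  kill-spec v U I v<m bU bI Uv Iv e = loop-inv (λ y s → Killed v U I y (proj₁ s) (proj₂ s)) m next (U , I) (record
    { bitsV = bU ; bitsK = bI ; out = Uv ; in′ = Iv ; V≤U = λ _ → ≤-refl ; energy = e ; stable = refl
    ; lost = ≤-reflexive (+-identityʳ _) ; rest = λ _ _ → refl })
    where
    next : ∀ y s → y < m → Killed v U I y (proj₁ s) (proj₂ s) →
           Killed v U I (suc y) (proj₁ (killStep v y s)) (proj₂ (killStep v y s))
    next y (V , K) y<m κ with hit V v y in eq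
    ... | zero = record
      { bitsV = bitsV ; bitsK = bitsK ; out = out ; in′ = in′ ; V≤U = V≤U ; energy = energy ; stable = stable
      ; lost = subst (λ k → sumTo m V + k ≤ sumTo m U)
          (sym (trans (cong (sumTo y (hit U v) +_) (trans (cong (λ u → u + A v y ∸ 1) (sym (rest y ≤-refl))) eq)) (+-identityʳ _))) lost
      ; rest = λ z y<z → rest z (<⇒≤ y<z) }
      where open Killed κ
    ... | suc h with both-suc (Killed.bitsV κ y) (bit v y v<m y<m) eq
    ... | Vy , Avy = record
      { bitsV = bits-upd y z≤n bitsV ; bitsK = bits-upd y z≤n bitsK
      ; out = trans (upd-other V 0 y≢v) out ; in′ = trans (upd-other K 0 y≢v) in′
      ; V≤U = λ z → ≤-trans (upd-≤ V y z) (V≤U z)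
      ; energy = energy-remove V y y<m Vy bitsV energy
      ; stable = trans (sym (count-kill V K v y v<m y<m out in′ Vy Avy)) stable
      ; lost = ≤-trans (≤-reflexive (trans (cong (λ k → sumTo m (V [ y ↦ 0 ]) + (sumTo y (hit U v) + k)) one)
            (shift (sumTo m (V [ y ↦ 0 ])) (sumTo y (hit U v)))))
          (subst (λ k → k + sumTo y (hit U v) ≤ sumTo m U) (size-remove V y y<m Vy) lost)
      ; rest = λ z y<z → trans (upd-other V 0 (<⇒≢ y<z)) (rest z (<⇒≤ y<z)) }
      where
      open Killed κ
      y≢v : y ≢ v
      y≢v refl = 0≢1+n (trans (sym (loopless v v<m)) Avy)
      one : hit U v y ≡ 1
      one = cong₂ (λ u a → u + a ∸ 1) (trans (sym (rest y ≤-refl)) Vy) Avy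
      shift : ∀ a b → a + (b + 1) ≡ suc a + b
      shift = solve-∀

  -- Induction on the vertices still to be visited. At a heavy vertex the range is cut as the table
  -- prescribes, in parallel to `count-decide`; the part choosing v inherits any surplus of X.
  accept-count : ∀ k v → k + v ≡ m → ∀ U I b X → Live v U I b → B b ≤ X →
                 sumTo X (λ r → accept (loopFrom v k branch (walk U I b r))) ≡ count U I
  accept-count zero v refl U I b X live B≤X = Matching.finish-count U bitsU light I bitsI X
    (≤-trans (weight-bound U bitsU light energy) (≤-trans (B-least b b≤m) B≤X)) b
    where open Live live
  accept-count (suc k) v eq U I b X live B≤X with U v in Uv | Live.bitsU live v
  ... | suc (suc _) | s≤s ()
  ... | zero | _ = accept-count k (suc v) (trans (+-suc k v) eq) U I b X
      (record { Live live ; light = λ x x<1+v Ux → Live.light live x (earlier x x<1+v Ux) Ux }) B≤X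
    where
    earlier : ∀ x → x < suc v → U x ≡ 1 → x < v
    earlier x x<1+v Ux with m<1+n⇒m<n∨m≡n x<1+v
    ... | inj₁ x<v  = x<v
    ... | inj₂ refl = ⊥-elim (0≢1+n (trans (sym Uv) Ux))
  ... | suc zero | _ with τ ∸ hits U v in heavy?
  ... | suc _ = accept-count k (suc v) (trans (+-suc k v) eq) U I b X (record { Live live ; light = light′ }) B≤X
    where
    light′ : ∀ x → x < suc v → U x ≡ 1 → deg U x < τ
    light′ x x<1+v Ux with m<1+n⇒m<n∨m≡n x<1+v
    ... | inj₁ x<v  = Live.light live x x<v Ux
    ... | inj₂ refl = subst (_< τ) (hits≡deg v (subst (suc v ≤_) eq (s≤s (m≤n+m v k))) (Live.bitsU live))
                        (m∸n≢0⇒n<m λ z → 0≢1+n (trans (sym z) heavy?))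
  -- The budget cannot be 0 here: it bounds the number of alive vertices, and v is alive.
  accept-count (suc k) v eq U I zero X live B≤X | suc zero | _ | zero =
    ⊥-elim (<⇒≱ (subst (0 <_) (sym (size-remove U v (subst (suc v ≤_) eq (s≤s (m≤n+m v k))) Uv)) z<s) (Live.room live))
  accept-count (suc k) v eq U I (suc b) X live B≤X | suc zero | _ | zero
    with m≤n⇒∃[o]m+o≡n (≤-trans (≤-trans (m≤m+n (B b) (B (b ∸ τ))) (≤-reflexive (sym (B-suc b (Live.b≤m live))))) B≤X)
  ... | l , refl = begin
    sumTo (B b + l) F ≡⟨ sum-split (B b) l F ⟩
    sumTo (B b) F + sumTo l (λ r → F (B b + r))
      ≡⟨ cong₂ _+_ (sum-cong (B b) λ r r<B → cong rest-of (ifz-suc (m<n⇒0<n∸m r<B)))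
           (sum-cong l λ r _ → cong rest-of (trans (ifz-zero (m≤n⇒m∸n≡0 (m≤m+n (B b) r)))
             (cong (walk V K (b ∸ τ)) (m+n∸m≡n (B b) r)))) ⟩
    sumTo (B b) (λ r → rest-of (walk U₀ (I [ v ↦ 0 ]) b r)) + sumTo l (λ r → rest-of (walk V K (b ∸ τ) r))
      ≡⟨ cong₂ _+_ (accept-count k (suc v) eq′ U₀ (I [ v ↦ 0 ]) b (B b) skipped ≤-refl)
           (accept-count k (suc v) eq′ V K (b ∸ τ) l picked
             (+-cancelˡ-≤ (B b) _ _ (≤-trans (≤-reflexive (sym (B-suc b (Live.b≤m live)))) B≤X))) ⟩
    count U₀ (I [ v ↦ 0 ]) + count V K ≡⟨ cong (count U₀ (I [ v ↦ 0 ]) +_) (Killed.stable killed) ⟩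
    count U₀ (I [ v ↦ 0 ]) + count U₀ (I [ v ↦ 1 ]) ≡⟨ sym (count-decide U I v v<m Uv) ⟩
    count U I ∎
    where
    open ≡-Reasoning
    open Live live
    eq′ = trans (+-suc k v) eq
    v<m = subst (suc v ≤_) eq (s≤s (m≤n+m v k))
    U₀ = U [ v ↦ 0 ]
    V = proj₁ (kill v U₀ (I [ v ↦ 1 ]))
    K = proj₂ (kill v U₀ (I [ v ↦ 1 ]))
    rest-of : Walk → ℕ
    rest-of s = accept (loopFrom (suc v) k branch s)
    F : ℕ → ℕ
    F r = rest-of (ifz (B b ∸ r) (walk V K (b ∸ τ) (r ∸ B b)) (walk U₀ (I [ v ↦ 0 ]) b r))
    energy₀ : Energy U₀
    energy₀ = energy-remove U v v<m Uv bitsU energy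
    killed : Killed v U₀ (I [ v ↦ 1 ]) m V K
    killed = kill-spec v U₀ (I [ v ↦ 1 ]) v<m (bits-upd v z≤n bitsU) (bits-upd v ≤-refl bitsI)
               (upd-same U v 0) (upd-same I v 1) energy₀
    room₀ : sumTo m U₀ ≤ b
    room₀ = s≤s⁻¹ (subst (_≤ suc b) (size-remove U v v<m Uv) room)
    light-below : ∀ {V} → (∀ z → V z ≤ U₀ z) → ∀ x → x < suc v → V x ≡ 1 → deg V x < τ
    light-below {V} V≤ x x<1+v Vx with m<1+n⇒m<n∨m≡n x<1+v
    ... | inj₁ x<v  = ≤-<-trans (deg-mono x λ z → ≤-trans (V≤ z) (upd-≤ U v z))
          (light x x<v (≤-antisym (bitsU x) (≤-trans (subst (_≤ U₀ x) Vx (V≤ x)) (upd-≤ U v x))))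
    ... | inj₂ refl = ⊥-elim (<⇒≱ (subst (_≤ U₀ v) Vx (V≤ v)) (≤-reflexive (upd-same U v 0)))
    skipped : Live (suc v) U₀ (I [ v ↦ 0 ]) b
    skipped = record { bitsU = bits-upd v z≤n bitsU ; bitsI = bits-upd v z≤n bitsI ; room = room₀ ; b≤m = <⇒≤ b≤m
      ; light = light-below λ _ → ≤-refl ; energy = energy₀ }
    -- v was found heavy in U but its neighbours are removed from U₀; without loops the two degrees
    -- coincide.
    degrees : hits U₀ v ≡ hits U v
    degrees = trans (hits≡deg v v<m (bits-upd v z≤n bitsU)) (trans
      (sym (trans (degree-remove U v v v<m Uv) (trans (cong (deg U₀ v +_) (loopless v v<m)) (+-identityʳ _))))
      (sym (hits≡deg v v<m bitsU)))
    room₁ : sumTo m V ≤ b ∸ τ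
    room₁ = subst (_≤ b ∸ τ) (m+n∸n≡m (sumTo m V) τ) (∸-monoˡ-≤ τ (≤-trans
      (+-monoʳ-≤ (sumTo m V) (≤-trans (m∸n≡0⇒m≤n heavy?) (≤-reflexive (sym degrees))))
      (≤-trans (Killed.lost killed) room₀)))
    picked : Live (suc v) V K (b ∸ τ)
    picked = record { bitsU = Killed.bitsV killed ; bitsI = Killed.bitsK killed ; room = room₁
      ; b≤m = ≤-trans (m∸n≤m b τ) (<⇒≤ b≤m) ; light = light-below (Killed.V≤U killed) ; energy = Killed.energy killed }

  trial : (ℕ → ℕ) → (ℕ → ℕ) → ℕ → Walk
  trial U I r = loopFrom 0 m branch (walk U I m r)

  trial-count : ∀ U I → Bits U → Bits I → (∀ x → x < m → U x ≡ 1) → ∀ X → B m ≤ X →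
                sumTo X (λ r → accept (trial U I r)) ≡ isets m A
  trial-count U I bU bI U≡1 X B≤X = trans
    (accept-count m 0 (+-identityʳ m) U I m X (record
      { bitsU = bU ; bitsI = bI ; room = ≤-reflexive (trans (sum-cong m U≡1) (trans (sum-const m 1) (*-identityʳ m)))
      ; b≤m = ≤-refl ; light = λ _ () ; energy = energy-full U U≡1 }) B≤X)
    (count-all U I U≡1)

-- Chebyshev's inequality

sumᵇ-blocks : ∀ a b (g : Vec Bool a → Vec Bool b → ℕ) →
  sumᵇ (a + b) (λ ws → g (takeᵛ a ws) (dropᵛ a ws)) ≡ sumᵇ a (λ w → sumᵇ b (g w))
sumᵇ-blocks zero    b g = refl
sumᵇ-blocks (suc a) b g = cong₂ _+_ (sumᵇ-blocks a b (λ w → g (true ∷ w))) (sumᵇ-blocks a b (λ w → g (false ∷ w)))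

∣m+n-m∣ : ∀ m n → ∣ m + n - m ∣ ≡ n
∣m+n-m∣ m n = trans (∣-∣-comm (m + n) m) (∣m-m+n∣≡n m n)

-- The binomial formula for (x - y)², with the mixed term moved to the left to stay in ℕ.
distance-square : ∀ x y → ∣ x - y ∣ * ∣ x - y ∣ + 2 * (x * y) ≡ x * x + y * y
distance-square x y with ≤-total x y
... | inj₁ x≤y with m≤n⇒∃[o]m+o≡n x≤y
... | k , refl rewrite ∣m-m+n∣≡n x k = e x k
  where
  e : ∀ x k → k * k + 2 * (x * (x + k)) ≡ x * x + (x + k) * (x + k)
  e = solve-∀
distance-square x y | inj₂ y≤x with m≤n⇒∃[o]m+o≡n y≤x
... | k , refl rewrite ∣m+n-m∣ y k = e y k
  where
  e : ∀ y k → k * k + 2 * ((y + k) * y) ≡ (y + k) * (y + k) + y * y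
  e = solve-∀

-- A sampler whose acceptance events may depend on the past; only the conditional
-- acceptance probability i / 2 ^ N is constant.
record Trials (N i : ℕ) : Set₁ where
  field
    State    : Set
    Good     : State → Set
    next     : State → Vec Bool N → State
    accepted : State → Vec Bool N → ℕ
    good     : ∀ s w → Good s → Good (next s w)
    zero-one : ∀ s w → Good s → accepted s w ≤ 1
    total    : ∀ s → Good s → sumᵇ N (accepted s) ≡ i

module Chebyshev {N i : ℕ} (trials : Trials N i) where

  open Trials trials

  M : ℕ
  M = 2 ^ N

  score : ∀ k → State → Vec Bool (k * N) → ℕ
  score zero    s ws = 0
  score (suc k) s ws = accepted s (takeᵛ N ws) + score k (next s (takeᵛ N ws)) (dropᵛ N ws)

  space : ℕ → ℕ
  space k = 2 ^ (k * N)

  space-suc : ∀ k → space (suc k) ≡ M * space k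
  space-suc k = ^-distribˡ-+-* 2 N (k * N)

  mean : ∀ k s → Good s → M * sumᵇ (k * N) (score k s) ≡ k * i * space k
  mean zero    s g = *-zeroʳ M
  mean (suc k) s g = begin
    M * sumᵇ (N + k * N) (score (suc k) s)
      ≡⟨ cong (M *_) (sumᵇ-blocks N (k * N) (λ w ws → accepted s w + score k (next s w) ws)) ⟩
    M * sumᵇ N (λ w → sumᵇ (k * N) (λ ws → accepted s w + score k (next s w) ws))
      ≡⟨ sym (sumᵇ-* N M _) ⟩
    sumᵇ N (λ w → M * sumᵇ (k * N) (λ ws → accepted s w + score k (next s w) ws))
      ≡⟨ sumᵇ-cong N inner ⟩
    sumᵇ N (λ w → M * space k * accepted s w + k * i * space k)
      ≡⟨ sumᵇ-+ N (λ w → M * space k * accepted s w) (λ _ → k * i * space k) ⟩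
    sumᵇ N (λ w → M * space k * accepted s w) + sumᵇ N (λ _ → k * i * space k)
      ≡⟨ cong₂ _+_ (trans (sumᵇ-* N (M * space k) (accepted s)) (cong (M * space k *_) (total s g))) (sumᵇ-const N _) ⟩
    M * space k * i + M * (k * i * space k) ≡⟨ e M (space k) i k ⟩
    suc k * i * (M * space k) ≡⟨ cong (suc k * i *_) (sym (space-suc k)) ⟩
    suc k * i * space (suc k) ∎
    where
    open ≡-Reasoning
    inner : ∀ w → M * sumᵇ (k * N) (λ ws → accepted s w + score k (next s w) ws) ≡ M * space k * accepted s w + k * i * space k
    inner w = trans (cong (M *_) (sumᵇ-+ (k * N) (λ _ → accepted s w) (score k (next s w)))) (trans
      (*-distribˡ-+ M _ _) (cong₂ _+_ (trans (cong (M *_) (sumᵇ-const (k * N) (accepted s w))) (sym (*-assoc M (space k) _)))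
        (mean k (next s w) (good s w g))))
    e : ∀ M T i k → M * T * i + M * (k * i * T) ≡ suc k * i * (M * T)
    e = solve-∀

  -- With p = i / M this is E H² = k p - k p² + k² p², cleared of denominators and with the negative
  -- term moved across. The mean of the remaining trials is the same after every outcome, so the
  -- mixed terms factor as they do for independent trials.
  second-moment : ∀ k s → Good s →
    M * M * sumᵇ (k * N) (λ ws → score k s ws * score k s ws) + k * (i * i) * space k ≡
    (k * i * M + k * k * (i * i)) * space k
  second-moment zero    s g = trans (+-identityʳ _) (*-zeroʳ (M * M))
  second-moment (suc k) s g = begin
    M * M * sumᵇ (N + k * N) (λ ws → score (suc k) s ws * score (suc k) s ws) + suc k * (i * i) * space (suc k)
      ≡⟨ cong₂ (λ a b → M * M * a + suc k * (i * i) * b) (sumᵇ-blocks N (k * N) sq) (space-suc k) ⟩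
    M * M * sumᵇ N (λ w → sumᵇ (k * N) (sq w)) + suc k * (i * i) * (M * Ω)
      ≡⟨ cong₂ _+_ (sym (sumᵇ-* N (M * M) (λ w → sumᵇ (k * N) (sq w)))) (trans (e₁ (suc k * (i * i)) M Ω) (sym (sumᵇ-const N (suc k * (i * i) * Ω)))) ⟩
    sumᵇ N (λ w → M * M * sumᵇ (k * N) (sq w)) + sumᵇ N (λ _ → suc k * (i * i) * Ω)
      ≡⟨ sym (sumᵇ-+ N _ _) ⟩
    sumᵇ N (λ w → M * M * sumᵇ (k * N) (sq w) + suc k * (i * i) * Ω) ≡⟨ sumᵇ-cong N inner ⟩
    sumᵇ N (λ w → (M * M * Ω + 2 * M * (k * i * Ω)) * accepted s w + R) ≡⟨ sumᵇ-+ N _ _ ⟩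
    sumᵇ N (λ w → (M * M * Ω + 2 * M * (k * i * Ω)) * accepted s w) + sumᵇ N (λ _ → R)
      ≡⟨ cong₂ _+_ (trans (sumᵇ-* N (M * M * Ω + 2 * M * (k * i * Ω)) (accepted s)) (cong ((M * M * Ω + 2 * M * (k * i * Ω)) *_) (total s g)))
                   (sumᵇ-const N R) ⟩
    (M * M * Ω + 2 * M * (k * i * Ω)) * i + M * R ≡⟨ e₂ M Ω k i ⟩
    (suc k * i * M + suc k * suc k * (i * i)) * (M * Ω) ≡⟨ cong ((suc k * i * M + suc k * suc k * (i * i)) *_) (sym (space-suc k)) ⟩
    (suc k * i * M + suc k * suc k * (i * i)) * space (suc k) ∎
    where
    open ≡-Reasoning
    Ω = space k
    R = (k * i * M + k * k * (i * i)) * Ω + i * i * Ω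
    sq : Vec Bool N → Vec Bool (k * N) → ℕ
    sq w ws = (accepted s w + score k (next s w) ws) * (accepted s w + score k (next s w) ws)
    e₁ : ∀ a M Ω → a * (M * Ω) ≡ M * (a * Ω)
    e₁ = solve-∀
    e₂ : ∀ M Ω k i → (M * M * Ω + 2 * M * (k * i * Ω)) * i + M * ((k * i * M + k * k * (i * i)) * Ω + i * i * Ω)
                     ≡ (suc k * i * M + suc k * suc k * (i * i)) * (M * Ω)
    e₂ = solve-∀
    expand : ∀ {a} h → a ≤ 1 → (a + h) * (a + h) ≡ a + 2 * a * h + h * h
    expand h z≤n       = refl
    expand h (s≤s z≤n) = e h
      where
      e : ∀ h → (1 + h) * (1 + h) ≡ 1 + 2 * 1 * h + h * h
      e = solve-∀
    inner : ∀ w → M * M * sumᵇ (k * N) (sq w) + suc k * (i * i) * Ω ≡ (M * M * Ω + 2 * M * (k * i * Ω)) * accepted s w + R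
    inner w = begin
      M * M * sumᵇ (k * N) (sq w) + suc k * (i * i) * Ω
        ≡⟨ cong (λ x → M * M * x + suc k * (i * i) * Ω) (trans (sumᵇ-cong (k * N) λ ws → expand (h ws) (zero-one s w g))
             (trans (sumᵇ-+ (k * N) _ _) (cong (_+ S₂) (trans (sumᵇ-+ (k * N) _ _)
               (cong₂ _+_ (sumᵇ-const (k * N) a) (sumᵇ-* (k * N) (2 * a) h)))))) ⟩
      M * M * (Ω * a + 2 * a * S₁ + S₂) + suc k * (i * i) * Ω ≡⟨ e₃ M Ω a S₁ S₂ k i ⟩
      M * M * Ω * a + 2 * M * (M * S₁) * a + (M * M * S₂ + k * (i * i) * Ω) + i * i * Ω
        ≡⟨ cong₂ (λ x y → M * M * Ω * a + 2 * M * x * a + y + i * i * Ω) (mean k s′ g′) (second-moment k s′ g′) ⟩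
      M * M * Ω * a + 2 * M * (k * i * Ω) * a + (k * i * M + k * k * (i * i)) * Ω + i * i * Ω
        ≡⟨ e₄ (M * M * Ω) (2 * M * (k * i * Ω)) a ((k * i * M + k * k * (i * i)) * Ω) (i * i * Ω) ⟩
      (M * M * Ω + 2 * M * (k * i * Ω)) * a + R ∎
      where
      a = accepted s w
      s′ = next s w
      g′ = good s w g
      h = score k s′
      S₁ = sumᵇ (k * N) h
      S₂ = sumᵇ (k * N) (λ ws → h ws * h ws)
      e₃ : ∀ M Ω a S₁ S₂ k i → M * M * (Ω * a + 2 * a * S₁ + S₂) + suc k * (i * i) * Ω
           ≡ M * M * Ω * a + 2 * M * (M * S₁) * a + (M * M * S₂ + k * (i * i) * Ω) + i * i * Ω
      e₃ = solve-∀
      e₄ : ∀ x y a u v → x * a + y * a + u + v ≡ (x + y) * a + (u + v)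
      e₄ = solve-∀

  -- The estimate `score * M` of `k * i` is bad when its relative error exceeds 1 / e, a condition
  -- stated without division.
  module Tail (k e : ℕ) (s : State) (g : Good s) where

    bad : Vec Bool (k * N) → Bool
    bad ws = k * i <ᵇ e * ∣ score k s ws * M - k * i ∣

    good? : Vec Bool (k * N) → Bool
    good? ws = e * ∣ score k s ws * M - k * i ∣ ≤ᵇ k * i

    bads : ℕ
    bads = sumᵇ (k * N) (λ ws → toBit (bad ws))

    -- On a bad outcome K ≤ e |H M - K|, so K² times the indicator is at most e² (H M - K)². The
    -- square is expanded by `distance-square`, so that summing over all outcomes leaves only the
    -- first two moments.
    pointwise : ∀ ws → (k * i) * (k * i) * toBit (bad ws) + 2 * (e * e) * (k * i) * M * score k s ws
                ≤ e * e * (M * M) * (score k s ws * score k s ws) + e * e * ((k * i) * (k * i))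
    pointwise ws with k * i <ᵇ e * ∣ score k s ws * M - k * i ∣ in eq
    ... | b = begin
      K * K * toBit b + 2 * (e * e) * K * M * H ≡⟨ cong (K * K * toBit b +_) (e₁ e K M H) ⟩
      K * K * toBit b + e * e * (2 * (H * M * K)) ≤⟨ +-monoˡ-≤ _ (small b eq) ⟩
      e * e * (D * D) + e * e * (2 * (H * M * K)) ≡⟨ sym (*-distribˡ-+ (e * e) (D * D) _) ⟩
      e * e * (D * D + 2 * (H * M * K)) ≡⟨ cong (e * e *_) (distance-square (H * M) K) ⟩
      e * e * (H * M * (H * M) + K * K) ≡⟨ e₂ e H M K ⟩
      e * e * (M * M) * (H * H) + e * e * (K * K) ∎
      where
      open ≤-Reasoning
      K = k * i
      H = score k s ws
      D = ∣ H * M - K ∣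
      e₁ : ∀ e K M H → 2 * (e * e) * K * M * H ≡ e * e * (2 * (H * M * K))
      e₁ = solve-∀
      e₂ : ∀ e H M K → e * e * (H * M * (H * M) + K * K) ≡ e * e * (M * M) * (H * H) + e * e * (K * K)
      e₂ = solve-∀
      e₃ : ∀ e D → e * D * (e * D) ≡ e * e * (D * D)
      e₃ = solve-∀
      small : ∀ b → (K <ᵇ e * D) ≡ b → K * K * toBit b ≤ e * e * (D * D)
      small false _ = ≤-trans (≤-reflexive (*-zeroʳ (K * K))) z≤n
      small true eq = ≤-trans (≤-reflexive (*-identityʳ (K * K))) (≤-trans (*-mono-≤ K≤ K≤) (≤-reflexive (e₃ e D)))
        where
        K≤ : K ≤ e * D
        K≤ = <⇒≤ (<ᵇ⇒< K (e * D) (subst T (sym eq) tt))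

    markov : (k * i) * (k * i) * bads ≤ e * e * (k * i * M) * space k
    markov = +-cancelʳ-≤ (2 * (e * e) * K * (K * T′)) _ _ (begin
      K * K * bads + 2 * (e * e) * K * (K * T′)
        ≡⟨ cong (λ x → K * K * bads + 2 * (e * e) * K * x) (sym (mean k s g)) ⟩
      K * K * bads + 2 * (e * e) * K * (M * S₁) ≡⟨ cong (K * K * bads +_) (sym (*-assoc (2 * (e * e) * K) M S₁)) ⟩
      K * K * bads + 2 * (e * e) * K * M * S₁
        ≡⟨ cong₂ _+_ (sym (sumᵇ-* n (K * K) _)) (sym (sumᵇ-* n (2 * (e * e) * K * M) (score k s))) ⟩
      sumᵇ n (λ ws → K * K * toBit (bad ws)) + sumᵇ n (λ ws → 2 * (e * e) * K * M * score k s ws) ≡⟨ sym (sumᵇ-+ n _ _) ⟩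
      sumᵇ n (λ ws → K * K * toBit (bad ws) + 2 * (e * e) * K * M * score k s ws) ≤⟨ sumᵇ-mono n pointwise ⟩
      sumᵇ n (λ ws → e * e * (M * M) * (score k s ws * score k s ws) + e * e * (K * K)) ≡⟨ sumᵇ-+ n _ _ ⟩
      sumᵇ n (λ ws → e * e * (M * M) * (score k s ws * score k s ws)) + sumᵇ n (λ _ → e * e * (K * K))
        ≡⟨ cong₂ _+_ (sumᵇ-* n (e * e * (M * M)) _) (sumᵇ-const n _) ⟩
      e * e * (M * M) * S₂ + T′ * (e * e * (K * K)) ≡⟨ cong (_+ T′ * (e * e * (K * K))) (*-assoc (e * e) (M * M) S₂) ⟩
      e * e * (M * M * S₂) + T′ * (e * e * (K * K))
        ≤⟨ +-monoˡ-≤ _ (*-monoʳ-≤ (e * e) (≤-trans (m≤m+n (M * M * S₂) (k * (i * i) * T′)) (≤-reflexive (second-moment k s g)))) ⟩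
      e * e * ((K * M + k * k * (i * i)) * T′) + T′ * (e * e * (K * K)) ≡⟨ arith e k i M T′ ⟩
      e * e * (K * M) * T′ + 2 * (e * e) * K * (K * T′) ∎)
      where
      open ≤-Reasoning
      n = k * N
      K = k * i
      T′ = space k
      S₁ = sumᵇ n (score k s)
      S₂ = sumᵇ n (λ ws → score k s ws * score k s ws)
      arith : ∀ e k i M T → e * e * ((k * i * M + k * k * (i * i)) * T) + T * (e * e * (k * i * (k * i)))
              ≡ e * e * (k * i * M) * T + 2 * (e * e) * (k * i) * (k * i * T)
      arith = solve-∀

    -- `markov` bounds the probability of a bad outcome by e² M / (k i). The acceptance probability
    -- i / M is at least 1 / q, so 4 e² q trials make this at most 1 / 4.
    tail-bound : ∀ q → k ≡ 4 * (e * e) * q → M ≤ q * i → 1 ≤ e → 1 ≤ i → 1 ≤ q → 4 * bads ≤ space k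
    tail-bound q k≡ M≤qi 1≤e 1≤i 1≤q = *-cancelˡ-≤ (e * e * M) {{>-nonZero (*-mono-≤ (*-mono-≤ 1≤e 1≤e) (m^n>0 2 N))}} (begin
      e * e * M * (4 * bads) ≤⟨ *-monoˡ-≤ (4 * bads) (*-monoʳ-≤ (e * e) M≤qi) ⟩
      e * e * (q * i) * (4 * bads) ≡⟨ e₁ e q i bads ⟩
      4 * (e * e) * q * i * bads ≡⟨ cong (λ x → x * i * bads) (sym k≡) ⟩
      k * i * bads ≤⟨ *-cancelˡ-≤ (k * i) {{>-nonZero 1≤ki}} (begin
          k * i * (k * i * bads) ≡⟨ sym (*-assoc (k * i) (k * i) bads) ⟩
          k * i * (k * i) * bads ≤⟨ markov ⟩
          e * e * (k * i * M) * space k ≡⟨ e₂ e (k * i) M (space k) ⟩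
          k * i * (e * e * M * space k) ∎) ⟩
      e * e * M * space k ∎)
      where
      open ≤-Reasoning
      1≤ki : 1 ≤ k * i
      1≤ki = *-mono-≤ (subst (1 ≤_) (sym k≡) (*-mono-≤ (*-mono-≤ (m≤m+n 1 3) (*-mono-≤ 1≤e 1≤e)) 1≤q)) 1≤i
      e₁ : ∀ e q i b → e * e * (q * i) * (4 * b) ≡ 4 * (e * e) * q * i * b
      e₁ = solve-∀
      e₂ : ∀ e K M T → e * e * (K * M) * T ≡ K * (e * e * M * T)
      e₂ = solve-∀

    success : ∀ q → k ≡ 4 * (e * e) * q → M ≤ q * i → 1 ≤ e → 1 ≤ i → 1 ≤ q →
              3 * space k ≤ 4 * sumᵇ (k * N) (λ ws → toBit (good? ws))
    success q k≡ M≤qi 1≤e 1≤i 1≤q = +-cancelʳ-≤ (space k) _ _ (begin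
      3 * space k + space k ≡⟨ +-comm (3 * space k) (space k) ⟩
      4 * space k ≡⟨ cong (4 *_) (sym all) ⟩
      4 * (goods + bads) ≡⟨ *-distribˡ-+ 4 goods bads ⟩
      4 * goods + 4 * bads ≤⟨ +-monoʳ-≤ (4 * goods) (tail-bound q k≡ M≤qi 1≤e 1≤i 1≤q) ⟩
      4 * goods + space k ∎)
      where
      open ≤-Reasoning
      goods = sumᵇ (k * N) (λ ws → toBit (good? ws))
      either : ∀ a b → toBit (a ≤ᵇ b) + toBit (b <ᵇ a) ≡ 1
      either a b with a ≤ᵇ b in p | b <ᵇ a in q
      ... | true  | false = refl
      ... | false | true  = refl
      ... | true  | true  = ⊥-elim (<⇒≱ (<ᵇ⇒< b a (subst T (sym q) tt)) (≤ᵇ⇒≤ a b (subst T (sym p) tt)))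
      ... | false | false with ≤-total a b
      ... | inj₁ a≤b = ⊥-elim (subst T p (≤⇒≤ᵇ a≤b))
      ... | inj₂ b≤a with m≤n⇒m<n∨m≡n b≤a
      ... | inj₁ b<a = ⊥-elim (subst T q (<⇒<ᵇ b<a))
      ... | inj₂ refl = ⊥-elim (subst T p (≤⇒≤ᵇ {a} ≤-refl))
      all : goods + bads ≡ space k
      all = trans (sym (sumᵇ-+ (k * N) _ _)) (trans (sumᵇ-cong (k * N) λ ws → either (e * ∣ score k s ws * M - k * i ∣) (k * i))
        (trans (sumᵇ-const (k * N) 1) (*-identityʳ _)))

-- Partial sums of the exponential series

module _ where

  open ℚ-Solver.+-*-Solver

  fromℕ-shape : ∀ n → ℚ.toℚᵘ (fromℕ n) ℚᵘ.≃ mkℚᵘ (ℤ.+ n) 0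
  fromℕ-shape n = ℚ.toℚᵘ-fromℚᵘ (mkℚᵘ (ℤ.+ n) 0)

  fromℕ-+ : ∀ a b → fromℕ (a + b) ≡ fromℕ a ℚ.+ fromℕ b
  fromℕ-+ a b = ℚ.toℚᵘ-injective (begin
    ℚ.toℚᵘ (fromℕ (a + b)) ≈⟨ fromℕ-shape (a + b) ⟩
    mkℚᵘ (ℤ.+ (a + b)) 0
      ≈⟨ *≡* (cong (ℤ._* ℤ.+ 1) (sym (cong₂ ℤ._+_ (ℤ.*-identityʳ (ℤ.+ a)) (ℤ.*-identityʳ (ℤ.+ b))))) ⟩
    mkℚᵘ (ℤ.+ a) 0 ℚᵘ.+ mkℚᵘ (ℤ.+ b) 0 ≈⟨ ℚᵘ.≃-sym (ℚᵘ.+-cong (fromℕ-shape a) (fromℕ-shape b)) ⟩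
    ℚ.toℚᵘ (fromℕ a) ℚᵘ.+ ℚ.toℚᵘ (fromℕ b) ≈⟨ ℚᵘ.≃-sym (ℚ.toℚᵘ-homo-+ (fromℕ a) (fromℕ b)) ⟩
    ℚ.toℚᵘ (fromℕ a ℚ.+ fromℕ b) ∎)
    where open ℚᵘ.≃-Reasoning

  /-fromℕ : ∀ h k → (ℤ.+ h ℚ./ suc k) ℚ.* fromℕ (suc k) ≡ fromℕ h
  /-fromℕ h k = ℚ.toℚᵘ-injective (begin
    ℚ.toℚᵘ ((ℤ.+ h ℚ./ suc k) ℚ.* fromℕ (suc k)) ≈⟨ ℚ.toℚᵘ-homo-* (ℤ.+ h ℚ./ suc k) (fromℕ (suc k)) ⟩
    ℚ.toℚᵘ (ℤ.+ h ℚ./ suc k) ℚᵘ.* ℚ.toℚᵘ (fromℕ (suc k))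
      ≈⟨ ℚᵘ.*-cong (ℚ.toℚᵘ-fromℚᵘ (mkℚᵘ (ℤ.+ h) k)) (fromℕ-shape (suc k)) ⟩
    mkℚᵘ (ℤ.+ h) k ℚᵘ.* mkℚᵘ (ℤ.+ suc k) 0 ≈⟨ *≡* (trans (ℤ.*-identityʳ _) (cong (λ d → ℤ.+ h ℤ.* ℤ.+ d) (sym (*-identityʳ (suc k))))) ⟩
    mkℚᵘ (ℤ.+ h) 0 ≈⟨ ℚᵘ.≃-sym (fromℕ-shape h) ⟩
    ℚ.toℚᵘ (fromℕ h) ∎)
    where open ℚᵘ.≃-Reasoning

  fromℕ-* : ∀ a b → fromℕ (a * b) ≡ fromℕ a ℚ.* fromℕ b
  fromℕ-* a b = ℚ.toℚᵘ-injective (begin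
    ℚ.toℚᵘ (fromℕ (a * b)) ≈⟨ fromℕ-shape (a * b) ⟩
    mkℚᵘ (ℤ.+ (a * b)) 0 ≈⟨ *≡* (cong (ℤ._* ℤ.+ 1) (ℤ.pos-* a b)) ⟩
    mkℚᵘ (ℤ.+ a) 0 ℚᵘ.* mkℚᵘ (ℤ.+ b) 0 ≈⟨ ℚᵘ.≃-sym (ℚᵘ.*-cong (fromℕ-shape a) (fromℕ-shape b)) ⟩
    ℚ.toℚᵘ (fromℕ a) ℚᵘ.* ℚ.toℚᵘ (fromℕ b) ≈⟨ ℚᵘ.≃-sym (ℚ.toℚᵘ-homo-* (fromℕ a) (fromℕ b)) ⟩
    ℚ.toℚᵘ (fromℕ a ℚ.* fromℕ b) ∎)
    where open ℚᵘ.≃-Reasoning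

  0≤fromℕ : ∀ n → 0ℚ ℚ.≤ fromℕ n
  0≤fromℕ n = ℚ.nonNegative⁻¹ (fromℕ n) {{ℚ.normalize-nonNeg n 1}}

  0<fromℕ : ∀ n → 0ℚ ℚ.< fromℕ (suc n)
  0<fromℕ n = ℚ.positive⁻¹ (fromℕ (suc n)) {{ℚ.normalize-pos (suc n) 1}}

  fromℕ-mono : ∀ {a b} → a ≤ b → fromℕ a ℚ.≤ fromℕ b
  fromℕ-mono {a} a≤b with m≤n⇒∃[o]m+o≡n a≤b
  ... | k , refl = subst₂ ℚ._≤_ (ℚ.+-identityʳ (fromℕ a)) (sym (fromℕ-+ a k)) (ℚ.+-monoʳ-≤ (fromℕ a) (0≤fromℕ k))

  *-mono : ∀ {p q r s} → 0ℚ ℚ.≤ p → 0ℚ ℚ.≤ s → p ℚ.≤ q → r ℚ.≤ s → p ℚ.* r ℚ.≤ q ℚ.* s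
  *-mono {p} {q} {r} {s} 0≤p 0≤s p≤q r≤s = ℚ.≤-trans
    (ℚ.*-monoˡ-≤-nonNeg p {{ℚ.nonNegative 0≤p}} r≤s) (ℚ.*-monoʳ-≤-nonNeg s {{ℚ.nonNegative 0≤s}} p≤q)

  0≤* : ∀ {p q} → 0ℚ ℚ.≤ p → 0ℚ ℚ.≤ q → 0ℚ ℚ.≤ p ℚ.* q
  0≤* {p} {q} 0≤p 0≤q = subst (ℚ._≤ p ℚ.* q) (ℚ.*-zeroˡ q) (ℚ.*-monoʳ-≤-nonNeg q {{ℚ.nonNegative 0≤q}} 0≤p)

  0≤+ : ∀ {p q} → 0ℚ ℚ.≤ p → 0ℚ ℚ.≤ q → 0ℚ ℚ.≤ p ℚ.+ q
  0≤+ = ℚ.+-mono-≤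

  cancel : ∀ r {p q} → 0ℚ ℚ.< r → r ℚ.* p ℚ.≤ r ℚ.* q → p ℚ.≤ q
  cancel r 0<r = ℚ.*-cancelˡ-≤-pos r {{ℚ.positive 0<r}}

  cancel-≡ : ∀ r {p q} → 0ℚ ℚ.< r → r ℚ.* p ≡ r ℚ.* q → p ≡ q
  cancel-≡ r 0<r eq = ℚ.≤-antisym (cancel r 0<r (ℚ.≤-reflexive eq)) (cancel r 0<r (ℚ.≤-reflexive (sym eq)))

  p≤∣p∣ : ∀ p → p ℚ.≤ ℚ.∣ p ∣
  p≤∣p∣ p with ℚ.≤-total 0ℚ p
  ... | inj₁ 0≤p = ℚ.≤-reflexive (sym (ℚ.0≤p⇒∣p∣≡p 0≤p))
  ... | inj₂ p≤0 = ℚ.≤-trans p≤0 (ℚ.nonNegative⁻¹ ℚ.∣ p ∣ {{ℚ.∣-∣-nonNeg p}})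

  0≤∣p∣ : ∀ p → 0ℚ ℚ.≤ ℚ.∣ p ∣
  0≤∣p∣ p = ℚ.nonNegative⁻¹ ℚ.∣ p ∣ {{ℚ.∣-∣-nonNeg p}}

  archimedean : ∀ p → ∃[ N ] p ℚ.≤ fromℕ N
  archimedean p@(ℚ.mkℚ ℤ.-[1+ _ ] d _) = 0 , ℚ.<⇒≤ (ℚ.negative⁻¹ p)
  archimedean p@(ℚ.mkℚ (ℤ.+ n) d _) = n , subst (ℚ._≤ fromℕ n) (ℚ.*-identityʳ p)
    (subst (p ℚ.* 1ℚ ℚ.≤_) eq (ℚ.*-monoˡ-≤-nonNeg p (fromℕ-mono {1} {suc d} (s≤s z≤n))))
    where
    eq : p ℚ.* fromℕ (suc d) ≡ fromℕ n
    eq = trans (cong (ℚ._* fromℕ (suc d)) (sym (ℚ.↥p/↧p≡p p))) (/-fromℕ n d)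

  -- The partial sums for a negative argument alternate, so they are bounded through the product
  -- with those for the positive argument. The product of two partial sums of equal length is 1 plus
  -- a corner of the Cauchy product that tends to 0.
  module Exp (x : ℚ) where

    term-suc : ∀ q k → fromℕ (suc k) ℚ.* expTerm q (suc k) ≡ q ℚ.* expTerm q k
    term-suc q k = trans (solve 4 (λ s t q i → s :* (t :* q :* i) := q :* t :* (i :* s)) refl
        (fromℕ (suc k)) (expTerm q k) q (ℤ.+ 1 ℚ./ suc k))
      (trans (cong (q ℚ.* expTerm q k ℚ.*_) (/-fromℕ 1 k)) (ℚ.*-identityʳ _))

    a b : ℕ → ℚ
    a = expTerm x
    b = expTerm (ℚ.- x)

    -- The part p ≥ i of the diagonal p + q = i + j of the Cauchy product.
    convolution : ℕ → ℕ → ℚ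
    convolution i zero    = a i ℚ.* b 0
    convolution i (suc j) = a i ℚ.* b (suc j) ℚ.+ convolution (suc i) j

    -- (p+q) aₚ b_q = x (aₚ₋₁ b_q − aₚ b_{q-1}), so the sum telescopes.
    convolution-suc : ∀ i j → fromℕ (suc i + j) ℚ.* convolution (suc i) j ≡ x ℚ.* (a i ℚ.* b j)
    convolution-suc i zero rewrite +-identityʳ i = trans (sym (ℚ.*-assoc (fromℕ (suc i)) (a (suc i)) (b 0)))
      (trans (cong (ℚ._* b 0) (term-suc x i)) (ℚ.*-assoc x (a i) (b 0)))
    convolution-suc i (suc j) = begin
      fromℕ (suc i + suc j) ℚ.* (a (suc i) ℚ.* b (suc j) ℚ.+ convolution (suc (suc i)) j)
        ≡⟨ ℚ.*-distribˡ-+ (fromℕ (suc i + suc j)) _ _ ⟩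
      fromℕ (suc i + suc j) ℚ.* (a (suc i) ℚ.* b (suc j)) ℚ.+ fromℕ (suc i + suc j) ℚ.* convolution (suc (suc i)) j
        ≡⟨ cong₂ ℚ._+_ (cong (ℚ._* (a (suc i) ℚ.* b (suc j))) (fromℕ-+ (suc i) (suc j)))
             (trans (cong (λ k → fromℕ k ℚ.* convolution (suc (suc i)) j) (+-suc (suc i) j)) (convolution-suc (suc i) j)) ⟩
      (fromℕ (suc i) ℚ.+ fromℕ (suc j)) ℚ.* (a (suc i) ℚ.* b (suc j)) ℚ.+ x ℚ.* (a (suc i) ℚ.* b j)
        ≡⟨ solve 6 (λ s t a b x c → (s :+ t) :* (a :* b) :+ x :* (a :* c) := s :* a :* b :+ a :* (t :* b) :+ x :* (a :* c)) refl
             (fromℕ (suc i)) (fromℕ (suc j)) (a (suc i)) (b (suc j)) x (b j) ⟩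
      fromℕ (suc i) ℚ.* a (suc i) ℚ.* b (suc j) ℚ.+ a (suc i) ℚ.* (fromℕ (suc j) ℚ.* b (suc j)) ℚ.+ x ℚ.* (a (suc i) ℚ.* b j)
        ≡⟨ cong₂ (λ u v → u ℚ.* b (suc j) ℚ.+ a (suc i) ℚ.* v ℚ.+ x ℚ.* (a (suc i) ℚ.* b j)) (term-suc x i) (term-suc (ℚ.- x) j) ⟩
      x ℚ.* a i ℚ.* b (suc j) ℚ.+ a (suc i) ℚ.* (ℚ.- x ℚ.* b j) ℚ.+ x ℚ.* (a (suc i) ℚ.* b j)
        ≡⟨ solve 5 (λ x a b c d → x :* a :* b :+ c :* (:- x :* d) :+ x :* (c :* d) := x :* (a :* b)) refl
             x (a i) (b (suc j)) (a (suc i)) (b j) ⟩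
      x ℚ.* (a i ℚ.* b (suc j)) ∎
      where open ≡-Reasoning

    convolution-zero : ∀ j → convolution 0 (suc j) ≡ 0ℚ
    convolution-zero j = cancel-≡ (fromℕ (suc j)) (0<fromℕ j) (begin
      fromℕ (suc j) ℚ.* (1ℚ ℚ.* b (suc j) ℚ.+ convolution 1 j)
        ≡⟨ solve 3 (λ s b c → s :* (con 1ℚ :* b :+ c) := s :* b :+ s :* c) refl (fromℕ (suc j)) (b (suc j)) (convolution 1 j) ⟩
      fromℕ (suc j) ℚ.* b (suc j) ℚ.+ fromℕ (suc j) ℚ.* convolution 1 j ≡⟨ cong₂ ℚ._+_ (term-suc (ℚ.- x) j) (convolution-suc 0 j) ⟩
      ℚ.- x ℚ.* b j ℚ.+ x ℚ.* (1ℚ ℚ.* b j) ≡⟨ solve 2 (λ x b → :- x :* b :+ x :* (con 1ℚ :* b) := con 0ℚ) refl x (b j) ⟩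
      0ℚ ≡⟨ sym (ℚ.*-zeroʳ (fromℕ (suc j))) ⟩
      fromℕ (suc j) ℚ.* 0ℚ ∎)
      where open ≡-Reasoning

    -- The products of terms with p ≥ i and p + q < i + k: whole diagonals, of which only the
    -- constant one survives when i = 0.
    triangle : ℕ → ℕ → ℚ
    triangle i zero    = 0ℚ
    triangle i (suc k) = a i ℚ.* exp (ℚ.- x) (suc k) ℚ.+ triangle (suc i) k

    triangle-suc : ∀ i k → triangle i (suc k) ≡ triangle i k ℚ.+ convolution i k
    triangle-suc i zero    = solve 1 (λ a → a :* (con 0ℚ :+ con 1ℚ) :+ con 0ℚ := con 0ℚ :+ a :* con 1ℚ) refl (a i)
    triangle-suc i (suc k) = trans (cong (a i ℚ.* exp (ℚ.- x) (suc (suc k)) ℚ.+_) (triangle-suc (suc i) k))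
      (solve 5 (λ a s b t c → a :* (s :+ b) :+ (t :+ c) := a :* s :+ t :+ (a :* b :+ c)) refl
        (a i) (exp (ℚ.- x) (suc k)) (b (suc k)) (triangle (suc i) k) (convolution (suc i) k))

    triangle-one : ∀ k → triangle 0 (suc k) ≡ 1ℚ
    triangle-one zero    = refl
    triangle-one (suc k) = trans (triangle-suc 0 (suc k)) (trans (cong₂ ℚ._+_ (triangle-one k) (convolution-zero k)) (ℚ.+-identityʳ 1ℚ))

    partial : ℕ → ℕ → ℚ
    partial i zero    = 0ℚ
    partial i (suc k) = a i ℚ.+ partial (suc i) k

    exp-partial : ∀ i k → exp x (i + k) ≡ exp x i ℚ.+ partial i k
    exp-partial i zero    = trans (cong (exp x) (+-identityʳ i)) (sym (ℚ.+-identityʳ _))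
    exp-partial i (suc k) = trans (cong (exp x) (+-suc i k)) (trans (exp-partial (suc i) k) (ℚ.+-assoc (exp x i) (a i) _))

    -- What `triangle` misses in the rectangle i ≤ p < i + k, q < i + k, namely the products with p
    -- + q ≥ i + k.
    corner : ℕ → ℕ → ℚ
    corner i zero    = 0ℚ
    corner i (suc k) = a i ℚ.* (exp (ℚ.- x) (i + suc k) ℚ.- exp (ℚ.- x) (suc k)) ℚ.+ corner (suc i) k

    corner-spec : ∀ i k → partial i k ℚ.* exp (ℚ.- x) (i + k) ≡ triangle i k ℚ.+ corner i k
    corner-spec i zero    = trans (ℚ.*-zeroˡ (exp (ℚ.- x) (i + 0))) (sym (ℚ.+-identityʳ 0ℚ))
    corner-spec i (suc k) = trans (ℚ.*-distribʳ-+ (exp (ℚ.- x) (i + suc k)) (a i) (partial (suc i) k))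
      (trans (cong (a i ℚ.* exp (ℚ.- x) (i + suc k) ℚ.+_)
        (trans (cong (λ l → partial (suc i) k ℚ.* exp (ℚ.- x) l) (+-suc i k)) (corner-spec (suc i) k)))
        (solve 5 (λ a s u t c → a :* s :+ (t :+ c) := a :* u :+ t :+ (a :* (s :- u) :+ c)) refl
          (a i) (exp (ℚ.- x) (i + suc k)) (exp (ℚ.- x) (suc k)) (triangle (suc i) k) (corner (suc i) k)))

    exp-product : ∀ k → exp x (suc k) ℚ.* exp (ℚ.- x) (suc k) ≡ 1ℚ ℚ.+ corner 0 (suc k)
    exp-product k = trans (cong (ℚ._* exp (ℚ.- x) (suc k)) (trans (exp-partial 0 (suc k)) (ℚ.+-identityˡ (partial 0 (suc k)))))
      (trans (corner-spec 0 (suc k)) (cong (ℚ._+ corner 0 (suc k)) (triangle-one k)))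

  0≤expTerm : ∀ {z} → 0ℚ ℚ.≤ z → ∀ k → 0ℚ ℚ.≤ expTerm z k
  0≤expTerm 0≤z zero    = 0≤fromℕ 1
  0≤expTerm 0≤z (suc k) = 0≤* (0≤* (0≤expTerm 0≤z k) 0≤z) (ℚ.nonNegative⁻¹ (ℤ.+ 1 ℚ./ suc k) {{ℚ.normalize-nonNeg 1 (suc k)}})

  exp-mono : ∀ {z} → 0ℚ ℚ.≤ z → ∀ j n → exp z n ℚ.≤ exp z (j + n)
  exp-mono 0≤z zero    n = ℚ.≤-refl
  exp-mono {z} 0≤z (suc j) n = ℚ.≤-trans (exp-mono 0≤z j n)
    (subst (ℚ._≤ exp z (suc j + n)) (ℚ.+-identityʳ _) (ℚ.+-monoʳ-≤ (exp z (j + n)) (0≤expTerm 0≤z (j + n))))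

  ∣expTerm∣ : ∀ q k → ℚ.∣ expTerm q k ∣ ≡ expTerm ℚ.∣ q ∣ k
  ∣expTerm∣ q zero    = refl
  ∣expTerm∣ q (suc k) = trans (ℚ.∣p*q∣≡∣p∣*∣q∣ (expTerm q k ℚ.* q) (ℤ.+ 1 ℚ./ suc k))
    (cong₂ ℚ._*_ (trans (ℚ.∣p*q∣≡∣p∣*∣q∣ (expTerm q k) q) (cong (ℚ._* ℚ.∣ q ∣) (∣expTerm∣ q k)))
      (ℚ.0≤p⇒∣p∣≡p (ℚ.nonNegative⁻¹ (ℤ.+ 1 ℚ./ suc k) {{ℚ.normalize-nonNeg 1 (suc k)}})))

  expTerm-double : ∀ q k → fromℕ (2 ^ k) ℚ.* expTerm q k ≡ expTerm (q ℚ.+ q) k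
  expTerm-double q zero    = refl
  expTerm-double q (suc k) = trans (cong (ℚ._* expTerm q (suc k)) (fromℕ-* 2 (2 ^ k)))
    (trans (solve 4 (λ w t q i → con (fromℕ 2) :* w :* (t :* q :* i) := w :* t :* (q :+ q) :* i) refl
      (fromℕ (2 ^ k)) (expTerm q k) q (ℤ.+ 1 ℚ./ suc k))
      (cong (λ t → t ℚ.* (q ℚ.+ q) ℚ.* (ℤ.+ 1 ℚ./ suc k)) (expTerm-double q k)))

  module ExpBounded {z : ℚ} (0≤z : 0ℚ ℚ.≤ z) where

    onset : ℕ
    onset = proj₁ (archimedean (z ℚ.+ z))

    halving : ∀ j → expTerm z (suc (j + onset)) ℚ.+ expTerm z (suc (j + onset)) ℚ.≤ expTerm z (j + onset)
    halving j = cancel (fromℕ (suc k)) (0<fromℕ k) (begin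
      fromℕ (suc k) ℚ.* (expTerm z (suc k) ℚ.+ expTerm z (suc k)) ≡⟨ ℚ.*-distribˡ-+ (fromℕ (suc k)) _ _ ⟩
      fromℕ (suc k) ℚ.* expTerm z (suc k) ℚ.+ fromℕ (suc k) ℚ.* expTerm z (suc k) ≡⟨ cong₂ ℚ._+_ (Exp.term-suc z z k) (Exp.term-suc z z k) ⟩
      z ℚ.* expTerm z k ℚ.+ z ℚ.* expTerm z k ≡⟨ sym (ℚ.*-distribʳ-+ (expTerm z k) z z) ⟩
      (z ℚ.+ z) ℚ.* expTerm z k ≤⟨ ℚ.*-monoʳ-≤-nonNeg (expTerm z k) {{ℚ.nonNegative (0≤expTerm 0≤z k)}}
                                (ℚ.≤-trans (proj₂ (archimedean (z ℚ.+ z))) (fromℕ-mono (≤-trans (m≤n+m onset j) (n≤1+n k)))) ⟩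
      fromℕ (suc k) ℚ.* expTerm z k ∎)
      where
      open ℚ.≤-Reasoning
      k = j + onset

    bound : ℚ
    bound = exp z onset ℚ.+ (expTerm z onset ℚ.+ expTerm z onset)

    -- Once the index exceeds 2 z the terms at least halve, so a partial sum plus twice the next
    -- term can only decrease.
    bounded-from : ∀ j → exp z (j + onset) ℚ.+ (expTerm z (j + onset) ℚ.+ expTerm z (j + onset)) ℚ.≤ bound
    bounded-from zero    = ℚ.≤-refl
    bounded-from (suc j) = begin
      exp z k ℚ.+ t ℚ.+ (expTerm z (suc k) ℚ.+ expTerm z (suc k)) ≤⟨ ℚ.+-monoʳ-≤ (exp z k ℚ.+ t) (halving j) ⟩
      exp z k ℚ.+ t ℚ.+ t ≡⟨ ℚ.+-assoc (exp z k) t t ⟩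
      exp z k ℚ.+ (t ℚ.+ t) ≤⟨ bounded-from j ⟩
      bound ∎
      where
      open ℚ.≤-Reasoning
      k = j + onset
      t = expTerm z k

    exp-bounded : ∀ n → exp z n ℚ.≤ bound
    exp-bounded n = ℚ.≤-trans (subst (λ k → exp z n ℚ.≤ exp z k) (+-comm onset n) (exp-mono 0≤z onset n))
      (ℚ.≤-trans (subst (ℚ._≤ exp z k ℚ.+ (expTerm z k ℚ.+ expTerm z k)) (ℚ.+-identityʳ (exp z k))
        (ℚ.+-monoʳ-≤ (exp z k) (0≤+ (0≤expTerm 0≤z k) (0≤expTerm 0≤z k)))) (bounded-from n))
      where
      k = n + onset

    0≤bound : 0ℚ ℚ.≤ bound
    0≤bound = exp-bounded 0

  n≤2^n : ∀ n → n ≤ 2 ^ n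
  n≤2^n zero    = z≤n
  n≤2^n (suc n) = ≤-trans (+-mono-≤ (m^n>0 2 n) (n≤2^n n)) (≤-reflexive (cong (2 ^ n +_) (sym (+-identityʳ (2 ^ n)))))

  module Corner (x : ℚ) where

    open Exp x

    z : ℚ
    z = ℚ.∣ x ∣ ℚ.+ ℚ.∣ x ∣

    0≤z : 0ℚ ℚ.≤ z
    0≤z = 0≤+ (0≤∣p∣ x) (0≤∣p∣ x)

    open ExpBounded 0≤z

    scaled : ∀ q → ℚ.∣ q ∣ ≡ ℚ.∣ x ∣ → ∀ k → fromℕ (2 ^ k) ℚ.* ℚ.∣ expTerm q k ∣ ≡ expTerm z k
    scaled q eq k = trans (cong (fromℕ (2 ^ k) ℚ.*_) (trans (∣expTerm∣ q k) (cong (λ y → expTerm y k) eq))) (expTerm-double ℚ.∣ x ∣ k)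

    block : ∀ k j → fromℕ (2 ^ k) ℚ.* ℚ.∣ exp (ℚ.- x) (j + k) ℚ.- exp (ℚ.- x) k ∣ ℚ.+ exp z k ℚ.≤ exp z (j + k)
    block k zero    = ℚ.≤-reflexive (trans (cong (λ d → fromℕ (2 ^ k) ℚ.* ℚ.∣ d ∣ ℚ.+ exp z k) (ℚ.+-inverseʳ (exp (ℚ.- x) k)))
      (trans (cong (ℚ._+ exp z k) (ℚ.*-zeroʳ (fromℕ (2 ^ k)))) (ℚ.+-identityˡ _)))
    block k (suc j) = begin
      w ℚ.* ℚ.∣ s ℚ.+ t ℚ.- u ∣ ℚ.+ exp z k
        ≡⟨ cong (λ d → w ℚ.* ℚ.∣ d ∣ ℚ.+ exp z k) (solve 3 (λ s t u → s :+ t :- u := s :- u :+ t) refl s t u) ⟩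
      w ℚ.* ℚ.∣ s ℚ.- u ℚ.+ t ∣ ℚ.+ exp z k
        ≤⟨ ℚ.+-monoˡ-≤ (exp z k) (ℚ.*-monoˡ-≤-nonNeg w {{ℚ.nonNegative 0≤w}} (ℚ.∣p+q∣≤∣p∣+∣q∣ (s ℚ.- u) t)) ⟩
      w ℚ.* (ℚ.∣ s ℚ.- u ∣ ℚ.+ ℚ.∣ t ∣) ℚ.+ exp z k
        ≡⟨ solve 4 (λ w d t e → w :* (d :+ t) :+ e := w :* d :+ e :+ w :* t) refl w ℚ.∣ s ℚ.- u ∣ ℚ.∣ t ∣ (exp z k) ⟩
      w ℚ.* ℚ.∣ s ℚ.- u ∣ ℚ.+ exp z k ℚ.+ w ℚ.* ℚ.∣ t ∣
        ≤⟨ ℚ.+-mono-≤ (block k j) (ℚ.*-monoʳ-≤-nonNeg ℚ.∣ t ∣ {{ℚ.∣-∣-nonNeg t}} (fromℕ-mono (^-monoʳ-≤ 2 (m≤n+m k j)))) ⟩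
      exp z (j + k) ℚ.+ fromℕ (2 ^ (j + k)) ℚ.* ℚ.∣ t ∣ ≡⟨ cong (exp z (j + k) ℚ.+_) (scaled (ℚ.- x) (ℚ.∣-p∣≡∣p∣ x) (j + k)) ⟩
      exp z (suc j + k) ∎
      where
      open ℚ.≤-Reasoning
      w = fromℕ (2 ^ k)
      0≤w = 0≤fromℕ (2 ^ k)
      s = exp (ℚ.- x) (j + k)
      t = expTerm (ℚ.- x) (j + k)
      u = exp (ℚ.- x) k

    -- Weighting the product of the terms p and q by 2 ^ (p + q) amounts to replacing |x| by z = 2
    -- |x|. In the corner p + q ≥ i + k, so the weighted sum, which is bounded, dominates 2 ^ (i +
    -- k) times the corner.
    corner-bound : ∀ i k → fromℕ (2 ^ (i + k)) ℚ.* ℚ.∣ corner i k ∣ ℚ.+ exp z i ℚ.* bound ℚ.≤ exp z (i + k) ℚ.* bound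
    corner-bound i zero = ℚ.≤-reflexive (trans (cong (ℚ._+ exp z i ℚ.* bound) (ℚ.*-zeroʳ (fromℕ (2 ^ (i + 0)))))
      (trans (ℚ.+-identityˡ _) (cong (λ l → exp z l ℚ.* bound) (sym (+-identityʳ i)))))
    corner-bound i (suc k) = begin
      w ℚ.* ℚ.∣ a i ℚ.* d ℚ.+ corner (suc i) k ∣ ℚ.+ e
        ≤⟨ ℚ.+-monoˡ-≤ e (ℚ.*-monoˡ-≤-nonNeg w {{ℚ.nonNegative 0≤w}} (ℚ.∣p+q∣≤∣p∣+∣q∣ (a i ℚ.* d) (corner (suc i) k))) ⟩
      w ℚ.* (ℚ.∣ a i ℚ.* d ∣ ℚ.+ c) ℚ.+ e ≡⟨ cong₂ (λ u v → u ℚ.* (v ℚ.+ c) ℚ.+ e) w≡ (ℚ.∣p*q∣≡∣p∣*∣q∣ (a i) d) ⟩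
      w₁ ℚ.* w₂ ℚ.* (ℚ.∣ a i ∣ ℚ.* ℚ.∣ d ∣ ℚ.+ c) ℚ.+ e
        ≡⟨ solve 6 (λ w₁ w₂ a d c e → w₁ :* w₂ :* (a :* d :+ c) :+ e := w₁ :* a :* (w₂ :* d) :+ (w₁ :* w₂ :* c :+ e)) refl
             w₁ w₂ ℚ.∣ a i ∣ ℚ.∣ d ∣ c e ⟩
      w₁ ℚ.* ℚ.∣ a i ∣ ℚ.* (w₂ ℚ.* ℚ.∣ d ∣) ℚ.+ (w₁ ℚ.* w₂ ℚ.* c ℚ.+ e)
        ≡⟨ cong₂ (λ u v → u ℚ.* (w₂ ℚ.* ℚ.∣ d ∣) ℚ.+ (v ℚ.* c ℚ.+ e)) (scaled x refl i) (trans (sym w≡) (cong (λ l → fromℕ (2 ^ l)) (+-suc i k))) ⟩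
      expTerm z i ℚ.* (w₂ ℚ.* ℚ.∣ d ∣) ℚ.+ (w′ ℚ.* c ℚ.+ e)
        ≤⟨ ℚ.+-monoˡ-≤ (w′ ℚ.* c ℚ.+ e) (ℚ.*-monoˡ-≤-nonNeg (expTerm z i) {{ℚ.nonNegative (0≤expTerm 0≤z i)}} diff) ⟩
      expTerm z i ℚ.* bound ℚ.+ (w′ ℚ.* c ℚ.+ e)
        ≡⟨ solve 4 (λ t b v e → t :* b :+ (v :+ e :* b) := v :+ (e :+ t) :* b) refl (expTerm z i) bound (w′ ℚ.* c) (exp z i) ⟩
      w′ ℚ.* c ℚ.+ exp z (suc i) ℚ.* bound ≤⟨ corner-bound (suc i) k ⟩
      exp z (suc i + k) ℚ.* bound ≡⟨ cong (λ l → exp z l ℚ.* bound) (sym (+-suc i k)) ⟩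
      exp z (i + suc k) ℚ.* bound ∎
      where
      open ℚ.≤-Reasoning
      w = fromℕ (2 ^ (i + suc k))
      0≤w = 0≤fromℕ (2 ^ (i + suc k))
      w₁ = fromℕ (2 ^ i)
      w₂ = fromℕ (2 ^ suc k)
      w′ = fromℕ (2 ^ (suc i + k))
      d = exp (ℚ.- x) (i + suc k) ℚ.- exp (ℚ.- x) (suc k)
      c = ℚ.∣ corner (suc i) k ∣
      e = exp z i ℚ.* bound
      w≡ : w ≡ w₁ ℚ.* w₂
      w≡ = trans (cong fromℕ (^-distribˡ-+-* 2 i (suc k))) (fromℕ-* (2 ^ i) (2 ^ suc k))
      diff : w₂ ℚ.* ℚ.∣ d ∣ ℚ.≤ bound
      diff = ℚ.≤-trans (subst (ℚ._≤ w₂ ℚ.* ℚ.∣ d ∣ ℚ.+ exp z (suc k)) (ℚ.+-identityʳ _)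
          (ℚ.+-monoʳ-≤ (w₂ ℚ.* ℚ.∣ d ∣) (subst (λ l → 0ℚ ℚ.≤ exp z l) (+-identityʳ (suc k)) (exp-mono 0≤z (suc k) 0))))
        (ℚ.≤-trans (block (suc k) i) (exp-bounded (i + suc k)))

    corner-small : ∀ k → fromℕ k ℚ.* ℚ.∣ corner 0 k ∣ ℚ.≤ bound ℚ.* bound
    corner-small k = begin
      fromℕ k ℚ.* ℚ.∣ corner 0 k ∣ ≤⟨ ℚ.*-monoʳ-≤-nonNeg ℚ.∣ corner 0 k ∣ {{ℚ.∣-∣-nonNeg (corner 0 k)}} (fromℕ-mono (n≤2^n k)) ⟩
      fromℕ (2 ^ k) ℚ.* ℚ.∣ corner 0 k ∣ ≡⟨ sym (trans (cong (fromℕ (2 ^ k) ℚ.* ℚ.∣ corner 0 k ∣ ℚ.+_) (ℚ.*-zeroˡ bound)) (ℚ.+-identityʳ _)) ⟩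
      fromℕ (2 ^ k) ℚ.* ℚ.∣ corner 0 k ∣ ℚ.+ 0ℚ ℚ.* bound ≤⟨ corner-bound 0 k ⟩
      exp z k ℚ.* bound ≤⟨ ℚ.*-monoʳ-≤-nonNeg bound {{ℚ.nonNegative 0≤bound}} (exp-bounded k) ⟩
      bound ℚ.* bound ∎
      where open ℚ.≤-Reasoning

  one-plus≤exp : ∀ {ε} → 0ℚ ℚ.≤ ε → ∀ k → 1ℚ ℚ.+ ε ℚ.≤ exp ε (k + 2)
  one-plus≤exp {ε} 0≤ε k = ℚ.≤-trans (ℚ.≤-reflexive
    (solve 1 (λ q → con 1ℚ :+ q := con 0ℚ :+ con 1ℚ :+ con 1ℚ :* q :* con 1ℚ) refl ε)) (exp-mono 0≤ε k 2)

  ≤lim-exp : ∀ {ε r} → 0ℚ ℚ.≤ ε → r ℚ.≤ 1ℚ ℚ.+ ε → r ≤lim exp ε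
  ≤lim-exp {ε} {r} 0≤ε r≤ η η>0 = 2 , λ k 2≤k → ℚ.≤-trans r≤ (ℚ.≤-trans
    (subst (λ l → 1ℚ ℚ.+ ε ℚ.≤ exp ε l) (m∸n+n≡m 2≤k) (one-plus≤exp 0≤ε (k ∸ 2)))
    (subst (ℚ._≤ exp ε k ℚ.+ η) (ℚ.+-identityʳ _) (ℚ.+-monoʳ-≤ (exp ε k) (ℚ.<⇒≤ (ℚ.positive⁻¹ η {{η>0}})))))

  -- For a partial sum s of e^(-ε), (1 + ε) s is at most the product with the partial sum of e^ε,
  -- that is 1 plus a corner of size at most η, hence at most (1 + ε) (r + η).
  exp-neg-lim≤ : ∀ {ε r} → 0ℚ ℚ.≤ ε → 0ℚ ℚ.≤ r → 1ℚ ℚ.≤ (1ℚ ℚ.+ ε) ℚ.* r → exp (ℚ.- ε) lim≤ r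
  exp-neg-lim≤ {ε} {r} 0≤ε 0≤r 1≤ η η>0 = 2 + suc N , bound-at
    where
    open Corner ε
    open ExpBounded 0≤z
    open Exp ε
    0<η : 0ℚ ℚ.< η
    0<η = ℚ.positive⁻¹ η {{η>0}}
    instance
      η≢0 : ℚ.NonZero η
      η≢0 = ℚ.pos⇒nonZero η {{η>0}}
    N : ℕ
    N = proj₁ (archimedean (bound ℚ.* bound ℚ.* ℚ.1/ η))
    large : bound ℚ.* bound ℚ.≤ fromℕ (suc N) ℚ.* η
    large = begin
      bound ℚ.* bound ≡⟨ sym (trans (ℚ.*-assoc (bound ℚ.* bound) (ℚ.1/ η) η) (trans (cong (bound ℚ.* bound ℚ.*_) (ℚ.*-inverseˡ η)) (ℚ.*-identityʳ _))) ⟩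
      bound ℚ.* bound ℚ.* ℚ.1/ η ℚ.* η ≤⟨ ℚ.*-monoʳ-≤-nonNeg η {{ℚ.nonNegative (ℚ.<⇒≤ 0<η)}}
                                      (ℚ.≤-trans (proj₂ (archimedean (bound ℚ.* bound ℚ.* ℚ.1/ η))) (fromℕ-mono (n≤1+n N))) ⟩
      fromℕ (suc N) ℚ.* η ∎
      where open ℚ.≤-Reasoning
    bound-at : ∀ k → 2 + suc N ≤ k → exp (ℚ.- ε) k ℚ.≤ r ℚ.+ η
    bound-at (suc (suc k)) (s≤s (s≤s N≤k)) with ℚ.≤-total (exp (ℚ.- ε) (suc (suc k))) 0ℚ
    -- Multiplying inequalities by the partial sum needs its sign; a nonpositive one lies below r +
    -- η anyway.
    ... | inj₁ s≤0 = ℚ.≤-trans s≤0 (0≤+ 0≤r (ℚ.<⇒≤ 0<η))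
    ... | inj₂ 0≤s = cancel (1ℚ ℚ.+ ε) (ℚ.<-≤-trans (0<fromℕ 0) 1≤1+ε) (begin
      (1ℚ ℚ.+ ε) ℚ.* s ≤⟨ ℚ.*-monoʳ-≤-nonNeg s {{ℚ.nonNegative 0≤s}} (subst (λ l → 1ℚ ℚ.+ ε ℚ.≤ exp ε l) (+-comm k 2) (one-plus≤exp 0≤ε k)) ⟩
      exp ε K ℚ.* s ≡⟨ exp-product (suc k) ⟩
      1ℚ ℚ.+ corner 0 K ≤⟨ ℚ.+-mono-≤ 1≤ (ℚ.≤-trans (p≤∣p∣ (corner 0 K)) small) ⟩
      (1ℚ ℚ.+ ε) ℚ.* r ℚ.+ η ≡⟨ cong ((1ℚ ℚ.+ ε) ℚ.* r ℚ.+_) (sym (ℚ.*-identityˡ η)) ⟩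
      (1ℚ ℚ.+ ε) ℚ.* r ℚ.+ 1ℚ ℚ.* η ≤⟨ ℚ.+-monoʳ-≤ ((1ℚ ℚ.+ ε) ℚ.* r) (ℚ.*-monoʳ-≤-nonNeg η {{ℚ.nonNegative (ℚ.<⇒≤ 0<η)}} 1≤1+ε) ⟩
      (1ℚ ℚ.+ ε) ℚ.* r ℚ.+ (1ℚ ℚ.+ ε) ℚ.* η ≡⟨ sym (ℚ.*-distribˡ-+ (1ℚ ℚ.+ ε) r η) ⟩
      (1ℚ ℚ.+ ε) ℚ.* (r ℚ.+ η) ∎)
      where
      open ℚ.≤-Reasoning
      K = suc (suc k)
      s = exp (ℚ.- ε) K
      1≤1+ε : 1ℚ ℚ.≤ 1ℚ ℚ.+ ε
      1≤1+ε = subst (ℚ._≤ 1ℚ ℚ.+ ε) (ℚ.+-identityʳ 1ℚ) (ℚ.+-monoʳ-≤ 1ℚ 0≤ε)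
      small : ℚ.∣ corner 0 K ∣ ℚ.≤ η
      small = cancel (fromℕ (suc N)) (0<fromℕ N) (begin
        fromℕ (suc N) ℚ.* ℚ.∣ corner 0 K ∣
          ≤⟨ ℚ.*-monoʳ-≤-nonNeg ℚ.∣ corner 0 K ∣ {{ℚ.∣-∣-nonNeg (corner 0 K)}} (fromℕ-mono (≤-trans N≤k (≤-trans (n≤1+n k) (n≤1+n (suc k))))) ⟩
        fromℕ K ℚ.* ℚ.∣ corner 0 K ∣ ≤⟨ corner-small K ⟩
        bound ℚ.* bound ≤⟨ large ⟩
        fromℕ (suc N) ℚ.* η ∎)

-- From precision 1 / e to a relative ε-approximation

module _ {num den e a h : ℕ} (precise : num + den ≤ e * num) (close : e * ∣ h - a ∣ ≤ a) where

  private
    scaled-gap : (num + den) * ∣ h - a ∣ ≤ num * a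
    scaled-gap = begin
      (num + den) * ∣ h - a ∣ ≤⟨ *-monoˡ-≤ ∣ h - a ∣ precise ⟩
      e * num * ∣ h - a ∣ ≡⟨ arith e num ∣ h - a ∣ ⟩
      num * (e * ∣ h - a ∣) ≤⟨ *-monoʳ-≤ num close ⟩
      num * a ∎
      where
      open ≤-Reasoning
      arith : ∀ e n t → e * n * t ≡ n * (e * t)
      arith = solve-∀

    gap-≤ : ∀ x y → x ≤ y + ∣ x - y ∣
    gap-≤ x y = m≤n+∣m-n∣ x y

  -- With ε = num / den, `precise` reads 1 + 1 / ε ≤ e, so `close` gives |h - a| ≤ a ε / (1 + ε).
  -- Since a - a ε / (1 + ε) = a / (1 + ε), the claim (1 + ε) h ≥ a follows.
  estimate-lower : a * den ≤ (num + den) * h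
  estimate-lower = +-cancelˡ-≤ (num * a) _ _ (begin
    num * a + a * den ≡⟨ arith₁ num a den ⟩
    (num + den) * a ≤⟨ *-monoʳ-≤ (num + den) (gap-≤ a h) ⟩
    (num + den) * (h + ∣ a - h ∣) ≡⟨ cong (λ t → (num + den) * (h + t)) (∣-∣-comm a h) ⟩
    (num + den) * (h + ∣ h - a ∣) ≡⟨ *-distribˡ-+ (num + den) h ∣ h - a ∣ ⟩
    (num + den) * h + (num + den) * ∣ h - a ∣ ≤⟨ +-monoʳ-≤ _ scaled-gap ⟩
    (num + den) * h + num * a ≡⟨ +-comm _ (num * a) ⟩
    num * a + (num + den) * h ∎)
    where
    open ≤-Reasoning
    arith₁ : ∀ n a d → n * a + a * d ≡ (n + d) * a
    arith₁ = solve-∀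

  estimate-upper : h * den ≤ (num + den) * a
  estimate-upper = begin
    h * den ≤⟨ *-monoˡ-≤ den (gap-≤ h a) ⟩
    (a + ∣ h - a ∣) * den ≡⟨ arith₁ a ∣ h - a ∣ den ⟩
    den * a + den * ∣ h - a ∣ ≤⟨ +-monoʳ-≤ (den * a) (≤-trans (*-monoˡ-≤ ∣ h - a ∣ (m≤n+m den num)) scaled-gap) ⟩
    den * a + num * a ≡⟨ arith₂ den a num ⟩
    (num + den) * a ∎
    where
    open ≤-Reasoning
    arith₁ : ∀ a t d → (a + t) * d ≡ d * a + d * t
    arith₁ = solve-∀
    arith₂ : ∀ d a n → d * a + n * a ≡ (n + d) * a
    arith₂ = solve-∀

ε-fraction : ∀ ε → .{{ℚ.Positive ε}} → ε ℚ.* fromℕ (ℚ.↧ₙ ε) ≡ fromℕ ℤ.∣ ℚ.↥ ε ∣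
ε-fraction ε@(ℚ.mkℚ (ℤ.+ n) d _) =
  trans (cong (ℚ._* fromℕ (suc d)) (sym (ℚ.↥p/↧p≡p ε))) (/-fromℕ n d)

-- Both bounds pass through 1 + ε ≤ e^ε: the quotient z of truth and output satisfies z ≤ 1 + ε and
-- 1 ≤ (1 + ε) z.
relApprox : ∀ ε → .{{_ : ℚ.Positive ε}} → ∀ i h k e → 1 ≤ i →
  ℤ.∣ ℚ.↥ ε ∣ + ℚ.↧ₙ ε ≤ e * ℤ.∣ ℚ.↥ ε ∣ → e * ∣ h - suc k * i ∣ ≤ suc k * i →
  RelApprox ε (fromℕ i) (ℤ.+ h ℚ./ suc k)
-- Output 0 is impossible: the lower estimate would make the positive number (k + 1) i times the
-- denominator at most 0.
relApprox ε i zero k e 1≤i precise close = ⊥-elim (<⇒≱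
  (≤-trans (*-mono-≤ (*-mono-≤ (s≤s (z≤n {k})) 1≤i) (s≤s (z≤n {ℚ.denominator-1 ε}))) (estimate-lower {e = e} precise close))
  (≤-reflexive (*-zeroʳ (ℤ.∣ ℚ.↥ ε ∣ + ℚ.↧ₙ ε))))
relApprox ε i h@(suc _) k e 1≤i precise close =
  y≢0 , ≤lim-exp 0≤ε upper , exp-neg-lim≤ 0≤ε 0≤z lower
  where
  open ℚ-Solver.+-*-Solver
  y x z K D : ℚ
  y = ℤ.+ h ℚ./ suc k
  x = fromℕ i
  K = fromℕ (suc k)
  D = fromℕ (ℚ.↧ₙ ε)
  y>0 : ℚ.Positive y
  y>0 = ℚ.normalize-pos h (suc k)
  y≢0 : ℚ.NonZero y
  y≢0 = ℚ.pos⇒nonZero y {{y>0}}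
  z = (x ℚ.÷ y) {{y≢0}}
  0<y = ℚ.positive⁻¹ y {{y>0}}
  0≤ε = ℚ.<⇒≤ (ℚ.positive⁻¹ ε)
  yz≡x : y ℚ.* z ≡ x
  yz≡x = trans (solve 3 (λ x y w → y :* (x :* w) := x :* (y :* w)) refl x y ((ℚ.1/ y) {{y≢0}}))
    (trans (cong (x ℚ.*_) (ℚ.*-inverseʳ y {{y≢0}})) (ℚ.*-identityʳ x))
  0≤z : 0ℚ ℚ.≤ z
  0≤z = cancel y 0<y (ℚ.≤-trans (ℚ.≤-reflexive (ℚ.*-zeroʳ y)) (subst (0ℚ ℚ.≤_) (sym yz≡x) (0≤fromℕ i)))
  0<KD : 0ℚ ℚ.< K ℚ.* D
  0<KD = ℚ.positive⁻¹ (K ℚ.* D) {{ℚ.pos*pos⇒pos K {{ℚ.positive (0<fromℕ k)}} D {{ℚ.positive (0<fromℕ (ℚ.denominator-1 ε))}}}}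
  num = ℤ.∣ ℚ.↥ ε ∣
  den = ℚ.↧ₙ ε
  sum-part : ∀ u → (fromℕ num ℚ.+ D) ℚ.* fromℕ u ≡ fromℕ ((num + den) * u)
  sum-part u = sym (trans (fromℕ-* (num + den) u) (cong (ℚ._* fromℕ u) (fromℕ-+ num den)))
  upper : z ℚ.≤ 1ℚ ℚ.+ ε
  upper = cancel y 0<y (cancel (K ℚ.* D) 0<KD (begin
    K ℚ.* D ℚ.* (y ℚ.* z) ≡⟨ cong (K ℚ.* D ℚ.*_) yz≡x ⟩
    K ℚ.* D ℚ.* x ≡⟨ solve 3 (λ K D x → K :* D :* x := K :* x :* D) refl K D x ⟩
    K ℚ.* x ℚ.* D ≡⟨ trans (cong (ℚ._* D) (sym (fromℕ-* (suc k) i))) (sym (fromℕ-* (suc k * i) den)) ⟩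
    fromℕ (suc k * i * den) ≤⟨ fromℕ-mono (estimate-lower {e = e} precise close) ⟩
    fromℕ ((num + den) * h) ≡⟨ sym (sum-part h) ⟩
    (fromℕ num ℚ.+ D) ℚ.* fromℕ h ≡⟨ cong₂ (λ u v → (u ℚ.+ D) ℚ.* v) (sym (ε-fraction ε)) (sym (/-fromℕ h k)) ⟩
    (ε ℚ.* D ℚ.+ D) ℚ.* (y ℚ.* K) ≡⟨ solve 4 (λ q D y K → (q :* D :+ D) :* (y :* K) := K :* D :* (y :* (con 1ℚ :+ q))) refl ε D y K ⟩
    K ℚ.* D ℚ.* (y ℚ.* (1ℚ ℚ.+ ε)) ∎))
    where open ℚ.≤-Reasoning
  lower : 1ℚ ℚ.≤ (1ℚ ℚ.+ ε) ℚ.* z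
  lower = cancel y 0<y (cancel (K ℚ.* D) 0<KD (begin
    K ℚ.* D ℚ.* (y ℚ.* 1ℚ) ≡⟨ solve 3 (λ K D y → K :* D :* (y :* con 1ℚ) := y :* K :* D) refl K D y ⟩
    y ℚ.* K ℚ.* D ≡⟨ trans (cong (ℚ._* D) (/-fromℕ h k)) (sym (fromℕ-* h den)) ⟩
    fromℕ (h * den) ≤⟨ fromℕ-mono (estimate-upper {e = e} {h = h} precise close) ⟩
    fromℕ ((num + den) * (suc k * i)) ≡⟨ sym (sum-part (suc k * i)) ⟩
    (fromℕ num ℚ.+ D) ℚ.* fromℕ (suc k * i)
      ≡⟨ cong₂ (λ u v → (u ℚ.+ D) ℚ.* v) (sym (ε-fraction ε)) (trans (fromℕ-* (suc k) i) (cong (K ℚ.*_) (sym yz≡x))) ⟩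
    (ε ℚ.* D ℚ.+ D) ℚ.* (K ℚ.* (y ℚ.* z))
      ≡⟨ solve 5 (λ q D y K z → (q :* D :+ D) :* (K :* (y :* z)) := K :* D :* (y :* ((con 1ℚ :+ q) :* z))) refl ε D y K z ⟩
    K ℚ.* D ℚ.* (y ℚ.* ((1ℚ ℚ.+ ε) ℚ.* z)) ∎))
    where open ℚ.≤-Reasoning

-- The graph of the input

sum-cons : ∀ m (f : ℕ → ℕ) → sumTo (suc m) f ≡ f 0 + sumTo m (λ x → f (suc x))
sum-cons zero    f = sym (+-identityʳ (f 0))
sum-cons (suc m) f = trans (cong (_+ f (suc m)) (sum-cons m f)) (+-assoc (f 0) _ _)

prod-cases : ∀ k (f : ℕ → ℕ) → prodTo k f ≡ 0 ⊎ (∀ x → x < k → f x ≢ 0)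
prod-cases zero    f = inj₂ λ _ ()
prod-cases (suc k) f with f 0 in eq | prod-cases k (λ x → f (suc x))
... | zero  | _      = inj₁ refl
... | suc a | inj₁ z = inj₁ (trans (cong (suc a *_) z) (*-zeroʳ (suc a)))
... | suc a | inj₂ h = inj₂ λ { zero _ z → 1+n≢0 (trans (sym eq) z) ; (suc x) (s≤s x<k) → h x x<k }

prod-bits : ∀ k {f : ℕ → ℕ} → (∀ x → f x ≤ 1) → prodTo k f ≤ 1
prod-bits zero    h = ≤-refl
prod-bits (suc k) h = *-mono-≤ (h 0) (prod-bits k λ x → h (suc x))

filter-sum : ∀ m {P : Vec Bool m → Set} (P? : ∀ w → Dec (P w)) →
             length (filter P? (bitVectors m)) ≡ sumᵇ m (λ w → toBit (Dec.does (P? w)))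
filter-sum zero P? with Dec.does (P? [])
... | true  = refl
... | false = refl
filter-sum (suc m) P? = begin
  length (filter P? (map (true ∷_) B ++ map (false ∷_) B)) ≡⟨ cong length (List.filter-++ P? (map (true ∷_) B) _) ⟩
  length (filter P? (map (true ∷_) B) ++ filter P? (map (false ∷_) B)) ≡⟨ List.length-++ (filter P? (map (true ∷_) B)) ⟩
  length (filter P? (map (true ∷_) B)) + length (filter P? (map (false ∷_) B))
    ≡⟨ cong₂ _+_ (part true) (part false) ⟩
  sumᵇ (suc m) (λ w → toBit (Dec.does (P? w))) ∎
  where
  open ≡-Reasoning
  B = bitVectors m
  along : ∀ b (ws : List (Vec Bool m)) → length (filter P? (map (b ∷_) ws)) ≡ length (filter (λ w → P? (b ∷ w)) ws)
  along b []       = refl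
  along b (w ∷ ws) with Dec.does (P? (b ∷ w))
  ... | true  = cong suc (along b ws)
  ... | false = along b ws
  part : ∀ b → length (filter P? (map (b ∷_) B)) ≡ sumᵇ m (λ w → toBit (Dec.does (P? (b ∷ w))))
  part b = trans (along b B) (filter-sum m (λ w → P? (b ∷ w)))

at-lookup : ∀ {m} (J : Vec Bool m) u → at J (toℕ u) ≡ toBit (lookup J u)
at-lookup (b ∷ J) zero    = refl
at-lookup (b ∷ J) (suc u) = at-lookup J u

card-sum : ∀ {m} (S : Vec Bool m) → ∣ S ∣ˢ ≡ sumTo m (at S)
card-sum []          = refl
card-sum {suc m} (true ∷ S)  = trans (cong suc (card-sum S)) (sym (sum-cons m (at (true ∷ S))))
card-sum {suc m} (false ∷ S) = trans (card-sum S) (sym (sum-cons m (at (false ∷ S))))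

-- Agreeing with 0 outside U means being a subset of U.
free-completions : ∀ m {U : ℕ → ℕ} → Bits U → sumᵇ m (λ J → agree U (λ _ → 0) J) ≡ 2 ^ sumTo m U
free-completions zero    bits = refl
free-completions (suc m) {U} bits = begin
  sumᵇ m (λ J → ifz (U 0) 0 1 * rest J) + sumᵇ m (λ J → ifz (U 0) 1 1 * rest J)
    ≡⟨ cong₂ _+_ (sumᵇ-* m (ifz (U 0) 0 1) rest) (sumᵇ-* m (ifz (U 0) 1 1) rest) ⟩
  ifz (U 0) 0 1 * sumᵇ m rest + ifz (U 0) 1 1 * sumᵇ m rest
    ≡⟨ cong (λ k → ifz (U 0) 0 1 * k + ifz (U 0) 1 1 * k) (free-completions m (λ x → bits (suc x))) ⟩
  ifz (U 0) 0 1 * 2 ^ s + ifz (U 0) 1 1 * 2 ^ s ≡⟨ head-bit (bits 0) ⟩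
  2 ^ (U 0 + s) ≡⟨ cong (2 ^_) (sym (sum-cons m U)) ⟩
  2 ^ sumTo (suc m) U ∎
  where
  open ≡-Reasoning
  rest : Vec Bool m → ℕ
  rest = agree (λ x → U (suc x)) (λ _ → 0)
  s = sumTo m (λ x → U (suc x))
  head-bit : ∀ {u} → u ≤ 1 → ifz u 0 1 * 2 ^ s + ifz u 1 1 * 2 ^ s ≡ 2 ^ (u + s)
  head-bit z≤n       = +-identityʳ _
  head-bit (s≤s z≤n) = cong (_+ (2 ^ s + 0)) (+-identityʳ (2 ^ s))

isets-lower : ∀ m {A : ℕ → ℕ → ℕ} {U : ℕ → ℕ} → Bits U →
  (∀ x y → x < m → y < m → U x ≡ 1 → U y ≡ 1 → A x y ≡ 0) → 2 ^ sumTo m U ≤ isets m A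
isets-lower m {A} {U} bits indep = subst (_≤ isets m A) (free-completions m bits) (sumᵇ-mono m pointwise)
  where
  factor : Vec Bool m → ℕ → ℕ
  factor J x = agreeAt (U x) (at J x) 0
  factor-bit : ∀ J x → factor J x ≤ 1
  factor-bit J x with U x | at-bit J x
  ... | suc _ | _ = ≤-refl
  ... | zero | inj₁ eq rewrite eq = ≤-refl
  ... | zero | inj₂ eq rewrite eq = z≤n
  inside : ∀ J x → factor J x ≢ 0 → at J x ≡ 0 ⊎ U x ≡ 1
  inside J x nz with at-bit J x | bit-cases (bits x)
  ... | inj₁ Jx | _       = inj₁ Jx
  ... | inj₂ _  | inj₂ Ux = inj₂ Ux
  ... | inj₂ Jx | inj₁ Ux = ⊥-elim (nz (cong₂ (λ u j → agreeAt u j 0) Ux Jx))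
  pointwise : ∀ J → agree U (λ _ → 0) J ≤ 1 ∸ edges-in m A (at J)
  pointwise J with prod-cases m (factor J)
  ... | inj₁ z  = ≤-trans (≤-reflexive z) z≤n
  ... | inj₂ nz = ≤-trans (prod-bits m (factor-bit J)) (≤-reflexive (cong (1 ∸_) (sym no-edges)))
    where
    term : ∀ x y → x < m → y < m → at J x * (at J y * A x y) ≡ 0
    term x y x<m y<m with inside J x (nz x x<m) | inside J y (nz y y<m)
    ... | inj₁ Jx | _ = cong (_* (at J y * A x y)) Jx
    ... | inj₂ _ | inj₁ Jy = trans (cong (λ j → at J x * (j * A x y)) Jy) (*-zeroʳ (at J x))
    ... | inj₂ Ux | inj₂ Uy = trans (cong (λ a → at J x * (at J y * a)) (indep x y x<m y<m Ux Uy))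
          (trans (cong (at J x *_) (*-zeroʳ (at J y))) (*-zeroʳ (at J x)))
    scale-sum : ∀ k c (f : ℕ → ℕ) → c * sumTo k f ≡ sumTo k (λ y → c * f y)
    scale-sum zero    c f = *-zeroʳ c
    scale-sum (suc k) c f = trans (*-distribˡ-+ c (sumTo k f) (f k)) (cong (_+ c * f k) (scale-sum k c f))
    no-edges : edges-in m A (at J) ≡ 0
    no-edges = sum-zero m λ x x<m → trans (scale-sum m (at J x) _) (sum-zero m λ y y<m → term x y x<m y<m)

module Encoded {m : ℕ} (G : Graph m) (A : ℕ → ℕ → ℕ) (enc : ∀ u v → A (toℕ u) (toℕ v) ≡ toBit (adj G u v)) where

  entry : ∀ x y (x<m : x < m) (y<m : y < m) → A x y ≡ toBit (adj G (fromℕ< x<m) (fromℕ< y<m))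
  entry x y x<m y<m = trans (sym (cong₂ A (Fin.toℕ-fromℕ< x<m) (Fin.toℕ-fromℕ< y<m))) (enc _ _)

  toBit≤1 : ∀ b → toBit b ≤ 1
  toBit≤1 true  = ≤-refl
  toBit≤1 false = z≤n

  isGraph : IsGraph m A
  isGraph = record
    { bit       = λ x y x<m y<m → ≤-trans (≤-reflexive (entry x y x<m y<m)) (toBit≤1 _)
    ; symmetric = λ x y x<m y<m → trans (entry x y x<m y<m) (trans (cong toBit (adj-sym G _ _)) (sym (entry y x y<m x<m)))
    ; loopless  = λ x x<m → trans (entry x x x<m x<m) (cong toBit (adj-irrefl G _)) }

  row-sum : ∀ {d} → Regular d G → ∀ x → x < m → sumTo m (A x) ≡ d
  row-sum reg x x<m = trans (sum-cong m λ y y<m → trans (entry x y x<m y<m) (sym (row y<m)))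
    (trans (sym (card-sum (tabulate (adj G u)))) (reg u))
    where
    u = fromℕ< x<m
    row : ∀ {y} (y<m : y < m) → at (tabulate (adj G u)) y ≡ toBit (adj G u (fromℕ< y<m))
    row {y} y<m = trans (cong (at (tabulate (adj G u))) (sym (Fin.toℕ-fromℕ< y<m)))
      (trans (at-lookup (tabulate (adj G u)) (fromℕ< y<m)) (cong toBit (Vec.lookup∘tabulate (adj G u) (fromℕ< y<m))))

  decide-by : ∀ {P : Set} (P? : Dec P) e → (P → e ≡ 0) → (e ≡ 0 → P) → toBit (Dec.does P?) ≡ 1 ∸ e
  decide-by (yes p) e f g = cong (1 ∸_) (sym (f p))
  decide-by (no ¬p) zero f g = ⊥-elim (¬p (g refl))
  decide-by (no ¬p) (suc e) f g = sym (0∸n≡0 e)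

  independent-edges : ∀ J → toBit (Dec.does (independent? G J)) ≡ 1 ∸ edges-in m A (at J)
  independent-edges J = decide-by (independent? G J) _ (λ ind → sum-zero m (member ind)) ind
    where
    at≡ : ∀ {x} (x<m : x < m) → at J x ≡ toBit (lookup J (fromℕ< x<m))
    at≡ x<m = trans (cong (at J) (sym (Fin.toℕ-fromℕ< x<m))) (at-lookup J (fromℕ< x<m))
    member : Independent G J → ∀ x → x < m → at J x * degree-in m A (at J) x ≡ 0
    member ind x x<m with lookup J (fromℕ< x<m) in Jx | at≡ x<m
    ... | false | eq = cong (_* degree-in m A (at J) x) eq
    ... | true  | eq = trans (cong (at J x *_) (sum-zero m other)) (*-zeroʳ (at J x))
      where
      other : ∀ y → y < m → at J y * A x y ≡ 0
      other y y<m with lookup J (fromℕ< y<m) in Jy | at≡ y<m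
      ... | false | eq′ = cong (_* A x y) eq′
      ... | true  | _   = trans (cong (at J y *_) (trans (entry x y x<m y<m)
            (cong toBit (ind _ _ (Vec.lookup⇒[]= _ J Jx) (Vec.lookup⇒[]= _ J Jy))))) (*-zeroʳ (at J y))
    ind : edges-in m A (at J) ≡ 0 → Independent G J
    ind eq u v u∈J v∈J with adj G u v in uv
    ... | false = refl
    ... | true  = ⊥-elim (<⇒≱ (≤-trans (≤-reflexive (sym one))
          (≤-trans (*-monoʳ-≤ (at J (toℕ u)) (term≤sum m (λ y → at J y * A (toℕ u) y) (toℕ v) (Fin.toℕ<n v)))
            (term≤sum m (λ x → at J x * degree-in m A (at J) x) (toℕ u) (Fin.toℕ<n u)))) (≤-reflexive eq))
      where
      one : at J (toℕ u) * (at J (toℕ v) * A (toℕ u) (toℕ v)) ≡ 1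
      one = cong₂ _*_ (trans (at-lookup J u) (cong toBit (Vec.[]=⇒lookup u∈J)))
        (cong₂ _*_ (trans (at-lookup J v) (cong toBit (Vec.[]=⇒lookup v∈J))) (trans (enc u v) (cong toBit uv)))

  i≡isets : i[ G ] ≡ isets m A
  i≡isets = trans (filter-sum m (independent? G)) (sumᵇ-cong m independent-edges)

  -- The two sides share 2 n vertices, so one of them has at least n, and all its subsets are
  -- independent.
  i-lower : ∀ {n} → m ≡ 2 * n → Bipartite G → 2 ^ n ≤ isets m A
  i-lower {n} m≡ (side , proper) = choose (≤-total n (sumTo m left))
    where
    S : Vec Bool m
    S = tabulate side
    left right : ℕ → ℕ
    left  = at S
    right x = 1 ∸ at S x
    left-bits : Bits left
    left-bits x with at-bit S x
    ... | inj₁ eq = ≤-trans (≤-reflexive eq) z≤n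
    ... | inj₂ eq = ≤-reflexive eq
    left≡ : ∀ {x} (x<m : x < m) → left x ≡ toBit (side (fromℕ< x<m))
    left≡ x<m = trans (cong (at S) (sym (Fin.toℕ-fromℕ< x<m)))
      (trans (at-lookup S (fromℕ< x<m)) (cong toBit (Vec.lookup∘tabulate side (fromℕ< x<m))))
    same-side : ∀ x y (x<m : x < m) (y<m : y < m) → left x ≡ left y → A x y ≡ 0
    same-side x y x<m y<m eq with adj G (fromℕ< x<m) (fromℕ< y<m) in uv
    ... | false = trans (entry x y x<m y<m) (cong toBit uv)
    ... | true  = ⊥-elim (proper _ _ uv (toBit-injective (trans (sym (left≡ x<m)) (trans eq (left≡ y<m)))))
      where
      toBit-injective : ∀ {a b} → toBit a ≡ toBit b → a ≡ b
      toBit-injective {true}  {true}  _ = refl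
      toBit-injective {false} {false} _ = refl
    right⇒left : ∀ x → right x ≡ 1 → left x ≡ 0
    right⇒left x eq with left x
    ... | zero = refl
    right⇒left x () | suc zero
    right⇒left x () | suc (suc _)
    halves : sumTo m left + sumTo m right ≡ n + n
    halves = trans (sym (sum-+ m left right)) (trans (sum-cong m λ x _ → m+[n∸m]≡n (left-bits x))
      (trans (sum-const m 1) (trans (*-identityʳ m) (trans m≡ (cong (n +_) (+-identityʳ n))))))
    choose : n ≤ sumTo m left ⊎ sumTo m left ≤ n → 2 ^ n ≤ isets m A
    choose (inj₁ large) = ≤-trans (^-monoʳ-≤ 2 large) (isets-lower m left-bits
      λ x y x<m y<m Ux Uy → same-side x y x<m y<m (trans Ux (sym Uy)))
    choose (inj₂ small) = ≤-trans (^-monoʳ-≤ 2 large) (isets-lower m (λ x → m∸n≤m 1 (at S x))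
      λ x y x<m y<m Ux Uy → same-side x y x<m y<m (trans (right⇒left x Ux) (sym (right⇒left y Uy))))
      where
      large : n ≤ sumTo m right
      large = +-cancelˡ-≤ n _ _ (≤-trans (≤-reflexive (sym halves)) (+-monoˡ-≤ (sumTo m right) small))

input-cell : ∀ n (G : Graph (2 * n)) ε u v →
             inputMemory n G ε (3 + (toℕ u * (2 * n) + toℕ v)) ≡ toBit (adj G u v)
input-cell n G ε u v with (toℕ u * (2 * n) + toℕ v) <? (2 * n) * (2 * n)
... | no ≮ = ⊥-elim (≮ (subst (_< (2 * n) * (2 * n))
        (trans (Fin.toℕ-combine u v) (cong (_+ toℕ v) (*-comm (2 * n) (toℕ u)))) (Fin.toℕ<n (combine u v))))
... | yes k< = trans (cong (λ f → toBit (adj G (proj₁ (remQuot {2 * n} (2 * n) f)) (proj₂ (remQuot {2 * n} (2 * n) f)))) position)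
    (cong (λ p → toBit (adj G (proj₁ p) (proj₂ p))) (Fin.remQuot-combine u v))
  where
  position : fromℕ< k< ≡ combine u v
  position = Fin.toℕ-injective (trans (Fin.toℕ-fromℕ< k<)
    (sym (trans (Fin.toℕ-combine u v) (cong (_+ toℕ v) (*-comm (2 * n) (toℕ u))))))

filterᵇ-sum : ∀ m (f : Vec Bool m → Bool) → length (filterᵇ f (bitVectors m)) ≡ sumᵇ m (λ w → toBit (f w))
filterᵇ-sum m f = filter-sum m (λ w → Bool.T? (f w))

input-zero : ∀ n (G : Graph (2 * n)) ε k → (2 * n) * (2 * n) ≤ k → inputMemory n G ε (3 + k) ≡ 0
input-zero n G ε k large with k <? (2 * n) * (2 * n)
... | yes k< = ⊥-elim (<⇒≱ k< large)
... | no _   = refl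

-- The sampler as a program

-- A syntactic frame condition: for a concrete command it evaluates to `true`, so preservation of a
-- variable is proved by `tt`.
keepsVar : Cmd → ℕ → Bool
keepsVar skip           i = true
keepsVar (c ⨾ d)        i = keepsVar c i ∧ keepsVar d i
keepsVar (set x _)      i = not (x ≡ᵇ i)
keepsVar (par x _)      i = not (x ≡ᵇ i)
keepsVar (add x _ _)    i = not (x ≡ᵇ i)
keepsVar (sub x _ _)    i = not (x ≡ᵇ i)
keepsVar (get x _ _)    i = not (x ≡ᵇ i)
keepsVar (put _ _ _)    i = true
keepsVar (ifzero _ c d) i = keepsVar c i ∧ keepsVar d i
keepsVar (for x _ c)    i = not (x ≡ᵇ i) ∧ keepsVar c i

keepsArr : Cmd → ℕ → Bool
keepsArr (c ⨾ d)        b = keepsArr c b ∧ keepsArr d b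
keepsArr (put a _ _)    b = not (a ≡ᵇ b)
keepsArr (ifzero _ c d) b = keepsArr c b ∧ keepsArr d b
keepsArr (for _ _ c)    b = keepsArr c b
keepsArr _              b = true

if-not : ∀ {a} {A : Set a} (b : Bool) {x y : A} → T (not b) → (if b then x else y) ≡ y
if-not false _ = refl

ifz-map : ∀ {a b} {A : Set a} {B : Set b} (f : A → B) k {x y} → f (ifz k x y) ≡ ifz k (f x) (f y)
ifz-map f zero    = refl
ifz-map f (suc _) = refl

ifz-cong : ∀ {a} {A : Set a} {k l} {x y x′ y′ : A} → k ≡ l → x ≡ x′ → y ≡ y′ → ifz k x y ≡ ifz l x′ y′
ifz-cong refl refl refl = refl

loop-const : ∀ {a b} {S : Set a} {B : Set b} (f : S → B) {g : ℕ → S → S} → (∀ v s → f (g v s) ≡ f s) →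
             ∀ v k s → f (loopFrom v k g s) ≡ f s
loop-const f h v zero    s = refl
loop-const f h v (suc k) s = trans (loop-const f h (suc v) k _) (h v s)

loop-sim : ∀ {a b} {S : Set a} {S′ : Set b} (R : ℕ → S → S′ → Set) m {f : ℕ → S → S} {g : ℕ → S′ → S′} →
           (∀ v s s′ → v < m → R v s s′ → R (suc v) (f v s) (g v s′)) →
           ∀ s s′ → R 0 s s′ → R m (loopFrom 0 m f s) (loopFrom 0 m g s′)
loop-sim {S = S} {S′} R m {f} {g} next = go m 0 (+-identityʳ m)
  where
  go : ∀ k v → k + v ≡ m → ∀ s s′ → R v s s′ → R m (loopFrom v k f s) (loopFrom v k g s′)
  go zero    v refl s s′ r = r
  go (suc k) v eq   s s′ r = go k (suc v) (trans (+-suc k v) eq) (f v s) (g v s′)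
    (next v s s′ (subst (suc v ≤_) eq (s≤s (m≤n+m v k))) r)

module _ {ρ : ℕ → ℕ} where

  frame-var : ∀ c i → T (keepsVar c i) → ∀ σ → vars (⟦ c ⟧ ρ σ) i ≡ vars σ i
  frame-var skip           i t σ = refl
  frame-var (c ⨾ d)        i t σ = trans (frame-var d i (T-∧₂ (keepsVar c i) t) _) (frame-var c i (T-∧₁ (keepsVar c i) t) σ)
  frame-var (set x _)      i t σ = if-not (x ≡ᵇ i) t
  frame-var (par x _)      i t σ = if-not (x ≡ᵇ i) t
  frame-var (add x _ _)    i t σ = if-not (x ≡ᵇ i) t
  frame-var (sub x _ _)    i t σ = if-not (x ≡ᵇ i) t
  frame-var (get x _ _)    i t σ = if-not (x ≡ᵇ i) t
  frame-var (put _ _ _)    i t σ = refl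
  frame-var (ifzero x c d) i t σ with vars σ x
  ... | zero  = frame-var c i (T-∧₁ (keepsVar c i) t) σ
  ... | suc _ = frame-var d i (T-∧₂ (keepsVar c i) t) σ
  frame-var (for x p c)    i t σ = loop-const (λ τ → vars τ i)
    (λ v τ → trans (frame-var c i (T-∧₂ (not (x ≡ᵇ i)) t) _) (if-not (x ≡ᵇ i) (T-∧₁ (not (x ≡ᵇ i)) t))) 0 (ρ p) σ

  frame-arr : ∀ c b → T (keepsArr c b) → ∀ σ → arrs (⟦ c ⟧ ρ σ) b ≡ arrs σ b
  frame-arr skip           b t σ = refl
  frame-arr (c ⨾ d)        b t σ = trans (frame-arr d b (T-∧₂ (keepsArr c b) t) _) (frame-arr c b (T-∧₁ (keepsArr c b) t) σ)
  frame-arr (set _ _)      b t σ = refl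
  frame-arr (par _ _)      b t σ = refl
  frame-arr (add _ _ _)    b t σ = refl
  frame-arr (sub _ _ _)    b t σ = refl
  frame-arr (get _ _ _)    b t σ = refl
  frame-arr (put a _ _)    b t σ = if-not (a ≡ᵇ b) t
  frame-arr (ifzero x c d) b t σ with vars σ x
  ... | zero  = frame-arr c b (T-∧₁ (keepsArr c b) t) σ
  ... | suc _ = frame-arr d b (T-∧₂ (keepsArr c b) t) σ
  frame-arr (for x p c)    b t σ = loop-const (λ τ → arrs τ b) (λ v τ → frame-arr c b t _) 0 (ρ p) σ

-- Parameters: 0: n, 1: m = 2n, 2: e, 3: N, 4: number of trials.
-- Variables: 0: the constant 1, 17: the constant 0, 19: m, 1: τ, 2: r, 3: budget,
-- 4: v * m, 5: v, 6: y, 11: weight, 13: next coin, 14: accepted trials.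
-- Arrays: 0: adjacency matrix, 1: coins, 2: B, 3: alive, 4: chosen, 5: kind, 6: weight.

probe degCmd : ℕ → Cmd
probe a  = get 7 a 6 ⨾ add 9 4 6 ⨾ get 8 0 9 ⨾ add 7 7 8 ⨾ sub 7 7 0
degCmd a = set 10 0 ⨾ for 6 1 (probe a ⨾ add 10 10 7)

killing heavyCmd branchCmd branching : Cmd
killing   = for 6 1 (probe 3 ⨾ ifzero 7 skip (put 3 6 17 ⨾ put 4 6 17))
heavyCmd  = put 3 5 17 ⨾ sub 3 3 0 ⨾ get 11 2 3 ⨾ sub 7 11 2 ⨾
  ifzero 7 (put 4 5 0 ⨾ sub 2 2 11 ⨾ sub 3 3 1 ⨾ killing) (put 4 5 17)
branchCmd = get 12 3 5 ⨾ ifzero 12 skip ((degCmd 3 ⨾ sub 7 1 10) ⨾ ifzero 7 heavyCmd skip) ⨾ add 4 4 19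
branching = set 4 0 ⨾ for 5 1 branchCmd

mating matchCmd matching : Cmd
mating   = set 10 0 ⨾ for 6 1 (probe 3 ⨾ ifzero 7 skip (add 10 6 0))
matchCmd = put 6 5 11 ⨾ put 5 5 17 ⨾ get 12 3 5 ⨾
  ifzero 12 skip (put 3 5 17 ⨾ mating ⨾ add 12 10 0 ⨾ put 5 5 12 ⨾
    ifzero 10 (add 11 11 11) (sub 12 10 0 ⨾ put 3 12 17 ⨾ add 12 11 11 ⨾ add 11 12 11)) ⨾
  add 4 4 19
matching = set 4 0 ⨾ set 11 1 ⨾ for 5 1 matchCmd

digitCmd decoding : Cmd
digitCmd = sub 5 19 0 ⨾ sub 5 5 16 ⨾ get 7 5 5 ⨾ get 11 6 5 ⨾
  ifzero 7 skip (sub 7 7 0 ⨾ sub 8 11 2 ⨾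
    ifzero 7 (ifzero 8 (sub 2 2 11 ⨾ put 4 5 0) (put 4 5 17))
      (sub 9 7 0 ⨾
        ifzero 8 (sub 2 2 11 ⨾ sub 8 11 2 ⨾
            ifzero 8 (sub 2 2 11 ⨾ put 4 5 17 ⨾ put 4 9 0) (put 4 5 0 ⨾ put 4 9 17))
          (put 4 5 17 ⨾ put 4 9 17)))
decoding = for 16 1 digitCmd

checkCmd checking : Cmd
checkCmd = get 12 4 5 ⨾ ifzero 12 skip (degCmd 4 ⨾ add 18 18 10) ⨾ add 4 4 19
checking = set 4 0 ⨾ add 18 2 17 ⨾ for 5 1 checkCmd ⨾ sub 7 0 18 ⨾ add 14 14 7

-- `chosen` is not cleared between trials: while all vertices are undecided, the number of
-- completions does not depend on it. The last loop of `estimating` multiplies the tally by 2 ^ N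
-- through doublings, leaving only the division by the number of trials to `output`.
drawing reviving sampling estimating : Cmd
drawing    = set 2 0 ⨾ for 16 3 (get 7 1 13 ⨾ add 2 2 2 ⨾ add 2 2 7 ⨾ add 13 13 0)
reviving   = for 5 1 (put 3 5 0) ⨾ add 3 19 17
sampling   = drawing ⨾ reviving ⨾ branching ⨾ matching ⨾ decoding ⨾ checking
estimating = set 0 1 ⨾ set 17 0 ⨾ par 19 1 ⨾ set 13 0 ⨾ set 14 0 ⨾ for 15 4 sampling ⨾ for 16 3 (add 14 14 14)

-- The program simulates the functional sampler

module Simulation (ρ : ℕ → ℕ) (c B : ℕ → ℕ) (τ : ℕ) where

  m : ℕ
  m = ρ 1

  A : ℕ → ℕ → ℕ
  A x y = c (x * m + y)

  open Sampler m τ A B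

  record Env (σ : St) : Set where
    field
      one  : vars σ 0 ≡ 1
      nil  : vars σ 17 ≡ 0
      wide : vars σ 19 ≡ m
      thr  : vars σ 1 ≡ τ
      mat  : arrs σ 0 ≡ c
      tab  : arrs σ 2 ≡ B

  open Env

  envKept : Cmd → Bool
  envKept k = keepsVar k 0 ∧ (keepsVar k 17 ∧ (keepsVar k 19 ∧ (keepsVar k 1 ∧ (keepsArr k 0 ∧ keepsArr k 2))))

  env-frame : ∀ k → T (envKept k) → ∀ {σ} → Env σ → Env (⟦ k ⟧ ρ σ)
  env-frame k t {σ} e = record
    { one  = trans (frame-var k 0 (T-∧₁ (keepsVar k 0) t) σ) (one e)
    ; nil  = trans (frame-var k 17 (T-∧₁ (keepsVar k 17) t₁) σ) (nil e)
    ; wide = trans (frame-var k 19 (T-∧₁ (keepsVar k 19) t₂) σ) (wide e)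
    ; thr  = trans (frame-var k 1 (T-∧₁ (keepsVar k 1) t₃) σ) (thr e)
    ; mat  = trans (frame-arr k 0 (T-∧₁ (keepsArr k 0) t₄) σ) (mat e)
    ; tab  = trans (frame-arr k 2 (T-∧₂ (keepsArr k 0) t₄) σ) (tab e) }
    where
    t₁ = T-∧₂ (keepsVar k 0) t
    t₂ = T-∧₂ (keepsVar k 17) t₁
    t₃ = T-∧₂ (keepsVar k 19) t₂
    t₄ = T-∧₂ (keepsVar k 1) t₃

  probe-value : ∀ {σ} a v → Env σ → vars σ 4 ≡ v * m → vars (⟦ probe a ⟧ ρ σ) 7 ≡ hit (arrs σ a) v (vars σ 6)
  probe-value {σ} a v e base = cong₂ (λ w o → arrs σ a (vars σ 6) + w ∸ o)
    (trans (cong (λ f → f (vars σ 4 + vars σ 6)) (mat e)) (cong (λ k → c (k + vars σ 6)) base)) (one e)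

  degree-value : ∀ {σ} a v → Env σ → vars σ 4 ≡ v * m → vars (⟦ degCmd a ⟧ ρ σ) 10 ≡ hits (arrs σ a) v
  degree-value {σ} a v e base = proj₁ (loop-inv R m next (σ ⟪ 10 ≔ 0 ⟫) (refl , e₀ , base , refl))
    where
    e₀ : Env (σ ⟪ 10 ≔ 0 ⟫)
    e₀ = env-frame (set 10 0) tt e
    R : ℕ → St → Set
    R k s = vars s 10 ≡ sumTo k (hit (arrs σ a) v) × Env s × vars s 4 ≡ v * m × arrs s a ≡ arrs σ a
    next : ∀ k s → k < m → R k s → R (suc k) (⟦ probe a ⨾ add 10 10 7 ⟧ ρ (s ⟪ 6 ≔ k ⟫))
    next k s _ (acc , e , base , arr) =
      cong₂ _+_ acc (trans (probe-value {s ⟪ 6 ≔ k ⟫} a v (env-frame (set 6 k) tt e) base) (cong (λ U → hit U v k) arr)) ,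
      env-frame (set 6 k ⨾ probe a ⨾ add 10 10 7) tt e , base , arr

  kill-value : ∀ {σ} v → Env σ → vars σ 4 ≡ v * m →
    (arrs (⟦ killing ⟧ ρ σ) 3 , arrs (⟦ killing ⟧ ρ σ) 4) ≡ kill v (arrs σ 3) (arrs σ 4)
  kill-value {σ} v e base = proj₁ (loop-sim R m next σ (arrs σ 3 , arrs σ 4) (refl , e , base))
    where
    view : St → (ℕ → ℕ) × (ℕ → ℕ)
    view s = arrs s 3 , arrs s 4
    body : Cmd
    body = probe 3 ⨾ ifzero 7 skip (put 3 6 17 ⨾ put 4 6 17)
    R : ℕ → St → (ℕ → ℕ) × (ℕ → ℕ) → Set
    R k s s′ = view s ≡ s′ × Env s × vars s 4 ≡ v * m
    next : ∀ k s s′ → k < m → R k s s′ → R (suc k) (⟦ body ⟧ ρ (s ⟪ 6 ≔ k ⟫)) (killStep v k s′)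
    next k s _ _ (refl , e , base) =
      trans (ifz-map view (vars σ₁ 7))
        (ifz-cong (probe-value {s ⟪ 6 ≔ k ⟫} 3 v (env-frame (set 6 k) tt e) base) refl
          (cong (λ z → (arrs s 3 [ k ↦ z ]) , (arrs s 4 [ k ↦ z ])) (nil e))) ,
      env-frame (set 6 k ⨾ body) tt e , trans (frame-var {ρ} body 4 tt (s ⟪ 6 ≔ k ⟫)) base
      where
      σ₁ = ⟦ probe 3 ⟧ ρ (s ⟪ 6 ≔ k ⟫)

  view : St → Walk
  view σ = walk (arrs σ 3) (arrs σ 4) (vars σ 3) (vars σ 2)

  view-frame : ∀ k → T (keepsArr k 3 ∧ (keepsArr k 4 ∧ (keepsVar k 3 ∧ keepsVar k 2))) → ∀ σ → view (⟦ k ⟧ ρ σ) ≡ view σ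
  view-frame k t σ rewrite frame-arr {ρ} k 3 (T-∧₁ (keepsArr k 3) t) σ
    | frame-arr {ρ} k 4 (T-∧₁ (keepsArr k 4) (T-∧₂ (keepsArr k 3) t)) σ
    | frame-var {ρ} k 3 (T-∧₁ (keepsVar k 3) (T-∧₂ (keepsArr k 4) (T-∧₂ (keepsArr k 3) t))) σ
    | frame-var {ρ} k 2 (T-∧₂ (keepsVar k 3) (T-∧₂ (keepsArr k 4) (T-∧₂ (keepsArr k 3) t))) σ = refl

  heavy-value : ∀ {σ} v → Env σ → vars σ 4 ≡ v * m → vars σ 5 ≡ v → view (⟦ heavyCmd ⟧ ρ σ) ≡ heavy v (view σ)
  heavy-value {σ} v e base idx = trans (ifz-map view (vars σ₁ 7)) (ifz-cong
      (cong₂ (λ f o → f (vars σ 3 ∸ o) ∸ vars σ 2) (tab e) (one e))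
      picked
      (cong₃ (λ x z o → walk (arrs σ 3 [ x ↦ z ]) (arrs σ 4 [ x ↦ z ]) (vars σ 3 ∸ o) (vars σ 2)) idx (nil e) (one e)))
    where
    cong₃ : ∀ {A B C D : Set} (f : A → B → C → D) {x x′ y y′ z z′} → x ≡ x′ → y ≡ y′ → z ≡ z′ → f x y z ≡ f x′ y′ z′
    cong₃ f refl refl refl = refl
    prefix : Cmd
    prefix = put 3 5 17 ⨾ sub 3 3 0 ⨾ get 11 2 3 ⨾ sub 7 11 2
    σ₁ = ⟦ prefix ⟧ ρ σ
    selecting : Cmd
    selecting = put 4 5 0 ⨾ sub 2 2 11 ⨾ sub 3 3 1
    σ₂ = ⟦ selecting ⟧ ρ σ₁
    b = vars σ 3
    result : (ℕ → ℕ) × (ℕ → ℕ) → ℕ → ℕ → Walk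
    result p b r = walk (proj₁ p) (proj₂ p) b r
    picked : view (⟦ killing ⟧ ρ σ₂) ≡ result (kill v (arrs σ 3 [ v ↦ 0 ]) (arrs σ 4 [ v ↦ 1 ])) (b ∸ 1 ∸ τ) (vars σ 2 ∸ B (b ∸ 1))
    picked = cong₃ result
      (trans (kill-value {σ₂} v (env-frame (prefix ⨾ selecting) tt e) base)
        (cong₃ (λ x z o → kill v (arrs σ 3 [ x ↦ z ]) (arrs σ 4 [ x ↦ o ])) idx (nil e) (one e)))
      (trans (frame-var {ρ} killing 3 tt σ₂) (cong₂ (λ o t → b ∸ o ∸ t) (one e) (thr e)))
      (trans (frame-var {ρ} killing 2 tt σ₂) (cong₂ (λ f o → vars σ 2 ∸ f (b ∸ o)) (tab e) (one e)))

  branch-value : ∀ {σ} v → Env σ → vars σ 4 ≡ v * m → vars σ 5 ≡ v → view (⟦ branchCmd ⟧ ρ σ) ≡ branch v (view σ)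
  branch-value {σ} v e base idx = trans (ifz-map view (vars σ₁ 12)) (ifz-cong (cong (arrs σ 3) idx) refl
    (trans (ifz-map view (vars σ₂ 7)) (ifz-cong threshold
      (trans (heavy-value {σ₂} v e₂ (trans (frame-var {ρ} measuring 4 tt σ₁) base) (trans (frame-var {ρ} measuring 5 tt σ₁) idx))
        (cong (heavy v) (view-frame measuring tt σ₁)))
      (view-frame measuring tt σ₁))))
    where
    σ₁ = ⟦ get 12 3 5 ⟧ ρ σ
    measuring : Cmd
    measuring = degCmd 3 ⨾ sub 7 1 10
    σ₂ = ⟦ measuring ⟧ ρ σ₁
    e₁ : Env σ₁
    e₁ = env-frame (get 12 3 5) tt e
    e₂ : Env σ₂
    e₂ = env-frame measuring tt e₁
    threshold : vars σ₂ 7 ≡ τ ∸ hits (arrs σ 3) v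
    threshold = cong₂ _∸_ (trans (frame-var {ρ} (degCmd 3) 1 tt σ₁) (thr e₁)) (degree-value {σ₁} 3 v e₁ base)

  next-base : ∀ {σ} k v → T (keepsVar k 4) → T (keepsVar k 19) → Env σ → vars σ 4 ≡ v * m →
              vars (⟦ k ⨾ add 4 4 19 ⟧ ρ σ) 4 ≡ suc v * m
  next-base {σ} k v t t′ e base = trans (cong₂ _+_ (trans (frame-var {ρ} k 4 t σ) base) (trans (frame-var {ρ} k 19 t′ σ) (wide e))) (+-comm (v * m) m)

  branching-value : ∀ {σ} → Env σ → view (⟦ branching ⟧ ρ σ) ≡ loopFrom 0 m branch (view σ)
  branching-value {σ} e = proj₁ (loop-sim R m next (σ ⟪ 4 ≔ 0 ⟫) (view σ) (refl , env-frame (set 4 0) tt e , refl))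
    where
    R : ℕ → St → Walk → Set
    R v s s′ = view s ≡ s′ × Env s × vars s 4 ≡ v * m
    next : ∀ v s s′ → v < m → R v s s′ → R (suc v) (⟦ branchCmd ⟧ ρ (s ⟪ 5 ≔ v ⟫)) (branch v s′)
    next v s _ _ (refl , e , base) = branch-value {s ⟪ 5 ≔ v ⟫} v e₅ base refl , env-frame (set 5 v ⨾ branchCmd) tt e ,
      next-base {s ⟪ 5 ≔ v ⟫} (get 12 3 5 ⨾ ifzero 12 skip ((degCmd 3 ⨾ sub 7 1 10) ⨾ ifzero 7 heavyCmd skip)) v tt tt e₅ base
      where
      e₅ : Env (s ⟪ 5 ≔ v ⟫)
      e₅ = env-frame (set 5 v) tt e
  cong₃ : ∀ {a} {A B C : Set} {D : Set a} (f : A → B → C → D) {x x′ y y′ z z′} → x ≡ x′ → y ≡ y′ → z ≡ z′ → f x y z ≡ f x′ y′ z′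
  cong₃ f refl refl refl = refl

  mating-value : ∀ {σ} v → Env σ → vars σ 4 ≡ v * m → vars (⟦ mating ⟧ ρ σ) 10 ≡ mate v (arrs σ 3)
  mating-value {σ} v e base = proj₁ (loop-sim R m next (σ ⟪ 10 ≔ 0 ⟫) 0 (refl , env-frame (set 10 0) tt e , base , refl))
    where
    body : Cmd
    body = probe 3 ⨾ ifzero 7 skip (add 10 6 0)
    R : ℕ → St → ℕ → Set
    R k s t = vars s 10 ≡ t × Env s × vars s 4 ≡ v * m × arrs s 3 ≡ arrs σ 3
    next : ∀ k s t → k < m → R k s t → R (suc k) (⟦ body ⟧ ρ (s ⟪ 6 ≔ k ⟫)) (ifz (hit (arrs σ 3) v k) t (suc k))
    next k s _ _ (refl , e , base , arr) =
      trans (ifz-map (λ τ → vars τ 10) (vars σ₁ 7)) (ifz-cong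
        (trans (probe-value {s ⟪ 6 ≔ k ⟫} 3 v (env-frame (set 6 k) tt e) base) (cong (λ U → hit U v k) arr)) refl
        (trans (cong (k +_) (one e)) (+-comm k 1))) ,
      env-frame (set 6 k ⨾ body) tt e , trans (frame-var {ρ} body 4 tt (s ⟪ 6 ≔ k ⟫)) base ,
      trans (frame-arr {ρ} body 3 tt (s ⟪ 6 ≔ k ⟫)) arr
      where
      σ₁ = ⟦ probe 3 ⟧ ρ (s ⟪ 6 ≔ k ⟫)

  -- `kinds` and `weights` concern only the vertices below v; the cells above may still hold entries
  -- of an earlier trial.
  record Matched (U : ℕ → ℕ) (v : ℕ) (s : St) : Set where
    field
      alive   : arrs s 3 ≡ unmatched U v
      weighs  : vars s 11 ≡ weight U v
      kinds   : ∀ h → h < v → arrs s 5 h ≡ kind h (unmatched U h)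
      weights : ∀ h → h < v → arrs s 6 h ≡ weight U h
      env     : Env s
      base    : vars s 4 ≡ v * m

  matching-value : ∀ {σ} → Env σ → Matched (arrs σ 3) m (⟦ matching ⟧ ρ σ)
  matching-value {σ} e = loop-inv (Matched U) m next (σ ⟪ 4 ≔ 0 ⟫ ⟪ 11 ≔ 1 ⟫) (record
    { alive = refl ; weighs = refl ; kinds = λ _ () ; weights = λ _ () ; env = env-frame (set 4 0 ⨾ set 11 1) tt e ; base = refl })
    where
    U = arrs σ 3
    next : ∀ v s → v < m → Matched U v s → Matched U (suc v) (⟦ matchCmd ⟧ ρ (s ⟪ 5 ≔ v ⟫))
    next v s v<m M = record
      { alive = trans (ifz-map (λ τ → arrs τ 3) (V′ v)) (ifz-cong Vv alive
          (trans (ifz-map (λ τ → arrs τ 3) (vars σ₃ 10)) (ifz-cong mated (trans arr₃ V₁)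
            (cong₃ (λ W x z → W [ x ↦ z ]) (trans arr₃ V₁) (cong₂ _∸_ mated (one e₃)) (nil e₃)))))
      ; weighs = trans (ifz-map (λ τ → vars τ 11) (V′ v)) (ifz-cong Vv weighs
          (trans (ifz-map (λ τ → vars τ 11) (vars σ₃ 10)) (ifz-cong mated (cong (λ w → w + w) w₃) (cong (λ w → w + w + w) w₃))))
      ; kinds = kinds′
      ; weights = weights′
      ; env = env-frame (set 5 v ⨾ matchCmd) tt env
      ; base = next-base {s ⟪ 5 ≔ v ⟫} (put 6 5 11 ⨾ put 5 5 17 ⨾ get 12 3 5 ⨾ inner) v tt tt (env-frame (set 5 v) tt env) base }
      where
      open Matched M
      inner prefix : Cmd
      inner = ifzero 12 skip (put 3 5 17 ⨾ mating ⨾ add 12 10 0 ⨾ put 5 5 12 ⨾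
        ifzero 10 (add 11 11 11) (sub 12 10 0 ⨾ put 3 12 17 ⨾ add 12 11 11 ⨾ add 11 12 11))
      prefix = set 5 v ⨾ put 6 5 11 ⨾ put 5 5 17 ⨾ get 12 3 5 ⨾ put 3 5 17
      V′ = arrs s 3
      V = unmatched U v
      σ₂ = ⟦ prefix ⟧ ρ s
      σ₃ = ⟦ mating ⟧ ρ σ₂
      e₂ : Env σ₂
      e₂ = env-frame prefix tt env
      e₃ : Env σ₃
      e₃ = env-frame mating tt e₂
      Vv : V′ v ≡ V v
      Vv = cong (λ f → f v) alive
      V₁ : V′ [ v ↦ vars s 17 ] ≡ V [ v ↦ 0 ]
      V₁ = cong₂ (λ W z → W [ v ↦ z ]) alive (nil env)
      arr₃ : arrs σ₃ 3 ≡ V′ [ v ↦ vars s 17 ]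
      arr₃ = frame-arr {ρ} mating 3 tt σ₂
      mated : vars σ₃ 10 ≡ partner v V
      mated = trans (mating-value {σ₂} v e₂ base) (cong (mate v) V₁)
      w₃ : vars σ₃ 11 ≡ weight U v
      w₃ = trans (frame-var {ρ} mating 11 tt σ₂) weighs
      final = ⟦ matchCmd ⟧ ρ (s ⟪ 5 ≔ v ⟫)
      cleared : ℕ → ℕ
      cleared = arrs s 5 [ v ↦ 0 ]
      kinds-array : arrs final 5 ≡ ifz (V v) cleared (cleared [ v ↦ suc (partner v V) ])
      kinds-array = trans (ifz-map (λ τ → arrs τ 5) (V′ v)) (ifz-cong Vv (cong (λ z → arrs s 5 [ v ↦ z ]) (nil env))
        (trans (ifz-map (λ τ → arrs τ 5) (vars σ₃ 10)) (trans (ifz-same (vars σ₃ 10))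
          (cong₃ (λ W x k → W [ x ↦ k ])
            (trans (frame-arr {ρ} mating 5 tt σ₂) (cong (λ z → arrs s 5 [ v ↦ z ]) (nil env)))
            (frame-var {ρ} mating 5 tt σ₂)
            (trans (cong₂ _+_ mated (one e₃)) (+-comm (partner v V) 1))))))
        where
        ifz-same : ∀ {A : Set} k {x : A} → ifz k x x ≡ x
        ifz-same zero    = refl
        ifz-same (suc _) = refl
      kinds′ : ∀ h → h < suc v → arrs final 5 h ≡ kind h (unmatched U h)
      kinds′ h h<1+v with m<1+n⇒m<n∨m≡n h<1+v
      ... | inj₂ refl = trans (cong (λ f → f v) kinds-array) (trans (ifz-map (λ (f : ℕ → ℕ) → f v) (V v))
              (ifz-cong refl (upd-same (arrs s 5) v 0) (upd-same cleared v (suc (partner v V)))))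
      ... | inj₁ h<v = trans (cong (λ f → f h) kinds-array) (trans (ifz-map (λ (f : ℕ → ℕ) → f h) (V v))
              (trans (ifz-both (V v) (old 0 (arrs s 5)) (trans (old (suc (partner v V)) cleared) (old 0 (arrs s 5)))) (kinds h h<v)))
        where
        old : ∀ k (f : ℕ → ℕ) → (f [ v ↦ k ]) h ≡ f h
        old k f = upd-other f k (≢-sym (<⇒≢ h<v))
        ifz-both : ∀ {A : Set} k {x y z : A} → x ≡ z → y ≡ z → ifz k x y ≡ z
        ifz-both zero    p _ = p
        ifz-both (suc _) _ q = q
      weights-array : arrs final 6 ≡ arrs s 6 [ v ↦ vars s 11 ]
      weights-array = frame-arr {ρ} (put 5 5 17 ⨾ get 12 3 5 ⨾ inner ⨾ add 4 4 19) 6 tt (⟦ set 5 v ⨾ put 6 5 11 ⟧ ρ s)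
      weights′ : ∀ h → h < suc v → arrs final 6 h ≡ weight U h
      weights′ h h<1+v with m<1+n⇒m<n∨m≡n h<1+v
      ... | inj₂ refl = trans (cong (λ f → f v) weights-array) (trans (upd-same (arrs s 6) v (vars s 11)) weighs)
      ... | inj₁ h<v  = trans (cong (λ f → f h) weights-array) (trans (upd-other (arrs s 6) (vars s 11) (≢-sym (<⇒≢ h<v))) (weights h h<v))

  digit-value : ∀ {σ} v t w → Env σ → m ∸ 1 ∸ vars σ 16 ≡ v → arrs σ 5 v ≡ t → arrs σ 6 v ≡ w →
    (arrs (⟦ digitCmd ⟧ ρ σ) 4 , vars (⟦ digitCmd ⟧ ρ σ) 2) ≡ digit v t w (arrs σ 4 , vars σ 2)
  digit-value {σ} v t w e refl refl refl = trans
      (tree-map out (arrs σ 5 x) (arrs σ 5 x ∸ vars σ 0) (arrs σ 6 x ∸ vars σ 2) (arrs σ 6 x ∸ (vars σ 2 ∸ arrs σ 6 x)))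
      (raw x≡ (one e) (nil e) refl refl)
    where
    out : St → (ℕ → ℕ) × ℕ
    out s = arrs s 4 , vars s 2
    tree-map : ∀ {S S′ : Set} (f : S → S′) k l p q {a b c d e g} →
      f (ifz k a (ifz l (ifz p b c) (ifz p (ifz q d e) g))) ≡
      ifz k (f a) (ifz l (ifz p (f b) (f c)) (ifz p (ifz q (f d) (f e)) (f g)))
    tree-map f zero    l       p       q       = refl
    tree-map f (suc _) zero    zero    q       = refl
    tree-map f (suc _) zero    (suc _) q       = refl
    tree-map f (suc _) (suc _) zero    zero    = refl
    tree-map f (suc _) (suc _) zero    (suc _) = refl
    tree-map f (suc _) (suc _) (suc _) q       = refl
    x = vars σ 19 ∸ vars σ 0 ∸ vars σ 16
    x≡ : x ≡ v
    x≡ = cong₂ (λ m o → m ∸ o ∸ vars σ 16) (wide e) (one e)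
    I = arrs σ 4
    r = vars σ 2
    raw : ∀ {x o z} → x ≡ v → o ≡ 1 → z ≡ 0 → ∀ {t w} → arrs σ 5 x ≡ t → arrs σ 6 x ≡ w →
      ifz t (I , r) (ifz (t ∸ o) (ifz (w ∸ r) (I [ x ↦ o ] , r ∸ w) (I [ x ↦ z ] , r))
        (ifz (w ∸ r) (ifz (w ∸ (r ∸ w)) ((I [ x ↦ z ]) [ t ∸ o ∸ o ↦ o ] , r ∸ w ∸ w) ((I [ x ↦ o ]) [ t ∸ o ∸ o ↦ z ] , r ∸ w))
          ((I [ x ↦ z ]) [ t ∸ o ∸ o ↦ z ] , r)))
      ≡ digit v (arrs σ 5 v) (arrs σ 6 v) (I , r)
    raw refl refl refl refl refl = refl

  decoding-value : ∀ {σ} U → Env σ →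
    (∀ h → h < m → arrs σ 5 h ≡ kind h (unmatched U h)) → (∀ h → h < m → arrs σ 6 h ≡ weight U h) →
    (arrs (⟦ decoding ⟧ ρ σ) 4 , vars (⟦ decoding ⟧ ρ σ) 2) ≡ decode U (arrs σ 4 , vars σ 2)
  decoding-value {σ} U e kinds weights = proj₁ (loop-sim R m next σ _ (refl , e , refl , refl))
    where
    R : ℕ → St → (ℕ → ℕ) × ℕ → Set
    R k s s′ = (arrs s 4 , vars s 2) ≡ s′ × Env s × arrs s 5 ≡ arrs σ 5 × arrs s 6 ≡ arrs σ 6
    next : ∀ k s s′ → k < m → R k s s′ → R (suc k) (⟦ digitCmd ⟧ ρ (s ⟪ 16 ≔ k ⟫)) (decodeAt U (m ∸ 1 ∸ k) s′)
    next k s _ k<m (refl , e , k₅ , w₆) =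
      digit-value {s ⟪ 16 ≔ k ⟫} v _ _ (env-frame (set 16 k) tt e) refl
        (trans (cong (λ f → f v) k₅) (kinds v v<m)) (trans (cong (λ f → f v) w₆) (weights v v<m)) ,
      env-frame (set 16 k ⨾ digitCmd) tt e ,
      trans (frame-arr {ρ} digitCmd 5 tt (s ⟪ 16 ≔ k ⟫)) k₅ , trans (frame-arr {ρ} digitCmd 6 tt (s ⟪ 16 ≔ k ⟫)) w₆
      where
      v = m ∸ 1 ∸ k
      v<m : v < m
      v<m = ≤-<-trans (m∸n≤m (m ∸ 1) k) (≤-reflexive (suc-pred m {{>-nonZero (≤-<-trans z≤n k<m)}}))

  checking-value : ∀ {σ} → Env σ → vars (⟦ checking ⟧ ρ σ) 14 ≡ vars σ 14 + (1 ∸ defect (arrs σ 4 , vars σ 2))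
  checking-value {σ} e = cong₂ _+_ (trans (frame-var {ρ} (set 4 0 ⨾ add 18 2 17 ⨾ for 5 1 checkCmd) 14 tt σ) refl)
    (cong₂ _∸_ (one (proj₁ (proj₂ result))) (proj₁ result))
    where
    R : ℕ → St → ℕ → Set
    R v s d = vars s 18 ≡ d × Env s × vars s 4 ≡ v * m × arrs s 4 ≡ arrs σ 4
    I = arrs σ 4
    next : ∀ v s d → v < m → R v s d → R (suc v) (⟦ checkCmd ⟧ ρ (s ⟪ 5 ≔ v ⟫)) (ifz (I v) d (d + hits I v))
    next v s _ _ (refl , e , base , arr) =
      trans (ifz-map (λ τ → vars τ 18) (arrs s 4 v)) (ifz-cong (cong (λ f → f v) arr) refl
        (cong₂ _+_ (frame-var {ρ} (degCmd 4) 18 tt σ₁) (trans (degree-value {σ₁} 4 v e₁ base) (cong (λ f → hits f v) arr)))) ,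
      env-frame (set 5 v ⨾ checkCmd) tt e ,
      next-base {s ⟪ 5 ≔ v ⟫} (get 12 4 5 ⨾ ifzero 12 skip (degCmd 4 ⨾ add 18 18 10)) v tt tt (env-frame (set 5 v) tt e) base ,
      trans (frame-arr {ρ} checkCmd 4 tt (s ⟪ 5 ≔ v ⟫)) arr
      where
      σ₁ = ⟦ set 5 v ⨾ get 12 4 5 ⟧ ρ s
      e₁ : Env σ₁
      e₁ = env-frame (set 5 v ⨾ get 12 4 5) tt e
    initial = ⟦ set 4 0 ⨾ add 18 2 17 ⟧ ρ σ
    result : R m (⟦ for 5 1 checkCmd ⟧ ρ initial) (defect (I , vars σ 2))
    result = loop-sim R m next initial (vars σ 2)
      (trans (cong (vars σ 2 +_) (nil e)) (+-identityʳ _) , env-frame (set 4 0 ⨾ add 18 2 17) tt e , refl , refl)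

  number : (ℕ → ℕ) → ℕ → ℕ
  number coins p = loopFrom 0 (ρ 3) (λ i r → r + r + coins (p + i)) 0

  drawing-value : ∀ {σ} → Env σ → vars (⟦ drawing ⟧ ρ σ) 2 ≡ number (arrs σ 1) (vars σ 13) ×
                                   vars (⟦ drawing ⟧ ρ σ) 13 ≡ vars σ 13 + ρ 3
  drawing-value {σ} e = proj₁ result , proj₁ (proj₂ result)
    where
    p = vars σ 13
    R : ℕ → St → ℕ → Set
    R i s r = vars s 2 ≡ r × vars s 13 ≡ p + i × vars s 0 ≡ 1 × arrs s 1 ≡ arrs σ 1
    result : R (ρ 3) (⟦ drawing ⟧ ρ σ) (number (arrs σ 1) p)
    result = loop-sim R (ρ 3)
      (λ { i s r _ (refl , q , o , a) → cong₂ (λ f k → vars s 2 + vars s 2 + f k) a q ,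
           trans (cong₂ _+_ q o) (trans (+-assoc p i 1) (cong (p +_) (+-comm i 1))) , o , a })
      (σ ⟪ 2 ≔ 0 ⟫) 0 (refl , sym (+-identityʳ p) , one e , refl)

  -- Only the first m cells become 1, the others keep their content. Describing this by the same
  -- loop makes the arrays equal as functions, not merely pointwise.
  revived : (ℕ → ℕ) → ℕ → ℕ
  revived = loopFrom 0 m (λ x U → U [ x ↦ 1 ])

  reviving-value : ∀ {σ} → Env σ → view (⟦ reviving ⟧ ρ σ) ≡ walk (revived (arrs σ 3)) (arrs σ 4) m (vars σ 2)
  reviving-value {σ} e = cong₃ (λ U b r → walk U (arrs (⟦ reviving ⟧ ρ σ) 4) b r)
      (proj₁ result)
      (trans (cong₂ _+_ (trans (frame-var {ρ} (for 5 1 (put 3 5 0)) 19 tt σ) (wide e)) (trans (frame-var {ρ} (for 5 1 (put 3 5 0)) 17 tt σ) (nil e)))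
        (+-identityʳ m))
      (frame-var {ρ} reviving 2 tt σ)
    ∙ cong (λ I → walk (revived (arrs σ 3)) I m (vars σ 2)) (frame-arr {ρ} reviving 4 tt σ)
    where
    infixl 4 _∙_
    _∙_ : ∀ {A : Set} {x y z : A} → x ≡ y → y ≡ z → x ≡ z
    _∙_ = trans
    R : ℕ → St → (ℕ → ℕ) → Set
    R x s U = arrs s 3 ≡ U × vars s 0 ≡ 1
    result : R m (⟦ for 5 1 (put 3 5 0) ⟧ ρ σ) (revived (arrs σ 3))
    result = loop-sim R m (λ { x s _ _ (refl , o) → cong (λ k → arrs s 3 [ x ↦ k ]) o , o }) σ (arrs σ 3) (refl , one e)

  sampled : (ℕ → ℕ) → (ℕ → ℕ) → ℕ → Walk
  sampled U I r = loopFrom 0 m branch (walk (revived U) I m r)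

  record Sampled (σ σ′ : St) (s : Walk) : Set where
    field
      env    : Env σ′
      alive  : arrs σ′ 3 ≡ unmatched (Walk.alive s) m
      chosen : arrs σ′ 4 ≡ proj₁ (finish s)
      tally  : vars σ′ 14 ≡ vars σ 14 + accept s
      coins  : arrs σ′ 1 ≡ arrs σ 1
      next   : vars σ′ 13 ≡ vars σ 13 + ρ 3

  sampling-value : ∀ {σ} → Env σ →
    Sampled σ (⟦ sampling ⟧ ρ σ) (sampled (arrs σ 3) (arrs σ 4) (number (arrs σ 1) (vars σ 13)))
  sampling-value {σ} e = record
    { env    = env-frame sampling tt e
    ; alive  = trans (frame-arr {ρ} (decoding ⨾ checking) 3 tt σ₄) (trans (Matched.alive M) (cong (λ s → unmatched (Walk.alive s) m) walked))
    ; chosen = trans (frame-arr {ρ} checking 4 tt σ₅) (cong proj₁ finished)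
    ; tally  = trans (checking-value {σ₅} e₅) (cong₂ (λ a d → a + (1 ∸ defect d))
        (frame-var {ρ} (drawing ⨾ reviving ⨾ branching ⨾ matching ⨾ decoding) 14 tt σ) finished)
    ; coins  = frame-arr {ρ} sampling 1 tt σ
    ; next   = trans (frame-var {ρ} (reviving ⨾ branching ⨾ matching ⨾ decoding ⨾ checking) 13 tt σ₁) (proj₂ drawn) }
    where
    σ₁ = ⟦ drawing ⟧ ρ σ
    σ₂ = ⟦ reviving ⟧ ρ σ₁
    σ₃ = ⟦ branching ⟧ ρ σ₂
    σ₄ = ⟦ matching ⟧ ρ σ₃
    σ₅ = ⟦ decoding ⟧ ρ σ₄
    e₁ : Env σ₁
    e₁ = env-frame drawing tt e
    e₂ : Env σ₂
    e₂ = env-frame reviving tt e₁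
    e₃ : Env σ₃
    e₃ = env-frame branching tt e₂
    e₄ : Env σ₄
    e₄ = env-frame matching tt e₃
    e₅ : Env σ₅
    e₅ = env-frame decoding tt e₄
    drawn = drawing-value {σ} e
    r = number (arrs σ 1) (vars σ 13)
    walked : view σ₃ ≡ sampled (arrs σ 3) (arrs σ 4) r
    walked = trans (branching-value {σ₂} e₂) (cong (loopFrom 0 m branch) (trans (reviving-value {σ₁} e₁)
      (cong₃ (λ U I r → walk (revived U) I m r) (frame-arr {ρ} drawing 3 tt σ) (frame-arr {ρ} drawing 4 tt σ) (proj₁ drawn))))
    M : Matched (arrs σ₃ 3) m σ₄
    M = matching-value {σ₃} e₃
    finished : (arrs σ₅ 4 , vars σ₅ 2) ≡ finish (sampled (arrs σ 3) (arrs σ 4) r)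
    finished = trans (decoding-value {σ₄} (arrs σ₃ 3) e₄ (Matched.kinds M) (Matched.weights M))
      (trans (cong₂ (λ I r → decode (arrs σ₃ 3) (I , r)) (frame-arr {ρ} matching 4 tt σ₃) (frame-var {ρ} matching 2 tt σ₃))
        (cong finish walked))

-- From coin strings to trials

loop-cong : ∀ {a} {S : Set a} k v {f g : ℕ → S → S} → (∀ i s → v ≤ i → i < v + k → f i s ≡ g i s) → ∀ s → loopFrom v k f s ≡ loopFrom v k g s
loop-cong zero    v h s = refl
loop-cong (suc k) v {f} {g} h s = trans (loop-cong k (suc v) (λ i s v<i i< → h i s (<⇒≤ v<i) (subst (i <_) (sym (+-suc v k)) i<)) (f v s))
  (cong (loopFrom (suc v) k g) (h v s ≤-refl (m<m+n v z<s)))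

loop-shift : ∀ {a} {S : Set a} k v {f : ℕ → S → S} s → loopFrom (suc v) k f s ≡ loopFrom v k (λ i → f (suc i)) s
loop-shift zero    v s = refl
loop-shift (suc k) v {f} s = loop-shift k (suc v) (f (suc v) s)

binary : ∀ N → Vec Bool N → ℕ → ℕ
binary N w = loopFrom 0 N (λ i r → r + r + at w i)

-- The strings of length N run once through all continuations of the binary prefix a. The prefix is
-- there for the induction; uniform coins thus give a uniform number.
binary-sum : ∀ N (g : ℕ → ℕ) a → sumᵇ N (λ w → g (binary N w a)) ≡ sumTo (2 ^ N) (λ j → g (a * 2 ^ N + j))
binary-sum zero    g a = cong g (sym (trans (+-identityʳ (a * 1)) (*-identityʳ a)))
binary-sum (suc N) g a = begin
  sumᵇ N (λ w → g (binary (suc N) (true ∷ w) a)) + sumᵇ N (λ w → g (binary (suc N) (false ∷ w) a))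
    ≡⟨ cong₂ _+_ (sumᵇ-cong N λ w → cong g (loop-shift N 0 (a + a + 1))) (sumᵇ-cong N λ w → cong g (loop-shift N 0 (a + a + 0))) ⟩
  sumᵇ N (λ w → g (binary N w (a + a + 1))) + sumᵇ N (λ w → g (binary N w (a + a + 0)))
    ≡⟨ cong₂ _+_ (binary-sum N g (a + a + 1)) (binary-sum N g (a + a + 0)) ⟩
  sumTo (2 ^ N) (λ j → g ((a + a + 1) * 2 ^ N + j)) + sumTo (2 ^ N) (λ j → g ((a + a + 0) * 2 ^ N + j))
    ≡⟨ +-comm (sumTo (2 ^ N) (λ j → g ((a + a + 1) * 2 ^ N + j))) _ ⟩
  sumTo (2 ^ N) (λ j → g ((a + a + 0) * 2 ^ N + j)) + sumTo (2 ^ N) (λ j → g ((a + a + 1) * 2 ^ N + j))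
    ≡⟨ cong₂ _+_ (sum-cong (2 ^ N) λ j _ → cong g (low a (2 ^ N) j)) (sum-cong (2 ^ N) λ j _ → cong g (high a (2 ^ N) j)) ⟩
  sumTo (2 ^ N) (λ j → g (a * 2 ^ suc N + j)) + sumTo (2 ^ N) (λ j → g (a * 2 ^ suc N + (2 ^ N + j)))
    ≡⟨ sym (sum-split (2 ^ N) (2 ^ N) (λ j → g (a * 2 ^ suc N + j))) ⟩
  sumTo (2 ^ N + 2 ^ N) (λ j → g (a * 2 ^ suc N + j))
    ≡⟨ cong (λ k → sumTo (2 ^ N + k) (λ j → g (a * 2 ^ suc N + j))) (sym (+-identityʳ (2 ^ N))) ⟩
  sumTo (2 ^ suc N) (λ j → g (a * 2 ^ suc N + j)) ∎
  where
  open ≡-Reasoning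
  low : ∀ a p j → (a + a + 0) * p + j ≡ a * (2 * p) + j
  low = solve-∀
  high : ∀ a p j → (a + a + 1) * p + j ≡ a * (2 * p) + (p + j)
  high = solve-∀

at-take : ∀ a {b} (ws : Vec Bool (a + b)) i → i < a → at (takeᵛ a ws) i ≡ at ws i
at-take (suc a) (w ∷ ws) zero    _         = refl
at-take (suc a) (w ∷ ws) (suc i) (s≤s i<a) = at-take a ws i i<a

at-drop : ∀ a {b} (ws : Vec Bool (a + b)) j → at (dropᵛ a ws) j ≡ at ws (a + j)
at-drop zero    ws       j = refl
at-drop (suc a) (w ∷ ws) j = at-drop a ws j

module SamplerTrials (m τ N : ℕ) (A : ℕ → ℕ → ℕ) (B : ℕ → ℕ) {n d : ℕ}
    (gr : IsGraph m A) (m≡ : m ≡ 2 * n) (regular : ∀ x → x < m → sumTo m (A x) ≡ d)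
    (1≤d : 1 ≤ d) (τ≤d : 6 * τ ≤ d) (B-least : ∀ b → b ≤ m → 2 ^ n ≤ B b)
    (B-suc : ∀ b → b < m → B (suc b) ≡ B b + B (b ∸ τ)) (B≤ : B m ≤ 2 ^ N) where

  open Sampler m τ A B

  revive : (ℕ → ℕ) → ℕ → ℕ
  revive = loopFrom 0 m (λ x U → U [ x ↦ 1 ])

  bits-ifz : ∀ k {U V} → Bits U → Bits V → Bits (ifz k U V)
  bits-ifz zero    u v = u
  bits-ifz (suc _) u v = v

  revive-bits : ∀ U → Bits U → Bits (revive U)
  revive-bits U b = loop-inv (λ _ → Bits) m (λ v U _ → bits-upd v ≤-refl) U b

  revive-one : ∀ U x → x < m → revive U x ≡ 1
  revive-one U = loop-inv (λ v V → ∀ x → x < v → V x ≡ 1) m next U (λ _ ())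
    where
    next : ∀ v V → v < m → (∀ x → x < v → V x ≡ 1) → ∀ x → x < suc v → (V [ v ↦ 1 ]) x ≡ 1
    next v V _ h x x<1+v with v ≟ x
    ... | yes refl = upd-same V v 1
    ... | no v≢x with m<1+n⇒m<n∨m≡n x<1+v
    ... | inj₁ x<v  = trans (upd-other V 1 v≢x) (h x x<v)
    ... | inj₂ refl = ⊥-elim (v≢x refl)

  unmatched-bits : ∀ U v → Bits U → Bits (unmatched U v)
  unmatched-bits U zero    b = b
  unmatched-bits U (suc v) b = bits-ifz (V v) V-bits (bits-ifz (partner v V) V₁-bits (bits-upd (partner v V ∸ 1) z≤n V₁-bits))
    where
    V = unmatched U v
    V-bits = unmatched-bits U v b
    V₁-bits = bits-upd v z≤n V-bits

  BitsWalk : Walk → Set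
  BitsWalk s = Bits (Walk.alive s) × Bits (Walk.chosen s)

  walk-ifz : ∀ k {s t} → BitsWalk s → BitsWalk t → BitsWalk (ifz k s t)
  walk-ifz zero    p q = p
  walk-ifz (suc _) p q = q

  branch-bits : ∀ v s → BitsWalk s → BitsWalk (branch v s)
  branch-bits v s@(walk U I b r) (bU , bI) = walk-ifz (U v) (bU , bI) (walk-ifz (τ ∸ hits U v)
      (walk-ifz (B (b ∸ 1) ∸ r) (loop-inv (λ _ p → Bits (proj₁ p) × Bits (proj₂ p)) m next _ (bits-upd v z≤n bU , bits-upd v ≤-refl bI))
        (bits-upd v z≤n bU , bits-upd v z≤n bI))
      (bU , bI))
    where
    next : ∀ y p → y < m → Bits (proj₁ p) × Bits (proj₂ p) → Bits (proj₁ (killStep v y p)) × Bits (proj₂ (killStep v y p))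
    next y (V , K) _ (bV , bK) with hit V v y
    ... | zero  = bV , bK
    ... | suc _ = bits-upd y z≤n bV , bits-upd y z≤n bK

  digit-bits : ∀ v t w s → Bits (proj₁ s) → Bits (proj₁ (digit v t w s))
  digit-bits v zero          w s       b = b
  digit-bits v (suc zero)    w (I , r) b with w ∸ r
  ... | zero  = bits-upd v ≤-refl b
  ... | suc _ = bits-upd v z≤n b
  digit-bits v (suc (suc t)) w (I , r) b with w ∸ r | w ∸ (r ∸ w)
  ... | zero  | zero  = bits-upd t ≤-refl (bits-upd v z≤n b)
  ... | zero  | suc _ = bits-upd t z≤n (bits-upd v ≤-refl b)
  ... | suc _ | _     = bits-upd t z≤n (bits-upd v z≤n b)

  finish-bits : ∀ s → Bits (Walk.chosen s) → Bits (proj₁ (finish s))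
  finish-bits (walk U I b r) bI = loop-inv (λ _ p → Bits (proj₁ p)) m next (I , r) bI
    where
    next : ∀ k p → k < m → Bits (proj₁ p) → Bits (proj₁ (decodeAt U (m ∸ 1 ∸ k) p))
    next k p _ = digit-bits v (kind v (unmatched U v)) (weight U v) p
      where v = m ∸ 1 ∸ k

  sample : (ℕ → ℕ) × (ℕ → ℕ) → Vec Bool N → Walk
  sample (U , I) w = loopFrom 0 m branch (walk (revive U) I m (binary N w 0))

  -- A state is the pair of arrays left by the previous trial. Reviving all vertices makes the
  -- acceptance count the same from every state of bits.
  trials : Trials N (isets m A)
  trials = record
    { State    = (ℕ → ℕ) × (ℕ → ℕ)
    ; Good     = λ s → Bits (proj₁ s) × Bits (proj₂ s)
    ; next     = λ s w → unmatched (Walk.alive (sample s w)) m , proj₁ (finish (sample s w))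
    ; accepted = λ s w → accept (sample s w)
    ; good     = λ s w g → let bU , bI = sample-bits s w g in
                   unmatched-bits (Walk.alive (sample s w)) m bU ,
                   finish-bits (sample s w) bI
    ; zero-one = λ s w _ → m∸n≤m 1 (defect (finish (sample s w)))
    ; total    = λ { (U , I) (bU , bI) → trans
        (binary-sum N (λ r → accept (loopFrom 0 m branch (walk (revive U) I m r))) 0)
        (Acceptance.trial-count m τ A B {n} gr m≡ regular 1≤d τ≤d B-least B-suc
          (revive U) I (revive-bits U bU) bI (revive-one U) (2 ^ N) B≤) }
    }
    where
    sample-bits : ∀ s w → Bits (proj₁ s) × Bits (proj₂ s) → BitsWalk (sample s w)
    sample-bits (U , I) w (bU , bI) = loop-inv (λ _ → BitsWalk) m (λ v s _ → branch-bits v s) _ (revive-bits U bU , bI)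

module Estimation (ρ : ℕ → ℕ) (c B : ℕ → ℕ) (τ : ℕ) {n d : ℕ}
    (gr : IsGraph (ρ 1) (λ x y → c (x * ρ 1 + y))) (m≡ : ρ 1 ≡ 2 * n)
    (regular : ∀ x → x < ρ 1 → sumTo (ρ 1) (λ y → c (x * ρ 1 + y)) ≡ d)
    (1≤d : 1 ≤ d) (τ≤d : 6 * τ ≤ d) (B-least : ∀ b → b ≤ ρ 1 → 2 ^ n ≤ B b)
    (B-suc : ∀ b → b < ρ 1 → B (suc b) ≡ B b + B (b ∸ τ)) (B≤ : B (ρ 1) ≤ 2 ^ ρ 3) where

  open Simulation ρ c B τ
  open SamplerTrials (ρ 1) τ (ρ 3) A B {n} gr m≡ regular 1≤d τ≤d B-least B-suc B≤ public
  open Trials trials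
  open Chebyshev trials public

  arrays : St → (ℕ → ℕ) × (ℕ → ℕ)
  arrays σ = arrs σ 3 , arrs σ 4

  number-binary : ∀ coins p k (ws : Vec Bool (ρ 3 + k)) → (∀ j → coins (p + j) ≡ at ws j) →
                  number coins p ≡ binary (ρ 3) (takeᵛ (ρ 3) ws) 0
  number-binary coins p k ws h = loop-cong (ρ 3) 0
    (λ i r _ i<N → cong (r + r +_) (trans (h i) (sym (at-take (ρ 3) ws i i<N)))) 0

  tally : ∀ k v σ (ws : Vec Bool (k * ρ 3)) → Env σ → (∀ j → arrs σ 1 (vars σ 13 + j) ≡ at ws j) →
          let σ′ = loopFrom v k (λ v τ → ⟦ sampling ⟧ ρ (τ ⟪ 15 ≔ v ⟫)) σ in
          vars σ′ 14 ≡ vars σ 14 + score k (arrays σ) ws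
  tally zero    v σ ws e h = sym (+-identityʳ _)
  tally (suc k) v σ ws e h = trans (tally k (suc v) σ₁ (dropᵛ (ρ 3) ws) env rest)
      (trans (cong₂ _+_ (trans Sa.tally (cong (λ r → vars σ 14 + accept′ r) read))
        (cong (λ s → score k s (dropᵛ (ρ 3) ws)) (cong₂ _,_ (trans Sa.alive (cong alive′ read)) (trans Sa.chosen (cong chosen′ read)))))
        (+-assoc (vars σ 14) _ _))
    where
    open Sampler (ρ 1) τ A B
    σ₀ = σ ⟪ 15 ≔ v ⟫
    σ₁ = ⟦ sampling ⟧ ρ σ₀
    S = sampling-value {σ₀} (env-frame (set 15 v) tt e)
    module Sa = Sampled S
    open Sampled S using (env)
    read : number (arrs σ 1) (vars σ 13) ≡ binary (ρ 3) (takeᵛ (ρ 3) ws) 0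
    read = number-binary (arrs σ 1) (vars σ 13) (k * ρ 3) ws h
    accept′ : ℕ → ℕ
    accept′ r = accept (sampled (arrs σ 3) (arrs σ 4) r)
    alive′ chosen′ : ℕ → ℕ → ℕ
    alive′ r = unmatched (Walk.alive (sampled (arrs σ 3) (arrs σ 4) r)) (ρ 1)
    chosen′ r = proj₁ (finish (sampled (arrs σ 3) (arrs σ 4) r))
    rest : ∀ j → arrs σ₁ 1 (vars σ₁ 13 + j) ≡ at (dropᵛ (ρ 3) ws) j
    rest j = trans (cong₂ (λ f p → f (p + j)) Sa.coins Sa.next) (trans (cong (arrs σ 1) (+-assoc (vars σ 13) (ρ 3) j))
      (trans (h (ρ 3 + j)) (sym (at-drop (ρ 3) ws j))))

  estimating-value : ∀ σ (ws : Vec Bool (ρ 4 * ρ 3)) → vars σ 1 ≡ τ → arrs σ 0 ≡ c → arrs σ 2 ≡ B →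
    (∀ j → arrs σ 1 j ≡ at ws j) → vars (⟦ estimating ⟧ ρ σ) 14 ≡ score (ρ 4) (arrays σ) ws * 2 ^ ρ 3
  estimating-value σ ws thr mat tab h = trans (loop-inv (λ k s → vars s 14 ≡ vars σ₂ 14 * 2 ^ k) (ρ 3)
      (λ k s _ eq → trans (cong (λ x → x + x) eq) (double (vars σ₂ 14) (2 ^ k))) σ₂ (sym (*-identityʳ _)))
    (cong (_* 2 ^ ρ 3) (tally (ρ 4) 0 σ₁ ws (record { one = refl ; nil = refl ; wide = refl ; thr = thr ; mat = mat ; tab = tab }) h))
    where
    σ₁ = ⟦ set 0 1 ⨾ set 17 0 ⨾ par 19 1 ⨾ set 13 0 ⨾ set 14 0 ⟧ ρ σ
    σ₂ = ⟦ for 15 4 sampling ⟧ ρ σ₁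
    double : ∀ x p → x * p + x * p ≡ x * (2 * p)
    double = solve-∀

-- Growth of the table of path counts

module Table {B : ℕ → ℕ} {τ m P : ℕ} (B-zero : B 0 ≡ P) (B-suc : ∀ b → b < m → B (suc b) ≡ B b + B (b ∸ τ)) where

  B-step : ∀ {b} → b < m → B b ≤ B (suc b)
  B-step {b} b<m = ≤-trans (m≤m+n (B b) _) (≤-reflexive (sym (B-suc b b<m)))

  B-mono : ∀ {a} k → k + a ≤ m → B a ≤ B (k + a)
  B-mono zero    _    = ≤-refl
  B-mono (suc k) k+a≤ = ≤-trans (B-mono k (<⇒≤ k+a≤)) (B-step k+a≤)

  B-mono-≤ : ∀ {a b} → a ≤ b → b ≤ m → B a ≤ B b
  B-mono-≤ {a} {b} a≤b b≤m = subst (λ k → B a ≤ B k) (m∸n+n≡m a≤b) (B-mono (b ∸ a) (subst (_≤ m) (sym (m∸n+n≡m a≤b)) b≤m))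

  B-least : ∀ b → b ≤ m → P ≤ B b
  B-least b b≤m = subst (_≤ B b) B-zero (B-mono-≤ z≤n b≤m)

  B-exponential : ∀ b → b ≤ m → B b ≤ P * 2 ^ b
  B-exponential zero    _   = ≤-reflexive (trans B-zero (sym (*-identityʳ P)))
  B-exponential (suc b) b<m = begin
    B (suc b) ≡⟨ B-suc b b<m ⟩
    B b + B (b ∸ τ) ≤⟨ +-monoʳ-≤ (B b) (B-mono-≤ (m∸n≤m b τ) (<⇒≤ b<m)) ⟩
    B b + B b ≤⟨ +-mono-≤ (B-exponential b (<⇒≤ b<m)) (B-exponential b (<⇒≤ b<m)) ⟩
    P * 2 ^ b + P * 2 ^ b ≡⟨ double P (2 ^ b) ⟩
    P * 2 ^ suc b ∎
    where
    open ≤-Reasoning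
    double : ∀ p x → p * x + p * x ≡ p * (2 * x)
    double = solve-∀

  -- A choice uses up τ + 1 of the budget, so j bounds the number of choices on a path. Unrolling
  -- the recursion along b adds at most m terms, each bounded for j - 1 choices, and 1 + m (m + 1) ^
  -- (j - 1) ≤ (m + 1) ^ j.
  B-polynomial : ∀ j b → b ≤ m → b ≤ j * suc τ → B b ≤ P * suc m ^ j
  B-polynomial zero    zero    _   _    = ≤-reflexive (trans B-zero (sym (*-identityʳ P)))
  B-polynomial (suc j) b₀      b≤m b≤jτ = ≤-trans (go b₀ b≤m b≤jτ) (*-monoʳ-≤ P (begin
      1 + b₀ * M ≤⟨ +-mono-≤ (m^n>0 (suc m) j) (*-monoˡ-≤ M b≤m) ⟩
      M + m * M ∎))
    where
    open ≤-Reasoning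
    M = suc m ^ j
    go : ∀ b → b ≤ m → b ≤ suc j * suc τ → B b ≤ P * (1 + b * M)
    go zero    _   _  = ≤-reflexive (trans B-zero (sym (*-identityʳ P)))
    go (suc b) b<m b≤ = begin
      B (suc b) ≡⟨ B-suc b b<m ⟩
      B b + B (b ∸ τ) ≤⟨ +-mono-≤ (go b (<⇒≤ b<m) (<⇒≤ b≤)) (B-polynomial j (b ∸ τ) (≤-trans (m∸n≤m b τ) (<⇒≤ b<m)) earlier) ⟩
      P * (1 + b * M) + P * M ≡⟨ collect P b M ⟩
      P * (1 + suc b * M) ∎
      where
      collect : ∀ P b M → P * (1 + b * M) + P * M ≡ P * (1 + suc b * M)
      collect = solve-∀
      earlier : b ∸ τ ≤ j * suc τ
      earlier = subst (b ∸ τ ≤_) (m+n∸m≡n τ (j * suc τ)) (∸-monoˡ-≤ τ (s≤s⁻¹ b≤))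

-- Preparation of the threshold, the table and the number of trials

-- Quotients, powers and products are loops of additions and subtractions, run for a fixed number of
-- rounds and idling once finished. `scaling` doubles 2 ^ n until it covers B m and along the way
-- doubles the number of trials, initially 4 e², and counts the bits N.
constants mirroring powering tabulating squaring scaling counting : Cmd
dividing preparing : ℕ → Cmd
constants  = set 0 1 ⨾ set 17 0 ⨾ par 19 1
mirroring  = set 4 0 ⨾ for 5 1 (get 7 0 4 ⨾ put 0 5 7 ⨾ add 4 4 19) ⨾ put 0 17 17
dividing L = par 20 0 ⨾ set 1 0 ⨾ set 21 (suc L) ⨾ set 22 L ⨾
  for 6 0 (sub 7 20 22 ⨾ ifzero 7 skip (sub 20 20 21 ⨾ add 1 1 0))
powering   = set 20 1 ⨾ for 6 0 (add 20 20 20)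
tabulating = put 2 17 20 ⨾ for 6 1 (get 7 2 6 ⨾ sub 8 6 1 ⨾ get 8 2 8 ⨾ add 7 7 8 ⨾ add 9 6 0 ⨾ put 2 9 7)
squaring   = set 23 0 ⨾ par 24 2 ⨾ for 6 2 (add 23 23 24) ⨾ add 23 23 23 ⨾ add 23 23 23
scaling    = get 25 2 19 ⨾ par 26 0 ⨾
  for 6 1 (sub 7 25 20 ⨾ ifzero 7 skip (add 20 20 20 ⨾ add 23 23 23 ⨾ add 26 26 0))
counting   = set 27 0 ⨾ par 28 3 ⨾ for 6 4 (add 27 27 28)
preparing L = constants ⨾ mirroring ⨾ dividing L ⨾ powering ⨾ tabulating ⨾ squaring ⨾ scaling

module Preparation (ρ : ℕ → ℕ) (L : ℕ) where

  n m e : ℕ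
  n = ρ 0
  m = ρ 1
  e = ρ 2

  -- The first row, overwritten by the registers, is recovered from the first column.
  mirroring-value : ∀ σ → 1 ≤ m → vars σ 17 ≡ 0 → vars σ 19 ≡ m →
    let a = arrs (⟦ mirroring ⟧ ρ σ) 0 in
    a 0 ≡ 0 × (∀ y → 1 ≤ y → y < m → a y ≡ arrs σ 0 (y * m)) × (∀ k → m ≤ k → a k ≡ arrs σ 0 k)
  mirroring-value σ 1≤m nil wide = first , row , rest
    where
    a₀ = arrs σ 0
    body : Cmd
    body = get 7 0 4 ⨾ put 0 5 7 ⨾ add 4 4 19
    R : ℕ → St → Set
    R u s = vars s 4 ≡ u * m × vars s 19 ≡ m × vars s 17 ≡ 0 ×
            (∀ y → 1 ≤ y → y < u → arrs s 0 y ≡ a₀ (y * m)) × (∀ k → m ≤ k → arrs s 0 k ≡ a₀ k)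
    next : ∀ u s → u < m → R u s → R (suc u) (⟦ body ⟧ ρ (s ⟪ 5 ≔ u ⟫))
    next u s u<m (base , wide , nil , done , high) =
      trans (cong₂ _+_ base wide) (+-comm (u * m) m) , wide , nil , done′ ,
      λ k m≤k → trans (upd-other (arrs s 0) _ (<⇒≢ (<-≤-trans u<m m≤k))) (high k m≤k)
      where
      done′ : ∀ y → 1 ≤ y → y < suc u → (arrs s 0 [ u ↦ arrs s 0 (vars s 4) ]) y ≡ a₀ (y * m)
      done′ y 1≤y y<1+u with m<1+n⇒m<n∨m≡n y<1+u
      ... | inj₁ y<u  = trans (upd-other (arrs s 0) _ (≢-sym (<⇒≢ y<u))) (done y 1≤y y<u)
      ... | inj₂ refl = trans (upd-same (arrs s 0) u _) (trans (cong (arrs s 0) base)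
              (high (u * m) (subst (_≤ u * m) (*-identityˡ m) (*-monoˡ-≤ m 1≤y))))
    σ₁ = ⟦ set 4 0 ⨾ for 5 1 body ⟧ ρ σ
    inv : R m σ₁
    inv = loop-inv R m next (σ ⟪ 4 ≔ 0 ⟫) (refl , wide , nil , (λ _ _ ()) , λ _ _ → refl)
    z : vars σ₁ 17 ≡ 0
    z = proj₁ (proj₂ (proj₂ inv))
    first : (arrs σ₁ 0 [ vars σ₁ 17 ↦ vars σ₁ 17 ]) 0 ≡ 0
    first = trans (cong (λ i → (arrs σ₁ 0 [ i ↦ i ]) 0) z) refl
    skip-zero : ∀ k → 1 ≤ k → (arrs σ₁ 0 [ vars σ₁ 17 ↦ vars σ₁ 17 ]) k ≡ arrs σ₁ 0 k
    skip-zero k 1≤k = upd-other (arrs σ₁ 0) _ (λ eq → <⇒≢ 1≤k (trans (sym z) eq))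
    row : ∀ y → 1 ≤ y → y < m → (arrs σ₁ 0 [ vars σ₁ 17 ↦ vars σ₁ 17 ]) y ≡ a₀ (y * m)
    row y 1≤y y<m = trans (skip-zero y 1≤y) (proj₁ (proj₂ (proj₂ (proj₂ inv))) y 1≤y y<m)
    rest : ∀ k → m ≤ k → (arrs σ₁ 0 [ vars σ₁ 17 ↦ vars σ₁ 17 ]) k ≡ a₀ k
    rest k m≤k = trans (skip-zero k (≤-trans 1≤m m≤k)) (proj₂ (proj₂ (proj₂ (proj₂ inv))) k m≤k)

  dividing-value : ∀ σ → vars σ 0 ≡ 1 → let τ = vars (⟦ dividing L ⟧ ρ σ) 1 in
                   suc L * τ ≤ n × n < suc L * suc τ
  dividing-value σ one = conclude {⟦ dividing L ⟧ ρ σ} inv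
    where
    body : Cmd
    body = sub 7 20 22 ⨾ ifzero 7 skip (sub 20 20 21 ⨾ add 1 1 0)
    R : ℕ → St → Set
    -- Either the remainder is already small, or every round so far has subtracted. After n rounds
    -- the latter means quotient n, which satisfies the upper bound as well.
    R k s = vars s 20 + suc L * vars s 1 ≡ n × (vars s 20 ≤ L ⊎ vars s 1 ≡ k) ×
            vars s 0 ≡ 1 × vars s 21 ≡ suc L × vars s 22 ≡ L
    next : ∀ k s → k < n → R k s → R (suc k) (⟦ body ⟧ ρ (s ⟪ 6 ≔ k ⟫))
    next k s _ (total , small , one , d , d-1) with vars s 20 ∸ vars s 22 in eq
    ... | zero  = total , inj₁ (≤-trans (m∸n≡0⇒m≤n eq) (≤-reflexive d-1)) , one , d , d-1
    ... | suc j = trans (cong₂ (λ d o → vars s 20 ∸ d + suc L * (vars s 1 + o)) d one) (trans fewer total) ,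
                  inj₂ (trans (cong₂ _+_ (known small) one) (+-comm k 1)) , one , d , d-1
      where
      L<x : L < vars s 20
      L<x = subst (_< vars s 20) d-1 (m∸n≢0⇒n<m λ z → 0≢1+n (trans (sym z) eq))
      known : vars s 20 ≤ L ⊎ vars s 1 ≡ k → vars s 1 ≡ k
      known (inj₁ x≤L) = ⊥-elim (<⇒≱ L<x x≤L)
      known (inj₂ t≡k) = t≡k
      fewer : vars s 20 ∸ suc L + suc L * (vars s 1 + 1) ≡ vars s 20 + suc L * vars s 1
      fewer = trans (arith (vars s 20 ∸ suc L) (suc L) (vars s 1)) (cong (_+ suc L * vars s 1) (m∸n+n≡m L<x))
        where
        arith : ∀ x d t → x + d * (t + 1) ≡ x + d + d * t
        arith = solve-∀
    inv : R n (⟦ dividing L ⟧ ρ σ)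
    inv = loop-inv R n next (⟦ par 20 0 ⨾ set 1 0 ⨾ set 21 (suc L) ⨾ set 22 L ⟧ ρ σ)
      (trans (cong (n +_) (*-zeroʳ L)) (+-identityʳ n) , inj₂ refl , one , refl , refl)
    conclude : ∀ {s} → R n s → suc L * vars s 1 ≤ n × n < suc L * suc (vars s 1)
    conclude {s} (total , small , _) = ≤-trans (m≤n+m (suc L * vars s 1) (vars s 20)) (≤-reflexive total) , bound small
      where
      bound : vars s 20 ≤ L ⊎ vars s 1 ≡ n → n < suc L * suc (vars s 1)
      bound (inj₁ x≤L) = subst₂ _<_ total (sym (*-suc (suc L) (vars s 1))) (+-monoˡ-< (suc L * vars s 1) (s≤s x≤L))
      bound (inj₂ t≡n) = subst (λ t → n < suc L * suc t) (sym t≡n) (m≤m+n (suc n) (L * suc n))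

  powering-value : ∀ σ → vars (⟦ powering ⟧ ρ σ) 20 ≡ 2 ^ n
  powering-value σ = loop-inv (λ k s → vars s 20 ≡ 2 ^ k) n
    (λ k s _ eq → cong₂ _+_ eq (trans eq (sym (+-identityʳ (2 ^ k))))) (σ ⟪ 20 ≔ 1 ⟫) refl

  tabulating-value : ∀ σ → vars σ 0 ≡ 1 → vars σ 17 ≡ 0 →
    let B = arrs (⟦ tabulating ⟧ ρ σ) 2 in
    B 0 ≡ vars σ 20 × (∀ b → b < m → B (suc b) ≡ B b + B (b ∸ vars σ 1))
  tabulating-value σ one nil = let (z , s , _) = inv in z , s
    where
    τ = vars σ 1
    body : Cmd
    body = get 7 2 6 ⨾ sub 8 6 1 ⨾ get 8 2 8 ⨾ add 7 7 8 ⨾ add 9 6 0 ⨾ put 2 9 7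
    R : ℕ → St → Set
    R k s = arrs s 2 0 ≡ vars σ 20 × (∀ b → b < k → arrs s 2 (suc b) ≡ arrs s 2 b + arrs s 2 (b ∸ τ)) ×
            vars s 1 ≡ τ × vars s 0 ≡ 1
    next : ∀ k s → k < m → R k s → R (suc k) (⟦ body ⟧ ρ (s ⟪ 6 ≔ k ⟫))
    next k s _ (z , rec , thr , one) = trans (old z≤n) z , rec′ , thr , one
      where
      new : ℕ
      new = arrs s 2 k + arrs s 2 (k ∸ vars s 1)
      B′ : ℕ → ℕ
      B′ = arrs s 2 [ k + vars s 0 ↦ new ]
      place : k + vars s 0 ≡ suc k
      place = trans (cong (k +_) one) (+-comm k 1)
      old : ∀ {b} → b ≤ k → B′ b ≡ arrs s 2 b
      old b≤k = upd-other (arrs s 2) new (λ eq → <⇒≢ (s≤s b≤k) (trans (sym eq) place))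
      rec′ : ∀ b → b < suc k → B′ (suc b) ≡ B′ b + B′ (b ∸ τ)
      rec′ b b<1+k with m<1+n⇒m<n∨m≡n b<1+k
      ... | inj₁ b<k  = trans (old b<k) (trans (rec b b<k) (sym (cong₂ _+_ (old (<⇒≤ b<k)) (old (≤-trans (m∸n≤m b τ) (<⇒≤ b<k))))))
      ... | inj₂ refl = trans (cong (λ i → (arrs s 2 [ i ↦ new ]) (suc b)) place) (trans (upd-same (arrs s 2) (suc b) new)
              (trans (cong (λ t → arrs s 2 b + arrs s 2 (b ∸ t)) thr) (sym (cong₂ _+_ (old ≤-refl) (old (m∸n≤m b τ))))))
    inv : R m (⟦ tabulating ⟧ ρ σ)
    inv = loop-inv R m next (⟦ put 2 17 20 ⟧ ρ σ)
      (trans (cong (λ i → (arrs σ 2 [ i ↦ vars σ 20 ]) 0) nil) refl , (λ _ ()) , refl , one)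

  squaring-value : ∀ σ → vars (⟦ squaring ⟧ ρ σ) 23 ≡ 4 * (e * e)
  squaring-value σ = trans (cong (λ x → x + x + (x + x)) (proj₁ inv)) (quad (e * e))
    where
    inv : vars (⟦ set 23 0 ⨾ par 24 2 ⨾ for 6 2 (add 23 23 24) ⟧ ρ σ) 23 ≡ e * e × _
    inv = loop-inv (λ k s → vars s 23 ≡ k * e × vars s 24 ≡ e) e
      (λ { k s _ (eq , w) → trans (cong₂ _+_ eq w) (+-comm (k * e) e) , w }) (⟦ set 23 0 ⨾ par 24 2 ⟧ ρ σ) (refl , refl)
    quad : ∀ x → x + x + (x + x) ≡ 4 * x
    quad = solve-∀

  -- `enough` allows for a loop that has doubled in every round and is still short. `tight` holds
  -- because a doubling happens only below t; it keeps the number of trials polynomial.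
  record Scaled (P S t : ℕ) (k : ℕ) (s : St) : Set where
    field
      ℓ       : ℕ
      power   : vars s 20 ≡ P * 2 ^ ℓ
      samples : vars s 23 ≡ S * 2 ^ ℓ
      length′ : vars s 26 ≡ n + ℓ
      enough  : t ≤ P * 2 ^ ℓ ⊎ ℓ ≡ k
      tight   : P * 2 ^ ℓ ≤ 2 * t
      ℓ≤      : ℓ ≤ k

  scaling-value : ∀ σ → vars σ 0 ≡ 1 → vars σ 19 ≡ m → vars σ 20 ≤ arrs σ 2 m →
    Scaled (vars σ 20) (vars σ 23) (arrs σ 2 m) m (⟦ scaling ⟧ ρ σ)
  scaling-value σ one wide P≤t = proj₁ inv
    where
    P = vars σ 20
    S = vars σ 23
    t = arrs σ 2 m
    body : Cmd
    body = sub 7 25 20 ⨾ ifzero 7 skip (add 20 20 20 ⨾ add 23 23 23 ⨾ add 26 26 0)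
    R : ℕ → St → Set
    R k s = Scaled P S t k s × vars s 25 ≡ t × vars s 0 ≡ 1
    double : ∀ a b → a * b + a * b ≡ a * (2 * b)
    double = solve-∀
    next : ∀ k s → k < m → R k s → R (suc k) (⟦ body ⟧ ρ (s ⟪ 6 ≔ k ⟫))
    next k s _ (Z , goal , one) with vars s 25 ∸ vars s 20 in eq
    ... | zero  = record { ℓ = ℓ ; power = power ; samples = samples ; length′ = length′ ; tight = tight ; ℓ≤ = m≤n⇒m≤1+n ℓ≤
                         ; enough = inj₁ (subst₂ _≤_ goal power (m∸n≡0⇒m≤n eq)) } , goal , one
      where open Scaled Z
    ... | suc j = record
      { ℓ = suc ℓ
      ; power = trans (cong (λ x → x + x) power) (double P (2 ^ ℓ))
      ; samples = trans (cong (λ x → x + x) samples) (double S (2 ^ ℓ))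
      ; length′ = trans (cong₂ _+_ length′ one) (trans (+-assoc n ℓ 1) (cong (n +_) (+-comm ℓ 1)))
      ; enough = inj₂ (cong suc (known enough))
      ; tight = ≤-trans (≤-reflexive (trans (sym (double P (2 ^ ℓ))) (cong (P * 2 ^ ℓ +_) (sym (+-identityʳ _))))) (*-monoʳ-≤ 2 (<⇒≤ below))
      ; ℓ≤ = s≤s ℓ≤ } , goal , one
      where
      open Scaled Z
      below : P * 2 ^ ℓ < t
      below = subst₂ _<_ power goal (m∸n≢0⇒n<m λ z → 0≢1+n (trans (sym z) eq))
      known : t ≤ P * 2 ^ ℓ ⊎ ℓ ≡ k → ℓ ≡ k
      known (inj₁ t≤) = ⊥-elim (<⇒≱ below t≤)
      known (inj₂ ℓ≡) = ℓ≡
    inv : R m (⟦ scaling ⟧ ρ σ)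
    inv = loop-inv R m next (⟦ get 25 2 19 ⨾ par 26 0 ⟧ ρ σ) (record
      { ℓ = 0 ; power = sym (*-identityʳ P) ; samples = sym (*-identityʳ S) ; length′ = sym (+-identityʳ n) ; enough = inj₂ refl
      ; tight = ≤-trans (≤-reflexive (*-identityʳ P)) (≤-trans P≤t (m≤m+n t _)) ; ℓ≤ = z≤n } , cong (arrs σ 2) wide , one)

  counting-value : ∀ σ → vars (⟦ counting ⟧ ρ σ) 27 ≡ ρ 4 * ρ 3
  counting-value σ = proj₁ {B = λ _ → _} (loop-inv (λ k s → vars s 27 ≡ k * ρ 3 × vars s 28 ≡ ρ 3) (ρ 4)
      (λ { k s _ (eq , w) → trans (cong₂ _+_ eq w) (+-comm (k * ρ 3) (ρ 3)) , w }) (⟦ set 27 0 ⨾ par 28 3 ⟧ ρ σ) (refl , refl))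

  record Prepared (σ σ′ : St) : Set where
    field
      τ-upper  : suc L * vars σ′ 1 ≤ n
      τ-lower  : n < suc L * suc (vars σ′ 1)
      first    : arrs σ′ 0 0 ≡ 0
      top      : ∀ y → 1 ≤ y → y < m → arrs σ′ 0 y ≡ arrs σ 0 (y * m)
      lower    : ∀ k → m ≤ k → arrs σ′ 0 k ≡ arrs σ 0 k
      B-zero   : arrs σ′ 2 0 ≡ 2 ^ n
      B-suc    : ∀ b → b < m → arrs σ′ 2 (suc b) ≡ arrs σ′ 2 b + arrs σ′ 2 (b ∸ vars σ′ 1)
      scaled   : Scaled (2 ^ n) (4 * (e * e)) (arrs σ′ 2 m) m σ′

  prepared : ∀ σ → 1 ≤ m → Prepared σ (⟦ preparing L ⟧ ρ σ)
  prepared σ 1≤m = record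
    { τ-upper = subst (λ t → suc L * t ≤ n) (sym τ≡) (proj₁ divided)
    ; τ-lower = subst (λ t → n < suc L * suc t) (sym τ≡) (proj₂ divided)
    ; first = trans (cong (λ f → f 0) matrix) (proj₁ mirrored)
    ; top = λ y 1≤y y<m → trans (cong (λ f → f y) matrix) (proj₁ (proj₂ mirrored) y 1≤y y<m)
    ; lower = λ k m≤k → trans (cong (λ f → f k) matrix) (proj₂ (proj₂ mirrored) k m≤k)
    ; B-zero = trans (cong (λ f → f 0) table) (trans (proj₁ tabled) P≡)
    ; B-suc = λ b b<m → subst₂ (λ B t → B (suc b) ≡ B b + B (b ∸ t)) (sym table) (sym (late 1 tt)) (proj₂ tabled b b<m)
    ; scaled = subst (λ B → Scaled (2 ^ n) (4 * (e * e)) (B m) m σ₇) (sym table)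
        (subst₂ (λ P S → Scaled P S (arrs σ₅ 2 m) m σ₇) P₆ (squaring-value σ₅)
          (subst (λ B → Scaled (vars σ₆ 20) (vars σ₆ 23) (B m) m σ₇) table₆
            (scaling-value σ₆ (frame-var {ρ} (mirroring ⨾ dividing L ⨾ powering ⨾ tabulating ⨾ squaring) 0 tt σ₁)
              (frame-var {ρ} (mirroring ⨾ dividing L ⨾ powering ⨾ tabulating ⨾ squaring) 19 tt σ₁)
              (subst₂ (λ P B → P ≤ B m) (sym P₆) (sym table₆) (Table.B-least {arrs σ₅ 2} {vars σ₄ 1} (trans (proj₁ tabled) P≡) (proj₂ tabled) m ≤-refl))))) }
    where
    σ₁ = ⟦ constants ⟧ ρ σ
    σ₂ = ⟦ mirroring ⟧ ρ σ₁
    σ₃ = ⟦ dividing L ⟧ ρ σ₂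
    σ₄ = ⟦ powering ⟧ ρ σ₃
    σ₅ = ⟦ tabulating ⟧ ρ σ₄
    σ₆ = ⟦ squaring ⟧ ρ σ₅
    σ₇ = ⟦ scaling ⟧ ρ σ₆
    mirrored = mirroring-value σ₁ 1≤m refl refl
    divided = dividing-value σ₂ (frame-var {ρ} mirroring 0 tt σ₁)
    tabled = tabulating-value σ₄ (frame-var {ρ} (mirroring ⨾ dividing L ⨾ powering) 0 tt σ₁) (frame-var {ρ} (mirroring ⨾ dividing L ⨾ powering) 17 tt σ₁)
    P≡ : vars σ₄ 20 ≡ 2 ^ n
    P≡ = powering-value σ₃
    P₆ : vars σ₆ 20 ≡ 2 ^ n
    P₆ = trans (frame-var {ρ} (tabulating ⨾ squaring) 20 tt σ₄) P≡
    matrix : arrs σ₇ 0 ≡ arrs σ₂ 0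
    matrix = frame-arr {ρ} (dividing L ⨾ powering ⨾ tabulating ⨾ squaring ⨾ scaling) 0 tt σ₂
    table : arrs σ₇ 2 ≡ arrs σ₅ 2
    table = frame-arr {ρ} (squaring ⨾ scaling) 2 tt σ₅
    table₆ : arrs σ₆ 2 ≡ arrs σ₅ 2
    table₆ = frame-arr {ρ} squaring 2 tt σ₅
    late : ∀ i → T (keepsVar (tabulating ⨾ squaring ⨾ scaling) i) → vars σ₇ i ≡ vars σ₄ i
    late i t = frame-var {ρ} (tabulating ⨾ squaring ⨾ scaling) i t σ₄
    τ≡ : vars σ₇ 1 ≡ vars σ₃ 1
    τ≡ = frame-var {ρ} (powering ⨾ tabulating ⨾ squaring ⨾ scaling) 1 tt σ₃

-- Inputs with few vertices

tree-size : ℕ → ℕ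
tree-size zero    = 4
tree-size (suc k) = suc (tree-size k + tree-size k)

cells : ℕ → ℕ
cells n = (2 * n) * (2 * n)

dispatch-size : (k j : ℕ) → ℕ
dispatch-size zero    j = 2
dispatch-size (suc k) j = 3 + (tree-size (cells j) + (2 + dispatch-size k (suc j)))

-- A constant in each leaf of the decision tree: a small n admits only finitely many matrices.
answer : ∀ n → Vec Bool (cells n) → ℕ
answer n w = isets (2 * n) (λ x y → at w (x * (2 * n) + y))

module Dispatch (exit : ℕ) where

  -- A decision tree on the k cells from register i on; each leaf outputs f and jumps to exit.
  tree : (k i b : ℕ) → (Vec Bool k → ℕ) → List Instr
  tree zero    i b f = const 0 (f []) ∷ const 1 0 ∷ const 3 0 ∷ jz 3 exit ∷ []
  tree (suc k) i b f = jz i (tree-size k + suc b) ∷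
    tree k (suc i) (suc b) (λ w → f (true ∷ w)) ++ tree k (suc i) (tree-size k + suc b) (λ w → f (false ∷ w))

  length-tree : ∀ k i b f → length (tree k i b f) ≡ tree-size k
  length-tree zero    i b f = refl
  length-tree (suc k) i b f = cong suc (trans (List.length-++ (tree k (suc i) (suc b) _))
    (cong₂ _+_ (length-tree k (suc i) (suc b) _) (length-tree k (suc i) _ _)))

  tree-run : ∀ {P} k i b f (r : Memory) (w : Vec Bool k) → CodeAt P b (tree k i b f) → (∀ j → j < k → r (i + j) ≡ at w j) →
             ∃[ r′ ] Reach P ⟨ b , r ⟩ (k + 4) ⟨ exit , r′ ⟩ × r′ 0 ≡ f w × r′ 1 ≡ 0
  tree-run zero i b f r [] (f₀ , f₁ , f₂ , f₃ , _) h = _ ,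
    reach-trans (reach-straight b (const 0 (f []) ∷ const 1 0 ∷ const 3 0 ∷ []) r tt (f₀ , f₁ , f₂ , tt))
      (reach-jump (3 + b) 3 exit _ f₃ refl) , refl , refl
  tree-run (suc k) i b f r (x ∷ w) (f₀ , code) h
    with codeAt-++ (suc b) (tree k (suc i) (suc b) (λ w → f (true ∷ w))) code | x
  ... | left , right | true with tree-run k (suc i) (suc b) _ r w left (λ j j<k → trans (cong r (sym (+-suc i j))) (h (suc j) (s≤s j<k)))
  ... | r′ , path , out = r′ , reach-trans (reach-fall b i _ r f₀ (trans (cong r (sym (+-identityʳ i))) (h 0 z<s))) path , out
  tree-run (suc k) i b f r (x ∷ w) (f₀ , code) h | left , right | false
    with tree-run k (suc i) (tree-size k + suc b) _ r w
           (subst (λ l → CodeAt _ (l + suc b) (tree k (suc i) (tree-size k + suc b) (λ w → f (false ∷ w)))) (length-tree k (suc i) (suc b) _) right)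
           (λ j j<k → trans (cong r (sym (+-suc i j))) (h (suc j) (s≤s j<k)))
  ... | r′ , path , out = r′ , reach-trans (reach-jump b i _ r f₀ (trans (cong r (sym (+-identityʳ i))) (h 0 z<s))) path , out

  -- Register 0 holds n ∸ j; the inputs with j ≤ n < j + k are answered by decision trees.
  dispatch : (k j b : ℕ) → List Instr
  -- A large n has been lowered by j on the way, which is undone here.
  dispatch zero    j b = const 3 j ∷ add 0 0 3 ∷ []
  dispatch (suc k) j b =
    let next = tree-size (cells j) + (3 + b) in
    -- Register 3 is the matrix entry (0, 0). It is 0 in a loopless graph, so overwriting it by 0
    -- for the jump does not disturb the decision tree.
    const 3 0 ∷ jz 0 (3 + b) ∷ jz 3 next ∷
    tree (cells j) 3 (3 + b) (answer j) ++ const 3 1 ∷ sub 0 0 3 ∷ dispatch k (suc j) (2 + next)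

  length-dispatch : ∀ k j b → length (dispatch k j b) ≡ dispatch-size k j
  length-dispatch zero    j b = refl
  length-dispatch (suc k) j b = cong (3 +_) (trans (List.length-++ (tree (cells j) 3 (3 + b) (answer j)))
    (cong₂ _+_ (length-tree (cells j) 3 (3 + b) (answer j)) (cong (2 +_) (length-dispatch k (suc j) _))))

  module _ {P : Program} where

    private
      pieces : ∀ k j b → CodeAt P b (dispatch (suc k) j b) →
        (fetch P b ≡ just (const 3 0)) × (fetch P (1 + b) ≡ just (jz 0 (3 + b))) ×
        (fetch P (2 + b) ≡ just (jz 3 (tree-size (cells j) + (3 + b)))) ×
        CodeAt P (3 + b) (tree (cells j) 3 (3 + b) (answer j)) ×
        CodeAt P (tree-size (cells j) + (3 + b)) (const 3 1 ∷ sub 0 0 3 ∷ dispatch k (suc j) (2 + (tree-size (cells j) + (3 + b))))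
      pieces k j b (f₀ , f₁ , f₂ , rest) with codeAt-++ (3 + b) (tree (cells j) 3 (3 + b) (answer j)) rest
      ... | t , d = f₀ , f₁ , f₂ , t , subst (λ l → CodeAt P (l + (3 + b))
              (const 3 1 ∷ sub 0 0 3 ∷ dispatch k (suc j) (2 + (tree-size (cells j) + (3 + b))))) (length-tree (cells j) 3 (3 + b) (answer j)) d

      pass : ∀ k j b (r : Memory) {x} → CodeAt P b (dispatch (suc k) j b) → r 0 ≡ suc x →
        Reach P ⟨ b , r ⟩ 5 ⟨ 2 + (tree-size (cells j) + (3 + b)) , ((r [ 3 ↦ 0 ]) [ 3 ↦ 1 ]) [ 0 ↦ r 0 ∸ 1 ] ⟩
      pass k j b r c r0 with pieces k j b c
      ... | f₀ , f₁ , f₂ , _ , (f₃ , f₄ , _) =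
        reach-trans (reach-straight b (const 3 0 ∷ []) r tt (f₀ , tt))
          (reach-trans (reach-fall (1 + b) 0 (3 + b) _ f₁ r0)
            (reach-trans (reach-jump (2 + b) 3 _ _ f₂ refl)
              (reach-straight _ (const 3 1 ∷ sub 0 0 3 ∷ []) _ tt (f₃ , f₄ , tt))))

    dispatch-small : ∀ k j b n (r : Memory) x (w : Vec Bool (cells n)) → CodeAt P b (dispatch k j b) →
      r 0 ≡ x → x < k → j + x ≡ n → at w 0 ≡ 0 → (∀ i → 1 ≤ i → i < cells n → r (3 + i) ≡ at w i) →
      ∃[ t ] ∃[ r′ ] t ≤ 5 * k + (cells n + 6) × Reach P ⟨ b , r ⟩ t ⟨ exit , r′ ⟩ × r′ 0 ≡ answer n w × r′ 1 ≡ 0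
    dispatch-small (suc k) j b n r zero w c r0 _ eq w0 h with pieces k j b c | trans (sym (+-identityʳ j)) eq
    ... | f₀ , f₁ , _ , tr , _ | refl with tree-run (cells j) 3 (3 + b) (answer j) (r [ 3 ↦ 0 ]) w tr
            (λ { zero _ → sym w0 ; (suc i) i< → h (suc i) (s≤s z≤n) i< })
    ... | r′ , path , out = _ , r′ , ≤-trans (≤-reflexive (+-comm 2 (cells j + 4))) (≤-trans (≤-reflexive (+-assoc (cells j) 4 2)) (m≤n+m _ (5 * suc k))) ,
      reach-trans (reach-trans (reach-straight b (const 3 0 ∷ []) r tt (f₀ , tt)) (reach-jump (1 + b) 0 (3 + b) _ f₁ r0)) path , out
    dispatch-small (suc k) j b n r (suc x) w c r0 (s≤s x<k) eq w0 h with pieces k j b c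
    ... | _ , _ , _ , _ , (_ , _ , d) with dispatch-small k (suc j) _ n (((r [ 3 ↦ 0 ]) [ 3 ↦ 1 ]) [ 0 ↦ r 0 ∸ 1 ]) x w d
            (cong (_∸ 1) r0) x<k (trans (sym (+-suc j x)) eq) w0 (λ { (suc i) 1≤i i< → h (suc i) 1≤i i< })
    ... | t , r′ , t≤ , path , out = 5 + t , r′ ,
      ≤-trans (+-monoʳ-≤ 5 t≤) (≤-reflexive (trans (sym (+-assoc 5 (5 * k) _)) (cong (_+ (cells n + 6)) (sym (*-suc 5 k))))) ,
      reach-trans (pass k j b r c r0) path , out

    dispatch-large : ∀ k j b n (r : Memory) x → CodeAt P b (dispatch k j b) → r 0 ≡ k + x → j + (k + x) ≡ n →
      ∃[ r′ ] Reach P ⟨ b , r ⟩ (5 * k + 2) ⟨ dispatch-size k j + b , r′ ⟩ × r′ 0 ≡ n ×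
        (∀ i → i ≢ 0 → i ≢ 3 → r′ i ≡ r i)
    dispatch-large zero j b n r x c r0 eq = _ , reach-straight b (const 3 j ∷ add 0 0 3 ∷ []) r tt c ,
      trans (cong (_+ j) r0) (trans (+-comm x j) eq) ,
      λ i i≢0 i≢3 → trans (upd-other (r [ 3 ↦ j ]) _ (≢-sym i≢0)) (upd-other r j (≢-sym i≢3))
    dispatch-large (suc k) j b n r x c r0 eq with pieces k j b c
    ... | _ , _ , _ , _ , (_ , _ , d) with dispatch-large k (suc j) _ n (((r [ 3 ↦ 0 ]) [ 3 ↦ 1 ]) [ 0 ↦ r 0 ∸ 1 ]) x d
            (cong (_∸ 1) r0) (trans (sym (+-suc j (k + x))) eq)
    ... | r′ , path , out , same = r′ ,
      cast-end (e₁ (dispatch-size k (suc j)) (tree-size (cells j)) b)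
        (cast-time (trans (sym (+-assoc 5 (5 * k) 2)) (cong (_+ 2) (sym (*-suc 5 k)))) (reach-trans (pass k j b r c r0) path)) ,
      out , λ i i≢0 i≢3 → trans (same i i≢0 i≢3)
        (trans (upd-other ((r [ 3 ↦ 0 ]) [ 3 ↦ 1 ]) _ (≢-sym i≢0)) (trans (upd-other (r [ 3 ↦ 0 ]) 1 (≢-sym i≢3)) (upd-other r 0 (≢-sym i≢3))))
      where
      e₁ : ∀ d t b → d + (2 + (t + (3 + b))) ≡ 3 + (t + (2 + d)) + b
      e₁ = solve-∀

-- Loading the input and tossing the coins

-- k = ⌈ x / num ⌉, counted as the machine does, by repeated subtraction.
data Ceil (num : ℕ) : ℕ → ℕ → Set where
  done : Ceil num 0 0
  more : ∀ {x k} → Ceil num (suc x ∸ num) k → Ceil num (suc x) (suc k)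

ceil-zero : ∀ {num x} → Ceil num x 0 → x ≡ 0
ceil-zero done = refl

ceil-more : ∀ {num x k} → Ceil num x (suc k) → (∃[ y ] x ≡ suc y) × Ceil num (x ∸ num) k
ceil-more (more {x} c) = (x , refl) , c

ceil : ∀ num x → 1 ≤ num → ∃[ k ] Ceil num x k
ceil num x 1≤num = go x x ≤-refl
  where
  go : ∀ fuel x → x ≤ fuel → ∃[ k ] Ceil num x k
  go fuel       zero    _         = 0 , done
  go (suc fuel) (suc x) (s≤s x≤f) with go fuel (suc x ∸ num) (≤-trans (∸-monoʳ-≤ (suc x) 1≤num) x≤f)
  ... | k , c = suc k , more c

ceil-≥ : ∀ {num x k} → Ceil num x k → x ≤ k * num
ceil-≥ done = z≤n
ceil-≥ {num} (more {x} c) = ≤-trans (m≤n+m∸n (suc x) num) (+-monoʳ-≤ num (ceil-≥ c))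

ceil-≤ : ∀ {num x k} → Ceil num x k → k * num ≤ x + num
ceil-≤ done = z≤n
ceil-≤ {num} (more {x} {k} c) with ≤-total num (suc x)
... | inj₁ num≤x = subst (num + k * num ≤_) (trans (+-comm num _) (cong (_+ num) (m∸n+n≡m num≤x)))
                     (+-monoʳ-≤ num (ceil-≤ c))
... | inj₂ x≤num = ≤-trans (≤-reflexive (trans (cong (λ k → num + k * num) (last k c)) (+-identityʳ num))) (m≤n+m num (suc x))
  where
  last : ∀ k → Ceil num (suc x ∸ num) k → k ≡ 0
  last k c with suc x ∸ num | m≤n⇒m∸n≡0 x≤num
  last zero    c | .0 | refl = refl
  last (suc k) () | .0 | refl

-- The working registers below 64 destroy the beginning of the matrix, so only entries of index at
-- least 64 are trusted. The three loops compute e = 1 + ⌈1 / ε⌉, then W = 67 + m², an address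
-- beyond both registers and input, and copy the matrix into the cells of array 0, which lie 8
-- apart.
loading : ℕ → List Instr
loading b =
  const 3 0 ∷ const 4 1 ∷ add 24 0 3 ∷ add 25 0 0 ∷ const 26 1 ∷ add 5 2 3 ∷
  (jz 5 (10 + b) ∷ sub 5 5 1 ∷ add 26 26 4 ∷ jz 3 (6 + b) ∷
  (const 8 67 ∷ add 6 25 3 ∷
  (jz 6 (16 + b) ∷ add 8 8 25 ∷ sub 6 6 4 ∷ jz 3 (12 + b) ∷
  (const 5 67 ∷ sub 6 8 5 ∷ const 7 3 ∷ add 17 8 3 ∷ const 16 8 ∷
  (jz 6 (28 + b) ∷ load 5 7 ∷ store 17 5 ∷ add 7 7 4 ∷ add 17 17 16 ∷ sub 6 6 4 ∷ jz 3 (21 + b) ∷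
  (add 9 8 4 ∷ add 10 9 4 ∷ add 11 10 4 ∷ add 12 11 4 ∷ add 13 12 4 ∷ add 14 13 4 ∷ add 15 14 4 ∷ []))))))

regs-state : ℕ → Memory → St
regs-state W r = st (λ x → r (reg-var x)) (λ a i → r (cell W a i))

pars : Memory → ℕ → ℕ
pars r p = r (reg-par p)

cell-suc : ∀ W j → cell W 0 (suc j) ≡ cell W 0 j + 8
cell-suc W j = trans (cong (_+ W) (trans (octuple-* (suc j)) (cong (8 +_) (sym (octuple-* j)))))
  (trans (+-assoc 8 (octuple j) W) (+-comm 8 _))

lowTarget : Instr → Bool
lowTarget (const i _) = i <ᵇ 64
lowTarget (add i _ _) = i <ᵇ 64
lowTarget (sub i _ _) = i <ᵇ 64
lowTarget (load i _)  = i <ᵇ 64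
lowTarget _           = false

allLow : List Instr → Bool
allLow []       = true
allLow (i ∷ is) = lowTarget i ∧ allLow is

high-kept : ∀ is → T (allLow is) → ∀ r {x} → 64 ≤ x → execs is r x ≡ r x
high-kept []       t r 64≤x = refl
high-kept (i ∷ is) t r {x} 64≤x = trans (high-kept is (T-∧₂ (lowTarget i) t) (eff i r) 64≤x) (one i (T-∧₁ (lowTarget i) t))
  where
  low : ∀ j v → T (j <ᵇ 64) → (r [ j ↦ v ]) x ≡ r x
  low j v j< = upd-other r v (<⇒≢ (<-≤-trans (<ᵇ⇒< j 64 j<) 64≤x))
  one : ∀ i → T (lowTarget i) → eff i r x ≡ r x
  one (const i _) t = low i _ t
  one (add i _ _) t = low i _ t
  one (sub i _ _) t = low i _ t
  one (load i _)  t = low i _ t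

record Loaded (n e m : ℕ) (q : ℕ → ℕ) (r : Memory) : Set where
  field
    rep     : Rep (67 + m * m) (pars r) r (regs-state (67 + m * m) r)
    par-n   : pars r 0 ≡ n
    par-m   : pars r 1 ≡ m
    par-e   : pars r 2 ≡ e
    matrix  : ∀ i → 64 ≤ i → i < m * m → r (cell (67 + m * m) 0 i) ≡ q i
    blank   : ∀ a → 1 ≤ a → a < 8 → ∀ i → r (cell (67 + m * m) a i) ≡ 0

module Loading (n num k : ℕ) (q : ℕ → ℕ) (r : Memory) where

  m W : ℕ
  m = n + n
  W = 67 + m * m

  init₁ body₁ init₂ body₂ init₃ body₃ bases : List Instr
  init₁ = const 3 0 ∷ const 4 1 ∷ add 24 0 3 ∷ add 25 0 0 ∷ const 26 1 ∷ add 5 2 3 ∷ []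
  body₁ = sub 5 5 1 ∷ add 26 26 4 ∷ []
  init₂ = const 8 67 ∷ add 6 25 3 ∷ []
  body₂ = add 8 8 25 ∷ sub 6 6 4 ∷ []
  init₃ = const 5 67 ∷ sub 6 8 5 ∷ const 7 3 ∷ add 17 8 3 ∷ const 16 8 ∷ []
  body₃ = load 5 7 ∷ store 17 5 ∷ add 7 7 4 ∷ add 17 17 16 ∷ sub 6 6 4 ∷ []
  bases = add 9 8 4 ∷ add 10 9 4 ∷ add 11 10 4 ∷ add 12 11 4 ∷ add 13 12 4 ∷ add 14 13 4 ∷ add 15 14 4 ∷ []

  record Consts (s : Memory) : Set where
    constructor consts
    field
      nil : s 3 ≡ 0
      one : s 4 ≡ 1
      pn  : s 24 ≡ n
      pm  : s 25 ≡ m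

  High : Memory → Set
  High s = ∀ x → 64 ≤ x → s x ≡ r x

  high-execs : ∀ is → T (allLow is) → ∀ {s} → High s → High (execs is s)
  high-execs is t h x 64≤x = trans (high-kept is t _ 64≤x) (h x 64≤x)

  I₁ : ℕ → Memory → Set
  I₁ j s = Consts s × High s × Ceil num (s 5) j × s 1 ≡ num × s 26 + j ≡ 1 + k

  stop₁ : ∀ s → I₁ 0 s → s 5 ≡ 0
  stop₁ s (_ , _ , c , _) = ceil-zero c

  next₁ : ∀ j s → I₁ (suc j) s → (∃[ x ] s 5 ≡ suc x) × execs body₁ s 3 ≡ 0 × I₁ j (execs body₁ s)
  next₁ j s (consts z o a b , h , c , s1 , e) = proj₁ (ceil-more c) , z , consts z o a b , high-execs body₁ tt h ,
    subst (λ t → Ceil num (s 5 ∸ t) j) (sym s1) (proj₂ (ceil-more c)) , s1 ,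
    trans (cong (λ o → s 26 + o + j) o) (trans (+-assoc (s 26) 1 j) e)

  I₂ : ℕ → Memory → Set
  I₂ j s = Consts s × High s × s 6 ≡ j × s 8 + j * m ≡ W × s 26 ≡ 1 + k

  next₂ : ∀ j s → I₂ (suc j) s → (∃[ x ] s 6 ≡ suc x) × execs body₂ s 3 ≡ 0 × I₂ j (execs body₂ s)
  next₂ j s (consts z o a b , h , c , w , e) = (j , c) , z , consts z o a b , high-execs body₂ tt h ,
    cong₂ _∸_ c o , trans (cong (λ b → s 8 + b + j * m) b) (trans (+-assoc (s 8) m (j * m)) w) , e

  record Copying (j : ℕ) (s : Memory) : Set where
    field
      fixed  : Consts s
      base   : s 8 ≡ W
      par-e  : s 26 ≡ 1 + k
      eight  : s 16 ≡ 8
      left   : s 6 ≡ j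
      i      : ℕ
      i+j    : i + j ≡ m * m
      source : s 7 ≡ 3 + i
      target : s 17 ≡ cell W 0 i
      inp  : ∀ x → 64 ≤ x → x < m * m → s (3 + x) ≡ q x
      copied : ∀ x → 64 ≤ x → x < i → s (cell W 0 x) ≡ q x
      fresh  : ∀ x → i ≤ x → s (cell W 0 x) ≡ 0
      blank  : ∀ a → 1 ≤ a → a < 8 → ∀ x → s (cell W a x) ≡ 0

  cell≥64 : ∀ a x → 64 ≤ cell W a x
  cell≥64 a x = ≤-trans (m≤m+n 64 (3 + m * m)) (cell-≥ W a x)

  next₃ : ∀ j s → Copying (suc j) s → (∃[ x ] s 6 ≡ suc x) × execs body₃ s 3 ≡ 0 × Copying j (execs body₃ s)
  next₃ j s C = (j , left) , trans (low 3 (m≤m+n 4 60)) nil , record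
    { fixed  = consts (trans (low 3 (m≤m+n 4 60)) nil) one′ (trans (low 24 (m≤m+n 25 39)) pn) (trans (low 25 (m≤m+n 26 38)) pm)
    ; base   = trans (low 8 (m≤m+n 9 55)) base
    ; par-e  = trans (low 26 (m≤m+n 27 37)) par-e
    ; eight  = trans (low 16 (m≤m+n 17 47)) eight
    ; left   = cong₂ _∸_ (trans (low 6 (m≤m+n 7 57)) left) one′
    ; i      = suc i
    ; i+j    = trans (sym (+-suc i j)) i+j
    ; source = trans (cong₂ _+_ (trans (low 7 (m≤m+n 8 56)) source) one′) (+-comm (3 + i) 1)
    ; target = trans (cong₂ _+_ (trans (low 17 (m≤m+n 18 46)) target) (trans (low 16 (m≤m+n 17 47)) eight)) (sym (cell-suc W i))
    ; inp  = λ x 64≤x x< → trans (other (3 + x) (≤-trans 64≤x (m≤n+m x 3)) (inp≢ x x<)) (inp x 64≤x x<)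
    ; copied = copied′
    ; fresh  = λ x i<x → trans (other (cell W 0 x) (cell≥64 0 x) λ eq →
                 <⇒≢ i<x (proj₁ (cell-injective W i x z<s z<s eq))) (fresh x (<⇒≤ i<x))
    ; blank  = λ a 1≤a a<8 x → trans (other (cell W a x) (cell≥64 a x) λ eq →
                 <⇒≢ 1≤a (proj₂ (cell-injective W i x z<s a<8 eq))) (blank a 1≤a a<8 x) }
    where
    open Copying C
    open Consts fixed
    t : Memory
    t = (s [ 5 ↦ s (s 7) ]) [ s 17 ↦ s (s 7) ]
    17≥64 : 64 ≤ s 17
    17≥64 = subst (64 ≤_) (sym target) (cell≥64 0 i)
    low : ∀ x → x < 64 → t x ≡ (s [ 5 ↦ s (s 7) ]) x
    low x x<64 = upd-other (s [ 5 ↦ s (s 7) ]) _ (≢-sym (<⇒≢ (<-≤-trans x<64 17≥64)))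
    one′ : t 4 ≡ 1
    one′ = trans (low 4 (m≤m+n 5 59)) one
    rest : ∀ x → 64 ≤ x → execs body₃ s x ≡ t x
    rest x 64≤x = high-kept (add 7 7 4 ∷ add 17 17 16 ∷ sub 6 6 4 ∷ []) tt t 64≤x
    other : ∀ x → 64 ≤ x → cell W 0 i ≢ x → execs body₃ s x ≡ s x
    other x 64≤x ≢x = trans (rest x 64≤x) (trans (upd-other (s [ 5 ↦ _ ]) _ (λ eq → ≢x (trans (sym target) eq)))
      (upd-other s _ (<⇒≢ (<-≤-trans (m≤m+n 6 58) 64≤x))))
    inp≢ : ∀ x → x < m * m → cell W 0 i ≢ 3 + x
    inp≢ x x< eq = <-irrefl refl (<-≤-trans (+-mono-≤-< (m≤m+n 3 64) x<) (≤-trans (cell-≥ W 0 i) (≤-reflexive eq)))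
    copied′ : ∀ x → 64 ≤ x → x < suc i → execs body₃ s (cell W 0 x) ≡ q x
    copied′ x 64≤x x<1+i with m<1+n⇒m<n∨m≡n x<1+i
    ... | inj₁ x<i = trans (other (cell W 0 x) (cell≥64 0 x) λ eq → <⇒≢ x<i (sym (proj₁ (cell-injective W i x z<s z<s eq)))) (copied x 64≤x x<i)
    ... | inj₂ refl = trans (rest (cell W 0 x) (cell≥64 0 x)) (trans (cong t (sym target)) (trans (upd-same (s [ 5 ↦ _ ]) (s 17) _)
            (trans (cong s source) (inp x 64≤x (subst (x <_) i+j (m<m+n x z<s))))))

  finish-loading : ∀ s → Copying 0 s → Loaded n (1 + k) m q (execs bases s)
  finish-loading s C = record
    { rep = record
      { rep-zero = nil ; rep-one = one ; rep-base = base-at ; rep-par = λ _ _ → refl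
      ; rep-var = λ _ _ → refl ; rep-arr = λ _ _ _ → refl }
    ; par-n = pn ; par-m = pm ; par-e = par-e
    ; matrix = λ x 64≤x x< → trans (kept (cell≥64 0 x)) (copied x 64≤x (subst (x <_) (trans (sym i+j) (+-identityʳ i)) x<))
    ; blank = λ a 1≤a a<8 x → trans (kept (cell≥64 a x)) (blank a 1≤a a<8 x) }
    where
    open Copying C
    open Consts fixed
    kept : ∀ {x} → 64 ≤ x → execs bases s x ≡ s x
    kept = high-kept bases tt s
    next : ∀ {v} a → v ≡ a + W → v + s 4 ≡ suc a + W
    next {v} a eq = trans (cong₂ _+_ eq one) (+-comm (a + W) 1)
    base-at : ∀ a → a < 8 → execs bases s (8 + a) ≡ a + W
    base-at 0 _ = base
    base-at 1 _ = next 0 base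
    base-at 2 _ = next 1 (next 0 base)
    base-at 3 _ = next 2 (next 1 (next 0 base))
    base-at 4 _ = next 3 (next 2 (next 1 (next 0 base)))
    base-at 5 _ = next 4 (next 3 (next 2 (next 1 (next 0 base))))
    base-at 6 _ = next 5 (next 4 (next 3 (next 2 (next 1 (next 0 base)))))
    base-at 7 _ = next 6 (next 5 (next 4 (next 3 (next 2 (next 1 (next 0 base))))))
    base-at (suc (suc (suc (suc (suc (suc (suc (suc a)))))))) (s≤s (s≤s (s≤s (s≤s (s≤s (s≤s (s≤s (s≤s ()))))))))

  load-run : ∀ {P b} → CodeAt P b (loading b) → ∀ den →
    r 0 ≡ n → r 1 ≡ num → r 2 ≡ den → Ceil num den k →
    (∀ i → 64 ≤ i → i < m * m → r (3 + i) ≡ q i) → (∀ i → W ≤ i → r i ≡ 0) →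
    ∃[ r′ ] Reach P ⟨ b , r ⟩ (6 + (k * 4 + 1 + (2 + (m * 4 + 1 + (5 + (m * m * 7 + 1 + 7)))))) ⟨ 35 + b , r′ ⟩ × Loaded n (1 + k) m q r′
  load-run {P} {b} (i₀ , i₁ , i₂ , i₃ , i₄ , i₅ , j₀ , j₁ , j₂ , j₃ , k₀ , k₁ , l₀ , l₁ , l₂ , l₃ , m₀ , m₁ , m₂ , m₃ , m₄ ,
      c₀ , c₁ , c₂ , c₃ , c₄ , c₅ , c₆ , tail) den r0 r1 r2 c inp zeros =
    let start₁ = consts refl refl (trans (+-identityʳ (r 0)) r0) (cong₂ _+_ r0 r0) , high-execs init₁ tt (λ _ _ → refl) ,
                 subst (λ x → Ceil num x k) (sym (trans (+-identityʳ (r 2)) r2)) c , r1 , refl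
        s₁ , path₁ , (C₁ , h₁ , _ , _ , e₁) = reach-while (6 + b) 5 body₁ (10 + b) tt (j₀ , j₁ , j₂ , j₃ , tt) I₁ stop₁ next₁ k (execs init₁ r) start₁
        start₂ = consts (Consts.nil C₁) (Consts.one C₁) (Consts.pn C₁) (Consts.pm C₁) , high-execs init₂ tt h₁ ,
                 trans (cong₂ _+_ (Consts.pm C₁) (Consts.nil C₁)) (+-identityʳ m) , refl , trans (sym (+-identityʳ (s₁ 26))) e₁
        s₂ , path₂ , (C₂ , h₂ , _ , w₂ , e₂) = reach-while (12 + b) 6 body₂ (16 + b) tt (l₀ , l₁ , l₂ , l₃ , tt) I₂ (λ _ x → proj₁ (proj₂ (proj₂ x))) next₂ m (execs init₂ s₁) start₂
        base₂ = trans (sym (+-identityʳ (s₂ 8))) w₂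
        high₃ = high-execs init₃ tt h₂
        start₃ = record
          { fixed = consts (Consts.nil C₂) (Consts.one C₂) (Consts.pn C₂) (Consts.pm C₂)
          ; base = base₂ ; par-e = e₂ ; eight = refl
          ; left = trans (cong (_∸ 67) base₂) (m+n∸m≡n 67 (m * m))
          ; i = 0 ; i+j = refl ; source = refl ; target = trans (cong₂ _+_ base₂ (Consts.nil C₂)) (+-identityʳ W)
          ; inp = λ x 64≤x x< → trans (high₃ (3 + x) (≤-trans 64≤x (m≤n+m x 3))) (inp x 64≤x x<)
          ; copied = λ _ _ ()
          ; fresh = λ x _ → trans (high₃ (cell W 0 x) (cell≥64 0 x)) (zeros _ (cell-≥ W 0 x))
          ; blank = λ a _ _ x → trans (high₃ (cell W a x) (cell≥64 a x)) (zeros _ (cell-≥ W a x)) }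
        s₃ , path₃ , C₃ = reach-while (21 + b) 6 body₃ (28 + b) tt (c₀ , c₁ , c₂ , c₃ , c₄ , c₅ , c₆ , tt) Copying (λ _ → Copying.left) next₃ (m * m) (execs init₃ s₂) start₃
    in execs bases s₃ ,
       reach-trans (reach-straight b init₁ r tt (i₀ , i₁ , i₂ , i₃ , i₄ , i₅ , tt))
         (reach-trans path₁ (reach-trans (reach-straight (10 + b) init₂ s₁ tt (k₀ , k₁ , tt))
           (reach-trans path₂ (reach-trans (reach-straight (16 + b) init₃ s₂ tt (m₀ , m₁ , m₂ , m₃ , m₄ , tt))
             (reach-trans path₃ (reach-straight (28 + b) bases s₃ tt tail)))))) ,
       finish-loading s₃ C₃

rep-cong : ∀ {W ρ r σ τ} → (∀ x → vars σ x ≡ vars τ x) → (∀ a i → arrs σ a i ≡ arrs τ a i) → Rep W ρ r σ → Rep W ρ r τ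
rep-cong hv ha R = record
  { rep-zero = rep-zero R ; rep-one = rep-one R ; rep-base = rep-base R ; rep-par = rep-par R
  ; rep-var = λ x x< → trans (rep-var R x x<) (hv x) ; rep-arr = λ a a< i → trans (rep-arr R a a< i) (ha a i) }

scratch-6 : Scratch 6
scratch-6 = record { s-zero = λ () ; s-one = λ () ; s-base = λ _ _ () ; s-par = λ _ _ () ; s-var = m≤m+n 7 25 }

scratch-7 : Scratch 7
scratch-7 = record { s-zero = λ () ; s-one = λ () ; s-base = λ _ _ () ; s-par = λ _ _ () ; s-var = m≤m+n 8 24 }

-- All coins are stored before the sampling starts, so that what follows is covered by `Reach`. A
-- round takes six steps, the second of which is the toss.
flipping : ℕ → List Instr
flipping b =
  add 6 (reg-var 27) 3 ∷ add 7 (reg-base 1) 3 ∷ const 16 8 ∷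
  jz 6 (9 + b) ∷ coin 5 ∷ store 7 5 ∷ add 7 7 16 ∷ sub 6 6 4 ∷ jz 3 (3 + b) ∷ []

-- The coins read by the flipping loop among the bits offered to it.
tossed : ∀ C {z} → Vec Bool (C * 6 + z) → Vec Bool C
tossed zero    bs           = []
tossed (suc C) (_ ∷ b ∷ bs) = b ∷ tossed C (dropᵛ 4 bs)

sumᵇ-drop : ∀ a {k} (g : Vec Bool k → ℕ) → sumᵇ (a + k) (λ bs → g (dropᵛ a bs)) ≡ 2 ^ a * sumᵇ k g
sumᵇ-drop zero    g = sym (+-identityʳ _)
sumᵇ-drop (suc a) {k} g = trans (cong₂ _+_ (sumᵇ-drop a g) (sumᵇ-drop a g)) (double (2 ^ a) (sumᵇ k g))
  where
  double : ∀ p s → p * s + p * s ≡ 2 * p * s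
  double = solve-∀

-- Every string of C coins comes from equally many bit strings, so ignoring the other bits leaves
-- the coins uniform.
sumᵇ-tossed : ∀ C z (g : Vec Bool C → ℕ) → 2 ^ C * sumᵇ (C * 6 + z) (λ bs → g (tossed C bs)) ≡ 2 ^ (C * 6 + z) * sumᵇ C g
sumᵇ-tossed zero    z g = trans (+-identityʳ _) (sumᵇ-const z (g []))
sumᵇ-tossed (suc C) z g = begin
  2 * 2 ^ C * (sumᵇ (suc k) F + sumᵇ (suc k) F)
    ≡⟨ cong (λ s → 2 * 2 ^ C * (s + s)) (cong₂ _+_ (sumᵇ-drop 4 (λ bs → g (true ∷ tossed C bs))) (sumᵇ-drop 4 (λ bs → g (false ∷ tossed C bs)))) ⟩
  2 * 2 ^ C * (16 * S₁ + 16 * S₀ + (16 * S₁ + 16 * S₀)) ≡⟨ e₁ (2 ^ C) S₁ S₀ ⟩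
  64 * (2 ^ C * S₁ + 2 ^ C * S₀) ≡⟨ cong₂ (λ x y → 64 * (x + y)) (sumᵇ-tossed C z (λ w → g (true ∷ w))) (sumᵇ-tossed C z (λ w → g (false ∷ w))) ⟩
  64 * (2 ^ (C * 6 + z) * sumᵇ C (λ w → g (true ∷ w)) + 2 ^ (C * 6 + z) * sumᵇ C (λ w → g (false ∷ w)))
    ≡⟨ e₂ (2 ^ (C * 6 + z)) (sumᵇ C (λ w → g (true ∷ w))) (sumᵇ C (λ w → g (false ∷ w))) ⟩
  2 ^ (suc C * 6 + z) * sumᵇ (suc C) g ∎
  where
  open ≡-Reasoning
  k = 4 + (C * 6 + z)
  F : Vec Bool (suc k) → ℕ
  F (b ∷ bs) = g (b ∷ tossed C (dropᵛ 4 bs))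
  S₁ = sumᵇ (C * 6 + z) (λ bs → g (true ∷ tossed C bs))
  S₀ = sumᵇ (C * 6 + z) (λ bs → g (false ∷ tossed C bs))
  e₁ : ∀ p s t → 2 * p * (16 * s + 16 * t + (16 * s + 16 * t)) ≡ 64 * (p * s + p * t)
  e₁ = solve-∀
  e₂ : ∀ p s t → 64 * (p * s + p * t) ≡ 2 * (2 * (2 * (2 * (2 * (2 * p))))) * (s + t)
  e₂ = solve-∀

module Flipping {P : Program} {b W : ℕ} (W≥64 : 64 ≤ W) {ρ : ℕ → ℕ} where

  with-coins : St → (ℕ → ℕ) → St
  with-coins σ f = st (vars σ) (arrs σ [ 1 ⇐ f ])

  -- g is the final content of the coin array. The current content f already agrees with it below j
  -- and is still 0 from j on, which also settles the cells beyond the last coin, where `at` reads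
  -- 0.
  flip-loop : CodeAt P b (flipping b) → ∀ C z σ (f g : ℕ → ℕ) j (r : Memory) (bs : Vec Bool (C * 6 + suc z)) →
    Rep W ρ r (with-coins σ f) → r 6 ≡ C → r 7 ≡ cell W 1 j → r 16 ≡ 8 →
    (∀ x → x < j → f x ≡ g x) → (∀ x → j ≤ x → f x ≡ 0) → (∀ x → g (j + x) ≡ at (tossed C bs) x) →
    ∃[ r′ ] run P ⟨ 3 + b , r ⟩ bs ≡ run P ⟨ 9 + b , r′ ⟩ (dropᵛ 1 (dropᵛ (C * 6) bs)) × Rep W ρ r′ (with-coins σ g)
  flip-loop (_ , _ , _ , f₃ , _) zero z σ f g j r bs R c a e below above coins = r , run-drop 1 (reach-jump (3 + b) 6 (9 + b) r f₃ c) bs , rep-cong (λ _ → refl) agreed R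
    where
    f≡g : ∀ x → f x ≡ g x
    f≡g x with <-≤-connex x j
    ... | inj₁ x<j = below x x<j
    ... | inj₂ j≤x = trans (above x j≤x) (sym (trans (cong g (sym (m+[n∸m]≡n j≤x))) (coins (x ∸ j))))
    agreed : ∀ a i → (arrs σ [ 1 ⇐ f ]) a i ≡ (arrs σ [ 1 ⇐ g ]) a i
    agreed a i with 1 ≡ᵇ a
    ... | true  = f≡g i
    ... | false = refl
  flip-loop code@(_ , _ , _ , f₃ , f₄ , f₅ , f₆ , f₇ , f₈ , _) (suc C) z σ f g j r (x ∷ y ∷ bs@(_ ∷ _ ∷ _ ∷ _ ∷ _)) R c a e below above coins =
      proj₁ IH ,
      trans (run-drop 1 (reach-fall (3 + b) 6 (9 + b) r f₃ c) (x ∷ y ∷ bs))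
        (trans (cong (λ s → run P s bs) (step-fetch P ⟨ 4 + b , r ⟩ y f₄))
          (trans (run-drop 4 (reach-trans (reach-straight (5 + b) stores r₁ tt (f₅ , f₆ , f₇ , tt)) (reach-jump (8 + b) 3 (3 + b) r₃ f₈ (rep-zero R₃))) bs)
            (proj₁ (proj₂ IH)))) ,
      proj₂ (proj₂ IH)
    where
    stores : List Instr
    stores = store 7 5 ∷ add 7 7 16 ∷ sub 6 6 4 ∷ []
    r₁ = r [ 5 ↦ toBit y ]
    r₂ = r₁ [ r 7 ↦ toBit y ]
    r₃ = execs stores r₁
    r₂-low : ∀ k → k < 64 → r₂ k ≡ r₁ k
    r₂-low k k<64 = upd-other r₁ (toBit y) (λ eq → <⇒≢ (<-≤-trans k<64 (≤-trans W≥64 (cell-≥ W 1 j))) (trans (sym eq) a))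
    f′ : ℕ → ℕ
    f′ = f [ j ↦ toBit y ]
    merge : ∀ a i → ((arrs σ [ 1 ⇐ f ]) [ 1 ⇐ f′ ]) a i ≡ (arrs σ [ 1 ⇐ f′ ]) a i
    merge a i with 1 ≡ᵇ a
    ... | true  = refl
    ... | false = refl
    R₂ : Rep W ρ r₂ (with-coins σ f′)
    R₂ = rep-cong (λ _ → refl) merge (subst (λ k → Rep W ρ (r₁ [ k ↦ toBit y ]) (st (vars σ) ((arrs σ [ 1 ⇐ f ]) [ 1 ⇐ f′ ]))) (sym a)
           (rep-put W≥64 {i = j} (s≤s (s≤s z≤n)) refl (rep-scratch W≥64 (toBit y) scratch-5 R)))
    R₃ : Rep W ρ r₃ (with-coins σ f′)
    R₃ = rep-scratch W≥64 _ scratch-6 (rep-scratch W≥64 _ scratch-7 R₂)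
    cell-step : cell W 1 j + 8 ≡ cell W 1 (suc j)
    cell-step = sym (trans (cong (_+ (1 + W)) (trans (octuple-* (suc j)) (cong (8 +_) (sym (octuple-* j)))))
      (trans (+-assoc 8 (octuple j) (1 + W)) (+-comm 8 _)))
    IH = flip-loop code C z σ f′ g (suc j) r₃ (dropᵛ 4 bs) R₃
      (cong₂ _∸_ (trans (r₂-low 6 (m≤m+n 7 57)) c) (rep-one R₂))
      (trans (cong₂ _+_ (trans (r₂-low 7 (m≤m+n 8 56)) a) (trans (r₂-low 16 (m≤m+n 17 47)) e)) cell-step)
      (trans (r₂-low 16 (m≤m+n 17 47)) e)
      below′ (λ x j<x → trans (upd-other f (toBit y) (<⇒≢ j<x)) (above x (<⇒≤ j<x)))
      (λ x → trans (cong g (sym (+-suc j x))) (coins (suc x)))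
      where
      below′ : ∀ x → x < suc j → f′ x ≡ g x
      below′ x x<1+j with m<1+n⇒m<n∨m≡n x<1+j
      ... | inj₁ x<j  = trans (upd-other f (toBit y) (≢-sym (<⇒≢ x<j))) (below x x<j)
      ... | inj₂ refl = trans (upd-same f j (toBit y)) (sym (trans (cong g (sym (+-identityʳ j))) (coins 0)))

  flip-run : CodeAt P b (flipping b) → ∀ C z σ (r : Memory) (bs : Vec Bool (3 + (C * 6 + suc z))) → Rep W ρ r σ → vars σ 27 ≡ C → (∀ j → arrs σ 1 j ≡ 0) →
    ∃[ r′ ] run P ⟨ b , r ⟩ bs ≡ run P ⟨ 9 + b , r′ ⟩ (dropᵛ 1 (dropᵛ (C * 6) (dropᵛ 3 bs))) ×
      Rep W ρ r′ (with-coins σ (at (tossed C (dropᵛ 3 bs))))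
  flip-run code@(f₀ , f₁ , f₂ , _) C z σ r bs R count blank with flip-loop code C z σ (λ _ → 0) (at (tossed C (dropᵛ 3 bs))) 0 r₁ (dropᵛ 3 bs)
        (rep-cong (λ _ → refl) unblank (rep-scratch W≥64 8 (scratch-count {0} z<s) (rep-scratch W≥64 _ scratch-7 (rep-scratch W≥64 _ scratch-6 R))))
        (trans (cong₂ _+_ (trans (rep-var R 27 (m≤m+n 28 4)) count) (rep-zero R)) (+-identityʳ C))
        (trans (cong₂ _+_ (rep-base R 1 (s≤s (s≤s z≤n))) (rep-zero R)) (+-identityʳ (1 + W)))
        refl (λ _ ()) (λ _ _ → refl) (λ _ → refl)
    where
    r₁ = execs (add 6 (reg-var 27) 3 ∷ add 7 (reg-base 1) 3 ∷ const 16 8 ∷ []) r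
    unblank : ∀ a i → arrs σ a i ≡ (arrs σ [ 1 ⇐ (λ _ → 0) ]) a i
    unblank zero          i = refl
    unblank (suc zero)    i = blank i
    unblank (suc (suc a)) i = refl
  ... | r′ , path , R′ = r′ , trans (run-drop 3 (reach-straight b (add 6 (reg-var 27) 3 ∷ add 7 (reg-base 1) 3 ∷ const 16 8 ∷ []) r tt (f₀ , f₁ , f₂ , tt)) bs) path , R′

-- Running time

-- For u ≥ 1 a single monomial is enough as a bound, because exponents can be added for sums as well
-- as for products.
Polynomial : (ℕ → ℕ) → Set
Polynomial f = ∃[ a ] ∃[ k ] (∀ u → 1 ≤ u → f u ≤ a * u ^ k)

^-positive : ∀ u k → 1 ≤ u → 1 ≤ u ^ k
^-positive u zero    _   = ≤-refl
^-positive u (suc k) 1≤u = *-mono-≤ 1≤u (^-positive u k 1≤u)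

^-monoˡ : ∀ {u} k l → 1 ≤ u → u ^ k ≤ u ^ (k + l)
^-monoˡ {u} k l 1≤u = ≤-trans (≤-reflexive (sym (*-identityʳ (u ^ k))))
  (≤-trans (*-monoʳ-≤ (u ^ k) (^-positive u l 1≤u)) (≤-reflexive (sym (^-distribˡ-+-* u k l))))

poly-const : ∀ c → Polynomial (λ _ → c)
poly-const c = c , 0 , λ _ _ → ≤-reflexive (sym (*-identityʳ c))

poly-id : Polynomial (λ u → u)
poly-id = 1 , 1 , λ u _ → ≤-reflexive (sym (trans (+-identityʳ (u * 1)) (*-identityʳ u)))

poly-+ : ∀ {f g} → Polynomial f → Polynomial g → Polynomial (λ u → f u + g u)
poly-+ (a , k , F) (b , l , G) = a + b , k + l , λ u 1≤u → ≤-trans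
  (+-mono-≤ (≤-trans (F u 1≤u) (*-monoʳ-≤ a (^-monoˡ k l 1≤u)))
            (≤-trans (G u 1≤u) (*-monoʳ-≤ b (subst (λ j → u ^ l ≤ u ^ j) (+-comm l k) (^-monoˡ l k 1≤u)))))
  (≤-reflexive (sym (*-distribʳ-+ (u ^ (k + l)) a b)))

poly-* : ∀ {f g} → Polynomial f → Polynomial g → Polynomial (λ u → f u * g u)
poly-* (a , k , F) (b , l , G) = a * b , k + l , λ u 1≤u → ≤-trans (*-mono-≤ (F u 1≤u) (G u 1≤u))
  (≤-reflexive (trans (shuffle a (u ^ k) b (u ^ l)) (cong (a * b *_) (sym (^-distribˡ-+-* u k l)))))
  where
  shuffle : ∀ a x b y → a * x * (b * y) ≡ a * b * (x * y)
  shuffle = solve-∀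

poly-^ : ∀ k → Polynomial (λ u → u ^ k)
poly-^ zero    = poly-const 1
poly-^ (suc k) = poly-* poly-id (poly-^ k)

-- The parameters 3 and 4 are results of the preparation, so the cost of the preparation has to be
-- bounded through the parameters below 3 alone.
usesBelow : ℕ → Cmd → Bool
usesBelow u (c ⨾ d)        = usesBelow u c ∧ usesBelow u d
usesBelow u (ifzero _ c d) = usesBelow u c ∧ usesBelow u d
usesBelow u (for _ p c)    = (p <ᵇ u) ∧ usesBelow u c
usesBelow u _              = true

-- One common bound replaces all parameters and makes the cost a function of a single variable.
costBound : Cmd → (ℕ → ℕ)
costBound c z = cost c (λ _ → z)

cost-mono : ∀ u c → T (usesBelow u c) → ∀ {ρ z} → (∀ p → p < u → ρ p ≤ z) → cost c ρ ≤ costBound c z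
cost-mono u skip           t h = ≤-refl
cost-mono u (c ⨾ d)        t h = +-mono-≤ (cost-mono u c (T-∧₁ (usesBelow u c) t) h) (cost-mono u d (T-∧₂ (usesBelow u c) t) h)
cost-mono u (set _ _)      t h = ≤-refl
cost-mono u (par _ _)      t h = ≤-refl
cost-mono u (add _ _ _)    t h = ≤-refl
cost-mono u (sub _ _ _)    t h = ≤-refl
cost-mono u (get _ _ _)    t h = ≤-refl
cost-mono u (put _ _ _)    t h = ≤-refl
cost-mono u (ifzero _ c d) t h = +-monoʳ-≤ 2 (+-mono-≤ (cost-mono u c (T-∧₁ (usesBelow u c) t) h) (cost-mono u d (T-∧₂ (usesBelow u c) t) h))
cost-mono u (for _ p c)    t h = +-monoˡ-≤ 3 (*-mono-≤ (h p (<ᵇ⇒< p u (T-∧₁ (p <ᵇ u) t)))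
  (+-monoˡ-≤ 5 (cost-mono u c (T-∧₂ (p <ᵇ u) t) h)))

cost-poly : ∀ c {z} → Polynomial z → Polynomial (λ u → costBound c (z u))
cost-poly skip           Z = poly-const 0
cost-poly (c ⨾ d)        Z = poly-+ (cost-poly c Z) (cost-poly d Z)
cost-poly (set _ _)      Z = poly-const 1
cost-poly (par _ _)      Z = poly-const 1
cost-poly (add _ _ _)    Z = poly-const 1
cost-poly (sub _ _ _)    Z = poly-const 1
cost-poly (get _ _ _)    Z = poly-const 5
cost-poly (put _ _ _)    Z = poly-const 5
cost-poly (ifzero _ c d) Z = poly-+ (poly-const 2) (poly-+ (cost-poly c Z) (cost-poly d Z))
cost-poly (for _ p c)    Z = poly-+ (poly-* Z (poly-+ (cost-poly c Z) (poly-const 5))) (poly-const 3)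

-- Coefficients of (x + a) · p, given the constant term carried over from the left.
shiftBy : ℚ → ℚ → List ℚ → List ℚ
shiftBy a carry []      = carry ∷ []
shiftBy a carry (c ∷ p) = (carry ℚ.+ a ℚ.* c) ∷ shiftBy a c p

powerOf : ℚ → ℕ → List ℚ
powerOf a zero    = 1ℚ ∷ []
powerOf a (suc k) = shiftBy a 0ℚ (powerOf a k)

_^ℚ_ : ℚ → ℕ → ℚ
q ^ℚ zero  = 1ℚ
q ^ℚ suc k = q ℚ.* q ^ℚ k

module _ where

  open ℚ-Solver.+-*-Solver

  eval-shiftBy : ∀ a carry p x → eval (shiftBy a carry p) x ≡ carry ℚ.+ (x ℚ.+ a) ℚ.* eval p x
  eval-shiftBy a carry []      x = solve 3 (λ c x a → c :+ x :* con 0ℚ := c :+ (x :+ a) :* con 0ℚ) refl carry x a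
  eval-shiftBy a carry (c ∷ p) x = trans (cong (λ v → carry ℚ.+ a ℚ.* c ℚ.+ x ℚ.* v) (eval-shiftBy a c p x))
    (solve 5 (λ r a c x v → r :+ a :* c :+ x :* (c :+ (x :+ a) :* v) := r :+ (x :+ a) :* (c :+ x :* v)) refl carry a c x (eval p x))

  eval-powerOf : ∀ a k x → eval (powerOf a k) x ≡ (x ℚ.+ a) ^ℚ k
  eval-powerOf a zero    x = solve 1 (λ x → con 1ℚ :+ x :* con 0ℚ := con 1ℚ) refl x
  eval-powerOf a (suc k) x = trans (eval-shiftBy a 0ℚ (powerOf a k) x)
    (trans (ℚ.+-identityˡ _) (cong ((x ℚ.+ a) ℚ.*_) (eval-powerOf a k x)))

  eval-scale : ∀ c p x → eval (map (c ℚ.*_) p) x ≡ c ℚ.* eval p x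
  eval-scale c []      x = sym (ℚ.*-zeroʳ c)
  eval-scale c (b ∷ p) x = trans (cong (λ v → c ℚ.* b ℚ.+ x ℚ.* v) (eval-scale c p x))
    (solve 4 (λ c b x v → c :* b :+ x :* (c :* v) := c :* (b :+ x :* v)) refl c b x (eval p x))

  product₂ : List ℚ → List ℚ → List (List ℚ)
  product₂ p q = map (λ c → map (c ℚ.*_) q) p

  eval-product₂ : ∀ p q x y → eval₂ (product₂ p q) x y ≡ eval p x ℚ.* eval q y
  eval-product₂ []      q x y = sym (ℚ.*-zeroˡ (eval q y))
  eval-product₂ (c ∷ p) q x y = trans (cong₂ (λ u v → u ℚ.+ x ℚ.* v) (eval-scale c q y) (eval-product₂ p q x y))
    (solve 4 (λ c w x v → c :* w :+ x :* (v :* w) := (c :+ x :* v) :* w) refl c (eval q y) x (eval p x))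

^ℚ-mono : ∀ {p q} k → 0ℚ ℚ.≤ p → p ℚ.≤ q → p ^ℚ k ℚ.≤ q ^ℚ k
0≤^ℚ : ∀ {p} k → 0ℚ ℚ.≤ p → 0ℚ ℚ.≤ p ^ℚ k
0≤^ℚ zero    0≤p = 0≤fromℕ 1
0≤^ℚ (suc k) 0≤p = 0≤* 0≤p (0≤^ℚ k 0≤p)
^ℚ-mono zero    0≤p p≤q = ℚ.≤-refl
^ℚ-mono (suc k) 0≤p p≤q = *-mono 0≤p (0≤^ℚ k (ℚ.≤-trans 0≤p p≤q)) p≤q (^ℚ-mono k 0≤p p≤q)

^ℚ-* : ∀ p q k → (p ℚ.* q) ^ℚ k ≡ p ^ℚ k ℚ.* q ^ℚ k
^ℚ-* p q zero    = refl
^ℚ-* p q (suc k) = trans (cong (p ℚ.* q ℚ.*_) (^ℚ-* p q k))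
  (solve 4 (λ p q x y → p :* q :* (x :* y) := p :* x :* (q :* y)) refl p q (p ^ℚ k) (q ^ℚ k))
  where open ℚ-Solver.+-*-Solver

fromℕ-^ : ∀ u k → fromℕ (u ^ k) ≡ fromℕ u ^ℚ k
fromℕ-^ u zero    = refl
fromℕ-^ u (suc k) = trans (fromℕ-* u (u ^ k)) (cong (fromℕ u ℚ.*_) (fromℕ-^ u k))

abstract

  -- A single quantity dominating n and e. The 8 comes from the number of trials, 4 e² 2 ^ ℓ ≤ 8 e ·
  -- e · (m + 1) ^ `picks`, in which 8 e has to be covered as one factor.
  sizeBound : ℕ → ℕ → ℕ
  sizeBound n e = 8 * suc n * suc e

  sizeBound≡ : ∀ n e → sizeBound n e ≡ 8 * suc n * suc e
  sizeBound≡ n e = refl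

  sizeBound-positive : ∀ n e → 1 ≤ sizeBound n e
  sizeBound-positive n e = s≤s z≤n

  sizeBound-n : ∀ n e k → k ≤ 8 → k * suc n ≤ sizeBound n e
  sizeBound-n n e k k≤8 = ≤-trans (*-monoˡ-≤ (suc n) k≤8)
    (≤-trans (≤-reflexive (sym (*-identityʳ (8 * suc n)))) (*-monoʳ-≤ (8 * suc n) (s≤s (z≤n {e}))))

  sizeBound-e : ∀ n e k → k ≤ 8 → k * suc e ≤ sizeBound n e
  sizeBound-e n e k k≤8 = ≤-trans (*-monoˡ-≤ (suc e) k≤8)
    (*-monoˡ-≤ (suc e) (≤-trans (≤-reflexive (sym (*-identityʳ 8))) (*-monoʳ-≤ 8 (s≤s (z≤n {n})))))

-- a 8 ^ k (x + 1) ^ k (y + 3) ^ k, where x is n and y is 1 / ε; the 3 stems from e ≤ 1 / ε + 2.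
timePolynomial : ∀ {f} → Polynomial f → List (List ℚ)
timePolynomial (a , k , _) = product₂ (powerOf 1ℚ k) (map (fromℕ (a * 8 ^ k) ℚ.*_) (powerOf (fromℕ 3) k))

time-bound : ∀ {f} (F : Polynomial f) n e {y} → fromℕ e ℚ.≤ y ℚ.+ fromℕ 2 →
             fromℕ (f (sizeBound n e)) ℚ.≤ eval₂ (timePolynomial F) (fromℕ n) y
time-bound {f} (a , k , F) n e {y} e≤ = begin
  fromℕ (f (sizeBound n e)) ≤⟨ fromℕ-mono (F _ (sizeBound-positive n e)) ⟩
  fromℕ (a * sizeBound n e ^ k) ≡⟨ cong (λ u → fromℕ (a * u ^ k)) (sizeBound≡ n e) ⟩
  fromℕ (a * (8 * suc n * suc e) ^ k)
    ≡⟨ trans (fromℕ-* a _) (cong (fromℕ a ℚ.*_) (trans (fromℕ-^ (8 * suc n * suc e) k)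
         (cong (_^ℚ k) (trans (fromℕ-* (8 * suc n) (suc e)) (cong (ℚ._* fromℕ (suc e)) (fromℕ-* 8 (suc n))))))) ⟩
  fromℕ a ℚ.* (fromℕ 8 ℚ.* fromℕ (suc n) ℚ.* fromℕ (suc e)) ^ℚ k
    ≡⟨ cong (fromℕ a ℚ.*_) (trans (^ℚ-* (fromℕ 8 ℚ.* fromℕ (suc n)) (fromℕ (suc e)) k) (cong (ℚ._* fromℕ (suc e) ^ℚ k) (^ℚ-* (fromℕ 8) (fromℕ (suc n)) k))) ⟩
  fromℕ a ℚ.* (fromℕ 8 ^ℚ k ℚ.* fromℕ (suc n) ^ℚ k ℚ.* fromℕ (suc e) ^ℚ k)
    ≤⟨ ℚ.*-monoˡ-≤-nonNeg (fromℕ a) {{ℚ.nonNegative (0≤fromℕ a)}}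
         (ℚ.*-monoˡ-≤-nonNeg (fromℕ 8 ^ℚ k ℚ.* fromℕ (suc n) ^ℚ k) {{ℚ.nonNegative (0≤* (0≤^ℚ k (0≤fromℕ 8)) (0≤^ℚ k (0≤fromℕ (suc n))))}}
           (^ℚ-mono k (0≤fromℕ (suc e)) e+1≤)) ⟩
  fromℕ a ℚ.* (fromℕ 8 ^ℚ k ℚ.* fromℕ (suc n) ^ℚ k ℚ.* (y ℚ.+ fromℕ 3) ^ℚ k)
    ≡⟨ cong (λ v → fromℕ a ℚ.* (fromℕ 8 ^ℚ k ℚ.* v ^ℚ k ℚ.* (y ℚ.+ fromℕ 3) ^ℚ k)) (trans (fromℕ-+ 1 n) (ℚ.+-comm (fromℕ 1) (fromℕ n))) ⟩
  fromℕ a ℚ.* (fromℕ 8 ^ℚ k ℚ.* (fromℕ n ℚ.+ 1ℚ) ^ℚ k ℚ.* (y ℚ.+ fromℕ 3) ^ℚ k)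
    ≡⟨ solve 4 (λ a b c d → a :* (b :* c :* d) := c :* (a :* b :* d)) refl (fromℕ a) (fromℕ 8 ^ℚ k) ((fromℕ n ℚ.+ 1ℚ) ^ℚ k) ((y ℚ.+ fromℕ 3) ^ℚ k) ⟩
  (fromℕ n ℚ.+ 1ℚ) ^ℚ k ℚ.* (fromℕ a ℚ.* fromℕ 8 ^ℚ k ℚ.* (y ℚ.+ fromℕ 3) ^ℚ k)
    ≡⟨ sym (trans (eval-product₂ (powerOf 1ℚ k) (map (fromℕ (a * 8 ^ k) ℚ.*_) (powerOf (fromℕ 3) k)) (fromℕ n) y)
         (cong₂ ℚ._*_ (eval-powerOf 1ℚ k (fromℕ n)) (trans (eval-scale (fromℕ (a * 8 ^ k)) (powerOf (fromℕ 3) k) y)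
           (cong₂ ℚ._*_ (trans (fromℕ-* a (8 ^ k)) (cong (fromℕ a ℚ.*_) (fromℕ-^ 8 k))) (eval-powerOf (fromℕ 3) k y))))) ⟩
  eval₂ (timePolynomial {f} (a , k , F)) (fromℕ n) y ∎
  where
  open ℚ.≤-Reasoning
  open ℚ-Solver.+-*-Solver
  e+1≤ : fromℕ (suc e) ℚ.≤ y ℚ.+ fromℕ 3
  e+1≤ = ℚ.≤-trans (ℚ.≤-reflexive (fromℕ-+ 1 e)) (ℚ.≤-trans (ℚ.+-monoʳ-≤ (fromℕ 1) e≤)
    (ℚ.≤-reflexive (solve 1 (λ y → con (fromℕ 1) :+ (y :+ con (fromℕ 2)) := y :+ con (fromℕ 3)) refl y)))

precision-bound : ∀ ε → .{{ε>0 : ℚ.Positive ε}} → ∀ k → k * ℤ.∣ ℚ.↥ ε ∣ ≤ ℚ.↧ₙ ε + ℤ.∣ ℚ.↥ ε ∣ →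
                  fromℕ (suc k) ℚ.≤ (ℚ.1/ ε) {{ℚ.pos⇒nonZero ε}} ℚ.+ fromℕ 2
precision-bound ε {{ε>0}} k k≤ = cancel num 0<num (begin
  num ℚ.* fromℕ (suc k) ≡⟨ cong (num ℚ.*_) (fromℕ-+ 1 k) ⟩
  num ℚ.* (fromℕ 1 ℚ.+ fromℕ k) ≡⟨ solve 2 (λ m k → m :* (con (fromℕ 1) :+ k) := m :+ k :* m) refl num (fromℕ k) ⟩
  num ℚ.+ fromℕ k ℚ.* num ≡⟨ cong (num ℚ.+_) (sym (fromℕ-* k ℤ.∣ ℚ.↥ ε ∣)) ⟩
  num ℚ.+ fromℕ (k * ℤ.∣ ℚ.↥ ε ∣) ≤⟨ ℚ.+-monoʳ-≤ num (fromℕ-mono k≤) ⟩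
  num ℚ.+ fromℕ (ℚ.↧ₙ ε + ℤ.∣ ℚ.↥ ε ∣) ≡⟨ cong (num ℚ.+_) (fromℕ-+ (ℚ.↧ₙ ε) ℤ.∣ ℚ.↥ ε ∣) ⟩
  num ℚ.+ (den ℚ.+ num) ≡⟨ cong (λ d → num ℚ.+ (d ℚ.+ num)) (sym inverse) ⟩
  num ℚ.+ (num ℚ.* i ℚ.+ num) ≡⟨ solve 2 (λ m i → m :+ (m :* i :+ m) := m :* (i :+ con (fromℕ 2))) refl num i ⟩
  num ℚ.* (i ℚ.+ fromℕ 2) ∎)
  where
  open ℚ.≤-Reasoning
  open ℚ-Solver.+-*-Solver
  num = fromℕ ℤ.∣ ℚ.↥ ε ∣
  den = fromℕ (ℚ.↧ₙ ε)
  i = (ℚ.1/ ε) {{ℚ.pos⇒nonZero ε}}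
  0<num : 0ℚ ℚ.< num
  0<num = subst (0ℚ ℚ.<_) (ε-fraction ε) (ℚ.positive⁻¹ (ε ℚ.* den) {{ℚ.pos*pos⇒pos ε den {{ℚ.positive (0<fromℕ (ℚ.denominator-1 ε))}}}})
  inverse : num ℚ.* i ≡ den
  inverse = trans (cong (ℚ._* i) (sym (ε-fraction ε)))
    (trans (solve 3 (λ e d i → e :* d :* i := d :* (e :* i)) refl ε den i)
      (trans (cong (den ℚ.*_) (ℚ.*-inverseʳ ε {{ℚ.pos⇒nonZero ε}})) (ℚ.*-identityʳ den)))

-- The complete program

fromℕ-cancel : ∀ {a b} → fromℕ a ℚ.≤ fromℕ b → a ≤ b
fromℕ-cancel {a} {b} a≤b with <-≤-connex b a
... | inj₂ a≤b′ = a≤b′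
... | inj₁ b<a = ⊥-elim (ℚ.<-irrefl refl (ℚ.<-≤-trans strict (ℚ.≤-trans (fromℕ-mono b<a) a≤b)))
  where
  strict : fromℕ b ℚ.< fromℕ (suc b)
  strict = subst₂ ℚ._<_ (ℚ.+-identityˡ (fromℕ b)) (sym (fromℕ-+ 1 b)) (ℚ.+-monoˡ-< (fromℕ b) (0<fromℕ 0))

numerator-positive : ∀ ε → .{{ℚ.Positive ε}} → 1 ≤ ℤ.∣ ℚ.↥ ε ∣
numerator-positive ε with ℤ.∣ ℚ.↥ ε ∣ in eq
... | suc _ = s≤s z≤n
... | zero  = ⊥-elim (ℚ.<-irrefl (sym (trans (ε-fraction ε) (cong fromℕ eq)))
                (ℚ.positive⁻¹ (ε ℚ.* fromℕ (ℚ.↧ₙ ε)) {{ℚ.pos*pos⇒pos ε _ {{ℚ.positive (0<fromℕ (ℚ.denominator-1 ε))}}}}))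

-- A positive rational q below δ is at least the reciprocal of its denominator K + 1, and n q ≤ n δ
-- < d + 1.
dense : ∀ δ → 0ℚ <lim seq δ → ∃[ K ] (∀ n d → IsFloor δ n d → n ≤ suc d * suc K)
dense δ (q , 0<q , q≤δ) = ℚ.denominator-1 q , bound
  where
  open ℚ-Solver.+-*-Solver
  instance
    q>0 : ℚ.Positive q
    q>0 = ℚ.positive 0<q
  den = fromℕ (ℚ.↧ₙ q)
  1≤qden : 1ℚ ℚ.≤ q ℚ.* den
  1≤qden = subst (1ℚ ℚ.≤_) (sym (ε-fraction q)) (fromℕ-mono {1} (numerator-positive q))
  bound : ∀ n d → IsFloor δ n d → n ≤ suc d * ℚ.↧ₙ q
  bound n d (_ , q′ , nδ≤q′ , q′<) = fromℕ-cancel (begin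
    fromℕ n ≡⟨ sym (ℚ.*-identityʳ _) ⟩
    fromℕ n ℚ.* 1ℚ ≤⟨ ℚ.*-monoˡ-≤-nonNeg (fromℕ n) {{ℚ.nonNegative (0≤fromℕ n)}} 1≤qden ⟩
    fromℕ n ℚ.* (q ℚ.* den) ≡⟨ sym (ℚ.*-assoc (fromℕ n) q den) ⟩
    fromℕ n ℚ.* q ℚ.* den ≤⟨ ℚ.*-monoʳ-≤-nonNeg den {{ℚ.nonNegative (0≤fromℕ (ℚ.↧ₙ q))}} nq≤ ⟩
    fromℕ (suc d) ℚ.* den ≡⟨ sym (fromℕ-* (suc d) (ℚ.↧ₙ q)) ⟩
    fromℕ (suc d * ℚ.↧ₙ q) ∎)
    where
    open ℚ.≤-Reasoning
    gap = fromℕ (suc d) ℚ.- q′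
    gap>0 : ℚ.Positive gap
    gap>0 = ℚ.positive (subst (ℚ._< gap) (ℚ.+-inverseʳ q′) (ℚ.+-monoˡ-< (ℚ.- q′) q′<))
    -- The error enters n times through q and once through q′; n + 1 copies of it just fill the gap.
    η = gap ℚ.* (ℤ.+ 1 ℚ./ suc n)
    η>0 : ℚ.Positive η
    η>0 = ℚ.pos*pos⇒pos gap {{gap>0}} (ℤ.+ 1 ℚ./ suc n) {{ℚ.normalize-pos 1 (suc n)}}
    k = proj₁ (q≤δ η η>0) ⊔ proj₁ (nδ≤q′ η η>0)
    nq≤ : fromℕ n ℚ.* q ℚ.≤ fromℕ (suc d)
    nq≤ = begin
      fromℕ n ℚ.* q ≤⟨ ℚ.*-monoˡ-≤-nonNeg (fromℕ n) {{ℚ.nonNegative (0≤fromℕ n)}} (proj₂ (q≤δ η η>0) k (m≤m⊔n _ _)) ⟩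
      fromℕ n ℚ.* (seq δ k ℚ.+ η) ≡⟨ ℚ.*-distribˡ-+ (fromℕ n) (seq δ k) η ⟩
      fromℕ n ℚ.* seq δ k ℚ.+ fromℕ n ℚ.* η ≤⟨ ℚ.+-monoˡ-≤ (fromℕ n ℚ.* η) (proj₂ (nδ≤q′ η η>0) k (m≤n⊔m _ _)) ⟩
      q′ ℚ.+ η ℚ.+ fromℕ n ℚ.* η ≡⟨ solve 3 (λ q e n → q :+ e :+ n :* e := q :+ e :* (con 1ℚ :+ n)) refl q′ η (fromℕ n) ⟩
      q′ ℚ.+ η ℚ.* (1ℚ ℚ.+ fromℕ n) ≡⟨ cong (λ v → q′ ℚ.+ η ℚ.* v) (sym (fromℕ-+ 1 n)) ⟩
      q′ ℚ.+ gap ℚ.* (ℤ.+ 1 ℚ./ suc n) ℚ.* fromℕ (suc n)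
        ≡⟨ cong (q′ ℚ.+_) (trans (ℚ.*-assoc gap (ℤ.+ 1 ℚ./ suc n) (fromℕ (suc n))) (trans (cong (gap ℚ.*_) (/-fromℕ 1 n)) (ℚ.*-identityʳ gap))) ⟩
      q′ ℚ.+ gap ≡⟨ solve 2 (λ q s → q :+ (s :- q) := s) refl q′ (fromℕ (suc d)) ⟩
      fromℕ (suc d) ∎

-- Computed values can bound loops only as parameters. Taking ρ to be whatever the parameter
-- registers hold lets it change between two commands.
rep-promote : ∀ {W ρ r σ} p v → 64 ≤ W → p < 8 → Rep W ρ r σ → Rep W (pars (r [ reg-par p ↦ v ])) (r [ reg-par p ↦ v ]) σ
rep-promote {r = r} p v W≥64 p<8 R = record
  { rep-zero = rep-zero R ; rep-one = rep-one R
  ; rep-base = λ a a<8 → trans (upd-other r v (≢-sym (<⇒≢ (<-≤-trans (+-monoʳ-< 8 a<8) (m≤m+n 16 (8 + p)))))) (rep-base R a a<8)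
  ; rep-par  = λ _ _ → refl
  ; rep-var  = λ x x<32 → trans (upd-other r v (<⇒≢ (<-≤-trans (+-monoʳ-< 24 p<8) (m≤m+n 32 x)))) (rep-var R x x<32)
  ; rep-arr  = λ a a<8 i → trans (upd-other r v (<⇒≢ (<-≤-trans (+-monoʳ-< 24 p<8)
                 (≤-trans (m≤m+n 32 32) (≤-trans W≥64 (cell-≥ _ a i)))))) (rep-arr R a a<8 i) }

run-within : ∀ {P c c′ t} z → Reach P c t c′ → t ≤ z → Halted P c′ → (bs : Vec Bool z) → run P c bs ≡ c′
run-within {P} {c} {c′} {t} z path t≤z h with m≤n⇒∃[o]m+o≡n t≤z
... | o , refl = λ bs → trans (run-drop t path bs) (run-halted P c′ (dropᵛ t bs) h)

-- The common interface of the exact answers for small n and the sampled ones for large n; ε enters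
-- only through the relative precision 1 / e.
record Approximates (P : Program) (c : Config) (i e bound : ℕ) : Set where
  field
    time     : ℕ
    within   : time ≤ bound
    good     : Vec Bool time → Bool
    likely   : 3 * 2 ^ time ≤ 4 * sumᵇ time (λ bs → toBit (good bs))
    final    : Vec Bool time → Config
    runs-to  : ∀ bs → run P c bs ≡ final bs
    halted   : ∀ bs → Halted P (final bs)
    accurate : ∀ bs → good bs ≡ true →
      e * ∣ mem (final bs) 0 - suc (mem (final bs) 1) * i ∣ ≤ suc (mem (final bs) 1) * i

-- Registers 58 and 55 are the variables 26 and 23 and become the parameters 3 and 4; register 46 is
-- variable 14, the scaled tally. `output` divides by one more than register 1, hence the
-- subtraction of 1 from the number of trials.
promoting finishing : List Instr
promoting = add 27 58 3 ∷ add 28 55 3 ∷ []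
finishing = add 0 46 3 ∷ sub 1 28 4 ∷ []

codeAt-split : ∀ {P} b xs {ys l} → length xs ≡ l → CodeAt P b (xs ++ ys) → CodeAt P b xs × CodeAt P (l + b) ys
codeAt-split b xs refl = codeAt-++ b xs

-- The coins, the alive and the chosen vertices.
blankArr : ℕ → Bool
blankArr a = (a ≡ᵇ 1) ∨ ((a ≡ᵇ 3) ∨ (a ≡ᵇ 4))

module Layout (n₁ : ℕ) (prep count est : Cmd) where

  abstract

    b₀ b₁ b₂ b₃ b₄ b₅ b₆ exit : ℕ
    b₀ = dispatch-size n₁ 0 + 0
    b₁ = 35 + b₀
    b₂ = size prep + b₁
    b₃ = 2 + b₂
    b₄ = size count + b₃
    b₅ = 9 + b₄
    b₆ = size est + b₅
    exit = 2 + b₆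

    rest₆ rest₅ rest₄ rest₃ rest₂ rest₁ program : Program
    rest₆ = code 0 b₅ est ++ finishing
    rest₅ = flipping b₄ ++ rest₆
    rest₄ = code 0 b₃ count ++ rest₅
    rest₃ = promoting ++ rest₄
    rest₂ = code 0 b₁ prep ++ rest₃
    rest₁ = loading b₀ ++ rest₂
    program = Dispatch.dispatch exit n₁ 0 0 ++ rest₁

    at-exit : ∀ r → Halted program ⟨ exit , r ⟩
    at-exit r = ≤-reflexive (trans (++-len (Dispatch.dispatch exit n₁ 0 0) rest₁ (Dispatch.length-dispatch exit n₁ 0 0) len₁)
      (arith (dispatch-size n₁ 0) (size prep) (size count) (size est)))
      where
      ++-len : ∀ (xs ys : List Instr) {l s} → length xs ≡ l → length ys ≡ s → length (xs ++ ys) ≡ l + s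
      ++-len xs ys refl refl = List.length-++ xs
      len₆ : length rest₆ ≡ size est + 2
      len₆ = ++-len (code 0 b₅ est) finishing (length-code 0 b₅ est) refl
      len₄ : length rest₄ ≡ size count + (9 + (size est + 2))
      len₄ = ++-len (code 0 b₃ count) rest₅ (length-code 0 b₃ count) (cong (9 +_) len₆)
      len₂ : length rest₂ ≡ size prep + (2 + (size count + (9 + (size est + 2))))
      len₂ = ++-len (code 0 b₁ prep) rest₃ (length-code 0 b₁ prep) (cong (2 +_) len₄)
      len₁ : length rest₁ ≡ 35 + (size prep + (2 + (size count + (9 + (size est + 2)))))
      len₁ = cong (35 +_) len₂
      arith : ∀ a p c s → a + (35 + (p + (2 + (c + (9 + (s + 2)))))) ≡ 2 + (s + (9 + (c + (2 + (p + (35 + (a + 0)))))))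
      arith = solve-∀

    split₀ : CodeAt program 0 (Dispatch.dispatch exit n₁ 0 0) × CodeAt program b₀ rest₁
    split₀ = codeAt-split 0 (Dispatch.dispatch exit n₁ 0 0) {rest₁} (Dispatch.length-dispatch exit n₁ 0 0) (codeAt-self program)

    split₁ : CodeAt program b₀ (loading b₀) × CodeAt program b₁ rest₂
    split₁ = codeAt-split b₀ (loading b₀) {rest₂} refl (proj₂ split₀)

    split₂ : CodeAt program b₁ (code 0 b₁ prep) × CodeAt program b₂ rest₃
    split₂ = codeAt-split b₁ (code 0 b₁ prep) {rest₃} (length-code 0 b₁ prep) (proj₂ split₁)

    split₃ : CodeAt program b₂ promoting × CodeAt program b₃ rest₄
    split₃ = codeAt-split b₂ promoting {rest₄} refl (proj₂ split₂)

    split₄ : CodeAt program b₃ (code 0 b₃ count) × CodeAt program b₄ rest₅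
    split₄ = codeAt-split b₃ (code 0 b₃ count) {rest₅} (length-code 0 b₃ count) (proj₂ split₃)

    split₅ : CodeAt program b₄ (flipping b₄) × CodeAt program b₅ rest₆
    split₅ = codeAt-split b₄ (flipping b₄) {rest₆} refl (proj₂ split₄)

    split₆ : CodeAt program b₅ (code 0 b₅ est) × CodeAt program b₆ finishing
    split₆ = codeAt-split b₅ (code 0 b₅ est) {finishing} (length-code 0 b₅ est) (proj₂ split₅)

    run-small : ∀ n (r : Memory) (w : Vec Bool (cells n)) → r 0 ≡ n → n < n₁ → at w 0 ≡ 0 →
      (∀ i → 1 ≤ i → i < cells n → r (3 + i) ≡ at w i) →
      ∃[ t ] ∃[ r′ ] t ≤ 5 * n₁ + (cells n + 6) × Reach program ⟨ 0 , r ⟩ t ⟨ exit , r′ ⟩ × r′ 0 ≡ answer n w × r′ 1 ≡ 0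
    run-small n r w r0 n<n₁ = Dispatch.dispatch-small exit n₁ 0 0 n r n w (proj₁ split₀) r0 n<n₁ refl

    run-large : ∀ n (r : Memory) x → r 0 ≡ n → n₁ + x ≡ n →
      ∃[ r′ ] Reach program ⟨ 0 , r ⟩ (5 * n₁ + 2) ⟨ b₀ , r′ ⟩ × r′ 0 ≡ n × (∀ i → i ≢ 0 → i ≢ 3 → r′ i ≡ r i)
    run-large n r x r0 n≡ = Dispatch.dispatch-large exit n₁ 0 0 n r x (proj₁ split₀) (trans r0 (sym n≡)) n≡

    run-load : ∀ n num den k (r : Memory) (q : ℕ → ℕ) → r 0 ≡ n → r 1 ≡ num → r 2 ≡ den → Ceil num den k →
      (∀ i → 64 ≤ i → i < (n + n) * (n + n) → r (3 + i) ≡ q i) → (∀ i → 67 + (n + n) * (n + n) ≤ i → r i ≡ 0) →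
      ∃[ r′ ] Reach program ⟨ b₀ , r ⟩ (6 + (k * 4 + 1 + (2 + ((n + n) * 4 + 1 + (5 + ((n + n) * (n + n) * 7 + 1 + 7)))))) ⟨ b₁ , r′ ⟩ ×
        Loaded n (1 + k) (n + n) q r′
    run-load n num den k r q = Loading.load-run n num k q r {program} {b₀} (proj₁ split₁) den

    run-prep : ∀ {W ρ m σ} → 64 ≤ W → T (wf 0 prep) → Rep W ρ m σ → Compiled program W ρ 0 b₁ m b₂ (cost prep ρ) (⟦ prep ⟧ ρ σ)
    run-prep W≥64 ok = correct {program} W≥64 prep 0 b₁ z≤n ok (proj₁ split₂)

    run-promote : ∀ r → Reach program ⟨ b₂ , r ⟩ 2 ⟨ b₃ , execs promoting r ⟩
    run-promote r = reach-straight {program} b₂ promoting r tt (proj₁ split₃)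

    run-count : ∀ {W ρ m σ} → 64 ≤ W → T (wf 0 count) → Rep W ρ m σ → Compiled program W ρ 0 b₃ m b₄ (cost count ρ) (⟦ count ⟧ ρ σ)
    run-count W≥64 ok = correct {program} W≥64 count 0 b₃ z≤n ok (proj₁ split₄)

    run-flip : ∀ {W ρ} → 64 ≤ W → ∀ C z σ (r : Memory) (bs : Vec Bool (3 + (C * 6 + suc z))) →
      Rep W ρ r σ → vars σ 27 ≡ C → (∀ j → arrs σ 1 j ≡ 0) →
      ∃[ r′ ] run program ⟨ b₄ , r ⟩ bs ≡ run program ⟨ b₅ , r′ ⟩ (dropᵛ 1 (dropᵛ (C * 6) (dropᵛ 3 bs))) ×
        Rep W ρ r′ (st (vars σ) (arrs σ [ 1 ⇐ at (tossed C (dropᵛ 3 bs)) ]))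
    run-flip W≥64 = Flipping.flip-run {program} {b₄} W≥64 (proj₁ split₅)

    run-est : ∀ {W ρ m σ} → 64 ≤ W → T (wf 0 est) → Rep W ρ m σ → Compiled program W ρ 0 b₅ m b₆ (cost est ρ) (⟦ est ⟧ ρ σ)
    run-est W≥64 ok = correct {program} W≥64 est 0 b₅ z≤n ok (proj₁ split₆)

    run-finish : ∀ r → Reach program ⟨ b₆ , r ⟩ 2 ⟨ exit , execs finishing r ⟩
    run-finish r = reach-straight {program} b₆ finishing r tt (proj₂ split₆)

-- Constants, small inputs and the facts established by the preparation

module Assembly (K n₁ : ℕ) where

  -- `suc L` is 12 (K + 1): with n ≤ 2 (K + 1) d, the quotient τ of n by it satisfies 6 τ ≤ d. From
  -- n < `suc L` * (τ + 1) it follows that `picks` steps of size τ + 1 exhaust m = 2 n.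
  L picks : ℕ
  L = 11 + 12 * K
  picks = 2 * suc L

  sucL≡ : suc L ≡ 12 * suc K
  sucL≡ = sym (*-suc 12 K)

  prep : Cmd
  prep = preparing L

  open Layout n₁ prep counting estimating public

  -- A bound for every parameter. The largest is the number of trials, at most 8 e · e · (m + 1) ^
  -- `picks`, where 8 e, e and m + 1 are each at most u.
  z : ℕ → ℕ
  z u = u ^ (2 + picks)

  smallTime : ℕ → ℕ
  smallTime u = 5 * n₁ + (u * u + 6)

  index-bound : ∀ {m} x y → x < m → y < m → x * m + y < m * m
  index-bound {m} x y x<m y<m = <-≤-trans (+-monoʳ-< (x * m) y<m) (≤-trans (≤-reflexive (+-comm (x * m) m)) (*-monoˡ-≤ m x<m))

  input-corner : ∀ n (G : Graph (2 * suc n)) ε → inputMemory (suc n) G ε 3 ≡ 0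
  input-corner n G ε = trans (input-cell (suc n) G ε zero zero) (cong toBit (adj-irrefl G zero))

  collect : ∀ k → (ℕ → ℕ) → Vec Bool k
  collect zero    f = []
  collect (suc k) f = (1 ≡ᵇ f 0) ∷ collect k (λ i → f (suc i))

  at-collect : ∀ k f i → i < k → at (collect k f) i ≡ toBit (1 ≡ᵇ f i)
  at-collect (suc k) f zero    _         = refl
  at-collect (suc k) f (suc i) (s≤s i<k) = at-collect k (λ i → f (suc i)) i i<k

  n≤u : ∀ n e → 2 * n ≤ sizeBound n e
  n≤u n e = ≤-trans (*-monoʳ-≤ 2 (n≤1+n n)) (sizeBound-n n e 2 (m≤m+n 2 6))

  -- The leaf reached holds the exact number, so every bit string is good and the deviation is 0.
  small : ∀ n (G : Graph (2 * n)) ε e → n < n₁ → Approximates program (input n G ε) i[ G ] e (smallTime (sizeBound n e))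
  small n G ε e n<n₁ = conclude (run-small n (inputMemory n G ε) w refl n<n₁ (first n G) (λ i _ i< → sym (at-w i i<)))
    where
    q : ℕ → ℕ
    q i = inputMemory n G ε (3 + i)
    w : Vec Bool (cells n)
    w = collect (cells n) q
    q-bit : ∀ i → toBit (1 ≡ᵇ q i) ≡ q i
    q-bit i with i <? (2 * n) * (2 * n)
    ... | no _  = refl
    ... | yes i< with adj G (proj₁ (remQuot {2 * n} (2 * n) (fromℕ< i<))) (proj₂ (remQuot {2 * n} (2 * n) (fromℕ< i<)))
    ... | true  = refl
    ... | false = refl
    at-w : ∀ i → i < cells n → at w i ≡ q i
    at-w i i< = trans (at-collect (cells n) q i i<) (q-bit i)
    first : ∀ n (G : Graph (2 * n)) → at (collect (cells n) (λ i → inputMemory n G ε (3 + i))) 0 ≡ 0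
    first zero    G = refl
    first (suc n) G = cong (λ k → toBit (1 ≡ᵇ k)) (input-corner n G ε)
    answer≡ : answer n w ≡ i[ G ]
    answer≡ = trans (isets-cong (2 * n) λ x y x< y< → at-w _ (index-bound x y x< y<))
      (sym (Encoded.i≡isets G (λ x y → q (x * (2 * n) + y)) (input-cell n G ε)))
    conclude : (∃[ t ] ∃[ r′ ] t ≤ 5 * n₁ + (cells n + 6) × Reach program (input n G ε) t ⟨ exit , r′ ⟩ × r′ 0 ≡ answer n w × r′ 1 ≡ 0) →
               Approximates program (input n G ε) i[ G ] e (smallTime (sizeBound n e))
    conclude (t , r′ , t≤ , path , out , out₁) = record
      { time = t
      ; within = ≤-trans t≤ (+-monoʳ-≤ (5 * n₁) (+-monoˡ-≤ 6 (*-mono-≤ (n≤u n e) (n≤u n e))))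
      ; good = λ _ → true
      ; likely = ≤-trans (*-monoˡ-≤ (2 ^ t) (n≤1+n 3)) (≤-reflexive (cong (4 *_) (sym (trans (sumᵇ-const t 1) (*-identityʳ (2 ^ t))))))
      ; final = λ _ → ⟨ exit , r′ ⟩
      ; runs-to = runs path
      ; halted = λ _ → at-exit r′
      ; accurate = λ _ _ → ≤-trans (≤-reflexive (trans (cong (e *_) gap) (*-zeroʳ e))) z≤n }
      where
      gap : ∣ r′ 0 - suc (r′ 1) * i[ G ] ∣ ≡ 0
      gap = trans (cong₂ (λ a b → ∣ a - suc b * i[ G ] ∣) (trans out answer≡) out₁)
        (trans (cong (λ k → ∣ i[ G ] - k ∣) (+-identityʳ i[ G ])) (∣n-n∣≡0 i[ G ]))

  record Ready (n e : ℕ) (q : ℕ → ℕ) (c₀ : Config) (bound : ℕ) : Set where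
    field
      time    : ℕ
      within  : time ≤ bound
      mem₀    : Memory
      ρ       : ℕ → ℕ
      σ       : St
      ℓ       : ℕ
      path    : Reach program c₀ time ⟨ b₄ , mem₀ ⟩
      rep     : Rep (67 + (n + n) * (n + n)) ρ mem₀ σ
      ρ-m     : ρ 1 ≡ n + n
      ρ-bits  : ρ 3 ≡ n + ℓ
      ρ-runs  : ρ 4 ≡ 4 * (e * e) * 2 ^ ℓ
      coins   : vars σ 27 ≡ ρ 4 * ρ 3
      τ-upper : suc L * vars σ 1 ≤ n
      entries : ∀ x y → x < n + n → y < n + n → arrs σ 0 (x * (n + n) + y) ≡ q (x * (n + n) + y)
      B-zero  : arrs σ 2 0 ≡ 2 ^ n
      B-suc   : ∀ b → b < n + n → arrs σ 2 (suc b) ≡ arrs σ 2 b + arrs σ 2 (b ∸ vars σ 1)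
      enough  : arrs σ 2 (n + n) ≤ 2 ^ (n + ℓ)
      bounded : ∀ p → p < 5 → ρ p ≤ z (sizeBound n e)
      blank   : ∀ a → T (blankArr a) → ∀ i → arrs σ a i ≡ 0

  record Facts (n e : ℕ) (q : ℕ → ℕ) (σ : St) : Set where
    field
      ℓ       : ℕ
      bits    : vars σ 26 ≡ n + ℓ
      many    : vars σ 23 ≡ 4 * (e * e) * 2 ^ ℓ
      τ-upper : suc L * vars σ 1 ≤ n
      entries : ∀ x y → x < n + n → y < n + n → arrs σ 0 (x * (n + n) + y) ≡ q (x * (n + n) + y)
      B-zero  : arrs σ 2 0 ≡ 2 ^ n
      B-suc   : ∀ b → b < n + n → arrs σ 2 (suc b) ≡ arrs σ 2 b + arrs σ 2 (b ∸ vars σ 1)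
      enough  : arrs σ 2 (n + n) ≤ 2 ^ (n + ℓ)
      ℓ≤      : ℓ ≤ n + n
      few     : 2 ^ ℓ ≤ 2 * suc (n + n) ^ picks
      blank   : ∀ a → T (blankArr a) → ∀ i → arrs σ a i ≡ 0

  module _ {n e : ℕ} {q : ℕ → ℕ} (64≤m : 64 ≤ n + n)
      (symmetric : ∀ x y → x < n + n → y < n + n → q (x * (n + n) + y) ≡ q (y * (n + n) + x)) (loopless : q 0 ≡ 0) where

    -- As m ≥ 64, the entries lost in loading all lie in the first row, and symmetry supplies those
    -- from the first column, whose entries below the corner have index at least m.
    matrix : ∀ {c a : ℕ → ℕ} → (∀ i → 64 ≤ i → i < (n + n) * (n + n) → a i ≡ q i) →
      c 0 ≡ 0 → (∀ y → 1 ≤ y → y < n + n → c y ≡ a (y * (n + n))) → (∀ i → n + n ≤ i → c i ≡ a i) →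
      ∀ x y → x < n + n → y < n + n → c (x * (n + n) + y) ≡ q (x * (n + n) + y)
    matrix loaded first top lower (suc x) y x<m y<m = trans (lower _ (≤-trans (m≤m+n (n + n) (x * (n + n))) (m≤m+n _ y)))
      (loaded _ (≤-trans 64≤m (≤-trans (m≤m+n (n + n) (x * (n + n))) (m≤m+n _ y))) (index-bound (suc x) y x<m y<m))
    matrix loaded first top lower zero zero x<m y<m = trans first (sym loopless)
    matrix loaded first top lower zero (suc y) x<m y<m = trans (top (suc y) (s≤s z≤n) y<m)
      (trans (loaded (suc y * (n + n)) (≤-trans 64≤m (m≤m+n (n + n) (y * (n + n)))) (*-monoˡ-< (n + n) {{>-nonZero (≤-trans (s≤s z≤n) 64≤m)}} y<m))
        (trans (cong q (sym (+-identityʳ (suc y * (n + n))))) (symmetric (suc y) 0 y<m x<m)))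

    facts : ∀ {ρ σ₀ σ} → ρ 0 ≡ n → ρ 1 ≡ n + n → ρ 2 ≡ e →
      (∀ i → 64 ≤ i → i < (n + n) * (n + n) → arrs σ₀ 0 i ≡ q i) →
      (∀ a → T (blankArr a) → ∀ i → arrs σ a i ≡ 0) → Preparation.Prepared ρ L σ₀ σ → Facts n e q σ
    facts {ρ} {σ₀} {σ} ρ0 ρ1 ρ2 loaded blank pr = record
      { ℓ = ℓ ; bits = trans length′ (cong (_+ ℓ) ρ0) ; many = trans samples (cong (λ e → 4 * (e * e) * 2 ^ ℓ) ρ2)
      ; τ-upper = ≤-trans τ-upper (≤-reflexive ρ0)
      ; entries = matrix loaded first (λ y 1≤y y< → trans (top y 1≤y (subst (y <_) (sym ρ1) y<)) (cong (λ j → arrs σ₀ 0 (y * j)) ρ1))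
          (λ i m≤i → lower i (subst (_≤ i) (sym ρ1) m≤i))
      ; B-zero = zero′ ; B-suc = suc′
      ; enough = ≤-trans (cover enough₁) (≤-reflexive (sym (^-distribˡ-+-* 2 n ℓ)))
      ; ℓ≤ = ≤-trans ℓ≤ (≤-reflexive ρ1)
      ; few = *-cancelˡ-≤ (2 ^ n) {{>-nonZero (m^n>0 2 n)}} (≤-trans tight₁ (≤-trans (*-monoʳ-≤ 2 polynomial) (≤-reflexive (swap (2 ^ n) (suc (n + n) ^ picks)))))
      ; blank = blank }
      where
      open Preparation.Prepared pr
      open Preparation.Scaled scaled
      B = arrs σ 2
      zero′ : B 0 ≡ 2 ^ n
      zero′ = trans B-zero (cong (2 ^_) ρ0)
      suc′ : ∀ b → b < n + n → B (suc b) ≡ B b + B (b ∸ vars σ 1)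
      suc′ b b< = B-suc b (subst (b <_) (sym ρ1) b<)
      module Ta = Table {B} {vars σ 1} {n + n} zero′ suc′
      enough₁ : B (n + n) ≤ 2 ^ n * 2 ^ ℓ ⊎ ℓ ≡ n + n
      enough₁ = subst₂ (λ N M → B M ≤ 2 ^ N * 2 ^ ℓ ⊎ ℓ ≡ M) ρ0 ρ1 enough
      tight₁ : 2 ^ n * 2 ^ ℓ ≤ 2 * B (n + n)
      tight₁ = subst₂ (λ N M → 2 ^ N * 2 ^ ℓ ≤ 2 * B M) ρ0 ρ1 tight
      -- If all m rounds doubled, 2 ^ n has grown by 2 ^ m, which the exponential bound on the table
      -- shows to be enough.
      cover : B (n + n) ≤ 2 ^ n * 2 ^ ℓ ⊎ ℓ ≡ n + n → B (n + n) ≤ 2 ^ n * 2 ^ ℓ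
      cover (inj₁ h) = h
      cover (inj₂ ℓ≡) = subst (λ j → B (n + n) ≤ 2 ^ n * 2 ^ j) (sym ℓ≡) (Ta.B-exponential (n + n) ≤-refl)
      steps : n + n ≤ picks * suc (vars σ 1)
      steps = ≤-trans (+-mono-≤ n≤ n≤) (≤-reflexive (twice (suc L) (suc (vars σ 1))))
        where
        n≤ : n ≤ suc L * suc (vars σ 1)
        n≤ = <⇒≤ (≤-trans (≤-reflexive (cong suc (sym ρ0))) τ-lower)
        twice : ∀ a b → a * b + a * b ≡ 2 * a * b
        twice = solve-∀
      polynomial : B (n + n) ≤ 2 ^ n * suc (n + n) ^ picks
      polynomial = Ta.B-polynomial picks (n + n) ≤-refl steps
      swap : ∀ p x → 2 * (p * x) ≡ p * (2 * x)
      swap = solve-∀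

  u : ℕ → ℕ → ℕ
  u = sizeBound

  module _ (n e : ℕ) where

    u≤z : u n e ≤ z (u n e)
    u≤z = ≤-trans (≤-reflexive (sym (*-identityʳ (u n e)))) (*-monoʳ-≤ (u n e) (^-positive (u n e) (suc picks) (sizeBound-positive n e)))

    scale-n : ∀ k → k ≤ 8 → k * suc n ≤ u n e
    scale-n = sizeBound-n n e

    scale-e : ∀ k → k ≤ 8 → k * suc e ≤ u n e
    scale-e = sizeBound-e n e

    n≤ : n ≤ u n e
    n≤ = ≤-trans (≤-trans (n≤1+n n) (≤-reflexive (sym (+-identityʳ (suc n))))) (scale-n 1 (m≤m+n 1 7))

    m+1≤ : suc (n + n) ≤ u n e
    m+1≤ = ≤-trans (≤-trans (n≤1+n _) (≤-reflexive (arith n))) (scale-n 2 (m≤m+n 2 6))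
      where
      arith : ∀ n → suc (suc (n + n)) ≡ 2 * suc n
      arith = solve-∀

    e≤ : e ≤ u n e
    e≤ = ≤-trans (≤-trans (n≤1+n e) (≤-reflexive (sym (+-identityʳ (suc e))))) (scale-e 1 (m≤m+n 1 7))

    params-small : ∀ {ρ : ℕ → ℕ} → ρ 0 ≡ n → ρ 1 ≡ n + n → ρ 2 ≡ e → ∀ p → p < 3 → ρ p ≤ z (u n e)
    params-small ρ0 ρ1 ρ2 0 _ = ≤-trans (≤-reflexive ρ0) (≤-trans n≤ u≤z)
    params-small ρ0 ρ1 ρ2 1 _ = ≤-trans (≤-reflexive ρ1) (≤-trans (≤-trans (n≤1+n _) m+1≤) u≤z)
    params-small ρ0 ρ1 ρ2 2 _ = ≤-trans (≤-reflexive ρ2) (≤-trans e≤ u≤z)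
    params-small ρ0 ρ1 ρ2 (suc (suc (suc p))) (s≤s (s≤s (s≤s ())))

    params-large : ∀ {ρ : ℕ → ℕ} {ℓ} → ρ 0 ≡ n → ρ 1 ≡ n + n → ρ 2 ≡ e → ρ 3 ≡ n + ℓ → ρ 4 ≡ 4 * (e * e) * 2 ^ ℓ →
      ℓ ≤ n + n → 2 ^ ℓ ≤ 2 * suc (n + n) ^ picks → ∀ p → p < 5 → ρ p ≤ z (u n e)
    params-large {ρ} ρ0 ρ1 ρ2 ρ3 ρ4 ℓ≤ small 0 _ = params-small {ρ} ρ0 ρ1 ρ2 0 z<s
    params-large {ρ} ρ0 ρ1 ρ2 ρ3 ρ4 ℓ≤ small 1 _ = params-small {ρ} ρ0 ρ1 ρ2 1 (s≤s (s≤s z≤n))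
    params-large {ρ} ρ0 ρ1 ρ2 ρ3 ρ4 ℓ≤ small 2 _ = params-small {ρ} ρ0 ρ1 ρ2 2 (s≤s (s≤s (s≤s z≤n)))
    params-large ρ0 ρ1 ρ2 ρ3 ρ4 ℓ≤ small 3 _ = ≤-trans (≤-reflexive ρ3) (≤-trans (≤-trans (+-monoʳ-≤ n ℓ≤)
      (≤-trans (≤-trans (m≤m+n (n + (n + n)) 3) (≤-reflexive (arith n))) (scale-n 3 (m≤m+n 3 5)))) u≤z)
      where
      arith : ∀ n → n + (n + n) + 3 ≡ 3 * suc n
      arith = solve-∀
    params-large {ℓ = ℓ} ρ0 ρ1 ρ2 ρ3 ρ4 ℓ≤ small 4 _ = begin
      _ ≡⟨ ρ4 ⟩
      4 * (e * e) * 2 ^ ℓ ≤⟨ *-monoʳ-≤ (4 * (e * e)) small ⟩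
      4 * (e * e) * (2 * suc (n + n) ^ picks) ≡⟨ arith e (suc (n + n) ^ picks) ⟩
      8 * e * (e * suc (n + n) ^ picks)
        ≤⟨ *-mono-≤ (≤-trans (*-monoʳ-≤ 8 (n≤1+n e)) (scale-e 8 ≤-refl)) (*-mono-≤ e≤ (^-monoˡ-≤ picks m+1≤)) ⟩
      z (u n e) ∎
      where
      open ≤-Reasoning
      arith : ∀ e y → 4 * (e * e) * (2 * y) ≡ 8 * e * (e * y)
      arith = solve-∀
    params-large ρ0 ρ1 ρ2 ρ3 ρ4 ℓ≤ small (suc (suc (suc (suc (suc p))))) (s≤s (s≤s (s≤s (s≤s (s≤s ())))))

-- From the input to the coin tosses

module Preparing (K n₁ : ℕ) where

  open Assembly K n₁

  prepTime countTime : ℕ → ℕ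
  prepTime u = (5 * n₁ + 2) + (6 + (u * 4 + 1 + (2 + (u * 4 + 1 + (5 + (u * u * 7 + 1 + 7)))))) + costBound prep (z u)
  countTime u = prepTime u + (2 + costBound counting (z u))

  to-flips : ∀ {n e q c₀ t r ρ σ} → 64 ≤ n + n → Reach program c₀ t ⟨ b₂ , r ⟩ → t ≤ prepTime (u n e) →
    Rep (67 + (n + n) * (n + n)) ρ r σ → ρ 0 ≡ n → ρ 1 ≡ n + n → ρ 2 ≡ e → Facts n e q σ →
    Ready n e q c₀ (countTime (u n e))
  to-flips {n} {e} {q} {c₀} {t} {r} {ρ} {σ} 64≤m path t≤ R ρ0 ρ1 ρ2 F = record
    { time = t + (2 + time) ; within = +-mono-≤ t≤ (+-monoʳ-≤ 2 (≤-trans within (cost-mono 5 counting tt small-params)))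
    ; mem₀ = end ; ρ = ρ′ ; σ = ⟦ counting ⟧ ρ′ σ ; ℓ = ℓ
    ; path = reach-trans path (reach-trans (run-promote r) steps)
    ; rep = rep
    ; ρ-m = p1 ; ρ-bits = p3 ; ρ-runs = p4
    ; coins = Preparation.counting-value ρ′ L σ
    ; τ-upper = subst (λ k → suc L * k ≤ n) (sym (frame-var {ρ′} counting 1 tt σ)) τ-upper
    ; entries = λ x y x< y< → trans (cong (λ f → f (x * (n + n) + y)) (frame-arr {ρ′} counting 0 tt σ)) (entries x y x< y<)
    ; B-zero = trans (cong (λ f → f 0) table) B-zero
    ; B-suc = λ b b< → subst₂ (λ B k → B (suc b) ≡ B b + B (b ∸ k)) (sym table) (sym (frame-var {ρ′} counting 1 tt σ)) (B-suc b b<)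
    ; enough = subst (λ B → B (n + n) ≤ 2 ^ (n + ℓ)) (sym table) enough
    ; bounded = small-params
    ; blank = λ a t i → trans (cong (λ f → f i) (frame-arr {ρ′} counting a tt σ)) (blank a t i) }
    where
    open Facts F
    W≥64 : 64 ≤ 67 + (n + n) * (n + n)
    W≥64 = m≤m+n 64 (3 + (n + n) * (n + n))
    r′ = execs promoting r
    ρ′ = pars r′
    R′ : Rep (67 + (n + n) * (n + n)) ρ′ r′ σ
    R′ = rep-promote 4 _ W≥64 (m≤m+n 5 3) (rep-promote 3 _ W≥64 (m≤m+n 4 4) R)
    p0 = trans (rep-par R 0 (m≤m+n 1 7)) ρ0
    p1 = trans (rep-par R 1 (m≤m+n 2 6)) ρ1
    p2 = trans (rep-par R 2 (m≤m+n 3 5)) ρ2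
    p3 = trans (cong₂ _+_ (rep-var R 26 (m≤m+n 27 5)) (rep-zero R)) (trans (+-identityʳ _) bits)
    p4 = trans (cong₂ _+_ (rep-var R 23 (m≤m+n 24 8)) (rep-zero R)) (trans (+-identityʳ _) many)
    small-params : ∀ p → p < 5 → ρ′ p ≤ z (u n e)
    small-params = params-large n e {ρ′} p0 p1 p2 p3 p4 ℓ≤ few
    open Compiled (run-count W≥64 tt R′)
    table : arrs (⟦ counting ⟧ ρ′ σ) 2 ≡ arrs σ 2
    table = frame-arr {ρ′} counting 2 tt σ

  to-preparation : ∀ {n k q c₀ t r} → 64 ≤ n + n →
    (∀ x y → x < n + n → y < n + n → q (x * (n + n) + y) ≡ q (y * (n + n) + x)) → q 0 ≡ 0 →
    Reach program c₀ t ⟨ b₁ , r ⟩ → t ≤ (5 * n₁ + 2) + (6 + (u n (suc k) * 4 + 1 + (2 + (u n (suc k) * 4 + 1 + (5 + (u n (suc k) * u n (suc k) * 7 + 1 + 7)))))) →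
    Loaded n (suc k) (n + n) q r → Ready n (suc k) q c₀ (countTime (u n (suc k)))
  to-preparation {n} {k} {q} {c₀} {t} {r} 64≤m symmetric loopless path t≤ lo =
    to-flips 64≤m (reach-trans path steps) (+-mono-≤ t≤ (≤-trans within (cost-mono 3 prep tt (params-small n (suc k) {pars r} par-n par-m par-e))))
      rep′ par-n par-m par-e
      (facts 64≤m symmetric loopless par-n par-m par-e matrix′ blank′ (Preparation.prepared (pars r) L σ (≤-trans (≤-trans (s≤s z≤n) 64≤m) (≤-reflexive (sym par-m)))))
    where
    open Loaded lo renaming (matrix to matrix′)
    W≥64 : 64 ≤ 67 + (n + n) * (n + n)
    W≥64 = m≤m+n 64 (3 + (n + n) * (n + n))
    σ = regs-state (67 + (n + n) * (n + n)) r
    open Compiled (run-prep W≥64 tt (Loaded.rep lo)) using (within; steps) renaming (rep to rep′)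
    blank′ : ∀ a → T (blankArr a) → ∀ i → arrs (⟦ prep ⟧ (pars r) σ) a i ≡ 0
    blank′ 1 _ i = trans (cong (λ f → f i) (frame-arr {pars r} prep 1 tt σ)) (blank 1 (m≤m+n 1 0) (m≤m+n 2 6) i)
    blank′ 3 _ i = trans (cong (λ f → f i) (frame-arr {pars r} prep 3 tt σ)) (blank 3 (m≤m+n 1 2) (m≤m+n 4 4) i)
    blank′ 4 _ i = trans (cong (λ f → f i) (frame-arr {pars r} prep 4 tt σ)) (blank 4 (m≤m+n 1 3) (m≤m+n 5 3) i)

-- Accuracy and running time for large inputs

module Final (K n₁ : ℕ) where

  open Assembly K n₁
  open Preparing K n₁

  module Large {n d e : ℕ} {q : ℕ → ℕ} {c₀ : Config} {bound : ℕ} (G : Graph (2 * n)) (bip : Bipartite G) (reg : Regular d G)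
      (1≤d : 1 ≤ d) (n≤2Kd : n ≤ 2 * suc K * d) (1≤e : 1 ≤ e)
      (enc : ∀ u v → q (toℕ u * (2 * n) + toℕ v) ≡ toBit (adj G u v)) (rd : Ready n e q c₀ bound) where

    open Ready rd

    c B : ℕ → ℕ
    c = arrs σ 0
    B = arrs σ 2
    τ = vars σ 1

    m≡ : ρ 1 ≡ 2 * n
    m≡ = trans ρ-m (cong (n +_) (sym (+-identityʳ n)))

    module En = Encoded G (λ x y → q (x * (2 * n) + y)) enc

    record Matrix (M : ℕ) : Set where
      field
        graph   : IsGraph M (λ x y → c (x * M + y))
        regular : ∀ x → x < M → sumTo M (λ y → c (x * M + y)) ≡ d
        number≡ : isets M (λ x y → c (x * M + y)) ≡ i[ G ]

    matrix-facts : ∀ M → M ≡ 2 * n → (∀ x y → x < M → y < M → c (x * M + y) ≡ q (x * M + y)) → Matrix M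
    matrix-facts M refl h = record
      { graph = record
        { bit = λ x y x< y< → subst (_≤ 1) (sym (h x y x< y<)) (IsGraph.bit En.isGraph x y x< y<)
        ; symmetric = λ x y x< y< → trans (h x y x< y<) (trans (IsGraph.symmetric En.isGraph x y x< y<) (sym (h y x y< x<)))
        ; loopless = λ x x< → trans (h x x x< x<) (IsGraph.loopless En.isGraph x x<) }
      ; regular = λ x x< → trans (sum-cong (2 * n) λ y y< → h x y x< y<) (En.row-sum reg x x<)
      ; number≡ = trans (isets-cong (2 * n) h) (sym En.i≡isets) }

    ma : Matrix (ρ 1)
    ma = matrix-facts (ρ 1) m≡ (subst (λ M → ∀ x y → x < M → y < M → c (x * M + y) ≡ q (x * M + y)) (sym ρ-m) entries)

    open Matrix ma

    τ≤d : 6 * τ ≤ d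
    τ≤d = *-cancelˡ-≤ (2 * suc K) (≤-trans (≤-reflexive (trans (arith K τ) (cong (_* τ) (sym sucL≡)))) (≤-trans τ-upper n≤2Kd))
      where
      arith : ∀ K t → 2 * suc K * (6 * t) ≡ 12 * suc K * t
      arith = solve-∀

    B-suc′ : ∀ b → b < ρ 1 → B (suc b) ≡ B b + B (b ∸ τ)
    B-suc′ b b< = B-suc b (subst (b <_) ρ-m b<)

    B≤ : B (ρ 1) ≤ 2 ^ ρ 3
    B≤ = subst₂ (λ M N → B M ≤ 2 ^ N) (sym ρ-m) (sym ρ-bits) enough

    open Estimation ρ c B τ {n} {d} graph m≡ regular 1≤d τ≤d (Table.B-least {B} {τ} {ρ 1} B-zero B-suc′) B-suc′ B≤

    i : ℕ
    i = isets (ρ 1) (λ x y → c (x * ρ 1 + y))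

    2^n≤i : 2 ^ n ≤ i
    2^n≤i = ≤-trans (En.i-lower {n} refl bip) (≤-reflexive (trans (sym En.i≡isets) (sym number≡)))

    1≤i : 1 ≤ i
    1≤i = ≤-trans (m^n>0 2 n) 2^n≤i

    s₀ : (ℕ → ℕ) × (ℕ → ℕ)
    s₀ = arrs σ 3 , arrs σ 4

    good₀ : Trials.Good trials s₀
    good₀ = (λ x → ≤-trans (≤-reflexive (blank 3 tt x)) z≤n) , (λ x → ≤-trans (≤-reflexive (blank 4 tt x)) z≤n)

    open Tail (ρ 4) e s₀ good₀ using (good?; success)

    -- The time after the coins may depend on them. `spare` bounds it and the halted machine idles
    -- through what is left, so that `total` serves all bit strings.
    C spare total : ℕ
    C = ρ 4 * ρ 3
    spare = cost estimating ρ + 2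
    total = time + (3 + (C * 6 + suc spare))

    1≤ρ4 : 1 ≤ ρ 4
    1≤ρ4 = ≤-trans (*-mono-≤ (*-mono-≤ (m≤m+n 1 3) (*-mono-≤ 1≤e 1≤e)) (m^n>0 2 ℓ)) (≤-reflexive (sym ρ-runs))

    -- Since N = n + ℓ and 2 ^ n ≤ i, a trial is accepted with probability at least 2 ^ -ℓ, so 4 e²
    -- 2 ^ ℓ trials are enough for Chebyshev's inequality.
    counted : 3 * 2 ^ C ≤ 4 * sumᵇ C (λ ws → toBit (good? ws))
    counted = success (2 ^ ℓ) ρ-runs enough-trials 1≤e 1≤i (m^n>0 2 ℓ)
      where
      enough-trials : 2 ^ ρ 3 ≤ 2 ^ ℓ * i
      enough-trials = ≤-trans (≤-reflexive (trans (cong (2 ^_) ρ-bits) (trans (^-distribˡ-+-* 2 n ℓ) (*-comm (2 ^ n) (2 ^ ℓ))))) (*-monoʳ-≤ (2 ^ ℓ) 2^n≤i)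

    coinsOf : Vec Bool total → Vec Bool C
    coinsOf bs = tossed C (dropᵛ 3 (dropᵛ time bs))

    likely′ : 3 * 2 ^ total ≤ 4 * sumᵇ total (λ bs → toBit (good? (coinsOf bs)))
    likely′ = begin
      3 * 2 ^ total ≡⟨ cong (3 *_) (trans (^-distribˡ-+-* 2 time (3 + y)) (cong (2 ^ time *_) (^-distribˡ-+-* 2 3 y))) ⟩
      3 * (2 ^ time * (2 ^ 3 * 2 ^ y)) ≡⟨ e₁ (2 ^ time) (2 ^ y) ⟩
      2 ^ time * (8 * (3 * 2 ^ y)) ≤⟨ *-monoʳ-≤ (2 ^ time) (*-monoʳ-≤ 8 tossing) ⟩
      2 ^ time * (8 * (4 * S)) ≡⟨ e₂ (2 ^ time) S ⟩
      4 * (2 ^ time * (2 ^ 3 * S)) ≡⟨ cong (λ s → 4 * (2 ^ time * s)) (sym (sumᵇ-drop 3 {y} (λ bs → toBit (good? (tossed C bs))))) ⟩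
      4 * (2 ^ time * sumᵇ (3 + y) (λ bs → toBit (good? (tossed C (dropᵛ 3 bs)))))
        ≡⟨ cong (4 *_) (sym (sumᵇ-drop time {3 + y} (λ bs → toBit (good? (tossed C (dropᵛ 3 bs)))))) ⟩
      4 * sumᵇ total (λ bs → toBit (good? (coinsOf bs))) ∎
      where
      open ≤-Reasoning
      y = C * 6 + suc spare
      S = sumᵇ y (λ bs → toBit (good? (tossed C bs)))
      e₁ : ∀ a b → 3 * (a * (8 * b)) ≡ a * (8 * (3 * b))
      e₁ = solve-∀
      e₂ : ∀ a s → a * (8 * (4 * s)) ≡ 4 * (a * (8 * s))
      e₂ = solve-∀
      e₃ : ∀ a b → a * (3 * b) ≡ b * (3 * a)
      e₃ = solve-∀
      e₄ : ∀ a b → a * (4 * b) ≡ 4 * (a * b)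
      e₄ = solve-∀
      tossing : 3 * 2 ^ y ≤ 4 * S
      tossing = *-cancelˡ-≤ (2 ^ C) {{>-nonZero (m^n>0 2 C)}} (begin
        2 ^ C * (3 * 2 ^ y) ≡⟨ e₃ (2 ^ C) (2 ^ y) ⟩
        2 ^ y * (3 * 2 ^ C) ≤⟨ *-monoʳ-≤ (2 ^ y) counted ⟩
        2 ^ y * (4 * sumᵇ C (λ ws → toBit (good? ws))) ≡⟨ e₄ (2 ^ y) _ ⟩
        4 * (2 ^ y * sumᵇ C (λ ws → toBit (good? ws))) ≡⟨ cong (4 *_) (sym (sumᵇ-tossed C (suc spare) (λ ws → toBit (good? ws)))) ⟩
        4 * (2 ^ C * S) ≡⟨ sym (e₄ (2 ^ C) S) ⟩
        2 ^ C * (4 * S) ∎)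

    W≥64 : 64 ≤ 67 + (n + n) * (n + n)
    W≥64 = m≤m+n 64 (3 + (n + n) * (n + n))

    finishes : ∀ bs → ∃[ r ] run program c₀ bs ≡ ⟨ exit , r ⟩ × r 0 ≡ score (ρ 4) s₀ (coinsOf bs) * 2 ^ ρ 3 × r 1 ≡ ρ 4 ∸ 1
    finishes bs = conclude (run-flip W≥64 C spare σ mem₀ (dropᵛ time bs) rep coins (blank 1 tt))
      where
      ws = coinsOf bs
      σ′ : St
      σ′ = st (vars σ) (arrs σ [ 1 ⇐ at ws ])
      rest = dropᵛ 1 (dropᵛ (C * 6) (dropᵛ 3 (dropᵛ time bs)))
      conclude : (∃[ r′ ] run program ⟨ b₄ , mem₀ ⟩ (dropᵛ time bs) ≡ run program ⟨ b₅ , r′ ⟩ rest × Rep (67 + (n + n) * (n + n)) ρ r′ σ′) →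
                 ∃[ r ] run program c₀ bs ≡ ⟨ exit , r ⟩ × r 0 ≡ score (ρ 4) s₀ ws * 2 ^ ρ 3 × r 1 ≡ ρ 4 ∸ 1
      conclude (r′ , flipped , R) = execs finishing r₇ ,
        trans (run-drop time path bs) (trans flipped (run-within spare
          (reach-trans steps (run-finish r₇)) (+-monoˡ-≤ 2 within′) (at-exit (execs finishing r₇)) rest)) ,
        trans (cong₂ _+_ (trans (rep-var R₇ 14 (m≤m+n 15 17)) (estimating-value σ′ ws refl refl refl (λ _ → refl))) (rep-zero R₇)) (+-identityʳ _) ,
        cong₂ _∸_ (rep-par R₇ 4 (m≤m+n 5 3)) (rep-one R₇)
        where
        open Compiled (run-est W≥64 tt R) using (steps) renaming (end to r₇; rep to R₇; within to within′)

    approximates : Approximates program c₀ i[ G ] e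
      (bound + (3 + (z (u n e) * z (u n e) * 6 + suc (costBound estimating (z (u n e)) + 2))))
    approximates = record
      { time = total
      ; within = +-mono-≤ within (+-monoʳ-≤ 3 (+-mono-≤ (*-monoˡ-≤ 6 (*-mono-≤ (bounded 4 (m≤m+n 5 0)) (bounded 3 (m≤m+n 4 1))))
          (s≤s (+-monoˡ-≤ 2 (cost-mono 5 estimating tt bounded)))))
      ; good = λ bs → good? (coinsOf bs)
      ; likely = likely′
      ; final = λ bs → ⟨ exit , proj₁ (finishes bs) ⟩
      ; runs-to = λ bs → proj₁ (proj₂ (finishes bs))
      ; halted = λ bs → at-exit (proj₁ (finishes bs))
      ; accurate = λ bs ok → precise bs (finishes bs) ok }
      where
      precise : ∀ bs ((r , _) : ∃[ r ] run program c₀ bs ≡ ⟨ exit , r ⟩ × r 0 ≡ score (ρ 4) s₀ (coinsOf bs) * 2 ^ ρ 3 × r 1 ≡ ρ 4 ∸ 1) →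
                good? (coinsOf bs) ≡ true → e * ∣ r 0 - suc (r 1) * i[ G ] ∣ ≤ suc (r 1) * i[ G ]
      precise bs (r , _ , r0 , r1) ok = subst₂ (λ h k → e * ∣ h - k * i[ G ] ∣ ≤ k * i[ G ]) (sym r0) (sym runs≡)
          (subst (λ j → e * ∣ score (ρ 4) s₀ (coinsOf bs) * 2 ^ ρ 3 - ρ 4 * j ∣ ≤ ρ 4 * j) number≡
            (≤ᵇ⇒≤ _ _ (subst T (sym ok) tt)))
        where
        runs≡ : suc (r 1) ≡ ρ 4
        runs≡ = trans (cong suc r1) (suc-pred (ρ 4) {{>-nonZero 1≤ρ4}})

  largeTime : ℕ → ℕ
  largeTime u = countTime u + (3 + (z u * z u * 6 + suc (costBound estimating (z u) + 2)))

  large : ∀ n x → n₁ + x ≡ n → 32 ≤ n₁ → 2 * suc K ≤ n₁ → (G : Graph (2 * n)) → Bipartite G → ∀ {d} → Regular d G →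
    n ≤ suc d * suc K → ∀ ε k → Ceil ℤ.∣ ℚ.↥ ε ∣ (ℚ.↧ₙ ε) k →
    Approximates program (input n G ε) i[ G ] (suc k)
      (largeTime (u n (suc k)))
  large n x n≡ 32≤n₁ 2K≤n₁ G bip {d} reg dense′ ε k ceiling =
    conclude (run-large n (inputMemory n G ε) x refl n≡)
    where
    e = suc k
    q : ℕ → ℕ
    q i = inputMemory n G ε (3 + i)
    2m : n + n ≡ 2 * n
    2m = cong (n +_) (sym (+-identityʳ n))
    n₁≤n : n₁ ≤ n
    n₁≤n = subst (n₁ ≤_) n≡ (m≤m+n n₁ x)
    64≤m : 64 ≤ n + n
    64≤m = +-mono-≤ (≤-trans 32≤n₁ n₁≤n) (≤-trans 32≤n₁ n₁≤n)
    -- For d = 0 the density bound would give n ≤ K + 1, less than 2 (K + 1) ≤ n₁ ≤ n.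
    positive : ∀ d → n ≤ suc d * suc K → 1 ≤ d
    positive (suc _) _  = s≤s z≤n
    positive zero    n≤ = ⊥-elim (<⇒≱ (≤-trans (≤-trans (m<m+n (suc K) (s≤s (z≤n {K + 0}))) 2K≤n₁) n₁≤n)
                            (≤-trans n≤ (≤-reflexive (+-identityʳ (suc K)))))
    1≤d : 1 ≤ d
    1≤d = positive d dense′
    n≤2Kd : n ≤ 2 * suc K * d
    n≤2Kd = ≤-trans dense′ (≤-trans (*-monoˡ-≤ (suc K) (+-monoˡ-≤ d 1≤d)) (≤-reflexive (arith d K)))
      where
      arith : ∀ d K → (d + d) * suc K ≡ 2 * suc K * d
      arith = solve-∀
    module En = Encoded G (λ x y → q (x * (2 * n) + y)) (input-cell n G ε)
    symmetric : ∀ x y → x < n + n → y < n + n → q (x * (n + n) + y) ≡ q (y * (n + n) + x)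
    symmetric = subst (λ M → ∀ x y → x < M → y < M → q (x * M + y) ≡ q (y * M + x)) (sym 2m) (IsGraph.symmetric En.isGraph)
    loopless : q 0 ≡ 0
    loopless = IsGraph.loopless En.isGraph 0 (subst (0 <_) 2m (≤-trans (s≤s z≤n) 64≤m))
    k≤u : k ≤ u n e
    k≤u = ≤-trans (n≤1+n k) (e≤ n e)
    m≤u : n + n ≤ u n e
    m≤u = ≤-trans (n≤1+n _) (m+1≤ n e)
    conclude : (∃[ r₁ ] Reach program (input n G ε) (5 * n₁ + 2) ⟨ b₀ , r₁ ⟩ × r₁ 0 ≡ n × (∀ i → i ≢ 0 → i ≢ 3 → r₁ i ≡ inputMemory n G ε i)) →
               Approximates program (input n G ε) i[ G ] (suc k)
                 (largeTime (u n (suc k)))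
    conclude (r₁ , path₁ , r0 , kept) = finish (run-load n ℤ.∣ ℚ.↥ ε ∣ (ℚ.↧ₙ ε) k r₁ q r0
        (kept 1 (λ ()) (λ ())) (kept 2 (λ ()) (λ ())) ceiling
        (λ i 64≤i _ → kept (3 + i) (λ ()) (λ eq → <⇒≢ (≤-trans (m≤m+n 1 63) 64≤i) (sym (+-cancelˡ-≡ 3 i 0 eq)))) zeros)
      where
      zeros : ∀ i → 67 + (n + n) * (n + n) ≤ i → r₁ i ≡ 0
      zeros (suc (suc (suc j))) (s≤s (s≤s (s≤s W≤j))) = trans (kept (3 + j) (λ ()) λ eq →
          <⇒≢ (≤-trans (m≤m+n 1 (63 + (n + n) * (n + n))) W≤j) (sym (+-cancelˡ-≡ 3 j 0 eq)))
        (input-zero n G ε j (≤-trans (≤-reflexive (cong₂ _*_ (sym 2m) (sym 2m))) (≤-trans (m≤n+m ((n + n) * (n + n)) 64) W≤j)))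
      finish : (∃[ r′ ] Reach program ⟨ b₀ , r₁ ⟩ (6 + (k * 4 + 1 + (2 + ((n + n) * 4 + 1 + (5 + ((n + n) * (n + n) * 7 + 1 + 7)))))) ⟨ b₁ , r′ ⟩ ×
                 Loaded n e (n + n) q r′) →
               Approximates program (input n G ε) i[ G ] (suc k)
                 (largeTime (u n (suc k)))
      finish (r₂ , path₂ , lo) = Large.approximates G bip reg 1≤d n≤2Kd (s≤s z≤n) (input-cell n G ε)
        (to-preparation 64≤m symmetric loopless (reach-trans path₁ path₂)
          (+-monoʳ-≤ (5 * n₁ + 2) (+-monoʳ-≤ 6 (+-mono-≤ (+-monoˡ-≤ 1 (*-monoˡ-≤ 4 k≤u)) (+-monoʳ-≤ 2 (+-mono-≤ (+-monoˡ-≤ 1 (*-monoˡ-≤ 4 m≤u))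
            (+-monoʳ-≤ 5 (+-monoˡ-≤ 7 (+-monoˡ-≤ 1 (*-monoˡ-≤ 7 (*-mono-≤ m≤u m≤u))))))))))
          lo)

  totalTime : ℕ → ℕ
  totalTime u = smallTime u + largeTime u

  abstract

    totalTime-poly : Polynomial totalTime
    totalTime-poly = poly-+ (poly-+ (poly-const (5 * n₁)) (poly-+ (poly-* poly-id poly-id) (poly-const 6)))
      (poly-+ (poly-+ preparation (poly-+ (poly-const 2) (cost-poly counting Z)))
        (poly-+ (poly-const 3) (poly-+ (poly-* (poly-* Z Z) (poly-const 6))
          (poly-+ (poly-const 1) (poly-+ (cost-poly estimating Z) (poly-const 2))))))
      where
      Z : Polynomial z
      Z = poly-^ (2 + picks)
      linear : Polynomial (λ u → u * 4 + 1)
      linear = poly-+ (poly-* poly-id (poly-const 4)) (poly-const 1)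
      quadratic : Polynomial (λ u → u * u * 7 + 1 + 7)
      quadratic = poly-+ (poly-+ (poly-* (poly-* poly-id poly-id) (poly-const 7)) (poly-const 1)) (poly-const 7)
      preparation : Polynomial prepTime
      preparation = poly-+ (poly-+ (poly-const (5 * n₁ + 2)) (poly-+ (poly-const 6) (poly-+ linear
        (poly-+ (poly-const 2) (poly-+ linear (poly-+ (poly-const 5) quadratic)))))) (cost-poly prep Z)

abstract

  -- n ≥ 32 makes a row of the matrix at least 64 long, so that loading damages only the first; n ≥
  -- 2 (K + 1) forces d ≥ 1.
  threshold : ℕ → ℕ
  threshold K = 32 + 2 * suc K

  threshold-32 : ∀ K → 32 ≤ threshold K
  threshold-32 K = m≤m+n 32 _

  threshold-K : ∀ K → 2 * suc K ≤ threshold K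
  threshold-K K = m≤n+m (2 * suc K) 32

relax-bound : ∀ {P c i e s t} → s ≤ t → Approximates P c i e s → Approximates P c i e t
relax-bound s≤t a = record { Approximates a ; within = ≤-trans (Approximates.within a) s≤t }

theorem1 : (δ : ℝ) → 0ℚ <lim seq δ → seq δ lim< 1ℚ →
           HasFPRAS (DenseRegularBipartite δ)
theorem1 δ 0<δ _ = program , timePolynomial totalTime-poly , correctness
  where
  K : ℕ
  K = proj₁ (dense δ 0<δ)
  open Assembly K (threshold K)
  open Final K (threshold K)
  correctness : ∀ n (G : Graph (2 * n)) → DenseRegularBipartite δ n G → ∀ ε → .{{ε>0 : ℚ.Positive ε}} →
    Σ[ t ∈ ℕ ] fromℕ t ℚ.≤ eval₂ (timePolynomial totalTime-poly) (fromℕ n) ((ℚ.1/ ε) {{ℚ.pos⇒nonZero ε}}) ×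
      (∀ (bs : Vec Bool t) → Halted program (run program (input n G ε) bs)) ×
      Pr[ (λ (bs : Vec Bool t) → RelApprox ε (fromℕ i[ G ]) (output (run program (input n G ε) bs))) ]≥¾
  correctness n G (bip , d , floor , reg) ε {{ε>0}} =
    time ,
    ℚ.≤-trans (fromℕ-mono within) (time-bound totalTime-poly n (suc k) {(ℚ.1/ ε) {{ℚ.pos⇒nonZero ε}}} (precision-bound ε {{ε>0}} k (ceil-≤ ceiling))) ,
    (λ bs → subst (Halted program) (sym (runs-to bs)) (halted bs)) ,
    good ,
    (λ bs ok → subst (λ c → RelApprox ε (fromℕ i[ G ]) (output c)) (sym (runs-to bs))
      (relApprox ε i[ G ] (mem (final bs) 0) (mem (final bs) 1) (suc k) 1≤i (+-monoʳ-≤ num (ceil-≥ ceiling)) (accurate bs ok))) ,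
    subst (λ s → 3 * 2 ^ time ≤ 4 * s) (sym (filterᵇ-sum time good)) likely
    where
    num = ℤ.∣ ℚ.↥ ε ∣
    1≤num : 1 ≤ num
    1≤num = numerator-positive ε {{ε>0}}
    -- k = ⌈1 / ε⌉, obtained by the same repeated subtraction as in the program; the precision
    -- parameter is k + 1 ≥ 1 + 1 / ε.
    k : ℕ
    k = proj₁ (ceil num (ℚ.↧ₙ ε) 1≤num)
    ceiling : Ceil num (ℚ.↧ₙ ε) k
    ceiling = proj₂ (ceil num (ℚ.↧ₙ ε) 1≤num)
    module En = Encoded G (λ x y → inputMemory n G ε (3 + (x * (2 * n) + y))) (input-cell n G ε)
    1≤i : 1 ≤ i[ G ]
    1≤i = ≤-trans (m^n>0 2 n) (≤-trans (En.i-lower {n} refl bip) (≤-reflexive (sym En.i≡isets)))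
    U = sizeBound n (suc k)
    approximation : Approximates program (input n G ε) i[ G ] (suc k) (totalTime U)
    approximation with <-≤-connex n (threshold K)
    ... | inj₁ n<n₁ = relax-bound (m≤m+n (smallTime U) (largeTime U)) (small n G ε (suc k) n<n₁)
    ... | inj₂ n₁≤n with m≤n⇒∃[o]m+o≡n n₁≤n
    ... | x , eq = relax-bound (m≤n+m (largeTime U) (smallTime U)) (large n x eq (threshold-32 K) (threshold-K K) G bip reg
            (proj₂ (dense δ 0<δ) n d floor) ε k ceiling)
    open Approximates approximation
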